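{- Let $k$ be a positive integer. For every non-empty index $\boldsymbol{k}=(k_1,\dots,k_r)$ with $\mathrm{wt}(\boldsymbol{k})=k$, the following equality holds in $\mathcal{Z}[[t]]$: \begin{align*} &\sum_{i=1}^r \sum_{j=0}^{k_i-2} \zeta^{\star,KY}_{\widehat{\mathcal{S}}}(j+1,k_{i+1},\ldots,k_r,k_1,\ldots,k_{i-1},k_i-j)\\ &=\sum_{i=1}^r \sum_{j=0}^\infty \zeta^{\star,KY}_{\widehat{\mathcal{S}}}(j+1,k_{i+1},\ldots,k_r,k_1,\ldots,k_i)\,t^j+k\,\zeta^{\star,KY}_{\widehat{\mathcal{S}}}(k+1)-\delta_{\boldsymbol{k},(\{1\}^r)}\cdot(1+(-1)^{k+1})\,k\,\zeta(k+1). \end{align*} Here $\delta_{\boldsymbol{k},(\{1\}^r)}$ is $1$ if $\boldsymbol{k}=(1,\dots,1)$ ($r$ ones) and $0$ otherwise.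
   Context: An index is a tuple $\boldsymbol{k}=(k_1,\dots,k_r)$ of positive integers ($r\ge 0$; $r=0$ gives the empty index $\varnothing$); $\mathrm{wt}(\boldsymbol{k})=k_1+\cdots+k_r$. It is admissible if it is empty or $k_r\ge 2$. For admissible $\boldsymbol{k}$, $\zeta(k_1,\dots,k_r)=\sum_{1\le n_1<\cdots<n_r}\frac{1}{n_1^{k_1}\cdots n_r^{k_r}}$, $\zeta(\varnothing)=1$. $\mathcal{Z}\subset\mathbb{R}$ is the $\mathbb{Q}$-linear span of $1$ and all multiple zeta values; it is a $\mathbb{Q}$-algebra. Empty sums (e.g. $\sum_{j=0}^{k_i-2}$ with $k_i=1$) are $0$; for $i=r$ the string $k_{i+1},\dots,k_r$ is empty, and for $i=1$ the string $k_1,\dots,k_{i-1}$ is empty. Let $\mathfrak{H}=\mathbb{Q}\langle x,y\rangle$, $\mathfrak{H}^1=\mathbb{Q}+y\mathfrak{H}\supset\mathfrak{H}^0=\mathbb{Q}+y\mathfrak{H}x$, $z_k=yx^{k-1}$, $z_{\boldsymbol{k}}=z_{k_1}\cdots z_{k_r}$. Let $Z:\mathfrak{H}^0\to\mathbb{R}$ be the $\mathbb{Q}$-linear map with $Z(z_{\boldsymbol{k}})=\zeta(\boldsymbol{k})$ for admissible $\boldsymbol{k}$. The shuffle product $\mathrm{sh}$ on $\mathfrak{H}$ is the $\mathbb{Q}$-bilinear product with $w\,\mathrm{sh}\,1=1\,\mathrm{sh}\,w=w$ and $w_1u_1\,\mathrm{sh}\,w_2u_2=(w_1\,\mathrm{sh}\,w_2u_2)u_1+(w_1u_1\,\mathrm{sh}\,w_2)u_2$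 for $u_1,u_2\in\{x,y\}$. Then $Z$ is a homomorphism for $\mathrm{sh}$ on $\mathfrak{H}^0$, $(\mathfrak{H}^1,\mathrm{sh})\cong(\mathfrak{H}^0,\mathrm{sh})[y]$, and $Z^{\mathrm{sh}}:(\mathfrak{H}^1,\mathrm{sh})\to\mathbb{R}[T]$, $w\mapsto Z^{\mathrm{sh}}(w;T)$, is the unique $\mathbb{Q}$-algebra homomorphism extending $Z$ with $Z^{\mathrm{sh}}(y;T)=T$; its image lies in $\mathcal{Z}[T]$. A 2-poset is a finite poset $X$ with a label map $\delta_X:X\to\{x,y\}$. Put $W(X)=\sum_f \delta_X(f^{ -1}(1))\cdots\delta_X(f^{ -1}(\#X))\in\mathfrak{H}$, summed over all bijections $f:X\to\{1,\dots,\#X\}$ such that $p<q$ implies $f(p)<f(q)$ ($W(\varnothing)=1$). For $\boldsymbol{k}=(k_1,\dots,k_r)$, let $X^\star(\boldsymbol{k})$ be the 2-poset with elements $p_{i,m}$ ($1\le i\le r$, $1\le m\le k_i$), with order generated by $p_{i,1}<p_{i,2}<\cdots<p_{i,k_i}$ for each $i$ and $p_{i,1}<p_{i+1,k_{i+1}}$ for $1\le i\le r-1$, and with $p_{i,1}$ labelled $y$ and $p_{i,m}$ ($m\ge2$) labelled $x$. Put $w^\star(\boldsymbol{k})=W(X^\star(\boldsymbol{k}))\in\mathfrak{H}^1$ and $\zeta^{\star,KY}(\boldsymbol{k})=Z^{\mathrm{sh}}(w^\star(\boldsymbol{k});0)\in\mathcal{Z}$ (so $\zeta^{\star,KY}(\varnothing)=1$).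 Define in $\mathcal{Z}[[t]]$ $$\zeta_{\widehat{\mathcal{S}}}^{\star,KY}(k_1,\dots,k_r)=\sum_{i=0}^{r}(-1)^{k_{i+1}+\cdots+k_r}\zeta^{\star,KY}(k_1,\ldots,k_i)\sum_{l_{i+1},\ldots,l_r\ge0}\ \prod_{j=i+1}^r\binom{k_j+l_j-1}{l_j}\,\zeta^{\star,KY}(k_r+l_r,\ldots,k_{i+1}+l_{i+1})\,t^{l_{i+1}+\cdots+l_r}.$$ -}

module Defs where

open import Algebra.Bundles.Raw using (RawRing)
open import Algebra.Morphism.Structures using (module RingMorphisms)
open import Data.Bool using (if_then_else_)
open import Data.Empty using (⊥-elim)
open import Data.Fin as Fin using (Fin; zero; suc; toℕ)
import Data.Fin.Properties as Fin
open import Data.Integer as ℤ using (ℤ; +_; -1ℤ)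
import Data.Integer.Properties as ℤ
open import Data.List as List
  using (List; []; _∷_; _++_; _∷ʳ_; map; concat; concatMap; length; lookup; reverse; take; drop;
         replicate; upTo; allFin; zipWith; filter; foldr)
import Data.List.Properties as List
open import Data.List.Membership.Propositional using (_∈_)
open import Data.List.Membership.Propositional.Properties
  using (∈-map⁺; ∈-map⁻; ∈-concat⁺′; ∈-concat⁻′; ∈-allFin; ∈-filter⁻; ∈-++⁻)
open import Data.List.Relation.Unary.All as All using (All; []; _∷_)
import Data.List.Relation.Unary.All.Properties as All
open import Data.List.Relation.Unary.Any as Any using (here; there)
import Data.List.Relation.Unary.Any.Properties as Any
import Data.List.Relation.Unary.AllPairs as AllPairs
import Data.List.Relation.Unary.AllPairs.Properties as AllPairs
open import Data.List.Relation.Binary.Disjoint.Propositional using (Disjoint)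
open import Data.List.Relation.Unary.Unique.Propositional using (Unique)
import Data.List.Relation.Unary.Unique.Propositional.Properties as Unique
open import Data.Nat as ℕ using (ℕ; zero; suc; NonZero; _∸_; z≤n; s≤s)
import Data.Nat.Properties as ℕ
open import Data.Nat.Combinatorics using (_C_)
open import Data.Nat.ListAction using (sum; product)
import Data.Nat.Solver
open import Data.Product using (Σ; Σ-syntax; ∃; _×_; _,_; proj₁; proj₂)
import Data.Product.Properties as Product
open import Data.Rational as ℚ
  using (ℚ; 0ℚ; 1ℚ; ½; mkℚ; ∣_∣; _/_; _+_; _*_; _-_; -_; _≤_; _<_; positive; nonNegative)
import Data.Rational.Properties as ℚ
open import Data.Rational.Solver using (module +-*-Solver)
module ℕ-Solver = Data.Nat.Solver.+-*-Solver
open import Data.Rational.Unnormalised as ℚᵘ using (mkℚᵘ; *≡*; *≤*; *<*)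
import Data.Rational.Unnormalised.Properties as ℚᵘ
open import Data.Sum using (_⊎_; inj₁; inj₂)
open import Function using (_∘_; _∋_; case_of_)
open import Level using (0ℓ)
open import Relation.Binary using (Rel; Decidable; DecidableEquality; IsDecStrictPartialOrder)
open import Relation.Binary.Construct.Closure.Transitive as TransClosure
  using (TransClosure; [_]; _∷_)
open import Relation.Binary.PropositionalEquality
open import Relation.Nullary using (Dec; yes; no; ¬_; does)
open import Relation.Nullary.Decidable using (_×-dec_; _⊎-dec_; _→-dec_; map′)

-- Cauchy sequences of rationals, identified when their difference tends to 0.
IsCauchy : (ℕ → ℚ) → Set
IsCauchy a = ∀ ε → 0ℚ < ε → ∃ λ N → ∀ m n → N ℕ.≤ m → N ℕ.≤ n → ∣ a m - a n ∣ < ε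

record ℝ : Set where
  constructor mkℝ
  field
    seq    : ℕ → ℚ
    cauchy : IsCauchy seq

open ℝ public

infix 4 _≈ᴿ_
infixl 6 _+ᴿ_
infixl 7 _*ᴿ_
infix 8 -ᴿ_

_≈ᴿ_ : ℝ → ℝ → Set
a ≈ᴿ b = ∀ ε → 0ℚ < ε → ∃ λ N → ∀ n → N ℕ.≤ n → ∣ seq a n - seq b n ∣ < ε

module _ where
  open +-*-Solver

  half-pos : ∀ {ε} → 0ℚ < ε → 0ℚ < ½ * ε
  half-pos {ε} 0<ε = subst (_< ½ * ε) (ℚ.*-zeroʳ ½) (ℚ.*-monoʳ-<-pos ½ 0<ε)

  half+half : ∀ ε → ½ * ε + ½ * ε ≡ ε
  half+half ε = trans (sym (ℚ.*-distribʳ-+ ε ½ ½)) (ℚ.*-identityˡ ε)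

  abstract
    cauchy-const : ∀ q → IsCauchy (λ _ → q)
    cauchy-const q ε 0<ε = 0 , λ _ _ _ _ → subst (λ z → ∣ z ∣ < ε) (sym (ℚ.+-inverseʳ q)) 0<ε

    cauchy-+ : ∀ {a b} → IsCauchy a → IsCauchy b → IsCauchy (λ n → a n + b n)
    cauchy-+ {a} {b} ca cb ε 0<ε with ca (½ * ε) (half-pos 0<ε) | cb (½ * ε) (half-pos 0<ε)
    ... | N₁ , h₁ | N₂ , h₂ = N₁ ℕ.⊔ N₂ , λ m n N≤m N≤n → begin-strict
      ∣ (a m + b m) - (a n + b n) ∣
        ≡⟨ cong ∣_∣ (solve 4 (λ p q r s → (p :+ q) :- (r :+ s) := (p :- r) :+ (q :- s))
                       refl (a m) (b m) (a n) (b n)) ⟩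
      ∣ (a m - a n) + (b m - b n) ∣
        ≤⟨ ℚ.∣p+q∣≤∣p∣+∣q∣ (a m - a n) (b m - b n) ⟩
      ∣ a m - a n ∣ + ∣ b m - b n ∣
        <⟨ ℚ.+-mono-< (h₁ m n (ℕ.m⊔n≤o⇒m≤o N₁ N₂ N≤m) (ℕ.m⊔n≤o⇒m≤o N₁ N₂ N≤n))
                      (h₂ m n (ℕ.m⊔n≤o⇒n≤o N₁ N₂ N≤m) (ℕ.m⊔n≤o⇒n≤o N₁ N₂ N≤n)) ⟩
      ½ * ε + ½ * ε ≡⟨ half+half ε ⟩
      ε ∎
      where open ℚ.≤-Reasoning

    cauchy-neg : ∀ {a} → IsCauchy a → IsCauchy (λ n → - a n)
    cauchy-neg {a} ca ε 0<ε with ca ε 0<ε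
    ... | N , h = N , λ m n N≤m N≤n → subst (_< ε)
      (trans (sym (ℚ.∣-p∣≡∣p∣ (a m - a n)))
             (cong ∣_∣ (solve 2 (λ p q → :- (p :- q) := (:- p) :- (:- q)) refl (a m) (a n))))
      (h m n N≤m N≤n)

    eventually-bounded : ∀ {a} → IsCauchy a →
                         ∃ λ B → 0ℚ < B × ∃ λ N → ∀ n → N ℕ.≤ n → ∣ a n ∣ ≤ B
    eventually-bounded {a} ca with ca 1ℚ (ℚ.positive⁻¹ 1ℚ)
    ... | N , h = ∣ a N ∣ + 1ℚ
                , ℚ.+-mono-≤-< (ℚ.0≤∣p∣ (a N)) (ℚ.positive⁻¹ 1ℚ)
                , N , λ n N≤n → begin
      ∣ a n ∣                   ≡⟨ cong ∣_∣ (solve 2 (λ p q → p := q :+ (p :- q)) refl (a n) (a N)) ⟩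
      ∣ a N + (a n - a N) ∣     ≤⟨ ℚ.∣p+q∣≤∣p∣+∣q∣ (a N) (a n - a N) ⟩
      ∣ a N ∣ + ∣ a n - a N ∣   ≤⟨ ℚ.+-monoʳ-≤ ∣ a N ∣ (ℚ.<⇒≤ (h n N N≤n ℕ.≤-refl)) ⟩
      ∣ a N ∣ + 1ℚ ∎
      where open ℚ.≤-Reasoning

    divide : ∀ {ε B} → 0ℚ < ε → 0ℚ < B → ∃ λ δ → 0ℚ < δ × B * δ ≡ ε
    divide {ε} {B} 0<ε 0<B = (ℚ.1/ B) * ε
      , ℚ.positive⁻¹ ((ℚ.1/ B) * ε) {{ℚ.pos*pos⇒pos (ℚ.1/ B) {{ℚ.1/pos⇒pos B}} ε {{positive 0<ε}}}}
      , trans (sym (ℚ.*-assoc B (ℚ.1/ B) ε))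
              (trans (cong (_* ε) (ℚ.*-inverseʳ B)) (ℚ.*-identityˡ ε))
      where instance
        B-pos : ℚ.Positive B
        B-pos = positive 0<B
        B-nz : ℚ.NonZero B
        B-nz = ℚ.pos⇒nonZero B

    product-bound : ∀ {A B α β} p q r s → 0ℚ < A → 0ℚ < B →
                    ∣ p ∣ ≤ A → ∣ q - s ∣ < α → ∣ s ∣ ≤ B → ∣ p - r ∣ < β →
                    ∣ p * q - r * s ∣ < A * α + B * β
    product-bound {A} {B} {α} {β} p q r s 0<A 0<B p≤A q-s<α s≤B p-r<β = begin-strict
      ∣ p * q - r * s ∣
        ≡⟨ cong ∣_∣ (solve 4 (λ p q r s → p :* q :- r :* s := p :* (q :- s) :+ s :* (p :- r))
                       refl p q r s) ⟩
      ∣ p * (q - s) + s * (p - r) ∣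
        ≤⟨ ℚ.∣p+q∣≤∣p∣+∣q∣ (p * (q - s)) (s * (p - r)) ⟩
      ∣ p * (q - s) ∣ + ∣ s * (p - r) ∣
        <⟨ ℚ.+-mono-< (small p (q - s) 0<A p≤A q-s<α) (small s (p - r) 0<B s≤B p-r<β) ⟩
      A * α + B * β ∎
      where
      open ℚ.≤-Reasoning
      small : ∀ {K δ} p q → 0ℚ < K → ∣ p ∣ ≤ K → ∣ q ∣ < δ → ∣ p * q ∣ < K * δ
      small {K} {δ} p q 0<K p≤K q<δ = begin-strict
        ∣ p * q ∣     ≡⟨ ℚ.∣p*q∣≡∣p∣*∣q∣ p q ⟩
        ∣ p ∣ * ∣ q ∣ ≤⟨ ℚ.*-monoʳ-≤-nonNeg ∣ q ∣ {{ℚ.∣-∣-nonNeg q}} p≤K ⟩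
        K * ∣ q ∣     <⟨ ℚ.*-monoʳ-<-pos K {{positive 0<K}} q<δ ⟩
        K * δ ∎

    cauchy-* : ∀ {a b} → IsCauchy a → IsCauchy b → IsCauchy (λ n → a n * b n)
    cauchy-* {a} {b} ca cb ε 0<ε =
      let A , 0<A , N₁ , a≤A = eventually-bounded ca
          B , 0<B , N₂ , b≤B = eventually-bounded cb
          α , 0<α , Aα≡      = divide (half-pos 0<ε) 0<A
          β , 0<β , Bβ≡      = divide (half-pos 0<ε) 0<B
          N₃ , h₃            = ca β 0<β
          N₄ , h₄            = cb α 0<α
          N₁₂ = N₁ ℕ.⊔ N₂
          N₃₄ = N₃ ℕ.⊔ N₄
          le₁ = ℕ.≤-trans (ℕ.m≤m⊔n N₁ N₂) (ℕ.m≤m⊔n N₁₂ N₃₄)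
          le₂ = ℕ.≤-trans (ℕ.m≤n⊔m N₁ N₂) (ℕ.m≤m⊔n N₁₂ N₃₄)
          le₃ = ℕ.≤-trans (ℕ.m≤m⊔n N₃ N₄) (ℕ.m≤n⊔m N₁₂ N₃₄)
          le₄ = ℕ.≤-trans (ℕ.m≤n⊔m N₃ N₄) (ℕ.m≤n⊔m N₁₂ N₃₄)
      in N₁₂ ℕ.⊔ N₃₄ , λ m n N≤m N≤n →
         subst (∣ a m * b m - a n * b n ∣ <_)
           (trans (cong₂ _+_ Aα≡ Bβ≡) (half+half ε))
           (product-bound (a m) (b m) (a n) (b n) 0<A 0<B
             (a≤A m (ℕ.≤-trans le₁ N≤m))
             (h₄ m n (ℕ.≤-trans le₄ N≤m) (ℕ.≤-trans le₄ N≤n))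
             (b≤B n (ℕ.≤-trans le₂ N≤n))
             (h₃ m n (ℕ.≤-trans le₃ N≤m) (ℕ.≤-trans le₃ N≤n)))

fromℚ : ℚ → ℝ
fromℚ q = mkℝ (λ _ → q) (cauchy-const q)

fromℤ : ℤ → ℝ
fromℤ n = fromℚ (n / 1)

0ᴿ 1ᴿ : ℝ
0ᴿ = fromℚ 0ℚ
1ᴿ = fromℚ 1ℚ

_+ᴿ_ _*ᴿ_ : ℝ → ℝ → ℝ
a +ᴿ b = mkℝ (λ n → seq a n + seq b n) (cauchy-+ {seq a} {seq b} (cauchy a) (cauchy b))
a *ᴿ b = mkℝ (λ n → seq a n * seq b n) (cauchy-* {seq a} {seq b} (cauchy a) (cauchy b))

-ᴿ_ : ℝ → ℝ
-ᴿ a = mkℝ (λ n → - seq a n) (cauchy-neg {seq a} (cauchy a))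

∑ᴿ : {A : Set} → List A → (A → ℝ) → ℝ
∑ᴿ xs f = foldr _+ᴿ_ 0ᴿ (map f xs)

-- An index is a List ℕ all of whose entries are NonZero; functions below
-- are total on List ℕ, and only their values at indices are meaningful.
data Admissible : List ℕ → Set where
  empty : Admissible []
  snoc  : ∀ ks {k} → All NonZero ks → 2 ℕ.≤ k → Admissible (ks ∷ʳ k)

1/_^_ : (n : ℕ) .{{_ : NonZero n}} → ℕ → ℚ
1/ n ^ k = (+ 1 / n ℕ.^ k) {{ℕ.m^n≢0 n k}}

-- truncated (k_r ∷ … ∷ k₁ ∷ []) N  =  ∑_{1 ≤ n₁ < … < n_r ≤ N} 1 / (n₁^k₁ ⋯ n_r^k_r);
-- the exponent of the largest summation variable comes first.
truncated : List ℕ → ℕ → ℚ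
truncated []       N       = 1ℚ
truncated (k ∷ ks) zero    = 0ℚ
truncated (k ∷ ks) (suc N) = truncated (k ∷ ks) N + 1/ suc N ^ k * truncated ks N


-- Convergence: with g us m = ∑_{vs a suffix of us} truncated vs (m + 1) / (m + 1), the
-- increments of truncated (k ∷ us), k ≥ 2, are at most those of - g us, and g us → 0.
module _ where
  private
    r q : ℕ → ℚ
    r m = + 1 / suc m
    q m = + suc m / 1

    toℚᵘ-/ : ∀ i n → ℚ.toℚᵘ (i / suc n) ℚᵘ.≃ mkℚᵘ i n
    toℚᵘ-/ i n = ℚ.toℚᵘ-fromℚᵘ (mkℚᵘ i n)

    /-* : ∀ a b .{{_ : NonZero a}} .{{_ : NonZero b}} →
          (+ 1 / (a ℕ.* b)) {{ℕ.m*n≢0 a b}} ≡ + 1 / a * (+ 1 / b)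
    /-* (suc a) (suc b) = ℚ.toℚᵘ-injective (ℚᵘ.≃-trans (toℚᵘ-/ (+ 1) (b ℕ.+ a ℕ.* suc b))
      (ℚᵘ.≃-trans (*≡* refl) (ℚᵘ.≃-trans
        (ℚᵘ.≃-sym (ℚᵘ.*-cong (toℚᵘ-/ (+ 1) a) (toℚᵘ-/ (+ 1) b)))
        (ℚᵘ.≃-sym (ℚ.toℚᵘ-homo-* (+ 1 / suc a) (+ 1 / suc b))))))

    1/^-suc : ∀ m k → 1/ suc m ^ suc k ≡ r m * 1/ suc m ^ k
    1/^-suc m k = /-* (suc m) (suc m ℕ.^ k) {{_}} {{ℕ.m^n≢0 (suc m) k}}

    0≤r : ∀ m → 0ℚ ≤ r m
    0≤r m = ℚ.nonNegative⁻¹ (r m) {{ℚ.normalize-nonNeg 1 (suc m)}}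

    0<r : ∀ m → 0ℚ < r m
    0<r m = ℚ.positive⁻¹ (r m) {{ℚ.normalize-pos 1 (suc m)}}

    r*q : ∀ m → r m * q m ≡ 1ℚ
    r*q m = ℚ.toℚᵘ-injective (ℚᵘ.≃-trans (ℚ.toℚᵘ-homo-* (r m) (q m))
      (ℚᵘ.≃-trans (ℚᵘ.*-cong (toℚᵘ-/ (+ 1) m) (toℚᵘ-/ (+ suc m) 0))
        (*≡* (cong +_ (solve 1 (λ m → con 1 :* (con 1 :+ m) :* con 1
                                   := con 1 :* ((con 1 :+ m) :* con 1)) refl m)))))
      where open ℕ-Solver

    q-suc : ∀ m → q (suc m) ≡ q m + 1ℚ
    q-suc m = ℚ.toℚᵘ-injective (ℚᵘ.≃-trans (toℚᵘ-/ (+ suc (suc m)) 0)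
      (ℚᵘ.≃-trans
        (*≡* (cong +_ (solve 1 (λ m → (con 2 :+ m) :* con 1
                                   := ((con 1 :+ m) :* con 1 :+ con 1) :* con 1) refl m)))
        (ℚᵘ.≃-sym (ℚᵘ.≃-trans (ℚ.toℚᵘ-homo-+ (q m) 1ℚ)
          (ℚᵘ.+-cong (toℚᵘ-/ (+ suc m) 0) ℚᵘ.≃-refl)))))
      where open ℕ-Solver

    r-anti : ∀ m n → m ℕ.≤ n → r n ≤ r m
    r-anti m n m≤n = ℚ.toℚᵘ-cancel-≤
      (ℚᵘ.≤-respˡ-≃ (ℚᵘ.≃-sym (toℚᵘ-/ (+ 1) n))
        (ℚᵘ.≤-respʳ-≃ (ℚᵘ.≃-sym (toℚᵘ-/ (+ 1) m))
          (*≤* (ℤ.+≤+ (ℕ.*-monoʳ-≤ 1 (s≤s m≤n))))))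

    *-mono-nonNeg : ∀ {a b} c → 0ℚ ≤ c → a ≤ b → a * c ≤ b * c
    *-mono-nonNeg c 0≤c = ℚ.*-monoʳ-≤-nonNeg c {{nonNegative 0≤c}}

    0≤* : ∀ {a b} → 0ℚ ≤ a → 0ℚ ≤ b → 0ℚ ≤ a * b
    0≤* {a} {b} 0≤a 0≤b = subst (_≤ a * b) (ℚ.*-zeroˡ b) (*-mono-nonNeg b 0≤b 0≤a)

    0≤+ : ∀ {a b} → 0ℚ ≤ a → 0ℚ ≤ b → 0ℚ ≤ a + b
    0≤+ 0≤a 0≤b = ℚ.+-mono-≤ 0≤a 0≤b

    0≤1/^ : ∀ m k → 0ℚ ≤ 1/ suc m ^ k
    0≤1/^ m zero    = ℚ.nonNegative⁻¹ 1ℚ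
    0≤1/^ m (suc k) = subst (0ℚ ≤_) (sym (1/^-suc m k)) (0≤* (0≤r m) (0≤1/^ m k))

    1/^≤1 : ∀ m k → 1/ suc m ^ k ≤ 1ℚ
    1/^≤1 m zero    = ℚ.≤-refl
    1/^≤1 m (suc k) = begin
      1/ suc m ^ suc k   ≡⟨ 1/^-suc m k ⟩
      r m * 1/ suc m ^ k ≤⟨ *-mono-nonNeg (1/ suc m ^ k) (0≤1/^ m k) (r-anti 0 m z≤n) ⟩
      1ℚ * 1/ suc m ^ k  ≡⟨ ℚ.*-identityˡ (1/ suc m ^ k) ⟩
      1/ suc m ^ k       ≤⟨ 1/^≤1 m k ⟩
      1ℚ ∎
      where open ℚ.≤-Reasoning

    1/^≤r : ∀ m k → 1/ suc m ^ suc k ≤ r m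
    1/^≤r m k = begin
      1/ suc m ^ suc k   ≡⟨ 1/^-suc m k ⟩
      r m * 1/ suc m ^ k ≤⟨ ℚ.*-monoˡ-≤-nonNeg (r m) {{nonNegative (0≤r m)}} (1/^≤1 m k) ⟩
      r m * 1ℚ           ≡⟨ ℚ.*-identityʳ (r m) ⟩
      r m ∎
      where open ℚ.≤-Reasoning

    1/^≤r² : ∀ m k → 1/ suc m ^ suc (suc k) ≤ r m * r m
    1/^≤r² m k = subst (_≤ r m * r m) (sym (1/^-suc m (suc k)))
      (ℚ.*-monoˡ-≤-nonNeg (r m) {{nonNegative (0≤r m)}} (1/^≤r m k))

    archimedean : ∀ B {ε} → 0ℚ < ε → ∃ λ N → ∀ m → N ℕ.≤ m → B * r m < ε
    archimedean B {ε} 0<ε = ℤ.∣ ℚ.↥ c ∣ , λ m N≤m → begin-strict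
        B * r m       ≡⟨ cong (_* r m) (sym εc≡B) ⟩
        ε * c * r m   ≡⟨ ℚ.*-assoc ε c (r m) ⟩
        ε * (c * r m) <⟨ ℚ.*-monoʳ-<-pos ε (ℚ.*-monoˡ-<-pos (r m) {{positive (0<r m)}} (c<q m N≤m)) ⟩
        ε * (q m * r m) ≡⟨ cong (ε *_) (trans (ℚ.*-comm (q m) (r m)) (r*q m)) ⟩
        ε * 1ℚ        ≡⟨ ℚ.*-identityʳ ε ⟩
        ε ∎
      where
      open ℚ.≤-Reasoning
      instance
        ε-pos : ℚ.Positive ε
        ε-pos = positive 0<ε
        ε-nz : ℚ.NonZero ε
        ε-nz = ℚ.pos⇒nonZero ε
      c = (ℚ.1/ ε) * B
      εc≡B : ε * c ≡ B
      εc≡B = trans (sym (ℚ.*-assoc ε (ℚ.1/ ε) B))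
                   (trans (cong (_* B) (ℚ.*-inverseʳ ε)) (ℚ.*-identityˡ B))
      below : ∀ c m → ℤ.∣ ℚ.↥ c ∣ ℕ.≤ m → c < q m
      below (mkℚ (+ n) d _) m n≤m = ℚ.toℚᵘ-cancel-<
        (ℚᵘ.<-respʳ-≃ (ℚᵘ.≃-sym (toℚᵘ-/ (+ suc m) 0))
          (*<* (subst₂ ℤ._<_ (ℤ.pos-* n 1) (ℤ.pos-* (suc m) (suc d))
            (ℤ.+<+ (subst (ℕ._< suc m ℕ.* suc d) (sym (ℕ.*-identityʳ n))
              (ℕ.≤-trans (s≤s n≤m) (ℕ.m≤m*n (suc m) (suc d))))))))
      below (mkℚ (ℤ.-[1+ n ]) d _) m n≤m = ℚ.toℚᵘ-cancel-<
        (ℚᵘ.<-respʳ-≃ (ℚᵘ.≃-sym (toℚᵘ-/ (+ suc m) 0)) (*<* ℤ.-<+))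
      c<q : ∀ m → ℤ.∣ ℚ.↥ c ∣ ℕ.≤ m → c < q m
      c<q = below c

    0≤truncated : ∀ ks n → 0ℚ ≤ truncated ks n
    0≤truncated []       n       = ℚ.nonNegative⁻¹ 1ℚ
    0≤truncated (k ∷ ks) zero    = ℚ.≤-refl
    0≤truncated (k ∷ ks) (suc n) =
      0≤+ (0≤truncated (k ∷ ks) n) (0≤* (0≤1/^ n k) (0≤truncated ks n))

    ≤+ : ∀ a {b} → 0ℚ ≤ b → a ≤ a + b
    ≤+ a {b} 0≤b = subst (_≤ a + b) (ℚ.+-identityʳ a) (ℚ.+-monoʳ-≤ a 0≤b)

    truncated-suc : ∀ ks n → truncated ks n ≤ truncated ks (suc n)
    truncated-suc []       n = ℚ.≤-refl
    truncated-suc (k ∷ ks) n =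
      ≤+ (truncated (k ∷ ks) n) (0≤* (0≤1/^ n k) (0≤truncated ks n))

    g : List ℕ → ℕ → ℚ
    g []       m = truncated [] (suc m) * r m
    g (k ∷ us) m = truncated (k ∷ us) (suc m) * r m + g us m

    r-step : ∀ m → r (suc m) * r (suc m) + r (suc m) ≤ r m
    r-step m = begin
      s * s + s           ≤⟨ ℚ.+-monoˡ-≤ s (*-mono-nonNeg s (0≤r (suc m)) (r-anti m (suc m) (ℕ.n≤1+n m))) ⟩
      r m * s + s         ≡⟨ cong (λ z → r m * s + z) (sym (ℚ.*-identityˡ s)) ⟩
      r m * s + 1ℚ * s    ≡⟨ cong (λ z → r m * s + z * s) (sym (r*q m)) ⟩
      r m * s + r m * q m * s ≡⟨ solve 3 (λ a b c → a :* c :+ a :* b :* c := a :* (c :* (b :+ con 1ℚ)))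
                                         refl (r m) (q m) s ⟩
      r m * (s * (q m + 1ℚ)) ≡⟨ cong (λ z → r m * (s * z)) (sym (q-suc m)) ⟩
      r m * (s * q (suc m)) ≡⟨ cong (r m *_) (r*q (suc m)) ⟩
      r m * 1ℚ            ≡⟨ ℚ.*-identityʳ (r m) ⟩
      r m ∎
      where
      open ℚ.≤-Reasoning
      open +-*-Solver
      s = r (suc m)

    g-step : ∀ us m → All NonZero us →
             truncated us (suc m) * (r (suc m) * r (suc m)) + g us (suc m) ≤ g us m
    g-step [] m [] = begin
      1ℚ * (s * s) + 1ℚ * s ≡⟨ cong₂ _+_ (ℚ.*-identityˡ (s * s)) (ℚ.*-identityˡ s) ⟩
      s * s + s             ≤⟨ r-step m ⟩
      r m                   ≡⟨ sym (ℚ.*-identityˡ (r m)) ⟩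
      1ℚ * r m ∎
      where
      open ℚ.≤-Reasoning
      s = r (suc m)
    g-step (suc k ∷ us) m (_ ∷ pos) = begin
      t * (s * s) + ((t + p * v) * s + g us (suc m))
        ≡⟨ solve 5 (λ t s p v G → t :* (s :* s) :+ ((t :+ p :* v) :* s :+ G)
                               := (s :* s :+ s) :* t :+ (p :* (v :* s) :+ G))
                 refl t s p v (g us (suc m)) ⟩
      (s * s + s) * t + (p * (v * s) + g us (suc m))
        ≤⟨ ℚ.+-mono-≤ (*-mono-nonNeg t (0≤truncated (suc k ∷ us) (suc m)) (r-step m))
             (ℚ.+-monoˡ-≤ (g us (suc m))
               (*-mono-nonNeg (v * s) (0≤* (0≤truncated us (suc m)) (0≤r (suc m)))
                 (1/^≤r (suc m) k))) ⟩
      r m * t + (s * (v * s) + g us (suc m))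
        ≡⟨ solve 5 (λ t s R v G → R :* t :+ (s :* (v :* s) :+ G)
                               := t :* R :+ (v :* (s :* s) :+ G))
                 refl t s (r m) v (g us (suc m)) ⟩
      t * r m + (v * (s * s) + g us (suc m))
        ≤⟨ ℚ.+-monoʳ-≤ (t * r m) (g-step us m pos) ⟩
      t * r m + g us m ∎
      where
      open ℚ.≤-Reasoning
      open +-*-Solver
      s = r (suc m)
      t = truncated (suc k ∷ us) (suc m)
      v = truncated us (suc m)
      p = 1/ suc (suc m) ^ suc k

    Null : (ℕ → ℚ) → Set
    Null a = ∀ ε → 0ℚ < ε → ∃ λ N → ∀ m → N ℕ.≤ m → a m < ε

    null-+ : ∀ {a b} → Null a → Null b → Null (λ m → a m + b m)
    null-+ {a} {b} na nb ε 0<ε =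
      let N₁ , h₁ = na (½ * ε) (half-pos 0<ε)
          N₂ , h₂ = nb (½ * ε) (half-pos 0<ε)
      in N₁ ℕ.⊔ N₂ , λ m N≤m → subst (a m + b m <_) (half+half ε)
           (ℚ.+-mono-< (h₁ m (ℕ.m⊔n≤o⇒m≤o N₁ N₂ N≤m)) (h₂ m (ℕ.m⊔n≤o⇒n≤o N₁ N₂ N≤m)))

    mean-null : ∀ us → All NonZero us → Null (λ m → truncated us (suc m) * r m)
    mean-null [] [] ε 0<ε = archimedean 1ℚ 0<ε
    mean-null (suc k ∷ us) (_ ∷ pos) ε 0<ε =
      let N , h  = mean-null us pos (½ * ε) (half-pos 0<ε)
          N′ , h′ = archimedean (S N) (half-pos 0<ε)
      in N ℕ.⊔ N′ , λ m N≤m →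
           bound N h N′ h′ m (ℕ.m⊔n≤o⇒m≤o N N′ N≤m) (ℕ.m⊔n≤o⇒n≤o N N′ N≤m)
      where
      open ℚ.≤-Reasoning
      S = truncated (suc k ∷ us)
      δ = ½ * ε
      0≤δ : 0ℚ ≤ δ
      0≤δ = ℚ.<⇒≤ (half-pos 0<ε)
      grow : ∀ N → (∀ m → N ℕ.≤ m → truncated us (suc m) * r m < δ) →
             ∀ m → N ℕ.≤ m → S (suc m) ≤ S N + δ * q m
      step : ∀ N → (∀ m → N ℕ.≤ m → truncated us (suc m) * r m < δ) →
             ∀ m → N ℕ.≤ m → S (suc m) ≤ S m + δ
      step N h m N≤m = ℚ.+-monoʳ-≤ (S m) (begin
        1/ suc m ^ suc k * truncated us m
          ≤⟨ *-mono-nonNeg (truncated us m) (0≤truncated us m) (1/^≤r m k) ⟩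
        r m * truncated us m
          ≡⟨ ℚ.*-comm (r m) (truncated us m) ⟩
        truncated us m * r m
          ≤⟨ *-mono-nonNeg (r m) (0≤r m) (truncated-suc us m) ⟩
        truncated us (suc m) * r m
          ≤⟨ ℚ.<⇒≤ (h m N≤m) ⟩
        δ ∎)
      grow N h m N≤m with ℕ.m≤n⇒m<n∨m≡n N≤m
      grow N h m N≤m | inj₂ refl = begin
        S (suc N)       ≤⟨ step N h N ℕ.≤-refl ⟩
        S N + δ         ≡⟨ cong (λ z → S N + z) (sym (ℚ.*-identityʳ δ)) ⟩
        S N + δ * 1ℚ    ≤⟨ ℚ.+-monoʳ-≤ (S N) (ℚ.*-monoˡ-≤-nonNeg δ {{nonNegative 0≤δ}} (1≤q N)) ⟩
        S N + δ * q N ∎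
        where
        1≤q : ∀ m → 1ℚ ≤ q m
        1≤q zero    = ℚ.≤-refl
        1≤q (suc m) = subst (1ℚ ≤_) (sym (q-suc m))
          (ℚ.≤-trans (1≤q m) (≤+ (q m) (ℚ.nonNegative⁻¹ 1ℚ)))
      grow N h (suc m) N≤m | inj₁ (s≤s N≤m′) = begin
        S (suc (suc m))         ≤⟨ step N h (suc m) N≤m ⟩
        S (suc m) + δ           ≤⟨ ℚ.+-monoˡ-≤ δ (grow N h m N≤m′) ⟩
        S N + δ * q m + δ       ≡⟨ solve 3 (λ a b c → a :+ b :* c :+ b := a :+ b :* (c :+ con 1ℚ))
                                           refl (S N) δ (q m) ⟩
        S N + δ * (q m + 1ℚ)    ≡⟨ cong (λ z → S N + δ * z) (sym (q-suc m)) ⟩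
        S N + δ * q (suc m) ∎
        where open +-*-Solver
      bound : ∀ N → (∀ m → N ℕ.≤ m → truncated us (suc m) * r m < δ) →
              ∀ N′ → (∀ m → N′ ℕ.≤ m → S N * r m < δ) →
              ∀ m → N ℕ.≤ m → N′ ℕ.≤ m → S (suc m) * r m < ε
      bound N h N′ h′ m N≤m N′≤m = begin-strict
        S (suc m) * r m           ≤⟨ *-mono-nonNeg (r m) (0≤r m) (grow N h m N≤m) ⟩
        (S N + δ * q m) * r m     ≡⟨ solve 4 (λ a b c d → (a :+ b :* c) :* d := a :* d :+ b :* (d :* c))
                                             refl (S N) δ (q m) (r m) ⟩
        S N * r m + δ * (r m * q m) ≡⟨ cong (λ z → S N * r m + δ * z) (r*q m) ⟩
        S N * r m + δ * 1ℚ        ≡⟨ cong (λ z → S N * r m + z) (ℚ.*-identityʳ δ) ⟩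
        S N * r m + δ             <⟨ ℚ.+-monoˡ-< δ (h′ m N′≤m) ⟩
        δ + δ                     ≡⟨ half+half ε ⟩
        ε ∎
        where open +-*-Solver

    g-null : ∀ us → All NonZero us → Null (g us)
    g-null []       []          = mean-null [] []
    g-null (k ∷ us) (k>0 ∷ pos) =
      null-+ {λ m → truncated (k ∷ us) (suc m) * r m} (mean-null (k ∷ us) (k>0 ∷ pos)) (g-null us pos)

    0≤g : ∀ us m → 0ℚ ≤ g us m
    0≤g []       m = 0≤* (0≤truncated [] (suc m)) (0≤r m)
    0≤g (k ∷ us) m = 0≤+ (0≤* (0≤truncated (k ∷ us) (suc m)) (0≤r m)) (0≤g us m)

    truncated-cauchy′ : ∀ k us → 2 ℕ.≤ k → All NonZero us → IsCauchy (truncated (k ∷ us))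
    truncated-cauchy′ (suc (suc k)) us (s≤s (s≤s _)) pos ε 0<ε = suc N , close
      where
      open ℚ.≤-Reasoning
      S = truncated (suc (suc k) ∷ us)
      N = proj₁ (g-null us pos ε 0<ε)
      step : ∀ m → S (suc (suc m)) + g us (suc m) ≤ S (suc m) + g us m
      step m = begin
        S (suc m) + p * v + g us (suc m)
          ≡⟨ ℚ.+-assoc (S (suc m)) (p * v) (g us (suc m)) ⟩
        S (suc m) + (p * v + g us (suc m))
          ≤⟨ ℚ.+-monoʳ-≤ (S (suc m)) (ℚ.+-monoˡ-≤ (g us (suc m))
               (*-mono-nonNeg v (0≤truncated us (suc m)) (1/^≤r² (suc m) k))) ⟩
        S (suc m) + (s * s * v + g us (suc m))
          ≡⟨ cong (λ z → S (suc m) + (z + g us (suc m))) (ℚ.*-comm (s * s) v) ⟩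
        S (suc m) + (v * (s * s) + g us (suc m))
          ≤⟨ ℚ.+-monoʳ-≤ (S (suc m)) (g-step us m pos) ⟩
        S (suc m) + g us m ∎
        where
        s = r (suc m)
        v = truncated us (suc m)
        p = 1/ suc (suc m) ^ suc (suc k)
      increasing : ∀ m d → S m ≤ S (d ℕ.+ m)
      increasing m zero    = ℚ.≤-refl
      increasing m (suc d) = ℚ.≤-trans (increasing m d) (truncated-suc (suc (suc k) ∷ us) (d ℕ.+ m))
      decreasing : ∀ m d → S (suc (d ℕ.+ m)) + g us (d ℕ.+ m) ≤ S (suc m) + g us m
      decreasing m zero    = ℚ.≤-refl
      decreasing m (suc d) = ℚ.≤-trans (step (d ℕ.+ m)) (decreasing m d)
      ordered : ∀ m d → N ℕ.≤ m → ∣ S (suc (d ℕ.+ m)) - S (suc m) ∣ < ε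
      ordered m d N≤m = begin-strict
        ∣ b - a ∣       ≡⟨ ℚ.0≤p⇒∣p∣≡p (subst (_≤ b - a) (ℚ.+-inverseʳ a)
                             (ℚ.+-monoˡ-≤ (- a) (subst (λ z → a ≤ S z) (ℕ.+-suc d m) (increasing (suc m) d)))) ⟩
        b - a           ≤⟨ ℚ.+-monoˡ-≤ (- a) (≤+ b (0≤g us (d ℕ.+ m))) ⟩
        b + g us (d ℕ.+ m) - a ≤⟨ ℚ.+-monoˡ-≤ (- a) (decreasing m d) ⟩
        a + g us m - a  ≡⟨ solve 2 (λ a G → a :+ G :- a := G) refl a (g us m) ⟩
        g us m          <⟨ proj₂ (g-null us pos ε 0<ε) m N≤m ⟩
        ε ∎
        where
        open +-*-Solver
        a = S (suc m)
        b = S (suc (d ℕ.+ m))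
      gap : ∀ {m n} → m ℕ.≤ n → N ℕ.≤ m → ∣ S (suc n) - S (suc m) ∣ < ε
      gap {m} {n} m≤n N≤m =
        subst (λ z → ∣ S (suc z) - S (suc m) ∣ < ε) (ℕ.m∸n+n≡m m≤n) (ordered m (n ∸ m) N≤m)
      close : ∀ m n → suc N ℕ.≤ m → suc N ℕ.≤ n → ∣ S m - S n ∣ < ε
      close (suc m) (suc n) (s≤s N≤m) (s≤s N≤n) with ℕ.≤-total m n
      ... | inj₂ n≤m = gap n≤m N≤n
      ... | inj₁ m≤n = subst (_< ε)
        (trans (sym (ℚ.∣-p∣≡∣p∣ (S (suc n) - S (suc m))))
               (cong ∣_∣ (solve 2 (λ a b → :- (b :- a) := a :- b) refl (S (suc m)) (S (suc n)))))
        (gap m≤n N≤m)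
        where open +-*-Solver

  abstract
    truncated-cauchy : ∀ k us → 2 ℕ.≤ k → All NonZero us → IsCauchy (truncated (k ∷ us))
    truncated-cauchy = truncated-cauchy′

    truncated-empty-cauchy : IsCauchy (truncated [])
    truncated-empty-cauchy = cauchy-const 1ℚ

ζ-cauchy : ∀ {ks} → Admissible ks → IsCauchy (truncated (reverse ks))
ζ-cauchy empty                  = truncated-empty-cauchy
ζ-cauchy (snoc ks {k} pos 2≤k) = subst (IsCauchy ∘ truncated) (sym (List.reverse-++ ks (k ∷ [])))
  (truncated-cauchy k (reverse ks) 2≤k (All.tabulate (All.lookup pos ∘ Any.reverse⁻)))

ζ : ∀ ks → Admissible ks → ℝ
ζ ks adm = mkℝ (truncated (reverse ks)) (ζ-cauchy adm)

-- Coefficient lists of polynomials over ℝ, constant term first.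
Polynomial : Set
Polynomial = List ℝ

coefficient : Polynomial → ℕ → ℝ
coefficient []      n       = 0ᴿ
coefficient (a ∷ p) zero    = a
coefficient (a ∷ p) (suc n) = coefficient p n

const : ℝ → Polynomial
const a = a ∷ []

T : Polynomial
T = 0ᴿ ∷ 1ᴿ ∷ []

evaluate : Polynomial → ℝ → ℝ
evaluate p c = foldr (λ a v → a +ᴿ c *ᴿ v) 0ᴿ p

addᴾ mulᴾ : Polynomial → Polynomial → Polynomial
addᴾ []      q       = q
addᴾ (a ∷ p) []      = a ∷ p
addᴾ (a ∷ p) (b ∷ q) = a +ᴿ b ∷ addᴾ p q
mulᴾ []      q = []
mulᴾ (a ∷ p) q = addᴾ (map (a *ᴿ_) q) (0ᴿ ∷ mulᴾ p q)

ℝ[T] : RawRing 0ℓ 0ℓ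
ℝ[T] = record
  { Carrier = Polynomial
  ; _≈_     = λ p q → ∀ n → coefficient p n ≈ᴿ coefficient q n
  ; _+_     = addᴾ
  ; _*_     = mulᴾ
  ; -_      = map -ᴿ_
  ; 0#      = []
  ; 1#      = const 1ᴿ
  }

ℝ[[t]] : Set
ℝ[[t]] = ℕ → ℝ

infix 4 _≈_
infixl 6 _⊕_ _⊖_
infixr 7 _·_ t^_·_

_≈_ : ℝ[[t]] → ℝ[[t]] → Set
f ≈ g = ∀ n → f n ≈ᴿ g n

_⊕_ _⊖_ : ℝ[[t]] → ℝ[[t]] → ℝ[[t]]
(f ⊕ g) n = f n +ᴿ g n
(f ⊖ g) n = f n +ᴿ (-ᴿ g n)

_·_ : ℝ → ℝ[[t]] → ℝ[[t]]
(c · f) n = c *ᴿ f n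

constant : ℝ → ℝ[[t]]
constant c zero    = c
constant c (suc n) = 0ᴿ

t^_·_ : ℕ → ℝ[[t]] → ℝ[[t]]
(t^ j · f) n = if j ℕ.≤ᵇ n then f (n ∸ j) else 0ᴿ

∑ : {A : Set} → List A → (A → ℝ[[t]]) → ℝ[[t]]
∑ xs f n = ∑ᴿ xs (λ x → f x n)

-- The sum of a family with f j divisible by t^j, so that only f 0, …, f n
-- contribute to the coefficient of t^n.
∑∞ : (ℕ → ℝ[[t]]) → ℝ[[t]]
∑∞ f n = ∑ᴿ (upTo (suc n)) (λ j → f j n)

data Letter : Set where
  x y : Letter

_≟ᴸ_ : DecidableEquality Letter
x ≟ᴸ x = yes refl
x ≟ᴸ y = no λ ()
y ≟ᴸ x = no λ ()
y ≟ᴸ y = yes refl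

Word : Set
Word = List Letter

-- Elements of ℚ⟨x,y⟩ as formal sums of multiples of words; equality of elements
-- is equality of the functions coeff.
𝔥 : Set
𝔥 = List (ℚ × Word)

coeff : 𝔥 → Word → ℚ
coeff []            w = 0ℚ
coeff ((c , v) ∷ p) w = (if does (List.≡-dec _≟ᴸ_ v w) then c else 0ℚ) + coeff p w

scale : ℚ → 𝔥 → 𝔥
scale c = map (λ (d , w) → c * d , w)

-- The words occurring (with multiplicity) in the shuffle product, which is
-- defined by recursion on last letters: shuffleʳ works on reversed words.
shuffleʳ : Word → Word → List Word
shuffleʳ []      v       = v ∷ []
shuffleʳ (a ∷ u) []      = (a ∷ u) ∷ []
shuffleʳ (a ∷ u) (b ∷ v) = map (a ∷_) (shuffleʳ u (b ∷ v)) ++ map (b ∷_) (shuffleʳ (a ∷ u) v)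

shuffle : Word → Word → List Word
shuffle u v = map reverse (shuffleʳ (reverse u) (reverse v))

_sh_ : 𝔥 → 𝔥 → 𝔥
p sh q = concatMap (λ (c , u) → concatMap (λ (d , v) → map (c * d ,_) (shuffle u v)) q) p

data IsWord¹ : Word → Set where
  ε  : IsWord¹ []
  y∷ : ∀ w → IsWord¹ (y ∷ w)

-- ℚ + y𝔥 is the span of the empty word and the words beginning with y.
In𝔥¹ : 𝔥 → Set
In𝔥¹ = All (IsWord¹ ∘ proj₂)

𝔥¹ : Set
𝔥¹ = Σ 𝔥 In𝔥¹

private
  data EndsInʸ : Word → Set where
    base : EndsInʸ (y ∷ [])
    step : ∀ {a b w} → EndsInʸ (b ∷ w) → EndsInʸ (a ∷ b ∷ w)

  snoc-ends : ∀ w → EndsInʸ (w ∷ʳ y)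
  snoc-ends []          = base
  snoc-ends (a ∷ [])    = step base
  snoc-ends (a ∷ b ∷ w) = step (snoc-ends (b ∷ w))

  ends-snoc : ∀ {w} → EndsInʸ w → ∃ λ v → w ≡ v ∷ʳ y
  ends-snoc base             = [] , refl
  ends-snoc (step {a = a} e) = let v , eq = ends-snoc e in a ∷ v , cong (a ∷_) eq

  ends-∷ : ∀ {a w} → EndsInʸ w → EndsInʸ (a ∷ w)
  ends-∷ base     = step base
  ends-∷ (step e) = step (step e)

  mutual
    shuffleʳ-ends : ∀ u v → EndsInʸ u → EndsInʸ v → All EndsInʸ (shuffleʳ u v)
    shuffleʳ-ends (a ∷ u) (b ∷ v) eu ev = All.++⁺
      (All.map⁺ (shuffleʳ-endsˡ u a (b ∷ v) eu ev))
      (All.map⁺ (shuffleʳ-endsʳ (a ∷ u) v b eu ev))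

    shuffleʳ-endsˡ : ∀ u a v → EndsInʸ (a ∷ u) → EndsInʸ v →
                     All (λ w → EndsInʸ (a ∷ w)) (shuffleʳ u v)
    shuffleʳ-endsˡ []      a v eu        ev = ends-∷ ev ∷ []
    shuffleʳ-endsˡ (c ∷ u) a v (step eu) ev = All.map ends-∷ (shuffleʳ-ends (c ∷ u) v eu ev)

    shuffleʳ-endsʳ : ∀ u v b → EndsInʸ u → EndsInʸ (b ∷ v) →
                     All (λ w → EndsInʸ (b ∷ w)) (shuffleʳ u v)
    shuffleʳ-endsʳ (a ∷ u) []      b eu ev        = ends-∷ eu ∷ []
    shuffleʳ-endsʳ (a ∷ u) (c ∷ v) b eu (step ev) = All.map ends-∷ (shuffleʳ-ends (a ∷ u) (c ∷ v) eu ev)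

  reverse-ends : ∀ w → EndsInʸ (reverse (y ∷ w))
  reverse-ends w = subst EndsInʸ (sym (List.unfold-reverse y w)) (snoc-ends (reverse w))

  ends-reverse : ∀ {w} → EndsInʸ w → IsWord¹ (reverse w)
  ends-reverse e with ends-snoc e
  ... | v , refl = subst IsWord¹ (sym (List.reverse-++ v (y ∷ []))) (y∷ (reverse v))

  shuffleʳ-[] : ∀ u → shuffleʳ u [] ≡ u ∷ []
  shuffleʳ-[] []      = refl
  shuffleʳ-[] (a ∷ u) = refl

  shuffle-word¹ : ∀ {u v} → IsWord¹ u → IsWord¹ v → All IsWord¹ (shuffle u v)
  shuffle-word¹ {v = v} ε wv = subst IsWord¹ (sym (List.reverse-involutive v)) wv ∷ []
  shuffle-word¹ (y∷ u) ε = subst (All IsWord¹)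
    (sym (trans (cong (map reverse) (shuffleʳ-[] (reverse (y ∷ u))))
                (cong (_∷ []) (List.reverse-involutive (y ∷ u)))))
    (y∷ u ∷ [])
  shuffle-word¹ (y∷ u) (y∷ v) = All.map⁺ (All.map ends-reverse
    (shuffleʳ-ends (reverse (y ∷ u)) (reverse (y ∷ v)) (reverse-ends u) (reverse-ends v)))

  concatMap-All : ∀ {A B : Set} {P : A → Set} {Q : B → Set} {f : A → List B} →
                  (∀ {a} → P a → All Q (f a)) → ∀ {as} → All P as → All Q (concatMap f as)
  concatMap-All h []         = []
  concatMap-All h (pa ∷ pas) = All.++⁺ (h pa) (concatMap-All h pas)

scale-∈𝔥¹ : ∀ c {p} → In𝔥¹ p → In𝔥¹ (scale c p)
scale-∈𝔥¹ c = All.map⁺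

sh-∈𝔥¹ : ∀ {p q} → In𝔥¹ p → In𝔥¹ q → In𝔥¹ (p sh q)
sh-∈𝔥¹ wp wq = concatMap-All (λ wu → concatMap-All (λ wv → All.map⁺ (shuffle-word¹ wu wv)) wq) wp

scale¹ : ℚ → 𝔥¹ → 𝔥¹
scale¹ c (p , wp) = scale c p , scale-∈𝔥¹ c wp

⟨𝔥¹,sh⟩ : RawRing 0ℓ 0ℓ
⟨𝔥¹,sh⟩ = record
  { Carrier = 𝔥¹
  ; _≈_     = λ (p , _) (q , _) → ∀ w → coeff p w ≡ coeff q w
  ; _+_     = λ (p , wp) (q , wq) → p ++ q , All.++⁺ wp wq
  ; _*_     = λ (p , wp) (q , wq) → p sh q , sh-∈𝔥¹ wp wq
  ; -_      = scale¹ (- 1ℚ)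
  ; 0#      = [] , []
  ; 1#      = (1ℚ , []) ∷ [] , ε ∷ []
  }

word¹ : ∀ w → IsWord¹ w → 𝔥¹
word¹ w w¹ = (1ℚ , w) ∷ [] , w¹ ∷ []

z : List ℕ → Word
z = concatMap (λ k → y ∷ replicate (k ∸ 1) x)

z-word¹ : ∀ ks → IsWord¹ (z ks)
z-word¹ []       = ε
z-word¹ (k ∷ ks) = y∷ _

record IsℚAlgebraHomomorphism (φ : 𝔥¹ → Polynomial) : Set where
  open RawRing ℝ[T] using () renaming (_≈_ to _≈ᴾ_)
  open RingMorphisms ⟨𝔥¹,sh⟩ ℝ[T] using (IsRingHomomorphism)
  field
    isRingHomomorphism : IsRingHomomorphism φ
    scale-homo         : ∀ c p → φ (scale¹ c p) ≈ᴾ map (fromℚ c *ᴿ_) (φ p)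

-- The defining property of w ↦ Z^sh(w;T).  The words z k, k admissible, form
-- a basis of 𝔥⁰ = ℚ + y𝔥x, so for a linear φ the field extends-Z says that φ
-- extends Z.
record IsShuffleRegularization (φ : 𝔥¹ → Polynomial) : Set where
  open RawRing ℝ[T] using () renaming (_≈_ to _≈ᴾ_)
  field
    isℚAlgebraHomomorphism : IsℚAlgebraHomomorphism φ
    extends-Z              : ∀ ks (adm : Admissible ks) →
                             φ (word¹ (z ks) (z-word¹ ks)) ≈ᴾ const (ζ ks adm)
    y↦T                    : φ (word¹ (y ∷ []) (y∷ [])) ≈ᴾ T

record 2-Poset : Set₁ where
  infix 4 _≺_
  field
    Carrier                 : Set
    _≺_                     : Rel Carrier 0ℓ
    isDecStrictPartialOrder : IsDecStrictPartialOrder _≡_ _≺_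
    elements                : List Carrier
    elements-unique         : Unique elements
    elements-complete       : ∀ p → p ∈ elements
    δ                       : Carrier → Letter

  open IsDecStrictPartialOrder isDecStrictPartialOrder public using ()
    renaming (_<?_ to _≺?_)

insertions : {A : Set} → A → List A → List (List A)
insertions a []       = (a ∷ []) ∷ []
insertions a (b ∷ bs) = (a ∷ b ∷ bs) ∷ map (b ∷_) (insertions a bs)

permutations : {A : Set} → List A → List (List A)
permutations []       = [] ∷ []
permutations (a ∷ as) = concatMap (insertions a) (permutations as)

private
  ∈-insertions : ∀ {A : Set} {a b : A} {as} → b ∈ (a ∷ as) → ∀ {bs} → bs ∈ insertions a as → b ∈ bs
  ∈-insertions {as = []}     b∈           (here refl) = b∈
  ∈-insertions {as = c ∷ as} b∈           (here refl) = b∈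
  ∈-insertions {as = c ∷ as} b∈ (there bs∈) with ∈-map⁻ (c ∷_) bs∈
  ∈-insertions {as = c ∷ as} (here refl)         (there _) | cs , cs∈ , refl = there (∈-insertions (here refl) cs∈)
  ∈-insertions {as = c ∷ as} (there (here refl)) (there _) | cs , cs∈ , refl = here refl
  ∈-insertions {as = c ∷ as} (there (there b∈))  (there _) | cs , cs∈ , refl = there (∈-insertions (there b∈) cs∈)

  ∈-permutations : ∀ {A : Set} {b : A} as → b ∈ as → ∀ {bs} → bs ∈ permutations as → b ∈ bs
  ∈-permutations (a ∷ as) b∈ bs∈ with ∈-concat⁻′ (map (insertions a) (permutations as)) bs∈
  ... | ins , bs∈ins , ins∈ with ∈-map⁻ (insertions a) ins∈
  ... | cs , cs∈ , refl = case b∈ of λ where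
    (here refl)  → ∈-insertions (here refl) bs∈ins
    (there b∈as) → ∈-insertions (there (∈-permutations as b∈as cs∈)) bs∈ins

module _ (X : 2-Poset) where
  open 2-Poset X

  -- A bijection f : X → {1,…,#X} is given by the list f⁻¹(1), …, f⁻¹(#X).
  IsLinearExtension : List Carrier → Set
  IsLinearExtension ps = ∀ i j → lookup ps i ≺ lookup ps j → i Fin.< j

  isLinearExtension? : ∀ ps → Dec (IsLinearExtension ps)
  isLinearExtension? ps =
    Fin.all? λ i → Fin.all? λ j → (lookup ps i ≺? lookup ps j) →-dec (i Fin.<? j)

  linearExtensions : List (List Carrier)
  linearExtensions = filter isLinearExtension? (permutations elements)

  W : 𝔥
  W = map (λ ps → 1ℚ , map δ ps) linearExtensions

-- The transitive closure of a decidable relation on a finite set along which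
-- a rank function increases is decidable.
module _ {A : Set} {_⋖_ : Rel A 0ℓ} (_⋖?_ : Decidable _⋖_)
         (elements : List A) (complete : ∀ a → a ∈ elements)
         (rank : A → ℕ) (rank-mono : ∀ {a b} → a ⋖ b → rank a ℕ.< rank b) where

  rank-mono⁺ : ∀ {a b} → TransClosure _⋖_ a b → rank a ℕ.< rank b
  rank-mono⁺ [ r ]   = rank-mono r
  rank-mono⁺ (r ∷ s) = ℕ.<-trans (rank-mono r) (rank-mono⁺ s)

  private
    dec : ∀ fuel a b → rank b ℕ.≤ fuel ℕ.+ rank a → Dec (TransClosure _⋖_ a b)
    dec zero a b le = no λ s → ℕ.<⇒≱ (rank-mono⁺ s) le
    dec (suc fuel) a b le with a ⋖? b
    ... | yes r = yes [ r ]
    ... | no ¬r = map′ to from (Any.any? via? elements)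
      where
      Via : A → Set
      Via c = Σ[ _ ∈ a ⋖ c ] TransClosure _⋖_ c b
      via? : ∀ c → Dec (Via c)
      via? c with a ⋖? c
      ... | no ¬s = no (¬s ∘ proj₁)
      ... | yes s = map′ (s ,_) proj₂ (dec fuel c b (begin
        rank b                ≤⟨ le ⟩
        suc (fuel ℕ.+ rank a) ≡⟨ sym (ℕ.+-suc fuel (rank a)) ⟩
        fuel ℕ.+ suc (rank a) ≤⟨ ℕ.+-monoʳ-≤ fuel (rank-mono s) ⟩
        fuel ℕ.+ rank c ∎))
        where open ℕ.≤-Reasoning
      to : Any.Any Via elements → TransClosure _⋖_ a b
      to via = let c , s , t = Any.satisfied via in s ∷ t
      from : TransClosure _⋖_ a b → Any.Any Via elements
      from [ r ]           = ⊥-elim (¬r r)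
      from (_∷_ {y = c} s t) = Any.map (λ { refl → s , t }) (complete c)

  transClosure? : Decidable (TransClosure _⋖_)
  transClosure? a b = dec (rank b) a b (ℕ.m≤m+n (rank b) (rank a))

letter : ∀ {n} → Fin n → Letter
letter zero    = y
letter (suc m) = x

-- The 2-poset X⋆(k): the element p_{i,m} is (i , m), with i and m counted from 0.
module _ (ks : List ℕ) where
  private
    P : Set
    P = Σ[ i ∈ Fin (length ks) ] Fin (lookup ks i)

  infix 4 _⋖_
  _⋖_ : Rel P 0ℓ
  (i , m) ⋖ (j , n) = (i ≡ j × toℕ n ≡ suc (toℕ m))
                    ⊎ (toℕ j ≡ suc (toℕ i) × toℕ m ≡ 0 × suc (toℕ n) ≡ lookup ks j)

  private
    _⋖?_ : Decidable _⋖_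
    (i , m) ⋖? (j , n) = (i Fin.≟ j ×-dec toℕ n ℕ.≟ suc (toℕ m))
                   ⊎-dec (toℕ j ℕ.≟ suc (toℕ i) ×-dec toℕ m ℕ.≟ 0 ×-dec suc (toℕ n) ℕ.≟ lookup ks j)

    rank : P → ℕ
    rank (i , m) = toℕ i ℕ.+ toℕ m

    rank-mono : ∀ {p q} → p ⋖ q → rank p ℕ.< rank q
    rank-mono {i , m} {.i , n} (inj₁ (refl , n≡)) rewrite n≡ = ℕ.+-monoʳ-< (toℕ i) ℕ.≤-refl
    rank-mono {i , m} {j , n} (inj₂ (j≡ , m≡ , _)) rewrite j≡ | m≡ =
      s≤s (ℕ.+-monoʳ-≤ (toℕ i) z≤n)

    row : ∀ i → List P
    row i = map (i ,_) (allFin (lookup ks i))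

    rows : List P
    rows = concatMap row (allFin (length ks))

    rows-complete : ∀ p → p ∈ rows
    rows-complete (i , m) =
      ∈-concat⁺′ (∈-map⁺ (i ,_) (∈-allFin m)) (∈-map⁺ row (∈-allFin i))

    rows-unique : Unique rows
    rows-unique = Unique.concat⁺
      (All.map⁺ (All.tabulate (λ {i} _ → Unique.map⁺ ,-injectiveʳ (Unique.allFin⁺ (lookup ks i)))))
      (AllPairs.map⁺ (AllPairs.map disjoint (Unique.allFin⁺ (length ks))))
      where
      ,-injectiveʳ : ∀ {i} {m n : Fin (lookup ks i)} → (P ∋ (i , m)) ≡ (i , n) → m ≡ n
      ,-injectiveʳ refl = refl
      disjoint : ∀ {i j} → i ≢ j → Disjoint (row i) (row j)
      disjoint {i} {j} i≢j (p∈i , p∈j)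
        with ∈-map⁻ (i ,_) p∈i | ∈-map⁻ (j ,_) p∈j
      ... | _ , _ , refl | _ , _ , refl = i≢j refl

    ⋖⁺? : Decidable (TransClosure _⋖_)
    ⋖⁺? = transClosure? _⋖?_ rows rows-complete rank rank-mono

  label : P → Letter
  label (i , m) = letter {lookup ks i} m

  X⋆ : 2-Poset
  X⋆ = record
    { Carrier = P
    ; _≺_     = TransClosure _⋖_
    ; isDecStrictPartialOrder = record
      { isStrictPartialOrder = record
        { isEquivalence = isEquivalence
        ; irrefl        = λ { refl p≺p → ℕ.<-irrefl refl (rank-mono⁺ _⋖?_ rows rows-complete rank rank-mono p≺p) }
        ; trans         = TransClosure.transitive _⋖_
        ; <-resp-≈      = resp₂ (TransClosure _⋖_)
        }
      ; _≟_  = Product.≡-dec Fin._≟_ Fin._≟_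
      ; _<?_ = ⋖⁺?
      }
    ; elements          = rows
    ; elements-unique   = rows-unique
    ; elements-complete = rows-complete
    ; δ                 = label
    }

  w⋆ : 𝔥
  w⋆ = W X⋆

  private
    y-or-above : ∀ {n} (m : Fin n) → letter m ≡ y ⊎ ∃ λ (m′ : Fin n) → toℕ m ≡ suc (toℕ m′)
    y-or-above zero    = inj₁ refl
    y-or-above (suc m) = inj₂ (Fin.inject₁ m , cong suc (sym (Fin.toℕ-inject₁ m)))

    first-label : ∀ ps → ps ∈ linearExtensions X⋆ → IsWord¹ (map label ps)
    first-label []             _   = ε
    first-label ((i , m) ∷ ps) ps∈ with y-or-above m
    ... | inj₁ eq rewrite eq = y∷ _
    ... | inj₂ (m′ , eq) = case first of λ ()
      where
      split = ∈-filter⁻ (isLinearExtension? X⋆) {xs = permutations rows} ps∈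
      below∈ : (i , m′) ∈ ((i , m) ∷ ps)
      below∈ = ∈-permutations rows (rows-complete (i , m′)) (proj₁ split)
      first : Any.index below∈ Fin.< zero {length ps}
      first = proj₂ split (Any.index below∈) zero
        (subst (λ p → TransClosure _⋖_ p (i , m)) (Any.lookup-index below∈) [ inj₁ (refl , eq) ])

  w⋆-∈𝔥¹ : In𝔥¹ w⋆
  w⋆-∈𝔥¹ = All.map⁺ (All.tabulate (λ {ps} → first-label ps))

-- The tuples (l₁, …, l_m) of natural numbers with l₁ + ⋯ + l_m = n.
weakCompositions : (m n : ℕ) → List (List ℕ)
weakCompositions zero    zero    = [] ∷ []
weakCompositions zero    (suc n) = []
weakCompositions (suc m) n       =
  concatMap (λ l → map (l ∷_) (weakCompositions m (n ∸ l))) (upTo (suc n))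

binomials : List ℕ → List ℕ → ℕ
binomials ks ls = product (zipWith (λ k l → (k ℕ.+ l ∸ 1) C l) ks ls)

module _ (Zˢʰ : 𝔥¹ → Polynomial) where

  ζ⋆ᴷʸ : List ℕ → ℝ
  ζ⋆ᴷʸ ks = evaluate (Zˢʰ (w⋆ ks , w⋆-∈𝔥¹ ks)) 0ᴿ

  -- The coefficient of tⁿ collects the l with l_{i+1} + ⋯ + l_r = n.
  ζ⋆ᴷʸ-Ŝ : List ℕ → ℝ[[t]]
  ζ⋆ᴷʸ-Ŝ ks n = ∑ᴿ (upTo (suc (length ks))) λ i →
    let ks≤i = take i ks
        ks>i = drop i ks
    in fromℤ (-1ℤ ℤ.^ sum ks>i) *ᴿ ζ⋆ᴷʸ ks≤i *ᴿ
       ∑ᴿ (weakCompositions (length ks>i) n) λ ls →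
         fromℤ (+ binomials ks>i ls) *ᴿ ζ⋆ᴷʸ (reverse (zipWith ℕ._+_ ks>i ls))

-- δ_{k,({1}^r)}
δ₁ : List ℕ → ℤ
δ₁ ks = if does (List.≡-dec ℕ._≟_ ks (replicate (length ks) 1)) then + 1 else + 0

depth-one-admissible : ∀ k .{{_ : NonZero k}} → Admissible (suc k ∷ [])
depth-one-admissible (suc k) = snoc [] [] (s≤s (s≤s z≤n))

-- Inclusion–exclusion over the relations p_{i,1} < p_{i+1,k_{i+1}} writes ζ^{⋆,KY}(k) as an
-- alternating sum S, over the ways of joining adjacent entries of k, of products of regularised
-- values g of words.  The sums over l turn the second factors of ζ_Ŝ into the same expression for
-- a twist g⁻ of g, and the shuffle product gives ∑ⱼ g(j+1, U) g⁻(a-j, V) = f₂(U, (a, V)) - f₂((a, U), V)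
-- for some f₂.  Telescoping cyclically, the two cyclic sums of ζ_Ŝ agree up to cyclic sums of star
-- values in one of the two factors alone.
--
-- Those are given by the cyclic sum formula of Ohno and Wakabayashi.  Since Z^sh(y; 0) = 0, inserting
-- the letter y in all possible ways relates the cyclic sum of S to a cyclic analogue C of S, in which
-- the last entry is also linked to the first.  For truncated harmonic sums the links of C form a
-- chain n ≤ m₁ ≤ ⋯ ≤ m_r ≤ n, so that C is the single sum of weight k + 1.  To let the truncation
-- tend to infinity, leading ones are first removed on both sides by shuffle regularisation, and the
-- difference of the truncated product and the truncated shuffle product of two words is shown to
-- tend to 0.
{-# OPTIONS --safe #-}
module Submission where

-- The function `f₂` has its origin in the series ∑ₙ tⁿ Z((u ⧢ v) y xⁿ), the entries of v being
-- twisted. Comparing last letters gives this series a recursion whose remaining term carries a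
-- factor t, and such a recursion has only one solution.
--
-- In generating functions the twist is the substitution φ = -x / (1 - t x), an involution; the
-- identities between weights are rational identities for φ, proved through a recursion. They turn
-- the cyclic sum of the second factor into minus a weighted sum, over all indices M ≥ k entrywise,
-- of the cyclic sum of the first. This explains the δ-term: on (1, ..., 1) the first cyclic sum is
-- empty instead of being given by the cyclic sum formula, and M consists of ones only if k does and
-- M = k.
--
-- The obstacle in the cyclic sum formula is that the chain argument uses products of truncated
-- sums, whereas Z multiplies by shuffles and truncations diverge at leading ones. The comparison
-- rests on ∑ e(b) / (a + b) = h(a) / a, summed over b ≥ 0, where e lists the coefficients of
-- (-log(1 - z))ᵐ / m! and h(a) is the complete symmetric polynomial of degree m in 1, ..., 1/a.

-- Finite sums in a commutative ring, and a ring solver with integer coefficients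

module RingSums where

  open import Algebra.Bundles using (CommutativeRing)
  open import Level using (0ℓ)

  module RingTools (R : CommutativeRing 0ℓ 0ℓ) where
    open CommutativeRing R hiding (zero)
    import Algebra.Properties.Ring ring as RP
    open import Algebra.Properties.Semiring.Mult semiring using (_×_; ×-homo-+; ×1-homo-*)
    open import Algebra.Solver.Ring.AlmostCommutativeRing
      using (fromCommutativeRing; _-Raw-AlmostCommutative⟶_)
    open import Data.Integer as ℤ using (ℤ; +_; -[1+_]; _⊖_; _◃_)
    import Data.Integer.Properties as ℤ
    open import Data.List using (List; []; _∷_; _++_; map; concatMap)
    open import Data.Maybe using (Maybe; map)
    open import Data.Nat as ℕ using (ℕ; zero; suc)
    import Data.Nat.Properties as ℕ
    open import Data.Sign as Sign using (Sign)
    open import Function using (_∘_)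
    open import Relation.Binary.PropositionalEquality as ≡ using (_≡_)
    open import Relation.Binary.Reasoning.Setoid setoid
    open import Relation.Nullary.Decidable using (dec⇒maybe)

    -- The coefficient map of the ring solver. Integers have decidable equality, so cancellation can
    -- be normalised over any commutative ring, whose own equality need not be decidable.
    fromInt : ℤ → Carrier
    fromInt (+ n)    = n × 1#
    fromInt -[1+ n ] = - (suc n × 1#)

    private
      cancel-1 : ∀ a b → a - b ≈ (1# + a) - (1# + b)
      cancel-1 a b = begin
        a - b                     ≈⟨ +-identityˡ _ ⟨
        0# + (a - b)              ≈⟨ +-congʳ (-‿inverseʳ 1#) ⟨
        (1# - 1#) + (a - b)       ≈⟨ +-assoc _ _ _ ⟩
        1# + (- 1# + (a - b))     ≈⟨ +-congˡ (+-assoc _ _ _) ⟨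
        1# + ((- 1# + a) - b)     ≈⟨ +-congˡ (+-congʳ (+-comm _ _)) ⟩
        1# + ((a - 1#) - b)       ≈⟨ +-congˡ (+-assoc _ _ _) ⟩
        1# + (a + (- 1# - b))     ≈⟨ +-congˡ (+-congˡ (RP.-‿+-comm 1# b)) ⟩
        1# + (a - (1# + b))       ≈⟨ +-assoc _ _ _ ⟨
        (1# + a) - (1# + b) ∎

      ⊖-homo : ∀ m n → fromInt (m ⊖ n) ≈ m × 1# - n × 1#
      ⊖-homo zero    zero    = sym (-‿inverseʳ 0#)
      ⊖-homo zero    (suc n) = sym (+-identityˡ _)
      ⊖-homo (suc m) zero    = sym (trans (+-congˡ RP.-0#≈0#) (+-identityʳ _))
      ⊖-homo (suc m) (suc n) = trans (reflexive (≡.cong fromInt (ℤ.[1+m]⊖[1+n]≡m⊖n m n)))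
        (trans (⊖-homo m n) (cancel-1 (m × 1#) (n × 1#)))

      +-homo : ∀ i j → fromInt (i ℤ.+ j) ≈ fromInt i + fromInt j
      +-homo (+ m)    (+ n)    = ×-homo-+ 1# m n
      +-homo (+ m)    -[1+ n ] = ⊖-homo m (suc n)
      +-homo -[1+ m ] (+ n)    = trans (⊖-homo n (suc m)) (+-comm _ _)
      +-homo -[1+ m ] -[1+ n ] = begin
        - (suc (suc (m ℕ.+ n)) × 1#)        ≈⟨ -‿cong (reflexive (≡.cong (_× 1#) (≡.cong suc (≡.sym (ℕ.+-suc m n))))) ⟩
        - ((suc m ℕ.+ suc n) × 1#)          ≈⟨ -‿cong (×-homo-+ 1# (suc m) (suc n)) ⟩
        - (suc m × 1# + suc n × 1#)         ≈⟨ RP.-‿+-comm _ _ ⟨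
        - (suc m × 1#) - (suc n × 1#) ∎

      signed : Sign → Carrier → Carrier
      signed Sign.+ a = a
      signed Sign.- a = - a

      ◃-homo : ∀ s n → fromInt (s ◃ n) ≈ signed s (n × 1#)
      ◃-homo Sign.+ zero    = refl
      ◃-homo Sign.- zero    = sym RP.-0#≈0#
      ◃-homo Sign.+ (suc n) = refl
      ◃-homo Sign.- (suc n) = refl

      *-homo : ∀ i j → fromInt (i ℤ.* j) ≈ fromInt i * fromInt j
      *-homo i@(+ m) j@(+ n) = trans (◃-homo Sign.+ (m ℕ.* n)) (×1-homo-* m n)
      *-homo (+ m) -[1+ n ] = trans (◃-homo Sign.- (m ℕ.* suc n))
        (trans (-‿cong (×1-homo-* m (suc n))) (RP.-‿distribʳ-* _ _))
      *-homo -[1+ m ] (+ n) = trans (◃-homo Sign.- (suc m ℕ.* n))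
        (trans (-‿cong (×1-homo-* (suc m) n)) (RP.-‿distribˡ-* _ _))
      *-homo -[1+ m ] -[1+ n ] = trans (×1-homo-* (suc m) (suc n)) (sym (begin
        (- a) * (- b)   ≈⟨ RP.-‿distribˡ-* a (- b) ⟨
        - (a * - b)     ≈⟨ -‿cong (RP.-‿distribʳ-* a b) ⟨
        - (- (a * b))   ≈⟨ RP.-‿involutive _ ⟩
        a * b ∎))
        where
        a = suc m × 1#
        b = suc n × 1#

      neg-homo : ∀ i → fromInt (ℤ.- i) ≈ - fromInt i
      neg-homo (+ zero)  = sym RP.-0#≈0#
      neg-homo (+ suc n) = refl
      neg-homo -[1+ n ]  = sym (RP.-‿involutive _)

      almostRing = fromCommutativeRing R

      morphism : ℤ.+-*-rawRing -Raw-AlmostCommutative⟶ almostRing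
      morphism = record
        { ⟦_⟧ = fromInt ; +-homo = +-homo ; *-homo = *-homo ; -‿homo = neg-homo
        ; 0-homo = refl ; 1-homo = +-identityʳ 1# }

    fromInt-+ = +-homo
    fromInt-* = *-homo
    fromInt-neg = neg-homo

    fromInt-1 : fromInt (+ 1) ≈ 1#
    fromInt-1 = +-identityʳ 1#

    open import Algebra.Solver.Ring ℤ.+-*-rawRing almostRing morphism
      (λ i j → Data.Maybe.map (λ eq → reflexive (≡.cong fromInt eq)) (dec⇒maybe (i ℤ.≟ j)))
      public using (solve; _:=_; _:+_; _:*_; _:-_; :-_; con)

    ∑ : {A : Set} → List A → (A → Carrier) → Carrier
    ∑ []       f = 0#
    ∑ (a ∷ as) f = f a + ∑ as f

    ∑< : ℕ → (ℕ → Carrier) → Carrier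
    ∑< zero    f = 0#
    ∑< (suc n) f = f 0 + ∑< n (f ∘ suc)

    module _ {A : Set} where
      ∑-cong : ∀ (as : List A) {f g} → (∀ a → f a ≈ g a) → ∑ as f ≈ ∑ as g
      ∑-cong []       h = refl
      ∑-cong (a ∷ as) h = +-cong (h a) (∑-cong as h)

      ∑-+ : ∀ (as : List A) f g → ∑ as (λ a → f a + g a) ≈ ∑ as f + ∑ as g
      ∑-+ []       f g = sym (+-identityˡ 0#)
      ∑-+ (a ∷ as) f g = trans (+-congˡ (∑-+ as f g))
        (solve 4 (λ p q r s → (p :+ q) :+ (r :+ s) := (p :+ r) :+ (q :+ s)) refl _ _ _ _)

      ∑-*ˡ : ∀ (as : List A) c f → ∑ as (λ a → c * f a) ≈ c * ∑ as f
      ∑-*ˡ []       c f = sym (zeroʳ c)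
      ∑-*ˡ (a ∷ as) c f = trans (+-congˡ (∑-*ˡ as c f)) (sym (distribˡ c _ _))

      ∑-neg : ∀ (as : List A) f → ∑ as (λ a → - f a) ≈ - ∑ as f
      ∑-neg []       f = sym RP.-0#≈0#
      ∑-neg (a ∷ as) f = trans (+-congˡ (∑-neg as f)) (RP.-‿+-comm _ _)

      ∑-++ : ∀ (as bs : List A) f → ∑ (as ++ bs) f ≈ ∑ as f + ∑ bs f
      ∑-++ []       bs f = sym (+-identityˡ _)
      ∑-++ (a ∷ as) bs f = trans (+-congˡ (∑-++ as bs f)) (sym (+-assoc _ _ _))

      ∑-map : ∀ {B : Set} (h : B → A) bs f → ∑ (Data.List.map h bs) f ≈ ∑ bs (f ∘ h)
      ∑-map h []       f = refl
      ∑-map h (b ∷ bs) f = +-congˡ (∑-map h bs f)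

      ∑-concatMap : ∀ {B : Set} (h : B → List A) bs f →
                    ∑ (concatMap h bs) f ≈ ∑ bs (λ b → ∑ (h b) f)
      ∑-concatMap h []       f = refl
      ∑-concatMap h (b ∷ bs) f = trans (∑-++ (h b) _ f) (+-congˡ (∑-concatMap h bs f))

    ∑<-cong : ∀ n {f g} → (∀ j → f j ≈ g j) → ∑< n f ≈ ∑< n g
    ∑<-cong zero    h = refl
    ∑<-cong (suc n) h = +-cong (h 0) (∑<-cong n (h ∘ suc))

    ∑<-cong-< : ∀ n {f g} → (∀ j → j ℕ.< n → f j ≈ g j) → ∑< n f ≈ ∑< n g
    ∑<-cong-< zero    h = refl
    ∑<-cong-< (suc n) h = +-cong (h 0 (ℕ.s≤s ℕ.z≤n)) (∑<-cong-< n (λ j j<n → h (suc j) (ℕ.s≤s j<n)))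

    ∑<-0 : ∀ n → ∑< n (λ _ → 0#) ≈ 0#
    ∑<-0 zero    = refl
    ∑<-0 (suc n) = trans (+-identityˡ _) (∑<-0 n)

    ∑<-+ : ∀ n f g → ∑< n (λ j → f j + g j) ≈ ∑< n f + ∑< n g
    ∑<-+ zero    f g = sym (+-identityˡ 0#)
    ∑<-+ (suc n) f g = trans (+-congˡ (∑<-+ n _ _))
      (solve 4 (λ p q r s → (p :+ q) :+ (r :+ s) := (p :+ r) :+ (q :+ s)) refl _ _ _ _)

    ∑<-*ˡ : ∀ n c f → ∑< n (λ j → c * f j) ≈ c * ∑< n f
    ∑<-*ˡ zero    c f = sym (zeroʳ c)
    ∑<-*ˡ (suc n) c f = trans (+-congˡ (∑<-*ˡ n c _)) (sym (distribˡ c _ _))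

    ∑<-neg : ∀ n f → ∑< n (λ j → - f j) ≈ - ∑< n f
    ∑<-neg zero    f = sym RP.-0#≈0#
    ∑<-neg (suc n) f = trans (+-congˡ (∑<-neg n _)) (RP.-‿+-comm _ _)

    ∑<-last : ∀ n f → ∑< (suc n) f ≈ ∑< n f + f n
    ∑<-last zero    f = +-comm _ _
    ∑<-last (suc n) f = trans (+-congˡ (∑<-last n (f ∘ suc))) (sym (+-assoc _ _ _))

    ∑<-reverse : ∀ n f → ∑< n f ≈ ∑< n (λ j → f (n ℕ.∸ suc j))
    ∑<-reverse zero    f = refl
    ∑<-reverse (suc n) f = trans (∑<-last n f) (trans (+-comm _ _) (+-congˡ (∑<-reverse n f)))

    ∑<-const : ∀ n c → ∑< n (λ _ → c) ≈ fromInt (+ n) * c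
    ∑<-const zero    c = sym (zeroˡ c)
    ∑<-const (suc n) c = trans (+-congˡ (∑<-const n c))
      (sym (trans (distribʳ c 1# (n × 1#)) (+-congʳ (*-identityˡ c))))

-- Alternating sums over joined rows, and insertion of the letter y

module StarSums where

  open import Algebra.Bundles using (CommutativeRing)
  open import Level using (0ℓ)
  open import Data.List using (List; []; _∷_; _++_; _∷ʳ_)
  import Data.List.Properties as List
  open import Data.Nat as ℕ using (ℕ; zero; suc; _∸_)
  open RingSums

  -- A list k₁, …, k_p of positive integers encodes the word z_{k_p} ⋯ z_{k₁}.
  Row : Set
  Row = List ℕ

  module Insertion (R : CommutativeRing 0ℓ 0ℓ) where
    open CommutativeRing R hiding (zero)
    open RingTools R
    import Algebra.Properties.Ring ring as RP

    -- ∂ h v is the sum of h over the insertions of the letter y strictly inside the word v;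
    -- the value at the empty word is the one making ∂-++ hold.
    ∂ : (Row → Carrier) → Row → Carrier
    ∂ h []       = - h (1 ∷ [])
    ∂ h (k ∷ ks) = ∑< (k ∸ 1) (λ j → h ((k ∸ j) ∷ suc j ∷ ks)) + h (k ∷ 1 ∷ ks) + ∂ (λ U → h (k ∷ U)) ks

    ∂-cong : ∀ v {h h′} → (∀ U → h U ≈ h′ U) → ∂ h v ≈ ∂ h′ v
    ∂-cong []       eq = -‿cong (eq _)
    ∂-cong (k ∷ ks) eq = +-cong (+-cong (∑<-cong (k ∸ 1) (λ j → eq _)) (eq _)) (∂-cong ks (λ U → eq (k ∷ U)))

    ∂-+ : ∀ v h h′ → ∂ (λ U → h U + h′ U) v ≈ ∂ h v + ∂ h′ v
    ∂-+ []       h h′ = sym (RP.-‿+-comm _ _)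
    ∂-+ (k ∷ ks) h h′ = trans (+-cong (+-congʳ (∑<-+ (k ∸ 1) _ _)) (∂-+ ks _ _))
      (solve 6 (λ a b c d e f → ((a :+ b) :+ (c :+ d)) :+ (e :+ f) := ((a :+ c) :+ e) :+ ((b :+ d) :+ f)) refl _ _ _ _ _ _)

    ∂-*ˡ : ∀ v c h → ∂ (λ U → c * h U) v ≈ c * ∂ h v
    ∂-*ˡ []       c h = RP.-‿distribʳ-* _ _
    ∂-*ˡ (k ∷ ks) c h = trans (+-cong (+-congʳ (∑<-*ˡ (k ∸ 1) c _)) (∂-*ˡ ks c _))
      (solve 4 (λ c x y z → (c :* x :+ c :* y) :+ c :* z := c :* ((x :+ y) :+ z)) refl _ _ _ _)

    ∂-neg : ∀ v h → ∂ (λ U → - h U) v ≈ - ∂ h v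
    ∂-neg v h = trans (∂-cong v (λ U → sym (RP.-1*x≈-x (h U)))) (trans (∂-*ˡ v (- 1#) h) (RP.-1*x≈-x _))

    -- An inner place of a concatenation lies inside one of the two words or at the junction, where
    -- the letter forms the entry 1.
    ∂-++ : ∀ v u h → ∂ h (v ++ u) ≈ (∂ (λ v′ → h (v′ ++ u)) v + ∂ (λ u′ → h (v ++ u′)) u) + h (v ++ 1 ∷ u)
    ∂-++ []       u h = solve 2 (λ a b → b := (:- a :+ b) :+ a) refl _ _
    ∂-++ (k ∷ ks) u h = trans (+-congˡ (∂-++ ks u (λ U → h (k ∷ U))))
      (solve 5 (λ a b c d e → (a :+ b) :+ ((c :+ d) :+ e) := (((a :+ b) :+ c) :+ d) :+ e) refl _ _ _ _ _)

  module Star (R : CommutativeRing 0ℓ 0ℓ) (g : List ℕ → CommutativeRing.Carrier R) where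
    open CommutativeRing R hiding (zero)
    open RingTools R
    open Insertion R public
    import Algebra.Properties.Ring ring as RP
    open import Data.Integer using (+_)
    open import Relation.Binary.PropositionalEquality as ≡ using (_≡_)
    open import Relation.Binary.Reasoning.Setoid setoid

    -- Here `h U` is the value of an unfinished first row after the rows merged into it have been
    -- appended as `U`. A link equals the absence of a condition minus the reversed link: the
    -- absence closes the row and leaves a product, the reversal makes one chain of the two rows.
    E : (Row → Carrier) → List Row → Carrier
    E h []       = h []
    E h (u ∷ us) = h [] * E (λ U → g (u ++ U)) us - E (λ U → h (u ++ U)) us

    S : List Row → Carrier
    S []       = 1#
    S (u ∷ us) = E (λ U → g (u ++ U)) us

    E-cong : ∀ us {h h′} → (∀ U → h U ≈ h′ U) → E h us ≈ E h′ us
    E-cong []       eq = eq []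
    E-cong (u ∷ us) eq = +-cong (*-congʳ (eq [])) (-‿cong (E-cong us (λ U → eq (u ++ U))))

    E-+ : ∀ us h h′ → E (λ U → h U + h′ U) us ≈ E h us + E h′ us
    E-+ []       h h′ = refl
    E-+ (u ∷ us) h h′ = trans (+-congˡ (-‿cong (E-+ us _ _)))
      (solve 5 (λ a b s p q → (a :+ b) :* s :- (p :+ q) := (a :* s :- p) :+ (b :* s :- q)) refl _ _ _ _ _)

    E-*ˡ : ∀ us c h → E (λ U → c * h U) us ≈ c * E h us
    E-*ˡ []       c h = refl
    E-*ˡ (u ∷ us) c h = trans (+-congˡ (-‿cong (E-*ˡ us c _)))
      (solve 4 (λ c a s p → (c :* a) :* s :- c :* p := c :* (a :* s :- p)) refl _ _ _ _)

    E-neg : ∀ us h → E (λ U → - h U) us ≈ - E h us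
    E-neg us h = begin
      E (λ U → - h U) us      ≈⟨ E-cong us (λ U → RP.-1*x≈-x (h U)) ⟨
      E (λ U → - 1# * h U) us ≈⟨ E-*ˡ us (- 1#) h ⟩
      - 1# * E h us           ≈⟨ RP.-1*x≈-x _ ⟩
      - E h us ∎

    E-0 : ∀ us → E (λ _ → 0#) us ≈ 0#
    E-0 us = trans (E-cong us (λ _ → sym (zeroˡ 0#))) (trans (E-*ˡ us 0# _) (zeroˡ _))

    E-∑< : ∀ us n (h : ℕ → Row → Carrier) → E (λ U → ∑< n (λ j → h j U)) us ≈ ∑< n (λ j → E (h j) us)
    E-∑< us zero    h = E-0 us
    E-∑< us (suc n) h = trans (E-+ us (h 0) _) (+-congˡ (E-∑< us n (λ j → h (suc j))))

    -- The choice `h = g` means an empty unfinished row. Closing it and merging it with the next row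
    -- give the same value, and the two terms cancel.
    E-g : g [] ≈ 1# → ∀ u us → E g (u ∷ us) ≈ 0#
    E-g g≈1 u us = trans (+-congʳ (trans (*-congʳ g≈1) (*-identityˡ _))) (-‿inverseʳ _)

    S-front : ∀ u u′ us → S (u ∷ u′ ∷ us) ≈ g u * S (u′ ∷ us) - S ((u ++ u′) ∷ us)
    S-front u u′ us rewrite List.++-identityʳ u =
      +-congˡ (-‿cong (E-cong us (λ U → reflexive (≡.cong g (≡.sym (List.++-assoc u u′ U))))))

    -- Reversing the link bottom(v) < top(w) puts the row w below v.
    E-back : ∀ us h v w → E h (us ++ v ∷ w ∷ []) ≈ E h (us ∷ʳ v) * g w - E h (us ∷ʳ (v ++ w))
    E-back [] h v w
      rewrite List.++-identityʳ v | List.++-identityʳ w | List.++-identityʳ (v ++ w) =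
      solve 6 (λ a x y xy b c → a :* (x :* y :- xy) :- (b :* y :- c) := (a :* x :- b) :* y :- (a :* xy :- c))
        refl (h []) (g v) (g w) (g (v ++ w)) (h v) (h (v ++ w))
    E-back (u ∷ us) h v w = begin
      h [] * E k (us ++ v ∷ w ∷ []) - E h′ (us ++ v ∷ w ∷ [])
        ≈⟨ +-cong (*-congˡ (E-back us k v w)) (-‿cong (E-back us h′ v w)) ⟩
      h [] * (E k (us ∷ʳ v) * g w - E k (us ∷ʳ (v ++ w))) - (E h′ (us ∷ʳ v) * g w - E h′ (us ∷ʳ (v ++ w)))
        ≈⟨ solve 6 (λ a x y xy b c → a :* (x :* y :- xy) :- (b :* y :- c) := (a :* x :- b) :* y :- (a :* xy :- c))
             refl (h []) (E k (us ∷ʳ v)) (g w) (E k (us ∷ʳ (v ++ w))) (E h′ (us ∷ʳ v)) (E h′ (us ∷ʳ (v ++ w))) ⟩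
      (h [] * E k (us ∷ʳ v) - E h′ (us ∷ʳ v)) * g w - (h [] * E k (us ∷ʳ (v ++ w)) - E h′ (us ∷ʳ (v ++ w))) ∎
      where
      k h′ : Row → Carrier
      k U  = g (u ++ U)
      h′ U = h (u ++ U)

    S-back : ∀ u us v w → S (u ∷ us ++ v ∷ w ∷ []) ≈ S (u ∷ us ∷ʳ v) * g w - S (u ∷ us ∷ʳ (v ++ w))
    S-back u us = E-back us (λ U → g (u ++ U))

    -- The cyclic version of S: the row v is also linked below the first row.
    C : List Row → Row → Carrier
    C []       v = g v
    C (u ∷ us) v = S (u ∷ us ∷ʳ v) - C us (v ++ u)

    -- Induction on the number of rows. The link from `u` to `u′` is resolved by `S-front`, the
    -- closing link by the definition of `C`. Of the four resulting terms two recombine by `S-back`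
    -- into the first term of the rotated cycle, and the other two form a shorter cycle in which `u`
    -- and `u′` are joined.
    C-rotate : ∀ u us v → C (u ∷ us) v ≈ C (us ∷ʳ v) u
    C-rotate u [] v
      rewrite List.++-identityʳ u | List.++-identityʳ v =
      solve 4 (λ a b ab ba → (a :* b :- ab) :- ba := (b :* a :- ba) :- ab) refl (g u) (g v) _ _
    C-rotate u (u′ ∷ us) v = begin
      S (u ∷ u′ ∷ us ∷ʳ v) - (S (u′ ∷ us ∷ʳ (v ++ u)) - C us ((v ++ u) ++ u′))
        ≈⟨ +-congʳ (S-front u u′ (us ∷ʳ v)) ⟩
      (g u * S (u′ ∷ us ∷ʳ v) - S ((u ++ u′) ∷ us ∷ʳ v)) - (S (u′ ∷ us ∷ʳ (v ++ u)) - C us ((v ++ u) ++ u′))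
        ≈⟨ solve 5 (λ a b c d e → (a :* b :- c) :- (d :- e) := (b :* a :- d) :- (c :- e)) refl
             (g u) (S (u′ ∷ us ∷ʳ v)) (S ((u ++ u′) ∷ us ∷ʳ v)) (S (u′ ∷ us ∷ʳ (v ++ u))) (C us ((v ++ u) ++ u′)) ⟩
      (S (u′ ∷ us ∷ʳ v) * g u - S (u′ ∷ us ∷ʳ (v ++ u))) - (S ((u ++ u′) ∷ us ∷ʳ v) - C us ((v ++ u) ++ u′))
        ≈⟨ +-cong (sym (S-back u′ us v u)) (-‿cong (+-congˡ (-‿cong (reflexive (≡.cong (C us) (List.++-assoc v u u′)))))) ⟩
      S (u′ ∷ us ++ v ∷ u ∷ []) - C ((u ++ u′) ∷ us) v
        ≈⟨ +-cong (reflexive (≡.cong (λ z → S (u′ ∷ z)) (≡.sym (List.++-assoc us (v ∷ []) (u ∷ []))))) (-‿cong (C-rotate (u ++ u′) us v)) ⟩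
      S (u′ ∷ (us ∷ʳ v) ∷ʳ u) - C (us ∷ʳ v) (u ++ u′) ∎

    ∂-E : ∀ v us (h : Row → Row → Carrier) →
          ∂ (λ v′ → E (h v′) us) v ≈ E (λ L → ∂ (λ v′ → h v′ L) v) us
    ∂-E []       us h = sym (E-neg us _)
    ∂-E (k ∷ ks) us h = sym (trans (E-+ us _ _)
      (+-cong (trans (E-+ us _ _) (+-congʳ (E-∑< us (k ∸ 1) _))) (sym (∂-E ks us (λ U → h (k ∷ U))))))

    -- The two ways in which a letter y enters a list of rows: `𝒟` places it inside a row, `𝒢` adds
    -- it as a row of its own in any gap, the two ends included.
    𝒟 𝒢 : (List Row → Carrier) → List Row → Carrier
    𝒟 Φ []       = 0#
    𝒟 Φ (u ∷ us) = ∂ (λ u′ → Φ (u′ ∷ us)) u + 𝒟 (λ us′ → Φ (u ∷ us′)) us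
    𝒢 Φ []       = Φ ((1 ∷ []) ∷ [])
    𝒢 Φ (u ∷ us) = Φ ((1 ∷ []) ∷ u ∷ us) + 𝒢 (λ us′ → Φ (u ∷ us′)) us

    𝒟-cong : ∀ us {Φ Ψ} → (∀ us → Φ us ≈ Ψ us) → 𝒟 Φ us ≈ 𝒟 Ψ us
    𝒟-cong []       eq = refl
    𝒟-cong (u ∷ us) eq = +-cong (∂-cong u (λ u′ → eq (u′ ∷ us))) (𝒟-cong us (λ us′ → eq (u ∷ us′)))

    𝒢-cong : ∀ us {Φ Ψ} → (∀ us → Φ us ≈ Ψ us) → 𝒢 Φ us ≈ 𝒢 Ψ us
    𝒢-cong []       eq = eq _
    𝒢-cong (u ∷ us) eq = +-cong (eq _) (𝒢-cong us (λ us′ → eq (u ∷ us′)))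

    𝒟-lin : ∀ us c Φ Ψ → 𝒟 (λ us → c * Φ us - Ψ us) us ≈ c * 𝒟 Φ us - 𝒟 Ψ us
    𝒟-lin []       c Φ Ψ = sym (trans (+-cong (zeroʳ c) RP.-0#≈0#) (+-identityˡ 0#))
    𝒟-lin (u ∷ us) c Φ Ψ = trans
      (+-cong (trans (∂-+ u _ _) (+-cong (∂-*ˡ u c _) (∂-neg u _))) (𝒟-lin us c (λ us′ → Φ (u ∷ us′)) (λ us′ → Ψ (u ∷ us′))))
      (solve 5 (λ c p q r s → (c :* p :- q) :+ (c :* r :- s) := c :* (p :+ r) :- (q :+ s)) refl c _ _ _ _)

    𝒢-lin : ∀ us c Φ Ψ → 𝒢 (λ us → c * Φ us - Ψ us) us ≈ c * 𝒢 Φ us - 𝒢 Ψ us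
    𝒢-lin []       c Φ Ψ = refl
    𝒢-lin (u ∷ us) c Φ Ψ = trans
      (+-congˡ (𝒢-lin us c (λ us′ → Φ (u ∷ us′)) (λ us′ → Ψ (u ∷ us′))))
      (solve 5 (λ c p q r s → (c :* p :- q) :+ (c :* r :- s) := c :* (p :+ r) :- (q :+ s)) refl c _ _ _ _)

    𝒟-snoc : ∀ us v Φ → 𝒟 Φ (us ∷ʳ v) ≈ 𝒟 (λ us → Φ (us ∷ʳ v)) us + ∂ (λ v′ → Φ (us ∷ʳ v′)) v
    𝒟-snoc []       v Φ = +-comm _ _
    𝒟-snoc (u ∷ us) v Φ = trans (+-congˡ (𝒟-snoc us v (λ us′ → Φ (u ∷ us′)))) (sym (+-assoc _ _ _))

    𝒢-snoc : ∀ us v Φ → 𝒢 Φ (us ∷ʳ v) ≈ 𝒢 (λ us → Φ (us ∷ʳ v)) us + Φ (us ++ v ∷ (1 ∷ []) ∷ [])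
    𝒢-snoc []       v Φ = refl
    𝒢-snoc (u ∷ us) v Φ = trans (+-congˡ (𝒢-snoc us v (λ us′ → Φ (u ∷ us′)))) (sym (+-assoc _ _ _))

    module Derivation (y-insertion : ∀ v → (g (1 ∷ v) + g (v ∷ʳ 1)) + ∂ g v ≈ 0#) where

      private
        y : Row
        y = 1 ∷ []

        total : (Row → Carrier) → Row → Carrier
        total h L = (h (1 ∷ L) + h (L ∷ʳ 1)) + ∂ h L

      -- The case of the empty word, where the value chosen for `∂ g []` cancels one of the two end
      -- insertions and leaves a single `g y`.
      g-y : g y ≈ 0#
      g-y = trans (solve 1 (λ a → a := (a :+ a) :+ (:- a)) refl (g y)) (y-insertion [])

      -- In a joined row, insertions inside its parts are all inner insertions minus those at
      -- junctions, and by `y-insertion` all inner insertions are minus those at the two ends. On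
      -- the other side, `g y = 0` forces a new row y to be merged with a neighbour, which produces
      -- the same end and junction terms. For the unfinished row the value `h` is not annihilated,
      -- whence the remainder `total h`; it becomes a single end insertion when `h` is specialised
      -- to `g` in `𝒟-S`.
      𝒟-E : ∀ us h → 𝒟 (E h) us ≈ 𝒢 (E h) us + E (total h) us
      𝒟-S : ∀ us → 𝒟 S us ≈ 𝒢 S us

      𝒟-E [] h rewrite List.++-identityʳ y = solve 3 (λ a b c → con (+ 0) := (a :* b :- c) :+ ((c :+ c) :+ (:- c)) :- a :* b)
        refl (h []) (g y) (h y) ⟨ trans ⟩ trans (+-congˡ (trans (-‿cong (trans (*-congˡ g-y) (zeroʳ _))) RP.-0#≈0#)) (+-identityʳ _)
        where open import Function using (_⟨_⟩_)
      𝒟-E (u ∷ us) h = begin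
        ∂ (λ u′ → h [] * S (u′ ∷ us) - E (λ U → h (u′ ++ U)) us) u
          + 𝒟 (λ us′ → h [] * S (u ∷ us′) - E (λ U → h (u ++ U)) us′) us
          ≈⟨ +-cong (trans (∂-+ u _ _) (+-cong (∂-*ˡ u _ _) (trans (∂-neg u _) (-‿cong (∂-E u us (λ u′ U → h (u′ ++ U)))))))
                    (𝒟-lin us (h []) (λ us′ → S (u ∷ us′)) (E h′)) ⟩
        (h [] * a - b) + (h [] * c - 𝒟 (E h′) us)
          ≈⟨ solve 5 (λ h a b c d → (h :* a :- b) :+ (h :* c :- d) := h :* (a :+ c) :- (b :+ d)) refl (h []) a b c _ ⟩
        h [] * 𝒟 S (u ∷ us) - (b + 𝒟 (E h′) us)
          ≈⟨ +-cong (*-congˡ (𝒟-S (u ∷ us))) (-‿cong (+-congˡ (𝒟-E us h′))) ⟩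
        h [] * (S (y ∷ u ∷ us) + q) - (b + (p + E (total h′) us))
          ≈⟨ solve 7 (λ h s q b p t r → h :* (s :+ q) :- (b :+ (p :+ t))
                         := ((h :* s :- r) :+ (h :* q :- p)) :+ (r :- (b :+ t)))
               refl (h []) (S (y ∷ u ∷ us)) q b p (E (total h′) us) (E (λ U → h (1 ∷ U)) (u ∷ us)) ⟩
        ((h [] * S (y ∷ u ∷ us) - E (λ U → h (1 ∷ U)) (u ∷ us)) + (h [] * q - p))
          + (E (λ U → h (1 ∷ U)) (u ∷ us) - (b + E (total h′) us))
          ≈⟨ +-cong (+-congˡ (sym (𝒢-lin us (h []) (λ us′ → S (u ∷ us′)) (E h′)))) ends ⟩
        𝒢 (E h) (u ∷ us) + E (total h) (u ∷ us) ∎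
        where
        h′ : Row → Carrier
        h′ U = h (u ++ U)
        a = ∂ (λ u′ → S (u′ ∷ us)) u
        b = E (λ L → ∂ (λ u′ → h (u′ ++ L)) u) us
        c = 𝒟 (λ us′ → S (u ∷ us′)) us
        p = 𝒢 (E h′) us
        q = 𝒢 (λ us′ → S (u ∷ us′)) us
        ends : E (λ U → h (1 ∷ U)) (u ∷ us) - (b + E (total h′) us) ≈ E (total h) (u ∷ us)
        ends = begin
          (h y * S (u ∷ us) - E (λ U → h (1 ∷ u ++ U)) us) - (b + E (total h′) us)
            ≈⟨ solve 4 (λ x r b t → (x :- r) :- (b :+ t) := x :- (r :+ (b :+ t))) refl _ _ _ _ ⟩
          h y * S (u ∷ us) - (E (λ U → h (1 ∷ u ++ U)) us + (b + E (total h′) us))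
            ≈⟨ +-cong (*-congʳ (solve 1 (λ a → a := (a :+ a) :+ (:- a)) refl (h y)))
                 (-‿cong (sym (trans (E-+ us _ _) (+-congˡ (E-+ us _ _))))) ⟩
          total h [] * S (u ∷ us) - E (λ U → h (1 ∷ u ++ U) + (∂ (λ u′ → h (u′ ++ U)) u + total h′ U)) us
            ≈⟨ +-congˡ (-‿cong (E-cong us λ U → begin
                 h (1 ∷ u ++ U) + (∂ (λ u′ → h (u′ ++ U)) u + ((h (u ++ 1 ∷ U) + h (u ++ (U ∷ʳ 1))) + ∂ h′ U))
                   ≈⟨ solve 5 (λ a b c d e → a :+ (b :+ ((c :+ d) :+ e)) := (a :+ d) :+ ((b :+ e) :+ c)) refl _ _ _ _ _ ⟩
                 (h (1 ∷ u ++ U) + h (u ++ (U ∷ʳ 1))) + ((∂ (λ u′ → h (u′ ++ U)) u + ∂ h′ U) + h (u ++ 1 ∷ U))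
                   ≈⟨ +-cong (+-congˡ (reflexive (≡.cong h (≡.sym (List.++-assoc u U y))))) (sym (∂-++ u U h)) ⟩
                 total h (u ++ U) ∎)) ⟩
          E (total h) (u ∷ us) ∎

      𝒟-S [] rewrite List.++-identityʳ y = sym g-y
      𝒟-S (u ∷ us) = begin
        ∂ (λ u′ → S (u′ ∷ us)) u + 𝒟 (E k) us
          ≈⟨ +-cong (∂-E u us (λ u′ U → g (u′ ++ U))) (𝒟-E us k) ⟩
        b + (𝒢 (E k) us + E (total k) us)
          ≈⟨ solve 3 (λ b p t → b :+ (p :+ t) := (b :+ t) :+ p) refl _ _ _ ⟩
        (b + E (total k) us) + 𝒢 (E k) us
          ≈⟨ +-congʳ head ⟩
        S (y ∷ u ∷ us) + 𝒢 (E k) us ∎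
        where
        k : Row → Carrier
        k U = g (u ++ U)
        b = E (λ L → ∂ (λ u′ → g (u′ ++ L)) u) us
        head : b + E (total k) us ≈ S (y ∷ u ∷ us)
        head = begin
          b + E (total k) us
            ≈⟨ E-+ us _ _ ⟨
          E (λ U → ∂ (λ u′ → g (u′ ++ U)) u + total k U) us
            ≈⟨ E-cong us (λ U → begin
                 ∂ (λ u′ → g (u′ ++ U)) u + ((g (u ++ 1 ∷ U) + g (u ++ (U ∷ʳ 1))) + ∂ k U)
                   ≈⟨ solve 5 (λ f a c d e → a :+ ((c :+ d) :+ e) := ((f :+ d) :+ ((a :+ e) :+ c)) :- f) refl (g (1 ∷ u ++ U)) _ _ _ _ ⟩
                 ((g (1 ∷ u ++ U) + g (u ++ (U ∷ʳ 1))) + ((∂ (λ u′ → g (u′ ++ U)) u + ∂ k U) + g (u ++ 1 ∷ U))) - g (1 ∷ u ++ U)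
                   ≈⟨ +-congʳ (trans (+-cong (+-congˡ (reflexive (≡.cong g (≡.sym (List.++-assoc u U y))))) (sym (∂-++ u U g)))
                        (y-insertion (u ++ U))) ⟩
                 0# - g (1 ∷ u ++ U)
                   ≈⟨ +-identityˡ _ ⟩
                 - g (1 ∷ u ++ U) ∎) ⟩
          E (λ U → - g (1 ∷ u ++ U)) us
            ≈⟨ E-neg us _ ⟩
          - E (λ U → g (1 ∷ u ++ U)) us
            ≈⟨ +-identityˡ _ ⟨
          0# - E (λ U → g (1 ∷ u ++ U)) us
            ≈⟨ +-congʳ (trans (*-congʳ g-y) (zeroˡ _)) ⟨
          S (y ∷ u ∷ us) ∎

      S-snoc-y : ∀ u us v → S (u ∷ us ++ v ∷ y ∷ []) ≈ - S (u ∷ us ∷ʳ (v ∷ʳ 1))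
      S-snoc-y u us v = trans (S-back u us v y)
        (trans (+-congʳ (trans (*-congˡ g-y) (zeroʳ _))) (+-identityˡ _))

      -- The recursion of `C` reduces this to `𝒟-S`. Joining `u` to `v` hides the junction term `e`;
      -- it reappears on the right because a row y in front of `u` may be merged with `v` as well as
      -- with `u`.
      𝒟-C : ∀ us v → 𝒟 (λ us → C us v) us + ∂ (C us) v ≈ 𝒢 (λ us → C us v) us
      𝒟-C [] v rewrite List.++-identityʳ v = begin
        0# + ∂ g v
          ≈⟨ solve 3 (λ a b c → con (+ 0) :+ c := ((a :+ b) :+ c) :+ (:- a :- b)) refl (g (1 ∷ v)) (g (v ∷ʳ 1)) (∂ g v) ⟩
        ((g (1 ∷ v) + g (v ∷ʳ 1)) + ∂ g v) + (- g (1 ∷ v) - g (v ∷ʳ 1))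
          ≈⟨ +-congʳ (y-insertion v) ⟩
        0# + (- g (1 ∷ v) - g (v ∷ʳ 1))
          ≈⟨ trans (+-identityˡ _) (+-congʳ (trans (sym (+-identityˡ _)) (+-congʳ (sym (trans (*-congʳ g-y) (zeroˡ _)))))) ⟩
        (g y * g v - g (1 ∷ v)) - g (v ∷ʳ 1) ∎
      𝒟-C (u ∷ us) v = begin
        (∂ (λ u′ → S (u′ ∷ us ∷ʳ v) - C us (v ++ u′)) u + 𝒟 (λ us′ → S (u ∷ us′ ∷ʳ v) - C us′ (v ++ u)) us)
          + ∂ (λ v′ → S (u ∷ us ∷ʳ v′) - C us (v′ ++ u)) v
          ≈⟨ +-cong (+-cong (∂-sub u _ _) (𝒟-sub us (λ us′ → S (u ∷ us′ ∷ʳ v)) (λ us′ → C us′ (v ++ u)))) (∂-sub v _ _) ⟩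
        ((s₁ - c₁) + (s₂ - c₂)) + (s₃ - c₃)
          ≈⟨ solve 7 (λ s₁ s₂ s₃ c₁ c₂ c₃ e → ((s₁ :- c₁) :+ (s₂ :- c₂)) :+ (s₃ :- c₃)
                         := (((s₁ :+ s₂) :+ s₃) :- (c₂ :+ ((c₃ :+ c₁) :+ e))) :+ e) refl s₁ s₂ s₃ c₁ c₂ c₃ e ⟩
        (((s₁ + s₂) + s₃) - (c₂ + ((c₃ + c₁) + e))) + e
          ≈⟨ +-congʳ (+-cong (trans (sym (𝒟-snoc (u ∷ us) v S)) (trans (𝒟-S (u ∷ us ∷ʳ v)) (𝒢-snoc (u ∷ us) v S)))
               (-‿cong (trans (+-congˡ (sym (∂-++ v u (C us)))) (𝒟-C us (v ++ u))))) ⟩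
        ((((S (y ∷ u ∷ us ∷ʳ v)) + q) + S (u ∷ us ++ v ∷ y ∷ [])) - 𝒢 (λ us′ → C us′ (v ++ u)) us) + e
          ≈⟨ +-congʳ (+-congʳ (+-congˡ (S-snoc-y u us v))) ⟩
        (((S (y ∷ u ∷ us ∷ʳ v) + q) - S (u ∷ us ∷ʳ (v ∷ʳ 1))) - 𝒢 (λ us′ → C us′ (v ++ u)) us) + e
          ≈⟨ solve 5 (λ a q b d e → (((a :+ q) :- b) :- d) :+ e := (a :- (b :- e)) :+ (q :- d)) refl _ _ _ _ _ ⟩
        (S (y ∷ u ∷ us ∷ʳ v) - (S (u ∷ us ∷ʳ (v ∷ʳ 1)) - e)) + (q - 𝒢 (λ us′ → C us′ (v ++ u)) us)
          ≈⟨ +-cong (+-congˡ (-‿cong (+-congˡ (-‿cong (reflexive (≡.cong (C us) (≡.sym (List.++-assoc v y u))))))))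
               (sym (𝒢-sub us (λ us′ → S (u ∷ us′ ∷ʳ v)) (λ us′ → C us′ (v ++ u)))) ⟩
        𝒢 (λ us → C us v) (u ∷ us) ∎
        where
        s₁ = ∂ (λ u′ → S (u′ ∷ us ∷ʳ v)) u
        s₂ = 𝒟 (λ us′ → S (u ∷ us′ ∷ʳ v)) us
        s₃ = ∂ (λ v′ → S (u ∷ us ∷ʳ v′)) v
        c₁ = ∂ (λ u′ → C us (v ++ u′)) u
        c₂ = 𝒟 (λ us′ → C us′ (v ++ u)) us
        c₃ = ∂ (λ v′ → C us (v′ ++ u)) v
        e  = C us (v ++ 1 ∷ u)
        q  = 𝒢 (λ us′ → S (u ∷ us′ ∷ʳ v)) us
        ∂-sub : ∀ v h h′ → ∂ (λ U → h U - h′ U) v ≈ ∂ h v - ∂ h′ v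
        ∂-sub v h h′ = trans (∂-+ v _ _) (+-congˡ (∂-neg v h′))
        𝒟-sub : ∀ us Φ Ψ → 𝒟 (λ us → Φ us - Ψ us) us ≈ 𝒟 Φ us - 𝒟 Ψ us
        𝒟-sub us Φ Ψ = trans (𝒟-cong us (λ us → +-congʳ (sym (*-identityˡ _)))) (trans (𝒟-lin us 1# Φ Ψ) (+-congʳ (*-identityˡ _)))
        𝒢-sub : ∀ us Φ Ψ → 𝒢 (λ us → Φ us - Ψ us) us ≈ 𝒢 Φ us - 𝒢 Ψ us
        𝒢-sub us Φ Ψ = trans (𝒢-cong us (λ us → +-congʳ (sym (*-identityˡ _)))) (trans (𝒢-lin us 1# Φ Ψ) (+-congʳ (*-identityˡ _)))

-- Sums over rotations of an index, and the cyclic sum formula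

module CyclicSums where

  open import Algebra.Bundles using (CommutativeRing)
  open import Level using (0ℓ)
  open import Data.List using (List; []; _∷_; _++_; _∷ʳ_; [_]; map; length)
  import Data.List.Properties as List
  open import Data.List.Relation.Unary.All as All using (All; []; _∷_)
  import Data.List.Relation.Unary.All.Properties as All
  open import Data.Nat as ℕ using (ℕ; zero; suc; _∸_; _≤_; _<_; z≤n; s≤s; NonZero)
  open import Data.Nat.ListAction using (sum)
  open import Data.Nat.ListAction.Properties using (sum-++)
  import Data.Nat.Properties as ℕ
  open import Data.Product using (∃; _×_; _,_; ∃₂)
  open import Data.Sum using (_⊎_; inj₁; inj₂)
  open import Relation.Binary.PropositionalEquality as ≡ using (_≡_)
  open RingSums
  open StarSums

  all-ones? : ∀ {ks} → All NonZero ks →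
              All (_≡ 1) ks ⊎ ∃ λ pre → ∃₂ λ k post → ks ≡ pre ++ k ∷ post × 2 ≤ k
  all-ones? []                               = inj₁ []
  all-ones? {suc (suc k) ∷ ks} (_ ∷ pos) = inj₂ ([] , suc (suc k) , ks , ≡.refl , s≤s (s≤s z≤n))
  all-ones? {1 ∷ ks} (_ ∷ pos) with all-ones? pos
  ... | inj₁ ones                       = inj₁ (≡.refl ∷ ones)
  ... | inj₂ (pre , k , post , eq , 2≤k) = inj₂ (1 ∷ pre , k , post , ≡.cong (1 ∷_) eq , 2≤k)

  -- cyc F [] ks is the sum of F over the entries k of ks, the second argument being
  -- the rest of ks in cyclic order, starting after k.
  module CyclicSum (R : CommutativeRing 0ℓ 0ℓ) where
    open CommutativeRing R hiding (zero)
    open RingTools R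
    open import Data.Integer using (+_)

    cyc : (ℕ → List ℕ → Carrier) → List ℕ → List ℕ → Carrier
    cyc F acc []       = 0#
    cyc F acc (k ∷ ks) = F k (ks ++ acc) + cyc F (acc ∷ʳ k) ks

    cyc-cong-All : ∀ {P : ℕ → Set} {F G} → (∀ {k ks} → P k → All P ks → F k ks ≈ G k ks) →
                   ∀ {acc ks} → All P acc → All P ks → cyc F acc ks ≈ cyc G acc ks
    cyc-cong-All eq pacc []        = refl
    cyc-cong-All eq pacc (pk ∷ pks) =
      +-cong (eq pk (All.++⁺ pks pacc)) (cyc-cong-All eq (All.++⁺ pacc (pk ∷ [])) pks)

    cyc-+ : ∀ F G acc ks → cyc (λ k l → F k l + G k l) acc ks ≈ cyc F acc ks + cyc G acc ks
    cyc-+ F G acc []       = sym (+-identityˡ 0#)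
    cyc-+ F G acc (k ∷ ks) = trans (+-congˡ (cyc-+ F G _ ks))
      (solve 4 (λ p q r s → (p :+ q) :+ (r :+ s) := (p :+ r) :+ (q :+ s)) refl _ _ _ _)

    cyc-neg : ∀ F acc ks → cyc (λ k l → - F k l) acc ks ≈ - cyc F acc ks
    cyc-neg F acc []       = sym RP.-0#≈0#
      where import Algebra.Properties.Ring ring as RP
    cyc-neg F acc (k ∷ ks) = trans (+-congˡ (cyc-neg F _ ks)) (RP.-‿+-comm _ _)
      where import Algebra.Properties.Ring ring as RP

    cyc-snoc : ∀ F acc ks k → cyc F acc (ks ∷ʳ k) ≈ cyc F (k ∷ acc) ks + F k (acc ++ ks)
    cyc-snoc F acc [] k rewrite List.++-identityʳ acc = +-comm _ _
    cyc-snoc F acc (k′ ∷ ks) k = trans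
      (+-cong (reflexive (≡.cong (F k′) (List.++-assoc ks (k ∷ []) acc)))
        (trans (cyc-snoc F (acc ∷ʳ k′) ks k) (+-congˡ (reflexive (≡.cong (F k) (List.++-assoc acc (k′ ∷ []) ks))))))
      (sym (+-assoc _ _ _))

    cyc-rotate : ∀ F ps qs → cyc F [] (ps ++ qs) ≈ cyc F [] (qs ++ ps)
    cyc-rotate F []       qs rewrite List.++-identityʳ qs = refl
    cyc-rotate F (p ∷ ps) qs = trans step (trans (cyc-rotate F ps (qs ∷ʳ p))
        (reflexive (≡.cong (cyc F []) (List.++-assoc qs (p ∷ []) ps))))
      where
      step : cyc F [] (p ∷ ps ++ qs) ≈ cyc F [] (ps ++ (qs ∷ʳ p))
      step rewrite ≡.sym (List.++-assoc ps qs (p ∷ [])) | List.++-identityʳ (ps ++ qs) =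
        trans (+-comm _ _) (sym (cyc-snoc F [] (ps ++ qs) p))

    cyc-telescope : ∀ (G : List ℕ → Carrier) acc ks →
                    cyc (λ k l → G (k ∷ l) - G (l ∷ʳ k)) acc ks ≈ G (ks ++ acc) - G (acc ++ ks)
    cyc-telescope G acc [] rewrite List.++-identityʳ acc = sym (-‿inverseʳ _)
    cyc-telescope G acc (k ∷ ks) = trans
      (+-cong (+-congˡ (-‿cong (reflexive (≡.cong G (List.++-assoc ks acc (k ∷ []))))))
        (trans (cyc-telescope G (acc ∷ʳ k) ks) (+-congˡ (-‿cong (reflexive (≡.cong G (List.++-assoc acc (k ∷ []) ks)))))))
      (solve 3 (λ a b c → (a :- b) :+ (b :- c) := a :- c) refl _ _ _)

  module CyclicSumFormula (R : CommutativeRing 0ℓ 0ℓ) (g : List ℕ → CommutativeRing.Carrier R) where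
    open CommutativeRing R hiding (zero)
    open RingTools R
    open CyclicSum R
    open Star R g
    open import Data.Integer using (+_)
    open import Relation.Binary.Reasoning.Setoid setoid

    rows : List ℕ → List Row
    rows = map [_]

    S-split : ℕ → List ℕ → Carrier
    S-split k ks = ∑< (k ∸ 1) (λ j → S ([ suc j ] ∷ rows ks ∷ʳ [ k ∸ j ]))

    S-split-ones : ∀ {ks} → All (_≡ 1) ks → cyc S-split [] ks ≈ 0#
    S-split-ones {ks} ones = trans (cyc-cong-All {F = S-split} {G = λ _ _ → 0#} (λ { ≡.refl _ → refl }) [] ones) (cyc-0 [] ks)
      where
      cyc-0 : ∀ acc ks → cyc (λ _ _ → 0#) acc ks ≈ 0#
      cyc-0 acc []       = refl
      cyc-0 acc (k ∷ ks) = trans (+-identityˡ _) (cyc-0 _ ks)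

    private
      C-rotate* : ∀ us u ws v → C (us ++ u ∷ ws) v ≈ C (ws ++ v ∷ us) u
      C-rotate* []       u ws v = C-rotate u ws v
      C-rotate* (x ∷ us) u ws v = begin
        C (x ∷ us ++ u ∷ ws) v        ≈⟨ C-rotate x (us ++ u ∷ ws) v ⟩
        C ((us ++ u ∷ ws) ∷ʳ v) x     ≡⟨ ≡.cong (λ z → C z x) (List.++-assoc us (u ∷ ws) (v ∷ [])) ⟩
        C (us ++ u ∷ (ws ∷ʳ v)) x     ≈⟨ C-rotate* us u (ws ∷ʳ v) x ⟩
        C ((ws ∷ʳ v) ++ x ∷ us) u     ≡⟨ ≡.cong (λ z → C z u) (List.++-assoc ws (v ∷ []) (x ∷ us)) ⟩
        C (ws ++ v ∷ x ∷ us) u ∎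

      ∂C : ℕ → List ℕ → Carrier
      ∂C k ks = ∂ (C (rows ks)) [ k ]

      -- Since `C` is invariant under rotation, the row that receives the letter can be moved to the
      -- distinguished last place.
      𝒟-cyc : ∀ k pre ks → 𝒟 (λ us → C (rows pre ++ us) [ k ]) (rows ks) ≈ cyc ∂C (k ∷ pre) ks
      𝒟-cyc k pre [] = refl
      𝒟-cyc k pre (l ∷ ks) = +-cong
        (∂-cong [ l ] (λ u → trans (C-rotate* (rows pre) u (rows ks) [ k ])
          (reflexive (≡.cong (λ z → C z u) (≡.sym (List.map-++ [_] ks (k ∷ pre)))))))
        (trans (𝒟-cong (rows ks) (λ us → reflexive (≡.cong (λ z → C z [ k ]) (shift us)))) (𝒟-cyc k (pre ∷ʳ l) ks))
        where
        shift : ∀ us → rows pre ++ [ l ] ∷ us ≡ rows (pre ∷ʳ l) ++ us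
        shift us = ≡.trans (≡.sym (List.++-assoc (rows pre) [ [ l ] ] us)) (≡.cong (_++ us) (≡.sym (List.map-++ [_] pre [ l ])))

      ∂-row : ∀ h k → ∂ h [ k ] ≈ ∑< (k ∸ 1) (λ j → h ((k ∸ j) ∷ suc j ∷ []))
      ∂-row h k = solve 2 (λ a b → (a :+ b) :+ (:- b) := a) refl _ _

    module _ (y-insertion : ∀ v → (g (1 ∷ v) + g (v ∷ʳ 1)) + ∂ g v ≈ 0#)
             (ζ : ℕ → Carrier)
             (C-value : ∀ {ks k} → All NonZero ks → 2 ≤ k → C (rows ks) [ k ] ≈ ζ (sum ks ℕ.+ k)) where
      open Derivation y-insertion

      private
        𝒢-value : ∀ pre ks {k} → All NonZero pre → All NonZero ks → 2 ≤ k →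
                  𝒢 (λ us → C (rows pre ++ us) [ k ]) (rows ks)
                  ≈ fromInt (+ suc (length ks)) * ζ (suc (sum pre ℕ.+ sum ks ℕ.+ k))
        inserted : ∀ pre ks {k} → All NonZero pre → All NonZero ks → 2 ≤ k →
                   C (rows pre ++ [ 1 ] ∷ rows ks) [ k ] ≈ ζ (suc (sum pre ℕ.+ sum ks ℕ.+ k))
        inserted pre ks {k} pp pk 2≤k = begin
          C (rows pre ++ [ 1 ] ∷ rows ks) [ k ] ≡⟨ ≡.cong (λ z → C z [ k ]) (≡.sym (List.map-++ [_] pre (1 ∷ ks))) ⟩
          C (rows (pre ++ 1 ∷ ks)) [ k ]        ≈⟨ C-value (All.++⁺ pp (_ ∷ pk)) 2≤k ⟩
          ζ (sum (pre ++ 1 ∷ ks) ℕ.+ k)         ≡⟨ ≡.cong (λ z → ζ (z ℕ.+ k)) (≡.trans (sum-++ pre (1 ∷ ks)) (ℕ.+-suc (sum pre) (sum ks))) ⟩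
          ζ (suc (sum pre ℕ.+ sum ks ℕ.+ k)) ∎
        𝒢-value pre [] pp [] 2≤k = trans (inserted pre [] pp [] 2≤k) (sym (trans (*-congʳ fromInt-1) (*-identityˡ _)))
        𝒢-value pre (l ∷ ks) {k} pp (pl ∷ pk) 2≤k = begin
          C (rows pre ++ [ 1 ] ∷ [ l ] ∷ rows ks) [ k ] + 𝒢 (λ us → C (rows pre ++ [ l ] ∷ us) [ k ]) (rows ks)
            ≈⟨ +-cong (inserted pre (l ∷ ks) pp (pl ∷ pk) 2≤k)
                 (trans (𝒢-cong (rows ks) (λ us → reflexive (≡.cong (λ z → C z [ k ]) (shift us))))
                   (trans (𝒢-value (pre ∷ʳ l) ks (All.++⁺ pp (pl ∷ [])) pk 2≤k)
                     (*-congˡ (reflexive (≡.cong (λ z → ζ (suc (z ℕ.+ k))) weight))))) ⟩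
          c + fromInt (+ suc (length ks)) * c
            ≈⟨ trans (+-congʳ (sym (*-identityˡ c))) (sym (distribʳ c _ _)) ⟩
          fromInt (+ suc (suc (length ks))) * c ∎
          where
          c = ζ (suc (sum pre ℕ.+ sum (l ∷ ks) ℕ.+ k))
          shift : ∀ us → rows pre ++ [ l ] ∷ us ≡ rows (pre ∷ʳ l) ++ us
          shift us = ≡.trans (≡.sym (List.++-assoc (rows pre) [ [ l ] ] us)) (≡.cong (_++ us) (≡.sym (List.map-++ [_] pre [ l ])))
          weight : sum (pre ∷ʳ l) ℕ.+ sum ks ≡ sum pre ℕ.+ sum (l ∷ ks)
          weight = ≡.trans (≡.cong (ℕ._+ sum ks) (≡.trans (sum-++ pre [ l ]) (≡.cong (sum pre ℕ.+_) (ℕ.+-identityʳ l))))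
            (ℕ.+-assoc (sum pre) l (sum ks))

        sum-rest : ∀ acc ks {k n} → sum (k ∷ ks) ℕ.+ sum acc ≡ n → sum (ks ++ acc) ℕ.+ k ≡ n
        sum-rest acc ks {k} eq = ≡.trans (ℕ.+-comm _ k) (≡.trans (≡.cong (k ℕ.+_) (sum-++ ks acc))
          (≡.trans (≡.sym (ℕ.+-assoc k (sum ks) (sum acc))) eq))

        -- By definition, each `S` is a `C` with one more row plus a `C` whose last row is
        -- `k ∸ j ∷ suc j`. The first has a known value because `k ∸ j ≥ 2`. The second, summed over
        -- `j`, is the insertion of y inside the row `k`, that is `∂C`.
        S-split-C : ∀ n acc ks → sum ks ℕ.+ sum acc ≡ n → All NonZero acc → All NonZero ks →
                    cyc S-split acc ks ≈ fromInt (+ sum (map (_∸ 1) ks)) * ζ (suc n) + cyc ∂C acc ks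
        S-split-C n acc [] eq pa [] = sym (trans (+-identityʳ _) (zeroˡ _))
        S-split-C n acc (k ∷ ks) eq pa (pk ∷ pks) = begin
          S-split k (ks ++ acc) + cyc S-split (acc ∷ʳ k) ks
            ≈⟨ +-cong (trans (∑<-cong (k ∸ 1) (λ j → solve 2 (λ s c → s := (s :- c) :+ c) refl _ _))
                   (trans (∑<-+ (k ∸ 1) (λ j → C ([ suc j ] ∷ rows (ks ++ acc)) [ k ∸ j ]) _) (+-cong closed (sym (∂-row (C (rows (ks ++ acc))) k)))))
                 (S-split-C n (acc ∷ʳ k) ks sum′ (All.++⁺ pa (pk ∷ [])) pks) ⟩
          (fromInt (+ (k ∸ 1)) * ζ (suc n) + ∂C k (ks ++ acc)) + (fromInt (+ sum (map (_∸ 1) ks)) * ζ (suc n) + cyc ∂C (acc ∷ʳ k) ks)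
            ≈⟨ solve 5 (λ a b z p q → (a :* z :+ p) :+ (b :* z :+ q) := (a :+ b) :* z :+ (p :+ q)) refl _ _ _ _ _ ⟩
          (fromInt (+ (k ∸ 1)) + fromInt (+ sum (map (_∸ 1) ks))) * ζ (suc n) + cyc ∂C acc (k ∷ ks)
            ≈⟨ +-congʳ (*-congʳ (sym (fromInt-+ (+ (k ∸ 1)) (+ sum (map (_∸ 1) ks))))) ⟩
          fromInt (+ sum (map (_∸ 1) (k ∷ ks))) * ζ (suc n) + cyc ∂C acc (k ∷ ks) ∎
          where
          sum′ : sum ks ℕ.+ sum (acc ∷ʳ k) ≡ n
          sum′ = ≡.trans (≡.cong (sum ks ℕ.+_) (≡.trans (sum-++ acc [ k ]) (≡.trans (≡.cong (sum acc ℕ.+_) (ℕ.+-identityʳ k)) (ℕ.+-comm (sum acc) k))))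
            (≡.trans (≡.sym (ℕ.+-assoc (sum ks) k (sum acc))) (≡.trans (≡.cong (ℕ._+ sum acc) (ℕ.+-comm (sum ks) k)) eq))
          2≤ : ∀ k j → j < k ∸ 1 → 2 ≤ k ∸ j
          2≤ (suc k) zero    j< = s≤s j<
          2≤ (suc (suc k)) (suc j) (s≤s j<) = 2≤ (suc k) j j<
          weight : ∀ j → j < k ∸ 1 → sum (suc j ∷ ks ++ acc) ℕ.+ (k ∸ j) ≡ suc n
          weight j j< = ≡.cong suc (≡.trans (≡.cong (ℕ._+ (k ∸ j)) (ℕ.+-comm j _))
            (≡.trans (ℕ.+-assoc _ j (k ∸ j)) (≡.trans (≡.cong (sum (ks ++ acc) ℕ.+_) (ℕ.m+[n∸m]≡n (ℕ.<⇒≤ (ℕ.<-≤-trans j< (ℕ.m∸n≤m k 1)))))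
              (sum-rest acc ks eq))))
          closed : ∑< (k ∸ 1) (λ j → C ([ suc j ] ∷ rows (ks ++ acc)) [ k ∸ j ]) ≈ fromInt (+ (k ∸ 1)) * ζ (suc n)
          closed = trans (∑<-cong-< (k ∸ 1) (λ j j< → trans (C-value (_ ∷ All.++⁺ pks pa) (2≤ k j j<))
            (reflexive (≡.cong ζ (weight j j<))))) (∑<-const (k ∸ 1) (ζ (suc n)))

      -- Ohno and Wakabayashi's cyclic sum formula.
      S-split-sum : ∀ pre {k} post → All NonZero (pre ++ k ∷ post) → 2 ≤ k →
                    cyc S-split [] (pre ++ k ∷ post) ≈ fromInt (+ sum (pre ++ k ∷ post)) * ζ (suc (sum (pre ++ k ∷ post)))
      S-split-sum pre {k} post pos 2≤k = begin
        cyc S-split [] ks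
          ≈⟨ S-split-C (sum ks) [] ks (ℕ.+-identityʳ _) [] pos ⟩
        fromInt (+ sum (map (_∸ 1) ks)) * ζ (suc (sum ks)) + cyc ∂C [] ks
          -- The values of `C` are known only with a last row at least 2, so the index is rotated to
          -- bring the entry `k` there before `𝒟-C` is applied.
          ≈⟨ +-congˡ (trans (cyc-rotate ∂C pre (k ∷ post)) (trans (+-comm _ _)
               (+-cong (sym (𝒟-cyc k [] (post ++ pre))) (reflexive (≡.cong (∂C k) (List.++-identityʳ (post ++ pre))))))) ⟩
        fromInt (+ sum (map (_∸ 1) ks)) * ζ (suc (sum ks)) + (𝒟 (λ us → C us [ k ]) (rows (post ++ pre)) + ∂C k (post ++ pre))
          ≈⟨ +-congˡ (trans (𝒟-C (rows (post ++ pre)) [ k ])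
               (trans (𝒢-value [] (post ++ pre) [] (All.++⁺ pos-post pos-pre) 2≤k)
                 (*-congˡ (reflexive (≡.cong (λ n → ζ (suc n)) weight))))) ⟩
        fromInt (+ sum (map (_∸ 1) ks)) * ζ (suc (sum ks)) + fromInt (+ suc (length (post ++ pre))) * ζ (suc (sum ks))
          -- The splittings contribute ∑ (kᵢ - 1) equal terms and the gaps of the cycle one for each
          -- entry, together the weight.
          ≈⟨ trans (sym (distribʳ _ _ _)) (*-congʳ (trans (sym (fromInt-+ (+ sum (map (_∸ 1) ks)) (+ suc (length (post ++ pre)))))
               (reflexive (≡.cong (λ n → fromInt (+ n)) count)))) ⟩
        fromInt (+ sum ks) * ζ (suc (sum ks)) ∎
        where
        ks = pre ++ k ∷ post
        pos-pre = All.++⁻ˡ pre pos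
        pos-post = All.tail (All.++⁻ʳ pre pos)
        weight : sum (post ++ pre) ℕ.+ k ≡ sum ks
        weight = ≡.trans (≡.cong (ℕ._+ k) (sum-++ post pre)) (≡.trans (ℕ.+-comm _ k) (≡.trans (≡.sym (ℕ.+-assoc k (sum post) (sum pre)))
          (≡.trans (ℕ.+-comm _ (sum pre)) (≡.sym (sum-++ pre (k ∷ post))))))
        predecessors : ∀ {l} → All NonZero l → sum (map (_∸ 1) l) ℕ.+ length l ≡ sum l
        predecessors [] = ≡.refl
        predecessors {suc k ∷ l} (_ ∷ p) = ≡.trans (ℕ.+-assoc k _ _) (≡.trans (≡.cong (k ℕ.+_)
          (≡.trans (ℕ.+-suc _ (length l)) (≡.cong suc (predecessors p)))) (ℕ.+-suc k _))
        count : sum (map (_∸ 1) ks) ℕ.+ suc (length (post ++ pre)) ≡ sum ks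
        count = ≡.trans (≡.cong (sum (map (_∸ 1) ks) ℕ.+_) (≡.sym lengths)) (predecessors pos)
          where
          lengths : length ks ≡ suc (length (post ++ pre))
          lengths = ≡.trans (List.length-++ pre) (≡.trans (ℕ.+-suc (length pre) (length post))
            (≡.cong suc (≡.trans (ℕ.+-comm (length pre) (length post)) (≡.sym (List.length-++ post)))))

-- Formal power series, sums over splittings, and the telescoping of the symmetric sum

module PowerSeriesSums where

  open import Algebra.Bundles using (CommutativeRing)
  open import Level using (0ℓ)
  open import Data.List using (List; []; _∷_; _++_; _∷ʳ_; [_]; map; reverse)
  import Data.List.Properties as List
  open import Data.List.Relation.Unary.All as All using (All; []; _∷_)
  open import Data.Nat as ℕ using (ℕ; zero; suc; _∸_; NonZero)
  import Data.Nat.Properties as ℕ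
  open import Data.Product using (_,_)
  open import Function using (_∘_)
  open import Relation.Binary.PropositionalEquality as ≡ using (_≡_)
  open RingSums
  open StarSums
  open CyclicSums

  module PowerSeries (R : CommutativeRing 0ℓ 0ℓ) where
    open CommutativeRing R hiding (zero)
    open RingTools R

    Series : Set
    Series = ℕ → Carrier

    infix 4 _≋_
    _≋_ : Series → Series → Set
    f ≋ g = ∀ n → f n ≈ g n

    infixl 7 _⊛_
    _⊛_ : Series → Series → Series
    (f ⊛ g) zero    = f 0 * g 0
    (f ⊛ g) (suc n) = f 0 * g (suc n) + ((f ∘ suc) ⊛ g) n

    ι : Carrier → Series
    ι c zero    = c
    ι c (suc n) = 0#

    private
      _⊞_ : Series → Series → Series
      (f ⊞ g) n = f n + g n

      zero⊛ : ∀ g n → ((λ _ → 0#) ⊛ g) n ≈ 0#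
      zero⊛ g zero    = zeroˡ _
      zero⊛ g (suc n) = trans (+-cong (zeroˡ _) (zero⊛ g n)) (+-identityˡ 0#)

      ⊛-cong : ∀ {f f′ g g′} → f ≋ f′ → g ≋ g′ → f ⊛ g ≋ f′ ⊛ g′
      ⊛-cong p q zero    = *-cong (p 0) (q 0)
      ⊛-cong p q (suc n) = +-cong (*-cong (p 0) (q (suc n))) (⊛-cong (p ∘ suc) q n)

      ⊛-tailʳ : ∀ f g n → (f ⊛ g) (suc n) ≈ f (suc n) * g 0 + (f ⊛ (g ∘ suc)) n
      ⊛-tailʳ f g zero    = +-comm _ _
      ⊛-tailʳ f g (suc n) = trans (+-congˡ (⊛-tailʳ (f ∘ suc) g n))
        (solve 3 (λ a b c → a :+ (b :+ c) := b :+ (a :+ c)) refl _ _ _)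

      ⊛-comm : ∀ f g → f ⊛ g ≋ g ⊛ f
      ⊛-comm f g zero    = *-comm _ _
      ⊛-comm f g (suc n) = trans (+-cong (*-comm _ _) (⊛-comm (f ∘ suc) g n)) (sym (⊛-tailʳ g f n))

      ⊛-distribʳ : ∀ h f g → (f ⊞ g) ⊛ h ≋ ((f ⊛ h) ⊞ (g ⊛ h))
      ⊛-distribʳ h f g zero    = distribʳ _ _ _
      ⊛-distribʳ h f g (suc n) = trans (+-cong (distribʳ _ _ _) (⊛-distribʳ h (f ∘ suc) (g ∘ suc) n))
        (solve 4 (λ p q r s → (p :+ q) :+ (r :+ s) := (p :+ r) :+ (q :+ s)) refl _ _ _ _)

      ⊛-scale : ∀ c f g n → ((λ m → c * f m) ⊛ g) n ≈ c * (f ⊛ g) n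
      ⊛-scale c f g zero    = *-assoc _ _ _
      ⊛-scale c f g (suc n) = trans (+-cong (*-assoc _ _ _) (⊛-scale c (f ∘ suc) g n)) (sym (distribˡ _ _ _))

      ⊛-assoc : ∀ f g h → (f ⊛ g) ⊛ h ≋ f ⊛ (g ⊛ h)
      ⊛-assoc f g h zero    = *-assoc _ _ _
      ⊛-assoc f g h (suc n) = trans
        (+-congˡ (trans (⊛-distribʳ h (λ m → f 0 * g (suc m)) ((f ∘ suc) ⊛ g) n)
          (+-cong (⊛-scale (f 0) (g ∘ suc) h n) (⊛-assoc (f ∘ suc) g h n))))
        (solve 5 (λ a b c d e → (a :* b) :* c :+ (a :* d :+ e) := a :* (b :* c :+ d) :+ e) refl _ _ _ _ _)

      ⊛-identityˡ : ∀ f → ι 1# ⊛ f ≋ f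
      ⊛-identityˡ f zero    = *-identityˡ _
      ⊛-identityˡ f (suc n) = trans (+-cong (*-identityˡ _) (zero⊛ f n)) (+-identityʳ _)

    series : CommutativeRing 0ℓ 0ℓ
    series = record
      { Carrier = Series ; _≈_ = _≋_ ; _+_ = _⊞_ ; _*_ = _⊛_
      ; -_ = λ f n → - f n ; 0# = λ _ → 0# ; 1# = ι 1#
      ; isCommutativeRing = record
        { isRing = record
          { +-isAbelianGroup = record
            { isGroup = record
              { isMonoid = record
                { isSemigroup = record
                  { isMagma = record
                    { isEquivalence = record
                      { refl = λ n → refl ; sym = λ p n → sym (p n) ; trans = λ p q n → trans (p n) (q n) }
                    ; ∙-cong = λ p q n → +-cong (p n) (q n) }
                  ; assoc = λ f g h n → +-assoc _ _ _ }
                ; identity = (λ f n → +-identityˡ _) , (λ f n → +-identityʳ _) }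
              ; inverse = (λ f n → -‿inverseˡ _) , (λ f n → -‿inverseʳ _)
              ; ⁻¹-cong = λ p n → -‿cong (p n) }
            ; comm = λ f g n → +-comm _ _ }
          ; *-cong = λ {f} {f′} {g} {g′} → ⊛-cong {f} {f′} {g} {g′}
          ; *-assoc = ⊛-assoc
          ; *-identity = ⊛-identityˡ , λ f n → trans (⊛-comm f (ι 1#) n) (⊛-identityˡ f n)
          ; distrib = (λ f g h n → trans (⊛-comm f _ n) (trans (⊛-distribʳ f g h n)
                        (+-cong (⊛-comm g f n) (⊛-comm h f n)))) , ⊛-distribʳ }
        ; *-comm = ⊛-comm } }

    ι-*ˡ : ∀ c f → ι c ⊛ f ≋ λ n → c * f n
    ι-*ˡ c f zero    = refl
    ι-*ˡ c f (suc n) = trans (+-congˡ (zero⊛ f n)) (+-identityʳ _)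

    ι-* : ∀ a b → ι (a * b) ≋ ι a ⊛ ι b
    ι-* a b zero    = refl
    ι-* a b (suc n) = sym (trans (ι-*ˡ a (ι b) (suc n)) (zeroʳ a))

    ι-cong : ∀ {a b} → a ≈ b → ι a ≋ ι b
    ι-cong p zero    = p
    ι-cong p (suc n) = refl

    -- ∑ⱼ tʲ f j
    τ : (ℕ → Series) → Series
    τ f zero    = f 0 0
    τ f (suc n) = f 0 (suc n) + τ (f ∘ suc) n

    τ-cong : ∀ {f g : ℕ → Series} → (∀ j → f j ≋ g j) → τ f ≋ τ g
    τ-cong p zero    = p 0 0
    τ-cong p (suc n) = +-cong (p 0 (suc n)) (τ-cong (p ∘ suc) n)

    τ-+ : ∀ f g → τ (λ j → f j ⊞ g j) ≋ (τ f ⊞ τ g)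
    τ-+ f g zero    = refl
    τ-+ f g (suc n) = trans (+-congˡ (τ-+ (f ∘ suc) (g ∘ suc) n))
      (solve 4 (λ p q r s → (p :+ q) :+ (r :+ s) := (p :+ r) :+ (q :+ s)) refl _ _ _ _)

    τ-*ʳ : ∀ f c → τ (λ j → f j ⊛ c) ≋ τ f ⊛ c
    τ-*ʳ f c zero    = refl
    τ-*ʳ f c (suc n) = trans (+-congˡ (τ-*ʳ (f ∘ suc) c n)) (head (f 0) (τ (f ∘ suc)))
      where
      head : ∀ a b → (a ⊛ c) (suc n) + (b ⊛ c) n
                   ≈ a 0 * c (suc n) + (((λ m → a (suc m)) ⊞ b) ⊛ c) n
      head a b = trans (+-assoc _ _ _) (+-congˡ (sym (⊛-distribʳ c (a ∘ suc) b n)))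

    τ-coefficient : ∀ f n → τ f n ≈ ∑< (suc n) (λ j → f j (n ∸ j))
    τ-coefficient f zero    = sym (+-identityʳ _)
    τ-coefficient f (suc n) = +-congˡ (τ-coefficient (f ∘ suc) n)

    -- Both sides are the sum of tⁱ⁺ʲ `f i j`. In the induction on the degree, `peel` exchanges the
    -- row i = 0 for the column j = 0.
    τ-swap : ∀ (f : ℕ → ℕ → Series) → τ (λ i → τ (f i)) ≋ τ (λ j → τ (λ i → f i j))
    τ-swap f zero    = refl
    τ-swap f (suc n) = trans (+-assoc _ _ _) (trans
      (+-congˡ (trans (+-congˡ (τ-swap (f ∘ suc) n)) (peel f n))) (sym (+-assoc _ _ _)))
      where
      peel : ∀ (f : ℕ → ℕ → Series) n →
             τ (f 0 ∘ suc) n + τ (λ j → τ (λ i → f (suc i) j)) n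
             ≈ τ (λ i → f (suc i) 0) n + τ (λ j → τ (λ i → f i (suc j))) n
      peel f zero    = +-comm _ _
      peel f (suc n) = trans
        (solve 4 (λ a b c d → (a :+ b) :+ (c :+ d) := (c :+ a) :+ (b :+ d)) refl _ _ _ _)
        (trans (+-congˡ (peel (λ i j → f i (suc j)) n))
          (solve 4 (λ a b c d → (c :+ a) :+ (b :+ d) := c :+ ((a :+ b) :+ d)) refl _ _ _ _))

  -- Sums over the decompositions p ++ q of a list.
  module Splits (A : CommutativeRing 0ℓ 0ℓ) where
    open CommutativeRing A hiding (zero)
    open RingTools A

    spl : (List ℕ → List ℕ → Carrier) → List ℕ → Carrier
    spl Φ []      = Φ [] []
    spl Φ (a ∷ l) = Φ [] (a ∷ l) + spl (λ p q → Φ (a ∷ p) q) l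

    spl-cong : ∀ l {Φ Ψ} → (∀ p q → Φ p q ≈ Ψ p q) → spl Φ l ≈ spl Ψ l
    spl-cong []      eq = eq [] []
    spl-cong (a ∷ l) eq = +-cong (eq [] _) (spl-cong l (λ p q → eq (a ∷ p) q))

    spl-+ : ∀ l Φ Ψ → spl (λ p q → Φ p q + Ψ p q) l ≈ spl Φ l + spl Ψ l
    spl-+ []      Φ Ψ = refl
    spl-+ (a ∷ l) Φ Ψ = trans (+-congˡ (spl-+ l _ _))
      (solve 4 (λ p q r s → (p :+ q) :+ (r :+ s) := (p :+ r) :+ (q :+ s)) refl _ _ _ _)

    spl-neg : ∀ l Φ → spl (λ p q → - Φ p q) l ≈ - spl Φ l
    spl-neg []      Φ = refl
    spl-neg (a ∷ l) Φ = trans (+-congˡ (spl-neg l _)) (RP.-‿+-comm _ _)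
      where import Algebra.Properties.Ring ring as RP

    spl-0 : ∀ l → spl (λ _ _ → 0#) l ≈ 0#
    spl-0 []      = refl
    spl-0 (a ∷ l) = trans (+-identityˡ _) (spl-0 l)

    spl-∑< : ∀ l n (Φ : ℕ → List ℕ → List ℕ → Carrier) →
             ∑< n (λ j → spl (Φ j) l) ≈ spl (λ p q → ∑< n (λ j → Φ j p q)) l
    spl-∑< l zero    Φ = sym (spl-0 l)
    spl-∑< l (suc n) Φ = trans (+-congˡ (spl-∑< l n (Φ ∘ suc))) (sym (spl-+ l _ _))

    spl-snoc : ∀ l b Φ → spl Φ (l ∷ʳ b) ≈ spl (λ p q → Φ p (q ∷ʳ b)) l + Φ (l ∷ʳ b) []
    spl-snoc []      b Φ = refl
    spl-snoc (a ∷ l) b Φ = trans (+-congˡ (spl-snoc l b (λ p q → Φ (a ∷ p) q))) (sym (+-assoc _ _ _))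

  module SymmetricSum
    (A : CommutativeRing 0ℓ 0ℓ)
    (g⁺ g⁻ : List ℕ → CommutativeRing.Carrier A)
    (f₂ : List ℕ → List ℕ → CommutativeRing.Carrier A)
    where
    open CommutativeRing A hiding (zero)
    open RingTools A
    open CyclicSum A
    open Splits A
    module ⁺ = Star A g⁺
    module ⁻ = Star A g⁻
    open import Relation.Binary.Reasoning.Setoid setoid

    rows : List ℕ → List (List ℕ)
    rows = map [_]

    S⁺ S⁻ : List ℕ → Carrier
    S⁺ ks = ⁺.S (rows ks)
    S⁻ ks = ⁻.S (rows ks)

    Ŝ : List ℕ → Carrier
    Ŝ = spl (λ p q → S⁺ p * S⁻ (reverse q))

    -- The extension of `f₂` to star sums: both factors have an unfinished first row, and `f₂` is
    -- the joint value of these two rows.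
    Q : List ℕ → List ℕ → Carrier
    Q us vs = ⁺.E (λ U → ⁻.E (f₂ U) (rows vs)) (rows us)

    module _
      (f₂-product : ∀ a U V → ∑< (suc a) (λ j → g⁺ (suc j ∷ U) * g⁻ (suc a ∸ j ∷ V))
                            ≈ f₂ U (suc a ∷ V) - f₂ (suc a ∷ U) V)
      (f₂-[] : ∀ V → f₂ [] V ≈ - g⁻ (1 ∷ V))
      where

      Q-[] : ∀ vs → Q [] vs ≈ - S⁻ (1 ∷ vs)
      Q-[] vs = trans (⁻.E-cong (rows vs) f₂-[]) (⁻.E-neg (rows vs) _)

      -- Under both expansions `f₂-product` gives `X - Y`. One step of the recursion of `E` in
      -- either factor expresses `X` and `Y` through `Q` with one more entry and a product. The
      -- product accompanying `Y` is, by `Q-[]`, exactly the term j = a that the left side lacks.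
      S-product : ∀ a us vs → ∑< a (λ j → S⁺ (suc j ∷ us) * S⁻ (suc a ∸ j ∷ vs))
                            ≈ (Q us [] * S⁻ (suc a ∷ vs) + Q (suc a ∷ us) vs) - Q us (suc a ∷ vs)
      S-product a us vs = begin
        ∑< a F
          ≈⟨ solve 2 (λ s f → s := (s :+ f) :- f) refl _ (F a) ⟩
        (∑< a F + F a) - F a
          ≈⟨ +-congʳ (trans (sym (∑<-last a F)) full) ⟩
        (X - Y) - S⁺ (suc a ∷ us) * S⁻ (suc a ∸ a ∷ vs)
          ≈⟨ +-congˡ (-‿cong (*-congˡ (reflexive (≡.cong (λ z → S⁻ (z ∷ vs)) (ℕ.m+n∸n≡m 1 a))))) ⟩
        (X - Y) - S⁺ (suc a ∷ us) * S⁻ (1 ∷ vs)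
          ≈⟨ solve 5 (λ x y s t q → (x :- y) :- s :* t := (q :+ ((:- t) :* s :- y)) :- (q :- x)) refl _ _ _ _ (Q us [] * S⁻ (suc a ∷ vs)) ⟩
        (Q us [] * S⁻ (suc a ∷ vs) + (- S⁻ (1 ∷ vs) * S⁺ (suc a ∷ us) - Y)) - (Q us [] * S⁻ (suc a ∷ vs) - X)
          ≈⟨ +-cong (+-congˡ (+-congʳ (*-congʳ (sym (Q-[] vs))))) (-‿cong (sym Q-right)) ⟩
        (Q us [] * S⁻ (suc a ∷ vs) + Q (suc a ∷ us) vs) - Q us (suc a ∷ vs) ∎
        where
        F : ℕ → Carrier
        F j = S⁺ (suc j ∷ us) * S⁻ (suc a ∸ j ∷ vs)
        X = ⁺.E (λ U → ⁻.E (λ V → f₂ U (suc a ∷ V)) (rows vs)) (rows us)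
        Y = ⁺.E (λ U → ⁻.E (f₂ (suc a ∷ U)) (rows vs)) (rows us)
        *-E : ∀ (h : List ℕ → Carrier) us c → ⁺.E h us * c ≈ ⁺.E (λ U → h U * c) us
        *-E h us c = trans (*-comm _ _) (trans (sym (⁺.E-*ˡ us c h)) (⁺.E-cong us (λ U → *-comm _ _)))
        Q-right : Q us (suc a ∷ vs) ≈ Q us [] * S⁻ (suc a ∷ vs) - X
        Q-right = trans (⁺.E-+ (rows us) _ _) (+-cong (sym (*-E _ (rows us) _)) (⁺.E-neg (rows us) _))
        G : ℕ → List ℕ → List ℕ → Carrier
        G j U V = g⁺ (suc j ∷ U) * g⁻ (suc a ∸ j ∷ V)
        full : ∑< (suc a) F ≈ X - Y
        full = begin
          ∑< (suc a) F
            ≈⟨ ∑<-cong (suc a) (λ j → trans (*-E (λ U → g⁺ (suc j ∷ U)) (rows us) _)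
                 (⁺.E-cong (rows us) (λ U → sym (⁻.E-*ˡ (rows vs) (g⁺ (suc j ∷ U)) (λ V → g⁻ (suc a ∸ j ∷ V)))))) ⟩
          ∑< (suc a) (λ j → ⁺.E (λ U → ⁻.E (λ V → g⁺ (suc j ∷ U) * g⁻ (suc a ∸ j ∷ V)) (rows vs)) (rows us))
            ≈⟨ sym (⁺.E-∑< (rows us) (suc a) (λ j U → ⁻.E (G j U) (rows vs))) ⟩
          ⁺.E (λ U → ∑< (suc a) (λ j → ⁻.E (λ V → g⁺ (suc j ∷ U) * g⁻ (suc a ∸ j ∷ V)) (rows vs))) (rows us)
            ≈⟨ ⁺.E-cong (rows us) (λ U → trans (sym (⁻.E-∑< (rows vs) (suc a) (λ j → G j U)))
                 (trans (⁻.E-cong (rows vs) (f₂-product a U)) (trans (⁻.E-+ (rows vs) _ _) (+-congˡ (⁻.E-neg (rows vs) _))))) ⟩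
          ⁺.E (λ U → ⁻.E (λ V → f₂ U (suc a ∷ V)) (rows vs) - ⁻.E (f₂ (suc a ∷ U)) (rows vs)) (rows us)
            ≈⟨ trans (⁺.E-+ (rows us) _ _) (+-congˡ (⁺.E-neg (rows us) _)) ⟩
          X - Y ∎

      private
        Sn : List ℕ → Carrier
        Sn q = S⁻ (reverse q)

        Ŝ-ends : ∀ a l b → Ŝ (a ∷ l ∷ʳ b)
                         ≈ (Sn (a ∷ l ∷ʳ b) + spl (λ p q → S⁺ (a ∷ p) * Sn (q ∷ʳ b)) l) + S⁺ (a ∷ l ∷ʳ b)
        Ŝ-ends a l b = trans (+-cong (*-identityˡ _) (trans (spl-snoc l b _) (+-congˡ (*-identityʳ _)))) (sym (+-assoc _ _ _))

        splQ : List ℕ → Carrier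
        splQ = spl (λ p q → Q p (reverse q))

        reverse-snoc : ∀ (q : List ℕ) b → reverse (q ∷ʳ b) ≡ b ∷ reverse q
        reverse-snoc q b = List.reverse-++ q [ b ]

      -- The sum over k of the terms without splitting inside the middle part, in terms of the ends.
      module _
        (τ : (ℕ → Carrier) → Carrier)
        (τ-cong : ∀ {f g} → (∀ j → f j ≈ g j) → τ f ≈ τ g)
        (τ-+ : ∀ f g → τ (λ j → f j + g j) ≈ τ f + τ g)
        (τ-*ʳ : ∀ f c → τ (λ j → f j * c) ≈ τ f * c)
        (τ-S⁺ : ∀ us → τ (λ j → S⁺ (suc j ∷ us)) ≈ Q us [])
        where

        -- Apart from `left` and `right`, the summands of the two cyclic sums of the theorem, these
        -- are star values of one factor alone, and a difference of one function at consecutive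
        -- rotations.
        left right positive negative correction : ℕ → List ℕ → Carrier
        left k ks     = ∑< (k ∸ 1) (λ j → Ŝ (suc j ∷ ks ∷ʳ (k ∸ j)))
        right k ks    = τ (λ j → Ŝ (suc j ∷ ks ∷ʳ k))
        positive k ks = ∑< (k ∸ 1) (λ j → S⁺ (suc j ∷ ks ∷ʳ (k ∸ j)))
        negative k ks = ∑< k (λ j → S⁻ (reverse (suc j ∷ ks ∷ʳ (k ∸ j)))) - τ (λ j → S⁻ (reverse (suc j ∷ ks ∷ʳ k)))
        correction k ks = splQ (k ∷ ks) - splQ (ks ∷ʳ k)

        private
          τ-spl : ∀ l (Φ : ℕ → List ℕ → List ℕ → Carrier) →
                  τ (λ j → spl (Φ j) l) ≈ spl (λ p q → τ (λ j → Φ j p q)) l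
          τ-spl []      Φ = refl
          τ-spl (a ∷ l) Φ = trans (τ-+ _ _) (+-congˡ (τ-spl l (λ j p q → Φ j (a ∷ p) q)))

          middle : ℕ → List ℕ → Carrier
          middle k = spl (λ p q → Q p [] * Sn (q ∷ʳ k))

          -- A splitting of the summand leaves the first factor empty, leaves the second one empty,
          -- or separates the two outer entries; in the last case `S-product` applies. Its `Q` terms
          -- run over the splittings of the inner part only, so one extreme splitting is missing
          -- from each `splQ` and is subtracted again.
          left-term : ∀ a ks → let k = suc a in
            left k ks ≈ (∑< a (λ j → Sn (suc j ∷ ks ∷ʳ (k ∸ j))) + positive k ks)
                      + ((middle k ks + (splQ (k ∷ ks) - Q [] (reverse (k ∷ ks)))) - (splQ (ks ∷ʳ k) - Q (ks ∷ʳ k) []))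
          left-term a ks = begin
            ∑< a (λ j → Ŝ (suc j ∷ ks ∷ʳ (k ∸ j)))
              ≈⟨ ∑<-cong a (λ j → Ŝ-ends (suc j) ks (k ∸ j)) ⟩
            ∑< a (λ j → (N j + M j) + P j)
              ≈⟨ trans (∑<-+ a _ P) (+-congʳ (∑<-+ a N M)) ⟩
            (∑< a N + ∑< a M) + ∑< a P
              ≈⟨ solve 3 (λ n m p → (n :+ m) :+ p := (n :+ p) :+ m) refl _ _ _ ⟩
            (∑< a N + ∑< a P) + ∑< a M
              ≈⟨ +-congˡ (trans (spl-∑< ks a _) (spl-cong ks (λ p q → trans
                   (∑<-cong a (λ j → *-congˡ (reflexive (≡.cong S⁻ (reverse-snoc q (k ∸ j))))))
                   (trans (S-product a p (reverse q))
                     (+-cong (+-congʳ (*-congˡ (reflexive (≡.cong S⁻ (≡.sym (reverse-snoc q k))))))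
                       (-‿cong (reflexive (≡.cong (Q p) (≡.sym (reverse-snoc q k)))))))))) ⟩
            (∑< a N + ∑< a P) + spl (λ p q → (Q p [] * Sn (q ∷ʳ k) + Q (k ∷ p) (reverse q)) - Q p (reverse (q ∷ʳ k))) ks
              ≈⟨ +-congˡ (trans (spl-+ ks _ _) (+-cong (spl-+ ks _ _) (spl-neg ks _))) ⟩
            (∑< a N + ∑< a P) + ((middle k ks + spl (λ p q → Q (k ∷ p) (reverse q)) ks) - spl (λ p q → Q p (reverse (q ∷ʳ k))) ks)
              ≈⟨ +-congˡ (+-cong (+-congˡ (solve 2 (λ q s → s := (q :+ s) :- q) refl _ _))
                   (-‿cong (trans (solve 2 (λ q s → s := (s :+ q) :- q) refl _ _) (+-congʳ (sym (spl-snoc ks k (λ p q → Q p (reverse q)))))))) ⟩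
            (∑< a N + ∑< a P) + ((middle k ks + (splQ (k ∷ ks) - Q [] (reverse (k ∷ ks)))) - (splQ (ks ∷ʳ k) - Q (ks ∷ʳ k) [])) ∎
            where
            k = suc a
            N M P : ℕ → Carrier
            N j = Sn (suc j ∷ ks ∷ʳ (k ∸ j))
            M j = spl (λ p q → S⁺ (suc j ∷ p) * Sn (q ∷ʳ (k ∸ j))) ks
            P j = S⁺ (suc j ∷ ks ∷ʳ (k ∸ j))

          right-term : ∀ k ks → right k ks ≈ (τ (λ j → Sn (suc j ∷ ks ∷ʳ k)) + middle k ks) + Q (ks ∷ʳ k) []
          right-term k ks = begin
            τ (λ j → Ŝ (suc j ∷ ks ∷ʳ k))
              ≈⟨ τ-cong (λ j → Ŝ-ends (suc j) ks k) ⟩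
            τ (λ j → (N j + M j) + P j)
              ≈⟨ trans (τ-+ _ P) (+-cong (τ-+ N M) (τ-S⁺ (ks ∷ʳ k))) ⟩
            (τ N + τ M) + Q (ks ∷ʳ k) []
              ≈⟨ +-congʳ (+-congˡ (trans (τ-spl ks _) (spl-cong ks (λ p q → trans (τ-*ʳ _ _) (*-congʳ (τ-S⁺ p)))))) ⟩
            (τ N + middle k ks) + Q (ks ∷ʳ k) [] ∎
            where
            N M P : ℕ → Carrier
            N j = Sn (suc j ∷ ks ∷ʳ k)
            M j = spl (λ p q → S⁺ (suc j ∷ p) * Sn (q ∷ʳ k)) ks
            P j = S⁺ (suc j ∷ ks ∷ʳ k)

          -- The extreme term `Q []` is minus the missing summand j = a of `negative`, by `Q-[]`;
          -- the extreme term with empty second argument is the end term of `right-term`. The common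
          -- `middle` cancels, and only the difference of `splQ` at two consecutive rotations
          -- remains.
          term : ∀ k ks → NonZero k → left k ks ≈ ((right k ks + positive k ks) + negative k ks) + correction k ks
          term (suc a) ks _ = begin
            left k ks
              ≈⟨ left-term a ks ⟩
            (∑< a N + positive k ks) + ((middle k ks + (splQ (k ∷ ks) - Q [] (reverse (k ∷ ks)))) - (splQ (ks ∷ʳ k) - Q (ks ∷ʳ k) []))
              ≈⟨ +-congˡ (+-congʳ (+-congˡ (+-congˡ (-‿cong (trans (Q-[] (reverse (k ∷ ks))) (-‿cong (reflexive last))))))) ⟩
            (∑< a N + positive k ks) + ((middle k ks + (splQ (k ∷ ks) - (- N a))) - (splQ (ks ∷ʳ k) - Q (ks ∷ʳ k) []))
              ≈⟨ solve 8 (λ s n p m x y q t → (s :+ p) :+ ((m :+ (x :- (:- n))) :- (y :- q))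
                             := ((((t :+ m) :+ q) :+ p) :+ ((s :+ n) :- t)) :+ (x :- y))
                   refl (∑< a N) (N a) (positive k ks) (middle k ks) (splQ (k ∷ ks)) (splQ (ks ∷ʳ k)) (Q (ks ∷ʳ k) []) (τ (λ j → Sn (suc j ∷ ks ∷ʳ k))) ⟩
            (((((τ (λ j → Sn (suc j ∷ ks ∷ʳ k))) + middle k ks) + Q (ks ∷ʳ k) []) + positive k ks)
              + ((∑< a N + N a) - τ (λ j → Sn (suc j ∷ ks ∷ʳ k)))) + correction k ks
              ≈⟨ +-congʳ (+-cong (+-congʳ (sym (right-term k ks))) (+-congʳ (sym (∑<-last a N)))) ⟩
            ((right k ks + positive k ks) + negative k ks) + correction k ks ∎
            where
            k = suc a
            N : ℕ → Carrier
            N j = Sn (suc j ∷ ks ∷ʳ (k ∸ j))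
            last : S⁻ (1 ∷ reverse (k ∷ ks)) ≡ N a
            last = ≡.cong S⁻ (≡.trans (≡.sym (reverse-snoc (k ∷ ks) 1))
              (≡.cong (λ z → reverse (k ∷ ks ∷ʳ z)) (≡.sym (ℕ.m+n∸n≡m 1 a))))

        Ŝ-cyclic-sum : ∀ {ks} → All NonZero ks →
                       cyc left [] ks ≈ (cyc right [] ks + cyc positive [] ks) + cyc negative [] ks
        Ŝ-cyclic-sum {ks} pos = begin
          cyc left [] ks
            ≈⟨ cyc-cong-All (λ {k} {ks} pk _ → term k ks pk) [] pos ⟩
          cyc (λ k l → ((right k l + positive k l) + negative k l) + correction k l) [] ks
            ≈⟨ trans (cyc-+ _ correction [] ks) (+-cong (trans (cyc-+ _ negative [] ks) (+-congʳ (cyc-+ right positive [] ks))) (cyc-telescope splQ [] ks)) ⟩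
          ((cyc right [] ks + cyc positive [] ks) + cyc negative [] ks) + (splQ (ks ++ []) - splQ ks)
            ≈⟨ +-congˡ (trans (+-congʳ (reflexive (≡.cong splQ (List.++-identityʳ ks)))) (-‿inverseʳ _)) ⟩
          ((cyc right [] ks + cyc positive [] ks) + cyc negative [] ks) + 0#
            ≈⟨ +-identityʳ _ ⟩
          (cyc right [] ks + cyc positive [] ks) + cyc negative [] ks ∎

-- The weights of the twist and their identities

module WeightedSeries where

  open import Algebra.Bundles using (CommutativeRing)
  open import Level using (0ℓ)
  open import Data.Integer as ℤ using (ℤ; +_; -1ℤ)
  import Data.Integer.Properties as ℤ
  open import Data.List using (List; []; _∷_; _++_; _∷ʳ_; [_]; reverse)
  import Data.List.Properties as List
  open import Data.List.Relation.Unary.All as All using ([]; _∷_)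
  open import Data.List.Relation.Binary.Pointwise as Pointwise using (Pointwise; []; _∷_)
  open import Data.Nat as ℕ using (ℕ; zero; suc; _∸_; _≤_)
  open import Data.Nat.Combinatorics using (_C_; nCk+nC[k+1]≡[n+1]C[k+1]; k>n⇒nCk≡0)
  open import Data.Integer.Solver using (module +-*-Solver)
  open import Data.Nat.ListAction using (sum)
  import Data.Nat.Properties as ℕ
  open import Function using (_∘_)
  open import Relation.Binary.PropositionalEquality as ≡ using (_≡_)
  open RingSums
  open StarSums
  open CyclicSums
  open PowerSeriesSums

  -- (-1)ᵇ times the coefficient of tˡ in 1 / (1 - t)ᵇ.
  ν : ℕ → ℕ → ℤ
  ν b l = -1ℤ ℤ.^ b ℤ.* + ((b ℕ.+ l ∸ 1) C l)

  ν-0 : ∀ k → ν (suc k) 0 ≡ ℤ.- ν k 0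
  ν-0 k = solve 1 (λ s → (con -1ℤ :* s) :* con (+ 1) := :- (s :* con (+ 1))) ≡.refl (-1ℤ ℤ.^ k)
    where open +-*-Solver

  -- Pascal's rule: multiplication by 1 - t turns the weights for k + 1 into minus those for k.
  ν-suc : ∀ k l → ν (suc k) (suc l) ≡ ν (suc k) l ℤ.- ν k (suc l)
  ν-suc k l rewrite ℕ.+-suc k l | ≡.sym (nCk+nC[k+1]≡[n+1]C[k+1] (k ℕ.+ l) l) =
    solve 3 (λ s a b → (con -1ℤ :* s) :* (a :+ b) := (con -1ℤ :* s) :* a :- s :* b) ≡.refl
      (-1ℤ ℤ.^ k) (+ ((k ℕ.+ l) C l)) (+ ((k ℕ.+ l) C suc l))
    where open +-*-Solver

  -- Abstracts R[[t]] with X f = t f, τ f = ∑ⱼ tʲ f j, and the weighted sums N.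
  record Weighting (A : CommutativeRing 0ℓ 0ℓ) : Set₁ where
    open CommutativeRing A hiding (zero)
    field
      X       : Carrier → Carrier
      τ       : (ℕ → Carrier) → Carrier
      N       : ℕ → (ℕ → Carrier) → Carrier
      integer : ℕ → Carrier
      X-cong   : ∀ {f g} → f ≈ g → X f ≈ X g
      X-*      : ∀ f → X f ≈ X 1# * f
      τ-cong   : ∀ {f g} → (∀ j → f j ≈ g j) → τ f ≈ τ g
      τ-+      : ∀ f g → τ (λ j → f j + g j) ≈ τ f + τ g
      τ-*ˡ     : ∀ c f → τ (λ j → c * f j) ≈ c * τ f
      τ-unfold : ∀ f → τ f ≈ f 0 + X (τ (f ∘ suc))
      N-cong-≥ : ∀ b {F G} → (∀ m → b ≤ m → F m ≈ G m) → N b F ≈ N b G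
      N-+      : ∀ b F G → N b (λ m → F m + G m) ≈ N b F + N b G
      N-*ˡ     : ∀ b c F → N b (λ m → c * F m) ≈ c * N b F
      N-swap   : ∀ a b (F : ℕ → ℕ → Carrier) → N a (λ i → N b (λ j → F i j)) ≈ N b (λ j → N a (λ i → F i j))
      N-zero   : ∀ F → N 0 F ≈ F 0
      N-suc    : ∀ k F → N (suc k) F ≈ X (N (suc k) (F ∘ suc)) - N k (F ∘ suc)
      -- Each use of the equations pushes the difference of `Φ` and `Ψ` into one more power of t.
      -- The parameter `b` lets the summed function be shifted at every step.
      X-unique : ∀ {B : Set} (Φ Ψ : B → Carrier) (s : B → B) (r : B → Carrier) →
                 (∀ b → Φ b ≈ X (Φ (s b)) + r b) → (∀ b → Ψ b ≈ X (Ψ (s b)) + r b) →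
                 ∀ b → Φ b ≈ Ψ b
      integer-0   : integer 0 ≈ 0#
      integer-suc : ∀ m → integer (suc m) ≈ 1# + integer m

  module WeightedSums (A : CommutativeRing 0ℓ 0ℓ) (W : Weighting A) where
    open CommutativeRing A hiding (zero)
    open RingTools A
    open Weighting W
    import Algebra.Properties.Ring ring as RP
    open import Relation.Binary.Reasoning.Setoid setoid

    X-+ : ∀ f g → X (f + g) ≈ X f + X g
    X-+ f g = trans (X-* (f + g)) (trans (distribˡ (X 1#) f g) (sym (+-cong (X-* f) (X-* g))))

    X-neg : ∀ f → X (- f) ≈ - X f
    X-neg f = trans (X-* (- f)) (trans (sym (RP.-‿distribʳ-* (X 1#) f)) (-‿cong (sym (X-* f))))

    τ-neg : ∀ f → τ (λ j → - f j) ≈ - τ f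
    τ-neg f = trans (τ-cong (λ j → sym (RP.-1*x≈-x (f j)))) (trans (τ-*ˡ (- 1#) f) (RP.-1*x≈-x _))

    τ-X : ∀ f → τ (X ∘ f) ≈ X (τ f)
    τ-X f = trans (τ-cong (λ m → X-* (f m))) (trans (τ-*ˡ (X 1#) f) (sym (X-* (τ f))))

    N-cong : ∀ b {F G} → (∀ m → F m ≈ G m) → N b F ≈ N b G
    N-cong b eq = N-cong-≥ b (λ m _ → eq m)

    N-neg : ∀ b F → N b (λ m → - F m) ≈ - N b F
    N-neg b F = trans (N-cong b (λ m → sym (RP.-1*x≈-x (F m)))) (trans (N-*ˡ b (- 1#) F) (RP.-1*x≈-x _))

    N-X : ∀ b F → N b (X ∘ F) ≈ X (N b F)
    N-X b F = trans (N-cong b (λ m → X-* (F m))) (trans (N-*ˡ b (X 1#) F) (sym (X-* (N b F))))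

    N-0 : ∀ b → N b (λ _ → 0#) ≈ 0#
    N-0 b = trans (N-cong b (λ m → sym (zeroˡ 0#))) (trans (N-*ˡ b 0# (λ _ → 0#)) (zeroˡ _))

    private
      +0# : ∀ p q → p - q ≈ p - (q + 0#)
      +0# p q = +-congˡ (-‿cong (sym (+-identityʳ q)))

    -- Induction on `k` with `X-unique` inside: the recursion `N-suc` determines the weight k + 1
    -- from the weight k and a copy of itself multiplied by t. The identities below only require
    -- that both sides satisfy it with the same source `r`.
    N-unique : ∀ {B : Set} (Φ Ψ : ℕ → B → Carrier) (s : B → B) (r : ℕ → B → Carrier) →
               (∀ b → Φ 0 b ≈ Ψ 0 b) →
               (∀ k b → Φ (suc k) b ≈ X (Φ (suc k) (s b)) - (Φ k (s b) + r k b)) →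
               (∀ k b → Ψ (suc k) b ≈ X (Ψ (suc k) (s b)) - (Ψ k (s b) + r k b)) →
               ∀ k b → Φ k b ≈ Ψ k b
    N-unique Φ Ψ s r base p q zero    = base
    N-unique Φ Ψ s r base p q (suc k) = X-unique (Φ (suc k)) (Ψ (suc k)) s (λ b → - (Φ k (s b) + r k b))
      (p k) (λ b → trans (q k b) (+-congˡ (-‿cong (+-congʳ (sym (N-unique Φ Ψ s r base p q k (s b)))))))

    -- For F m = xᵐ the weighted sum `N b F` is φᵇ with φ = -x / (1 - t x), and these powers
    -- multiply.
    N-product : ∀ a b F → N a (λ m → N b (λ m′ → F (m ℕ.+ m′))) ≈ N (a ℕ.+ b) F
    N-product a b = N-unique (λ a F → N a (λ m → N b (λ m′ → F (m ℕ.+ m′)))) (λ a F → N (a ℕ.+ b) F)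
      (_∘ suc) (λ _ _ → 0#)
      (λ F → N-zero (λ m → N b (λ m′ → F (m ℕ.+ m′))))
      (λ k F → trans (N-suc k (λ m → N b (λ m′ → F (m ℕ.+ m′)))) (+0# _ _))
      (λ k F → trans (N-suc (k ℕ.+ b) F) (+0# _ _)) a

    -- In terms of φ = -x / (1 - t x) this is the derivative of φᵏ, because x² φ′ = -φ².
    N-integer : ∀ k G → N k (λ m → integer m * G (suc m)) ≈ - (integer k * N (suc k) G)
    N-integer = N-unique (λ k G → N k (λ m → integer m * G (suc m))) (λ k G → - (integer k * N (suc k) G))
      (_∘ suc) (λ k G → N k (λ m → G (suc (suc m))) - X (N (suc k) (λ m → G (suc (suc m)))))
      (λ G → trans (N-zero _) (trans (trans (*-congʳ {x = G 1} integer-0) (zeroˡ (G 1)))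
        (sym (trans (-‿cong (trans (*-congʳ {x = N 1 G} integer-0) (zeroˡ (N 1 G)))) RP.-0#≈0#))))
      (λ k G → begin
        N (suc k) (λ m → integer m * G (suc m))
          ≈⟨ N-suc k _ ⟩
        X (N (suc k) (λ m → integer (suc m) * G (suc (suc m)))) - N k (λ m → integer (suc m) * G (suc (suc m)))
          ≈⟨ +-cong (X-cong (split (suc k) G)) (-‿cong (split k G)) ⟩
        X (N (suc k) (λ m → G (suc (suc m))) + N (suc k) (λ m → integer m * G (suc (suc m))))
          - (N k (λ m → G (suc (suc m))) + N k (λ m → integer m * G (suc (suc m))))
          ≈⟨ +-congʳ (X-+ _ _) ⟩
        (X (N (suc k) (λ m → G (suc (suc m)))) + X (N (suc k) (λ m → integer m * G (suc (suc m)))))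
          - (N k (λ m → G (suc (suc m))) + N k (λ m → integer m * G (suc (suc m))))
          ≈⟨ solve 4 (λ a b c d → (a :+ b) :- (c :+ d) := b :- (d :+ (c :- a))) refl
               (X (N (suc k) (λ m → G (suc (suc m))))) (X (N (suc k) (λ m → integer m * G (suc (suc m)))))
               (N k (λ m → G (suc (suc m)))) (N k (λ m → integer m * G (suc (suc m)))) ⟩
        X (N (suc k) (λ m → integer m * G (suc (suc m))))
          - (N k (λ m → integer m * G (suc (suc m))) + (N k (λ m → G (suc (suc m))) - X (N (suc k) (λ m → G (suc (suc m)))))) ∎)
      (λ k G → begin
        - (integer (suc k) * N (suc (suc k)) G)
          ≈⟨ -‿cong (*-congˡ {x = integer (suc k)} (N-suc (suc k) G)) ⟩
        - (integer (suc k) * (X (N (suc (suc k)) (G ∘ suc)) - N (suc k) (G ∘ suc)))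
          ≈⟨ -‿cong (trans (solve 3 (λ i p q → i :* (p :- q) := i :* p :- i :* q) refl (integer (suc k)) (X (N (suc (suc k)) (G ∘ suc))) (N (suc k) (G ∘ suc)))
               (+-congˡ (-‿cong (*-congʳ {x = N (suc k) (G ∘ suc)} (integer-suc k))))) ⟩
        - (integer (suc k) * X (N (suc (suc k)) (G ∘ suc)) - (1# + integer k) * N (suc k) (G ∘ suc))
          ≈⟨ -‿cong (+-cong (X-scale (integer (suc k)) _) (-‿cong (trans (distribʳ (N (suc k) (G ∘ suc)) 1# (integer k))
               (+-congʳ (trans (*-identityˡ (N (suc k) (G ∘ suc))) (N-suc k (G ∘ suc))))))) ⟩
        - (X (integer (suc k) * N (suc (suc k)) (G ∘ suc))
           - ((X (N (suc k) (λ m → G (suc (suc m)))) - N k (λ m → G (suc (suc m)))) + integer k * N (suc k) (G ∘ suc)))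
          ≈⟨ solve 4 (λ x a b c → :- (x :- ((a :- b) :+ c)) := :- x :- (:- c :+ (b :- a))) refl
               (X (integer (suc k) * N (suc (suc k)) (G ∘ suc))) (X (N (suc k) (λ m → G (suc (suc m)))))
               (N k (λ m → G (suc (suc m)))) (integer k * N (suc k) (G ∘ suc)) ⟩
        - X (integer (suc k) * N (suc (suc k)) (G ∘ suc))
           - (- (integer k * N (suc k) (G ∘ suc)) + (N k (λ m → G (suc (suc m))) - X (N (suc k) (λ m → G (suc (suc m))))))
          ≈⟨ +-congʳ (sym (X-neg _)) ⟩
        X (- (integer (suc k) * N (suc (suc k)) (G ∘ suc)))
           - (- (integer k * N (suc k) (G ∘ suc)) + (N k (λ m → G (suc (suc m))) - X (N (suc k) (λ m → G (suc (suc m)))))) ∎)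
      where
      X-scale : ∀ c f → c * X f ≈ X (c * f)
      X-scale c f = trans (*-congˡ {x = c} (X-* f)) (trans (solve 3 (λ c x f → c :* (x :* f) := x :* (c :* f)) refl c (X 1#) f) (sym (X-* (c * f))))
      split : ∀ k G → N k (λ m → integer (suc m) * G (suc (suc m)))
                    ≈ N k (λ m → G (suc (suc m))) + N k (λ m → integer m * G (suc (suc m)))
      split k G = trans (N-cong k (λ m → trans (*-congʳ {x = G (suc (suc m))} (integer-suc m))
        (trans (distribʳ (G (suc (suc m))) 1# (integer m)) (+-congʳ (*-identityˡ (G (suc (suc m))))))))
        (N-+ k _ _)

    full : (ℕ → ℕ → Carrier) → ℕ → Carrier
    full F m = ∑< m (λ j → F (suc j) (m ∸ j))

    full-suc : ∀ F m → full F (suc m) ≈ full (λ a b → F a (suc b)) m + F (suc m) 1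
    full-suc F m = trans (∑<-last m (λ j → F (suc j) (suc m ∸ j)))
      (+-cong (∑<-cong-< m (λ j j<m → reflexive (≡.cong (F (suc j)) (ℕ.+-∸-assoc 1 (ℕ.<⇒≤ j<m)))))
        (reflexive (≡.cong (F (suc m)) (ℕ.m+n∸n≡m 1 m))))

    -- With two variables, ∑ φ(u)ᵏ⁻ʲ φ(v)ʲ⁺¹ and ∑ uʲ⁺¹ vᵐ⁻ʲ are geometric sums, and they correspond
    -- because φ(u) φ(v) / (φ(u) - φ(v)) = -u v / (u - v).
    N-convolution : ∀ k F → ∑< k (λ j → N (k ∸ j) (λ a → N (suc j) (F a))) ≈ - N k (full F)
    N-convolution = N-unique
      (λ k F → ∑< k (λ j → N (k ∸ j) (λ a → N (suc j) (F a)))) (λ k F → - N k (full F))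
      (λ F a b → F a (suc b)) (λ k F → N (suc k) (λ a → F a 1))
      (λ F → trans (sym RP.-0#≈0#) (-‿cong (sym (N-zero (full F)))))
      (λ k F → begin
        ∑< (suc k) (λ j → N (suc k ∸ j) (λ a → N (suc j) (F a)))
          ≈⟨ ∑<-cong (suc k) (λ j → trans (N-cong (suc k ∸ j) (λ a → N-suc j (F a)))
               (trans (N-+ (suc k ∸ j) _ _) (+-cong (N-X (suc k ∸ j) _) (N-neg (suc k ∸ j) _)))) ⟩
        ∑< (suc k) (λ j → X (N (suc k ∸ j) (λ a → N (suc j) (λ b → F a (suc b)))) - N (suc k ∸ j) (λ a → N j (λ b → F a (suc b))))
          ≈⟨ trans (∑<-+ (suc k) (X ∘ P k F) (λ j → - P′ k F j)) (+-cong (∑<-X (suc k) (P k F)) (∑<-neg (suc k) (P′ k F))) ⟩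
        X (∑< (suc k) (λ j → N (suc k ∸ j) (λ a → N (suc j) (λ b → F a (suc b)))))
          - ∑< (suc k) (λ j → N (suc k ∸ j) (λ a → N j (λ b → F a (suc b))))
          ≈⟨ +-congˡ {x = X (∑< (suc k) (λ j → N (suc k ∸ j) (λ a → N (suc j) (λ b → F a (suc b)))))}
               (-‿cong (trans (+-congʳ (N-cong (suc k) (λ a → N-zero (λ b → F a (suc b))))) (+-comm _ _))) ⟩
        X (∑< (suc k) (λ j → N (suc k ∸ j) (λ a → N (suc j) (λ b → F a (suc b)))))
          - (∑< k (λ j → N (k ∸ j) (λ a → N (suc j) (λ b → F a (suc b)))) + N (suc k) (λ a → F a 1)) ∎)
      (λ k F → begin
        - N (suc k) (full F)
          ≈⟨ -‿cong (trans (N-suc k (full F)) (+-cong (X-cong (split (suc k) F)) (-‿cong (split k F)))) ⟩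
        - (X (N (suc k) (full (s F)) + N (suc k) (λ m → F (suc m) 1)) - (N k (full (s F)) + N k (λ m → F (suc m) 1)))
          ≈⟨ -‿cong (+-congʳ (X-+ _ _)) ⟩
        - ((X (N (suc k) (full (s F))) + X (N (suc k) (λ m → F (suc m) 1))) - (N k (full (s F)) + N k (λ m → F (suc m) 1)))
          ≈⟨ solve 4 (λ a b c d → :- ((a :+ b) :- (c :+ d)) := :- a :- (:- c :+ (b :- d))) refl
               (X (N (suc k) (full (s F)))) (X (N (suc k) (λ m → F (suc m) 1))) (N k (full (s F))) (N k (λ m → F (suc m) 1)) ⟩
        - X (N (suc k) (full (s F))) - (- N k (full (s F)) + (X (N (suc k) (λ m → F (suc m) 1)) - N k (λ m → F (suc m) 1)))
          ≈⟨ +-cong (sym (X-neg _)) (-‿cong (+-congˡ {x = - N k (full (s F))} (sym (N-suc k (λ a → F a 1))))) ⟩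
        X (- N (suc k) (full (s F))) - (- N k (full (s F)) + N (suc k) (λ a → F a 1)) ∎)
      where
      P P′ : ℕ → (ℕ → ℕ → Carrier) → ℕ → Carrier
      P k F j  = N (suc k ∸ j) (λ a → N (suc j) (λ b → F a (suc b)))
      P′ k F j = N (suc k ∸ j) (λ a → N j (λ b → F a (suc b)))
      s : (ℕ → ℕ → Carrier) → ℕ → ℕ → Carrier
      s F a b = F a (suc b)
      split : ∀ k F → N k (full F ∘ suc) ≈ N k (full (s F)) + N k (λ m → F (suc m) 1)
      split k F = trans (N-cong k (full-suc F)) (N-+ k _ _)
      ∑<-X : ∀ n f → ∑< n (X ∘ f) ≈ X (∑< n f)
      ∑<-X n f = trans (∑<-cong n (λ j → X-* (f j))) (trans (∑<-*ˡ n (X 1#) f) (sym (X-* _)))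

    -- This is φ / (1 - t φ) = -x, which says that the substitution φ is an involution.
    τ-N : ∀ G → τ (λ j → N (suc j) G) ≈ - G 1
    τ-N G = begin
      τ (λ j → N (suc j) G)
        ≈⟨ trans (τ-cong (λ j → N-suc j G)) (trans (τ-+ _ _) (+-cong (τ-X (λ j → N (suc j) (G ∘ suc))) (τ-neg (λ j → N j (G ∘ suc))))) ⟩
      X p - τ (λ j → N j (G ∘ suc))
        ≈⟨ +-congˡ {x = X p} (-‿cong (trans (τ-unfold (λ j → N j (G ∘ suc))) (+-congʳ (N-zero (G ∘ suc))))) ⟩
      X p - (G 1 + X p)
        ≈⟨ solve 2 (λ p g → p :- (g :+ p) := :- g) refl (X p) (G 1) ⟩
      - G 1 ∎
      where p = τ (λ j → N (suc j) (G ∘ suc))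

    wsum : List ℕ → (List ℕ → Carrier) → Carrier
    wsum []      F = F []
    wsum (b ∷ L) F = N b (λ m → wsum L (λ M → F (m ∷ M)))

    wsum-cong-≥ : ∀ L {F G} → (∀ M → Pointwise _≤_ L M → F M ≈ G M) → wsum L F ≈ wsum L G
    wsum-cong-≥ []      eq = eq [] []
    wsum-cong-≥ (b ∷ L) eq = N-cong-≥ b (λ m b≤m → wsum-cong-≥ L (λ M L≤M → eq (m ∷ M) (b≤m ∷ L≤M)))

    wsum-cong : ∀ L {F G} → (∀ M → F M ≈ G M) → wsum L F ≈ wsum L G
    wsum-cong L eq = wsum-cong-≥ L (λ M _ → eq M)

    wsum-+ : ∀ L F G → wsum L (λ M → F M + G M) ≈ wsum L F + wsum L G
    wsum-+ []      F G = refl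
    wsum-+ (b ∷ L) F G = trans (N-cong b (λ m → wsum-+ L (λ M → F (m ∷ M)) (λ M → G (m ∷ M))))
      (N-+ b (λ m → wsum L (λ M → F (m ∷ M))) (λ m → wsum L (λ M → G (m ∷ M))))

    wsum-*ˡ : ∀ L c F → wsum L (λ M → c * F M) ≈ c * wsum L F
    wsum-*ˡ []      c F = refl
    wsum-*ˡ (b ∷ L) c F = trans (N-cong b (λ m → wsum-*ˡ L c (λ M → F (m ∷ M)))) (N-*ˡ b c (λ m → wsum L (λ M → F (m ∷ M))))

    wsum-neg : ∀ L F → wsum L (λ M → - F M) ≈ - wsum L F
    wsum-neg []      F = refl
    wsum-neg (b ∷ L) F = trans (N-cong b (λ m → wsum-neg L (λ M → F (m ∷ M)))) (N-neg b (λ m → wsum L (λ M → F (m ∷ M))))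

    wsum-0 : ∀ L → wsum L (λ _ → 0#) ≈ 0#
    wsum-0 []      = refl
    wsum-0 (b ∷ L) = trans (N-cong b (λ m → wsum-0 L)) (N-0 b)

    wsum-∑< : ∀ L n (F : ℕ → List ℕ → Carrier) → wsum L (λ M → ∑< n (λ j → F j M)) ≈ ∑< n (λ j → wsum L (F j))
    wsum-∑< L zero    F = wsum-0 L
    wsum-∑< L (suc n) F = trans (wsum-+ L (F 0) _) (+-congˡ (wsum-∑< L n (F ∘ suc)))

    wsum-N : ∀ L b (F : ℕ → List ℕ → Carrier) → wsum L (λ M → N b (λ m → F m M)) ≈ N b (λ m → wsum L (F m))
    wsum-N []      b F = refl
    wsum-N (a ∷ L) b F = trans (N-cong a (λ i → wsum-N L b (λ m M → F m (i ∷ M)))) (N-swap a b (λ i m → wsum L (λ M → F m (i ∷ M))))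

    wsum-++ : ∀ L L′ F → wsum (L ++ L′) F ≈ wsum L (λ M → wsum L′ (λ M′ → F (M ++ M′)))
    wsum-++ []      L′ F = refl
    wsum-++ (b ∷ L) L′ F = N-cong b (λ m → wsum-++ L L′ (λ M → F (m ∷ M)))

    wsum-swap : ∀ L L′ (F : List ℕ → List ℕ → Carrier) →
                wsum L (λ M → wsum L′ (F M)) ≈ wsum L′ (λ M′ → wsum L (λ M → F M M′))
    wsum-swap []      L′ F = refl
    wsum-swap (b ∷ L) L′ F = trans (N-cong b (λ m → wsum-swap L L′ (λ M → F (m ∷ M)))) (sym (wsum-N L′ b (λ m M′ → wsum L (λ M → F (m ∷ M) M′))))

    wsum-reverse : ∀ L F → wsum (reverse L) F ≈ wsum L (F ∘ reverse)
    wsum-reverse []      F = refl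
    wsum-reverse (b ∷ L) F = begin
      wsum (reverse (b ∷ L)) F
        ≡⟨ ≡.cong (λ L → wsum L F) (List.unfold-reverse b L) ⟩
      wsum (reverse L ∷ʳ b) F
        ≈⟨ wsum-++ (reverse L) [ b ] F ⟩
      wsum (reverse L) (λ M → N b (λ m → F (M ∷ʳ m)))
        ≈⟨ wsum-N (reverse L) b (λ m M → F (M ∷ʳ m)) ⟩
      N b (λ m → wsum (reverse L) (λ M → F (M ∷ʳ m)))
        ≈⟨ N-cong b (λ m → trans (wsum-reverse L (λ M → F (M ∷ʳ m)))
             (wsum-cong L (λ M → reflexive (≡.cong F (≡.sym (List.unfold-reverse m M)))))) ⟩
      wsum (b ∷ L) (F ∘ reverse) ∎

    wsum-sum : ∀ L G → wsum L (G ∘ sum) ≈ N (sum L) G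
    wsum-sum []      G = sym (N-zero G)
    wsum-sum (b ∷ L) G = trans (N-cong b (λ m → wsum-sum L (λ s → G (m ℕ.+ s)))) (N-product b (sum L) G)

  module Weights (R : CommutativeRing 0ℓ 0ℓ) where
    private module R = CommutativeRing R
    open PowerSeries R
    open CommutativeRing series hiding (zero)
    open RingTools series
    module RT = RingTools R
    import Algebra.Properties.Ring ring as RP
    import Algebra.Properties.Ring R.ring as RPᴿ
    open import Relation.Binary.Reasoning.Setoid setoid

    ν′ : ℕ → ℕ → R.Carrier
    ν′ b l = RT.fromInt (ν b l)

    -- N b F = ∑ₘ (coefficient of z_m in (-1)ᵇ y xᵇ⁻¹ / (1 - t x)ᵇ) F m.
    N : ℕ → (ℕ → Series) → Series
    N b F = τ (λ l → ι (ν′ b l) * F (b ℕ.+ l))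

    X : Series → Series
    X f zero    = R.0#
    X f (suc n) = f n

    X-cong : ∀ {f g} → f ≈ g → X f ≈ X g
    X-cong p zero    = R.refl
    X-cong p (suc n) = p n

    X-neg : ∀ f → X (- f) ≈ - X f
    X-neg f zero    = R.sym RPᴿ.-0#≈0#
    X-neg f (suc n) = R.refl

    X-+ : ∀ f g → X (f + g) ≈ X f + X g
    X-+ f g zero    = R.sym (R.+-identityˡ R.0#)
    X-+ f g (suc n) = R.refl

    τ-unfold : ∀ f → τ f ≈ f 0 + X (τ (f ∘ suc))
    τ-unfold f zero    = R.sym (R.+-identityʳ _)
    τ-unfold f (suc n) = R.refl

    τ-*ˡ : ∀ c f → τ (λ j → c * f j) ≈ c * τ f
    τ-*ˡ c f = trans (τ-cong (λ j → *-comm c (f j))) (trans (τ-*ʳ f c) (*-comm _ c))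

    τ-neg : ∀ f → τ (λ j → - f j) ≈ - τ f
    τ-neg f = trans (τ-cong (λ j → sym (RP.-1*x≈-x (f j)))) (trans (τ-*ˡ (- 1#) f) (RP.-1*x≈-x _))

    τ-0 : τ (λ _ → 0#) ≈ 0#
    τ-0 = trans (τ-cong (λ j → sym (zeroˡ 0#))) (trans (τ-*ˡ 0# (λ _ → 0#)) (zeroˡ _))

    N-cong-≥ : ∀ b {F G} → (∀ m → b ≤ m → F m ≈ G m) → N b F ≈ N b G
    N-cong-≥ b eq = τ-cong (λ l → *-congˡ {x = ι (ν′ b l)} (eq (b ℕ.+ l) (ℕ.m≤m+n b l)))

    N-+ : ∀ b F G → N b (λ m → F m + G m) ≈ N b F + N b G
    N-+ b F G = trans (τ-cong (λ l → distribˡ (ι (ν′ b l)) _ _)) (τ-+ _ _)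

    N-*ˡ : ∀ b c F → N b (λ m → c * F m) ≈ c * N b F
    N-*ˡ b c F = trans (τ-cong (λ l → solve 3 (λ p q r → p :* (q :* r) := q :* (p :* r)) refl (ι (ν′ b l)) c (F (b ℕ.+ l)))) (τ-*ˡ c _)

    N-τ : ∀ b (F : ℕ → ℕ → Series) → N b (λ m → τ (λ l → F l m)) ≈ τ (λ l → N b (F l))
    N-τ b F = trans (τ-cong (λ l → sym (τ-*ˡ (ι (ν′ b l)) _))) (τ-swap _)

    N-swap : ∀ a b (F : ℕ → ℕ → Series) → N a (λ i → N b (λ j → F i j)) ≈ N b (λ j → N a (λ i → F i j))
    N-swap a b F = trans (N-τ a (λ l i → ι (ν′ b l) * F i (b ℕ.+ l)))
      (τ-cong (λ l → N-*ˡ a (ι (ν′ b l)) (λ i → F i (b ℕ.+ l))))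

    N-zero : ∀ F → N 0 F ≈ F 0
    N-zero F = begin
      N 0 F
        ≈⟨ τ-unfold _ ⟩
      ι (ν′ 0 0) * F 0 + X (τ (λ l → ι (ν′ 0 (suc l)) * F (suc l)))
        ≈⟨ +-cong (trans (*-congʳ {x = F 0} (ι-cong RT.fromInt-1)) (*-identityˡ (F 0)))
             (X-cong (trans (τ-cong (λ l → trans (*-congʳ {x = F (suc l)} (zero-coefficient l)) (zeroˡ (F (suc l))))) τ-0)) ⟩
      F 0 + X 0#
        ≈⟨ (λ { zero → R.+-identityʳ _ ; (suc n) → R.+-identityʳ _ }) ⟩
      F 0 ∎
      where
      zero-coefficient : ∀ l → ι (ν′ 0 (suc l)) ≈ 0#
      zero-coefficient l rewrite k>n⇒nCk≡0 (ℕ.n<1+n l) = λ { zero → R.refl ; (suc n) → R.refl }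

    -- The expression (1 - t x) n_{k+1} = - n_k x, where n_b is the element with coefficients ν.
    N-suc : ∀ k F → N (suc k) F ≈ X (N (suc k) (F ∘ suc)) - N k (F ∘ suc)
    N-suc k F = begin
      N (suc k) F
        ≈⟨ τ-unfold _ ⟩
      ι (ν′ (suc k) 0) * F (suc k ℕ.+ 0) + X (τ (λ l → ι (ν′ (suc k) (suc l)) * F (suc k ℕ.+ suc l)))
        ≈⟨ +-cong (trans (*-congʳ {x = F (suc k ℕ.+ 0)} (ι-cong (R.trans (R.reflexive (≡.cong RT.fromInt (ν-0 k))) (RT.fromInt-neg (ν k 0)))))
                    (trans (*-congʳ {x = F (suc k ℕ.+ 0)} (ι-neg (ν′ k 0))) (sym (RP.-‿distribˡ-* (ι (ν′ k 0)) _))))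
                  (X-cong (trans (τ-cong step) (trans (τ-+ _ _) (+-congˡ {x = N (suc k) (F ∘ suc)} (τ-neg _))))) ⟩
      - p + X (N (suc k) (F ∘ suc) - q)
        ≈⟨ +-congˡ {x = - p} (trans (X-+ _ _) (+-congˡ {x = X (N (suc k) (F ∘ suc))} (X-neg q))) ⟩
      - p + (X (N (suc k) (F ∘ suc)) - X q)
        ≈⟨ solve 3 (λ p a q → :- p :+ (a :- q) := a :- (p :+ q)) refl p (X (N (suc k) (F ∘ suc))) (X q) ⟩
      X (N (suc k) (F ∘ suc)) - (p + X q)
        ≈⟨ +-congˡ {x = X (N (suc k) (F ∘ suc))} (-‿cong {x = p + X q} (sym (τ-unfold _))) ⟩
      X (N (suc k) (F ∘ suc)) - N k (F ∘ suc) ∎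
      where
      p = ι (ν′ k 0) * F (suc (k ℕ.+ 0))
      q = τ (λ l → ι (ν′ k (suc l)) * F (suc (k ℕ.+ suc l)))
      ι-neg : ∀ c → ι (R.- c) ≈ - ι c
      ι-neg c zero    = R.refl
      ι-neg c (suc n) = R.sym RPᴿ.-0#≈0#
      ι-+ : ∀ a b → ι (a R.+ b) ≈ ι a + ι b
      ι-+ a b zero    = R.refl
      ι-+ a b (suc n) = R.sym (R.+-identityˡ R.0#)
      step : ∀ l → ι (ν′ (suc k) (suc l)) * F (suc k ℕ.+ suc l)
                 ≈ ι (ν′ (suc k) l) * F (suc (suc k ℕ.+ l)) - ι (ν′ k (suc l)) * F (suc (k ℕ.+ suc l))
      step l = begin
        ι (ν′ (suc k) (suc l)) * F (suc k ℕ.+ suc l)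
          ≈⟨ *-congʳ {x = F (suc k ℕ.+ suc l)} (trans (ι-cong (R.trans (R.reflexive (≡.cong RT.fromInt (ν-suc k l)))
               (R.trans (RT.fromInt-+ (ν (suc k) l) (ℤ.- ν k (suc l))) (R.+-congˡ (RT.fromInt-neg (ν k (suc l)))))))
               (trans (ι-+ _ _) (+-congˡ {x = ι (ν′ (suc k) l)} (ι-neg (ν′ k (suc l)))))) ⟩
        (ι (ν′ (suc k) l) - ι (ν′ k (suc l))) * F (suc k ℕ.+ suc l)
          ≈⟨ solve 3 (λ a b f → (a :- b) :* f := a :* f :- b :* f) refl (ι (ν′ (suc k) l)) (ι (ν′ k (suc l))) (F (suc k ℕ.+ suc l)) ⟩
        ι (ν′ (suc k) l) * F (suc k ℕ.+ suc l) - ι (ν′ k (suc l)) * F (suc k ℕ.+ suc l)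
          ≈⟨ +-congʳ {x = - (ι (ν′ k (suc l)) * F (suc k ℕ.+ suc l))}
               (reflexive (≡.cong (λ m → ι (ν′ (suc k) l) * F (suc m)) (ℕ.+-suc k l))) ⟩
        ι (ν′ (suc k) l) * F (suc (suc k ℕ.+ l)) - ι (ν′ k (suc l)) * F (suc (k ℕ.+ suc l)) ∎

    X-* : ∀ f → X f ≈ X 1# * f
    X-* f zero    = R.sym (R.zeroˡ _)
    X-* f (suc n) = R.sym (R.trans (R.+-cong (R.zeroˡ _) (*-identityˡ f n)) (R.+-identityˡ _))

    X-unique : ∀ {B : Set} (Φ Ψ : B → Series) (s : B → B) (r : B → Series) →
               (∀ b → Φ b ≈ X (Φ (s b)) + r b) → (∀ b → Ψ b ≈ X (Ψ (s b)) + r b) →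
               ∀ b → Φ b ≈ Ψ b
    X-unique Φ Ψ s r p q b zero    = R.trans (p b 0) (R.sym (q b 0))
    X-unique Φ Ψ s r p q b (suc n) = R.trans (p b (suc n))
      (R.trans (R.+-congʳ (X-unique Φ Ψ s r p q (s b) n)) (R.sym (q b (suc n))))

    integer : ℕ → Series
    integer m = ι (RT.fromInt (+ m))

    integer-suc : ∀ m → integer (suc m) ≈ 1# + integer m
    integer-suc m zero    = R.refl
    integer-suc m (suc n) = R.sym (R.+-identityˡ R.0#)

    integer-0 : integer 0 ≈ 0#
    integer-0 zero    = R.refl
    integer-0 (suc n) = R.refl

    weighting : Weighting series
    weighting = record
      { X = X ; τ = τ ; N = N ; integer = integer ; X-cong = X-cong ; X-* = X-*
      ; τ-cong = τ-cong ; τ-+ = τ-+ ; τ-*ˡ = τ-*ˡ ; τ-unfold = τ-unfold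
      ; N-cong-≥ = λ b {F} {G} → N-cong-≥ b {F} {G}
      ; N-+ = N-+ ; N-*ˡ = N-*ˡ ; N-swap = N-swap
      ; N-zero = N-zero ; N-suc = N-suc ; X-unique = X-unique
      ; integer-0 = integer-0 ; integer-suc = integer-suc }

-- The star values of the second factor

module NegativeParts where

  open import Algebra.Bundles using (CommutativeRing)
  open import Level using (0ℓ)
  open import Data.List using (List; []; _∷_; _++_; _∷ʳ_; [_]; map; reverse; length)
  import Data.List.Properties as List
  open import Data.List.Relation.Unary.All as All using (All; []; _∷_)
  import Data.List.Relation.Unary.All.Properties as All
  import Data.List.Relation.Unary.Any.Properties as Any
  open import Data.List.Relation.Binary.Pointwise as Pointwise using (Pointwise; []; _∷_)
  open import Data.Nat as ℕ using (ℕ; zero; suc; _∸_; _≤_; s≤s; z≤n; NonZero)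
  open import Data.Nat.ListAction using (sum)
  open import Data.Nat.ListAction.Properties using (sum-↭)
  import Data.Nat.Properties as ℕ
  open import Data.List.Relation.Binary.Permutation.Propositional.Properties using (↭-reverse)
  open import Function using (_∘_)
  open import Relation.Nullary using (¬_)
  open import Relation.Binary.PropositionalEquality as ≡ using (_≡_)
  open RingSums
  open StarSums
  open CyclicSums
  open PowerSeriesSums
  open WeightedSeries

  module NegativePart (A : CommutativeRing 0ℓ 0ℓ) (W : Weighting A)
                      (g : List ℕ → CommutativeRing.Carrier A) where
    open CommutativeRing A hiding (zero)
    open RingTools A
    open CyclicSum A
    open Weighting W
    open WeightedSums A W
    import Algebra.Properties.Ring ring as RP
    open import Relation.Binary.Reasoning.Setoid setoid

    g⁻ : List ℕ → Carrier
    g⁻ V = wsum V g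

    private
      module ⁺ = Star A g
      module ⁻ = Star A g⁻

    rows : List ℕ → List (List ℕ)
    rows = map [_]

    S⁺ S⁻ : List ℕ → Carrier
    S⁺ ks = ⁺.S (rows ks)
    S⁻ ks = ⁻.S (rows ks)

    private
      E-N : ∀ b us (h : ℕ → List ℕ → Carrier) → ⁻.E (λ U → N b (λ m → h m U)) us ≈ N b (λ m → ⁻.E (h m) us)
      E-N b []       h = refl
      E-N b (u ∷ us) h = sym (trans (N-+ b (λ m → h m [] * ⁻.S (u ∷ us)) (λ m → - ⁻.E (λ U → h m (u ++ U)) us))
        (+-cong (trans (N-cong b (λ m → *-comm (h m []) _)) (trans (N-*ˡ b (⁻.S (u ∷ us)) (λ m → h m [])) (*-comm _ _)))
          (trans (N-neg b (λ m → ⁻.E (λ U → h m (u ++ U)) us)) (-‿cong (sym (E-N b us (λ m U → h m (u ++ U))))))))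

      E-wsum : ∀ us h → ⁻.E (λ V → wsum V h) (rows us) ≈ wsum us (λ M → ⁺.E h (rows M))
      E-wsum []       h = refl
      E-wsum (u ∷ us) h = begin
        h [] * ⁻.E (λ V → N u (λ m → wsum V (λ M → g (m ∷ M)))) (rows us) - ⁻.E (λ V → N u (λ m → wsum V (λ M → h (m ∷ M)))) (rows us)
          ≈⟨ +-cong (*-congˡ (below g)) (-‿cong (below h)) ⟩
        h [] * N u (λ m → p m) - N u (λ m → q m)
          ≈⟨ +-cong (sym (N-*ˡ u (h []) p)) (sym (N-neg u q)) ⟩
        N u (λ m → h [] * p m) + N u (λ m → - q m)
          ≈⟨ sym (N-+ u (λ m → h [] * p m) (λ m → - q m)) ⟩
        N u (λ m → h [] * p m - q m)
          ≈⟨ N-cong u (λ m → trans (+-cong (sym (wsum-*ˡ us (h []) _)) (sym (wsum-neg us _))) (sym (wsum-+ us _ _))) ⟩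
        wsum (u ∷ us) (λ M → ⁺.E h (rows M)) ∎
        where
        below : ∀ h → ⁻.E (λ V → N u (λ m → wsum V (λ M → h (m ∷ M)))) (rows us)
                    ≈ N u (λ m → wsum us (λ M → ⁺.E (λ U → h (m ∷ U)) (rows M)))
        below h = trans (E-N u (rows us) (λ m V → wsum V (λ M → h (m ∷ M)))) (N-cong u (λ m → E-wsum us (λ U → h (m ∷ U))))
        p q : ℕ → Carrier
        p m = wsum us (λ M → ⁺.E (λ U → g (m ∷ U)) (rows M))
        q m = wsum us (λ M → ⁺.E (λ U → h (m ∷ U)) (rows M))

    -- The twist acts on each entry separately and linearly. Hence it commutes with joining rows and
    -- with the products in `E`, and the star sum of twisted values is the twisted star sum.
    S⁻-wsum : ∀ L → S⁻ L ≈ wsum L S⁺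
    S⁻-wsum []      = refl
    S⁻-wsum (u ∷ us) = trans (E-N u (rows us) (λ m V → wsum V (λ M → g (m ∷ M)))) (N-cong u (λ m → E-wsum us (λ U → g (m ∷ U))))

    positive negative : ℕ → List ℕ → Carrier
    positive k ks = ∑< (k ∸ 1) (λ j → S⁺ (suc j ∷ ks ∷ʳ (k ∸ j)))
    negative k ks = ∑< k (λ j → S⁻ (reverse (suc j ∷ ks ∷ʳ (k ∸ j)))) - τ (λ j → S⁻ (reverse (suc j ∷ ks ∷ʳ k)))

    private
      ends : List ℕ → ℕ → ℕ → Carrier
      ends M a b = S⁺ (a ∷ reverse M ∷ʳ b)

      reverse-ends : ∀ (M : List ℕ) a b → reverse (b ∷ M ∷ʳ a) ≡ a ∷ reverse M ∷ʳ b
      reverse-ends M a b = ≡.trans (List.reverse-++ (b ∷ M) [ a ]) (≡.cong (a ∷_) (List.unfold-reverse b M))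

      S⁻-ends : ∀ a b ks → S⁻ (reverse (a ∷ ks ∷ʳ b)) ≈ N a (λ j → wsum ks (λ M → N b (λ i → ends M i j)))
      S⁻-ends a b ks = begin
        S⁻ (reverse (a ∷ ks ∷ʳ b))
          ≈⟨ trans (S⁻-wsum (reverse (a ∷ ks ∷ʳ b))) (wsum-reverse (a ∷ ks ∷ʳ b) S⁺) ⟩
        N a (λ j → wsum (ks ∷ʳ b) (λ M → S⁺ (reverse (j ∷ M))))
          ≈⟨ N-cong a (λ j → trans (wsum-++ ks [ b ] _)
               (wsum-cong ks (λ M → N-cong b (λ i → reflexive (≡.cong S⁺ (reverse-ends M i j)))))) ⟩
        N a (λ j → wsum ks (λ M → N b (λ i → ends M i j))) ∎

      -- The two outer entries carry weights that add up to k + 1, and `N-convolution` replaces them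
      -- by one entry of weight `k` split in all ways. The τ-sum, by `τ-N`, is the splitting whose
      -- final part is 1; removing it leaves the range of `positive`.
      negative-term : ∀ k ks → NonZero k → negative k ks ≈ - N k (λ m → wsum ks (λ M → positive m (reverse M)))
      negative-term k@(suc _) ks _ = begin
        ∑< k (λ j → S⁻ (reverse (suc j ∷ ks ∷ʳ (k ∸ j)))) - τ (λ j → S⁻ (reverse (suc j ∷ ks ∷ʳ k)))
          ≈⟨ +-cong (∑<-cong k (λ j → trans (S⁻-ends (suc j) (k ∸ j) ks)
                      (trans (sym (wsum-N ks (suc j) _)) (wsum-cong ks (λ M → N-swap (suc j) (k ∸ j) _)))))
               (-‿cong (trans (τ-cong (λ j → S⁻-ends (suc j) k ks)) (τ-N (λ j → wsum ks (λ M → N k (λ i → ends M i j)))))) ⟩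
        ∑< k (λ j → wsum ks (λ M → N (k ∸ j) (λ a → N (suc j) (ends M a)))) - (- wsum ks (λ M → N k (λ i → ends M i 1)))
          ≈⟨ +-cong (trans (sym (wsum-∑< ks k (λ j M → N (k ∸ j) (λ a → N (suc j) (ends M a)))))
                       (trans (wsum-cong ks (λ M → N-convolution k (ends M))) (wsum-neg ks _))) refl ⟩
        - wsum ks (λ M → N k (full (ends M))) - (- wsum ks (λ M → N k (λ i → ends M i 1)))
          ≈⟨ solve 2 (λ p q → :- p :- (:- q) := :- (p :- q)) refl _ _ ⟩
        - (wsum ks (λ M → N k (full (ends M))) - wsum ks (λ M → N k (λ i → ends M i 1)))
          ≈⟨ -‿cong (sym (trans (wsum-+ ks _ _) (+-congˡ (wsum-neg ks _)))) ⟩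
        - wsum ks (λ M → N k (full (ends M)) - N k (λ i → ends M i 1))
          ≈⟨ -‿cong (wsum-cong ks (λ M → sym (trans (N-+ k (full (ends M)) _) (+-congˡ (N-neg k _))))) ⟩
        - wsum ks (λ M → N k (λ m → full (ends M) m - ends M m 1))
          ≈⟨ -‿cong (trans (wsum-cong ks (λ M → N-cong-≥ k (λ m k≤m → drop-last M m (ℕ.≤-trans (s≤s z≤n) k≤m))))
               (wsum-N ks k (λ m M → positive m (reverse M)))) ⟩
        - N k (λ m → wsum ks (λ M → positive m (reverse M))) ∎
        where
        drop-last : ∀ M m → 1 ≤ m → full (ends M) m - ends M m 1 ≈ positive m (reverse M)
        drop-last M (suc m) _ = trans (+-congʳ (trans (∑<-last m (λ j → ends M (suc j) (suc m ∸ j)))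
            (+-congˡ (reflexive (≡.cong (ends M (suc m)) (ℕ.m+n∸n≡m 1 m))))))
          (solve 2 (λ p q → (p :+ q) :- q := p) refl _ _)

      cyc-wsum : ∀ (Θ : ℕ → List ℕ → Carrier) acc ks →
                 cyc (λ k l → N k (λ m → wsum l (Θ m))) acc ks ≈ wsum acc (λ B → wsum ks (cyc Θ B))
      cyc-wsum Θ acc [] = sym (wsum-0 acc)
      cyc-wsum Θ acc (k ∷ ks) = begin
        N k (λ m → wsum (ks ++ acc) (Θ m)) + cyc (λ k l → N k (λ m → wsum l (Θ m))) (acc ∷ʳ k) ks
          ≈⟨ +-cong (N-cong k (λ m → trans (wsum-++ ks acc (Θ m)) (wsum-swap ks acc _)))
               (trans (cyc-wsum Θ (acc ∷ʳ k) ks) (wsum-++ acc [ k ] _)) ⟩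
        N k (λ m → wsum acc (λ B → wsum ks (λ M → Θ m (M ++ B)))) + wsum acc (λ B → N k (λ m → wsum ks (cyc Θ (B ∷ʳ m))))
          ≈⟨ +-congʳ (sym (wsum-N acc k (λ m B → wsum ks (λ M → Θ m (M ++ B))))) ⟩
        wsum acc (λ B → N k (λ m → wsum ks (λ M → Θ m (M ++ B)))) + wsum acc (λ B → N k (λ m → wsum ks (cyc Θ (B ∷ʳ m))))
          ≈⟨ sym (wsum-+ acc _ _) ⟩
        wsum acc (λ B → N k (λ m → wsum ks (λ M → Θ m (M ++ B))) + N k (λ m → wsum ks (cyc Θ (B ∷ʳ m))))
          ≈⟨ wsum-cong acc (λ B → trans (sym (N-+ k _ _)) (N-cong k (λ m → sym (wsum-+ ks _ _)))) ⟩
        wsum acc (λ B → wsum (k ∷ ks) (cyc Θ B)) ∎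

      cyc-reverse : ∀ F acc ks → cyc (λ k l → F k (reverse l)) acc ks ≈ cyc F (reverse acc) (reverse ks)
      cyc-reverse F acc [] = refl
      cyc-reverse F acc (k ∷ ks) = begin
        F k (reverse (ks ++ acc)) + cyc (λ k l → F k (reverse l)) (acc ∷ʳ k) ks
          ≈⟨ +-cong (reflexive (≡.cong (F k) (List.reverse-++ ks acc))) (trans (cyc-reverse F (acc ∷ʳ k) ks)
               (reflexive (≡.cong (λ z → cyc F z (reverse ks)) (List.reverse-++ acc [ k ])))) ⟩
        F k (reverse acc ++ reverse ks) + cyc F (k ∷ reverse acc) (reverse ks)
          ≈⟨ trans (+-comm _ _) (sym (cyc-snoc F (reverse acc) (reverse ks) k)) ⟩
        cyc F (reverse acc) (reverse ks ∷ʳ k)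
          ≡⟨ ≡.cong (cyc F (reverse acc)) (≡.sym (List.unfold-reverse k ks)) ⟩
        cyc F (reverse acc) (reverse (k ∷ ks)) ∎

    -- This is why the cyclic sum formula for the first factor suffices for the second as well. The
    -- reversal comes from the second factor being read backwards.
    cyc-negative : ∀ {ks} → All NonZero ks → cyc negative [] ks ≈ - wsum ks (λ M → cyc positive [] (reverse M))
    cyc-negative {ks} pos = begin
      cyc negative [] ks
        ≈⟨ cyc-cong-All (λ {k} {l} pk _ → negative-term k l pk) [] pos ⟩
      cyc (λ k l → - N k (λ m → wsum l (λ M → positive m (reverse M)))) [] ks
        ≈⟨ trans (cyc-neg _ [] ks) (-‿cong (cyc-wsum (λ m M → positive m (reverse M)) [] ks)) ⟩
      - wsum ks (cyc (λ m M → positive m (reverse M)) [])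
        ≈⟨ -‿cong (wsum-cong ks (cyc-reverse positive [])) ⟩
      - wsum ks (λ M → cyc positive [] (reverse M)) ∎

    negate : ℕ → Carrier → Carrier
    negate zero    c = c
    negate (suc n) c = - negate n c

    -- Only `M = ks` survives, and each of its entries has the weight `ν 1 0 = -1`.
    wsum-ones : ∀ {ks} D → All (_≡ 1) ks → (∀ M → Pointwise _≤_ ks M → ¬ All (_≡ 1) M → D M ≈ 0#) →
                wsum ks D ≈ negate (length ks) (D ks)
    wsum-ones D [] vanish = refl
    wsum-ones {_ ∷ ks} D (≡.refl ∷ ones) vanish = begin
      N 1 (λ m → wsum ks (λ M → D (m ∷ M)))
        ≈⟨ N-suc 0 _ ⟩
      X (N 1 (λ m → wsum ks (λ M → D (suc m ∷ M)))) - N 0 (λ m → wsum ks (λ M → D (suc m ∷ M)))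
        ≈⟨ +-cong (trans (X-cong (trans (N-cong-≥ 1 big) (N-0 1))) (trans (X-* 0#) (zeroʳ _)))
             (-‿cong (trans (N-zero _) (wsum-ones (λ M → D (1 ∷ M)) ones
               (λ M le ¬ones → vanish (1 ∷ M) (s≤s z≤n ∷ le) (¬ones ∘ All.tail))))) ⟩
      0# - negate (length ks) (D (1 ∷ ks))
        ≈⟨ +-identityˡ _ ⟩
      - negate (length ks) (D (1 ∷ ks)) ∎
      where
      big : ∀ m → 1 ≤ m → wsum ks (λ M → D (suc m ∷ M)) ≈ 0#
      big (suc m) _ = trans (wsum-cong-≥ ks (λ M le → vanish (suc (suc m) ∷ M) (s≤s z≤n ∷ le) (λ { (() ∷ _) }))) (wsum-0 ks)

    module _
      (positive-ones : ∀ {M} → All (_≡ 1) M → cyc positive [] M ≈ 0#)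
      (positive-sum  : ∀ {M} → All NonZero M → ¬ All (_≡ 1) M → cyc positive [] M ≈ integer (sum M) * g [ suc (sum M) ])
      where

      private
        value : ℕ → Carrier
        value m = integer m * g [ suc m ]

        -- The summand depends only on the weight of `M`, so `N-product` collapses the multiple sum
        -- to a single `N`; then `N-integer` raises its index to k + 1 and brings out the factor k.
        wsum-value : ∀ ks → - wsum ks (value ∘ sum) ≈ integer (sum ks) * S⁻ [ suc (sum ks) ]
        wsum-value ks = begin
          - wsum ks (value ∘ sum)            ≈⟨ -‿cong (wsum-sum ks value) ⟩
          - N (sum ks) value                 ≈⟨ -‿cong (N-integer (sum ks) (λ m → g [ m ])) ⟩
          - - (integer (sum ks) * S⁻ [ suc (sum ks) ]) ≈⟨ RP.-‿involutive _ ⟩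
          integer (sum ks) * S⁻ [ suc (sum ks) ] ∎

        NonZero-≥ : ∀ {ks M} → All NonZero ks → Pointwise _≤_ ks M → All NonZero M
        NonZero-≥ []        []       = []
        NonZero-≥ (p ∷ pos) (le ∷ les) = ℕ.>-nonZero (ℕ.<-≤-trans (ℕ.>-nonZero⁻¹ _ {{p}}) le) ∷ NonZero-≥ pos les

        reverse-All : ∀ {P : ℕ → Set} {M} → All P M → All P (reverse M)
        reverse-All {M = M} p = All.tabulate (All.lookup p ∘ Any.reverse⁻)

        ones-reverse⁻ : ∀ {M} → All (_≡ 1) (reverse M) → All (_≡ 1) M
        ones-reverse⁻ p = All.tabulate (All.lookup p ∘ Any.reverse⁺)

        sum-reverse : ∀ M → sum (reverse M) ≡ sum M
        sum-reverse M = sum-↭ (↭-reverse M)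

        reverse-value : ∀ {M} → All NonZero M → ¬ All (_≡ 1) M → cyc positive [] (reverse M) ≈ value (sum M)
        reverse-value {M} pos ¬ones = trans (positive-sum (reverse-All pos) (¬ones ∘ ones-reverse⁻))
          (reflexive (≡.cong value (sum-reverse M)))

        ones-≥ : ∀ {ks M} → All NonZero ks → Pointwise _≤_ ks M → All (_≡ 1) M → All (_≡ 1) ks
        ones-≥ [] [] [] = []
        ones-≥ (p ∷ pos) (le ∷ les) (≡.refl ∷ ones) = ℕ.≤-antisym le (ℕ.>-nonZero⁻¹ _ {{p}}) ∷ ones-≥ pos les ones

      negative-sum : ∀ {ks} → All NonZero ks → ¬ All (_≡ 1) ks →
                     cyc negative [] ks ≈ integer (sum ks) * S⁻ [ suc (sum ks) ]
      negative-sum {ks} pos ¬ones = trans (cyc-negative pos) (trans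
        (-‿cong (wsum-cong-≥ ks (λ M le → reverse-value (NonZero-≥ pos le) (¬ones ∘ ones-≥ pos le))))
        (wsum-value ks))

      -- Among the indices `M ≥ ks` only `ks` itself consists of ones, and there the positive cyclic
      -- sum is 0 instead of `value`. Writing the sum as if the formula held everywhere leaves a
      -- correction supported at this index.
      negative-ones : ∀ {ks} → All (_≡ 1) ks →
                      cyc negative [] ks ≈ integer (sum ks) * S⁻ [ suc (sum ks) ]
                                         + negate (length ks) (integer (sum ks) * g [ suc (sum ks) ])
      negative-ones {ks} ones = begin
        cyc negative [] ks
          ≈⟨ cyc-negative pos ⟩
        - wsum ks (λ M → cyc positive [] (reverse M))
          ≈⟨ solve 2 (λ p q → :- p := :- q :+ (q :- p)) refl _ (wsum ks (value ∘ sum)) ⟩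
        - wsum ks (value ∘ sum) + (wsum ks (value ∘ sum) - wsum ks (λ M → cyc positive [] (reverse M)))
          ≈⟨ +-cong (wsum-value ks) (trans (sym (trans (wsum-+ ks _ _) (+-congˡ (wsum-neg ks _)))) (wsum-ones D ones vanish)) ⟩
        integer (sum ks) * S⁻ [ suc (sum ks) ] + negate (length ks) (D ks)
          ≈⟨ +-congˡ (negate-cong (length ks) (trans (+-congˡ (trans (-‿cong (positive-ones (reverse-All ones))) RP.-0#≈0#)) (+-identityʳ _))) ⟩
        integer (sum ks) * S⁻ [ suc (sum ks) ] + negate (length ks) (value (sum ks)) ∎
        where
        pos = All.map (λ { ≡.refl → _ }) ones
        D : List ℕ → Carrier
        D M = value (sum M) - cyc positive [] (reverse M)
        vanish : ∀ M → Pointwise _≤_ ks M → ¬ All (_≡ 1) M → D M ≈ 0#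
        vanish M le ¬ones = trans (+-congˡ (-‿cong (reverse-value (NonZero-≥ pos le) ¬ones))) (-‿inverseʳ _)
        negate-cong : ∀ n {a b} → a ≈ b → negate n a ≈ negate n b
        negate-cong zero    p = p
        negate-cong (suc n) p = -‿cong (negate-cong n p)

-- Shuffles of words and the function f₂

module Words where

  open import Algebra.Bundles using (CommutativeRing)
  open import Level using (0ℓ)
  open import Defs using (x; y; Word; shuffleʳ)
  open import Data.List using (List; []; _∷_; _++_; _∷ʳ_; [_]; map; replicate; reverse)
  import Data.List.Properties as List
  open import Data.Nat as ℕ using (ℕ; zero; suc; _∸_; _≤_; _<_; s≤s; z≤n)
  import Data.Nat.Properties as ℕ
  open import Function using (_∘_)
  open import Relation.Binary.PropositionalEquality as ≡ using (_≡_)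
  open RingSums
  open StarSums
  open PowerSeriesSums hiding (module SymmetricSum)
  open WeightedSeries
  open NegativeParts

  -- Words are read from the last letter to the first, as in shuffleʳ.
  infixr 5 xʸ_∷_
  xʸ_∷_ : ℕ → Word → Word
  xʸ n ∷ w = replicate n x ++ y ∷ w

  word : List ℕ → Word
  word []       = []
  word (k ∷ ks) = xʸ (k ∸ 1) ∷ word ks

  module ShuffleSum (R : CommutativeRing 0ℓ 0ℓ) where
    open CommutativeRing R hiding (zero)
    open RingTools R
    open Insertion R
    open import Relation.Binary.Reasoning.Setoid setoid

    -- The sum of `φ` over the shuffles, with the chosen letter absorbed into `φ`: recursions in the
    -- letters then become inductions for all `φ` at once.
    σ : (Word → Carrier) → Word → Word → Carrier
    σ φ []      v       = φ v
    σ φ (a ∷ u) []      = φ (a ∷ u)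
    σ φ (a ∷ u) (b ∷ v) = σ (φ ∘ (a ∷_)) u (b ∷ v) + σ (φ ∘ (b ∷_)) (a ∷ u) v

    σ-[] : ∀ φ u → σ φ u [] ≈ φ u
    σ-[] φ []      = refl
    σ-[] φ (a ∷ u) = refl

    σ-shuffle : ∀ φ u v → ∑ (shuffleʳ u v) φ ≈ σ φ u v
    σ-shuffle φ []      v       = +-identityʳ _
    σ-shuffle φ (a ∷ u) []      = +-identityʳ _
    σ-shuffle φ (a ∷ u) (b ∷ v) = trans (∑-++ (map (a ∷_) (shuffleʳ u (b ∷ v))) _ φ) (+-cong
      (trans (∑-map (a ∷_) (shuffleʳ u (b ∷ v)) φ) (σ-shuffle (φ ∘ (a ∷_)) u (b ∷ v)))
      (trans (∑-map (b ∷_) (shuffleʳ (a ∷ u) v) φ) (σ-shuffle (φ ∘ (b ∷_)) (a ∷ u) v)))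

    σ-cong : ∀ {φ ψ} → (∀ w → φ w ≈ ψ w) → ∀ u v → σ φ u v ≈ σ ψ u v
    σ-cong eq []      v       = eq v
    σ-cong eq (a ∷ u) []      = eq (a ∷ u)
    σ-cong eq (a ∷ u) (b ∷ v) = +-cong (σ-cong (λ w → eq (a ∷ w)) u (b ∷ v)) (σ-cong (λ w → eq (b ∷ w)) (a ∷ u) v)

    -- The shuffle product satisfies the same recursion at both ends. This is what makes it
    -- independent of the direction in which words are read.
    σ-snoc : ∀ φ u a v b → σ φ (u ∷ʳ a) (v ∷ʳ b) ≈ σ (λ w → φ (w ∷ʳ a)) u (v ∷ʳ b) + σ (λ w → φ (w ∷ʳ b)) (u ∷ʳ a) v
    σ-snoc φ []      a []      b = +-comm _ _
    σ-snoc φ []      a (d ∷ v) b = trans (+-congˡ (σ-snoc (φ ∘ (d ∷_)) [] a v b))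
      (solve 3 (λ p q r → p :+ (q :+ r) := q :+ (p :+ r)) refl _ _ _)
    σ-snoc φ (c ∷ u) a []      b = trans
      (+-congʳ (trans (σ-snoc (φ ∘ (c ∷_)) u a [] b) (+-congˡ (σ-[] _ (u ∷ʳ a)))))
      (solve 3 (λ p q r → (p :+ q) :+ r := (p :+ r) :+ q) refl _ _ _)
    σ-snoc φ (c ∷ u) a (d ∷ v) b = trans (+-cong (σ-snoc (φ ∘ (c ∷_)) u a (d ∷ v) b) (σ-snoc (φ ∘ (d ∷_)) (c ∷ u) a v b))
      (solve 4 (λ p q r s → (p :+ q) :+ (r :+ s) := (p :+ r) :+ (q :+ s)) refl _ _ _ _)

    σ-reverse : ∀ φ u v → σ φ (reverse u) (reverse v) ≈ σ (φ ∘ reverse) u v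
    σ-reverse φ []      v  = refl
    σ-reverse φ (a ∷ u) [] = σ-[] φ (reverse (a ∷ u))
    σ-reverse φ (a ∷ u) (b ∷ v) = begin
      σ φ (reverse (a ∷ u)) (reverse (b ∷ v))
        ≡⟨ ≡.cong₂ (σ φ) (List.unfold-reverse a u) (List.unfold-reverse b v) ⟩
      σ φ (reverse u ∷ʳ a) (reverse v ∷ʳ b)
        ≈⟨ σ-snoc φ (reverse u) a (reverse v) b ⟩
      σ (λ w → φ (w ∷ʳ a)) (reverse u) (reverse v ∷ʳ b) + σ (λ w → φ (w ∷ʳ b)) (reverse u ∷ʳ a) (reverse v)
        ≡⟨ ≡.cong₂ (λ p q → σ (λ w → φ (w ∷ʳ a)) (reverse u) p + σ (λ w → φ (w ∷ʳ b)) q (reverse v)) (≡.sym (List.unfold-reverse b v)) (≡.sym (List.unfold-reverse a u)) ⟩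
      σ (λ w → φ (w ∷ʳ a)) (reverse u) (reverse (b ∷ v)) + σ (λ w → φ (w ∷ʳ b)) (reverse (a ∷ u)) (reverse v)
        ≈⟨ +-cong (σ-reverse (λ w → φ (w ∷ʳ a)) u (b ∷ v)) (σ-reverse (λ w → φ (w ∷ʳ b)) (a ∷ u) v) ⟩
      σ (λ w → φ (reverse w ∷ʳ a)) u (b ∷ v) + σ (λ w → φ (reverse w ∷ʳ b)) (a ∷ u) v
        ≈⟨ +-cong (σ-cong (λ w → reflexive (≡.cong φ (≡.sym (List.unfold-reverse a w)))) u (b ∷ v))
                  (σ-cong (λ w → reflexive (≡.cong φ (≡.sym (List.unfold-reverse b w)))) (a ∷ u) v) ⟩
      σ (φ ∘ reverse) (a ∷ u) (b ∷ v) ∎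

    private
      insert-run : ∀ n φ w → σ φ (y ∷ []) (xʸ n ∷ w)
                 ≈ ∑< (suc n) (λ i → φ (xʸ i ∷ xʸ (n ∸ i) ∷ w)) + σ (λ u → φ (xʸ n ∷ u)) (y ∷ []) w
      insert-run zero    φ w = +-congʳ (sym (+-identityʳ _))
      insert-run (suc n) φ w = trans (+-congˡ (insert-run n (φ ∘ (x ∷_)) w)) (sym (+-assoc _ _ _))

    -- The places in the run of x's of an entry `k` number `k`. The first of them is the place at
    -- the end of the whole word and the others split the entry, in the order opposite to that of
    -- `∂`.
    σ-y : ∀ φ v → σ φ (y ∷ []) (word v) ≈ (φ (word (1 ∷ v)) + φ (word (v ∷ʳ 1))) + ∂ (φ ∘ word) v
    σ-y φ []       = solve 1 (λ a → a := (a :+ a) :+ (:- a)) refl (φ (y ∷ []))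
    σ-y φ (k ∷ ks) = begin
      σ φ (y ∷ []) (xʸ n ∷ word ks)
        ≈⟨ insert-run n φ (word ks) ⟩
      (φ (word (1 ∷ k ∷ ks)) + ∑< n (λ i → φ (xʸ suc i ∷ xʸ (n ∸ suc i) ∷ word ks))) + σ (λ u → φ (xʸ n ∷ u)) (y ∷ []) (word ks)
        ≈⟨ +-cong (+-congˡ (trans (∑<-reverse n _) (∑<-cong-< n (λ j j<n → reflexive (≡.cong φ (index j j<n))))))
             (σ-y (λ u → φ (xʸ n ∷ u)) ks) ⟩
      (φ (word (1 ∷ k ∷ ks)) + ∑< n (λ j → φ (word ((k ∸ j) ∷ suc j ∷ ks))))
        + ((φ (word (k ∷ 1 ∷ ks)) + φ (word (k ∷ ks ∷ʳ 1))) + ∂ (λ v → φ (word (k ∷ v))) ks)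
        ≈⟨ solve 5 (λ a s b c d → (a :+ s) :+ ((b :+ c) :+ d) := (a :+ c) :+ ((s :+ b) :+ d)) refl _ _ _ _ _ ⟩
      (φ (word (1 ∷ k ∷ ks)) + φ (word (k ∷ ks ∷ʳ 1))) + ∂ (φ ∘ word) (k ∷ ks) ∎
      where
      n = k ∸ 1
      index : ∀ j → j < n → xʸ suc (n ∸ suc j) ∷ xʸ (n ∸ suc (n ∸ suc j)) ∷ word ks ≡ word ((k ∸ j) ∷ suc j ∷ ks)
      index j j<n = ≡.cong₂ (λ p q → xʸ p ∷ xʸ q ∷ word ks) first
          (≡.trans (≡.cong (n ∸_) (≡.trans (≡.sym (ℕ.+-∸-assoc 1 j<n)) ≡.refl)) (ℕ.m∸[m∸n]≡n (ℕ.<⇒≤ j<n)))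
        where
        first : suc (n ∸ suc j) ≡ k ∸ j ∸ 1
        first = ≡.trans (≡.sym (ℕ.+-∸-assoc 1 j<n)) (≡.trans (ℕ.∸-+-assoc k 1 j)
          (≡.trans (≡.cong (k ∸_) (ℕ.+-comm 1 j)) (≡.sym (ℕ.∸-+-assoc k j 1))))

  -- The parameter `κ φ u v` abstracts the series ∑ₙ tⁿ φ(xⁿ y w), summed over the shuffles w of u
  -- and v, all words being read backwards. The equation `κ-step`, which separates n = 0 from the
  -- rest, determines it.
  module SymmetricShuffle
    (R : CommutativeRing 0ℓ 0ℓ)
    (A : CommutativeRing 0ℓ 0ℓ) (W : Weighting A)
    (ι : CommutativeRing.Carrier R → CommutativeRing.Carrier A)
    (κ : (Word → CommutativeRing.Carrier R) → Word → Word → CommutativeRing.Carrier A)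
    where
    private module R = CommutativeRing R
    open CommutativeRing A hiding (zero)
    open RingTools A
    open Weighting W
    open WeightedSums A W
    open ShuffleSum R
    open import Relation.Binary.Reasoning.Setoid setoid

    module _
      (ι-cong : ∀ {a b} → a R.≈ b → ι a ≈ ι b)
      (ι-+ : ∀ a b → ι (a R.+ b) ≈ ι a + ι b)
      (κ-step : ∀ φ u v → κ φ u v ≈ X (κ (φ ∘ (x ∷_)) u v) + ι (σ (φ ∘ (y ∷_)) u v))
      where

      private

        after-x : (Word → R.Carrier) → Word → R.Carrier
        after-x φ = φ ∘ (x ∷_)

      -- Comparing last letters, both sides solve the same recursion H φ = t H (φ ∘ (x ∷_)) + r φ.
      κ-product : ∀ a φ u v →
                  ∑< (suc a) (λ j → N (suc a ∸ j) (λ m → ι (σ φ (xʸ j ∷ u) (xʸ (m ∸ 1) ∷ v))))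
                  ≈ N (suc a) (λ m → κ φ u (xʸ (m ∸ 1) ∷ v)) - κ φ (xʸ a ∷ u) v
      κ-product a φ u v = X-unique H K after-x r H-step K-step φ
        where
        F first second : (Word → R.Carrier) → ℕ → ℕ → Carrier
        F φ j m = ι (σ φ (xʸ j ∷ u) (xʸ (m ∸ 1) ∷ v))
        first φ zero    m = ι (σ (φ ∘ (y ∷_)) u (xʸ (m ∸ 1) ∷ v))
        first φ (suc j) m = F (after-x φ) j m
        -- Since `m ∸ 1` is truncated, m = 0 has the same word as m = 1; with the same value there,
        -- `last-letter` holds for every `m`.
        second φ j zero          = ι (σ (φ ∘ (y ∷_)) (xʸ j ∷ u) v)
        second φ j (suc zero)    = ι (σ (φ ∘ (y ∷_)) (xʸ j ∷ u) v)
        second φ j (suc (suc m)) = F (after-x φ) j (suc m)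

        H K r : (Word → R.Carrier) → Carrier
        H φ = ∑< (suc a) (λ j → N (suc a ∸ j) (F φ j))
        K φ = N (suc a) (λ m → κ φ u (xʸ (m ∸ 1) ∷ v)) - κ φ (xʸ a ∷ u) v
        r φ = N (suc a) (first φ 0) - ι (σ (φ ∘ (y ∷_)) (xʸ a ∷ u) v)

        last-letter : ∀ φ j m → F φ j m ≈ first φ j m + second φ j m
        last-letter φ zero    zero          = ι-+ _ _
        last-letter φ zero    (suc zero)    = ι-+ _ _
        last-letter φ zero    (suc (suc m)) = ι-+ _ _
        last-letter φ (suc j) zero          = ι-+ _ _
        last-letter φ (suc j) (suc zero)    = ι-+ _ _
        last-letter φ (suc j) (suc (suc m)) = ι-+ _ _

        second-≥ : ∀ φ j m → 1 ≤ m → second φ j (suc m) ≈ F (after-x φ) j m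
        second-≥ φ j (suc m) _ = refl

        N-second : ∀ φ j b → N (suc b) (second φ j) ≈ X (N (suc b) (F (after-x φ) j)) - N b (second φ j ∘ suc)
        N-second φ j b = trans (N-suc b (second φ j)) (+-congʳ (X-cong (N-cong-≥ (suc b) (λ m le →
          second-≥ φ j m (ℕ.≤-trans (s≤s z≤n) le)))))

        second-sum : ∀ φ → ∑< (suc a) (λ j → N (suc a ∸ j) (second φ j))
                   ≈ X (H (after-x φ)) - (∑< a (λ j → N (a ∸ j) (F (after-x φ) j)) + ι (σ (φ ∘ (y ∷_)) (xʸ a ∷ u) v))
        second-sum φ = begin
          ∑< (suc a) (λ j → N (suc a ∸ j) (second φ j))
            ≈⟨ ∑<-cong-< (suc a) (λ j j≤a → trans (reflexive (≡.cong (λ b → N b (second φ j)) (ℕ.+-∸-assoc 1 (ℕ.≤-pred j≤a))))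
                 (trans (N-second φ j (a ∸ j)) (+-congʳ (X-cong (reflexive (≡.cong (λ b → N b (F (after-x φ) j)) (≡.sym (ℕ.+-∸-assoc 1 (ℕ.≤-pred j≤a))))))))) ⟩
          ∑< (suc a) (λ j → X (N (suc a ∸ j) (F (after-x φ) j)) - N (a ∸ j) (second φ j ∘ suc))
            ≈⟨ trans (∑<-+ (suc a) (λ j → X (N (suc a ∸ j) (F (after-x φ) j))) (λ j → - N (a ∸ j) (second φ j ∘ suc))) (+-cong
                 (trans (∑<-cong (suc a) (λ j → X-* (N (suc a ∸ j) (F (after-x φ) j)))) (trans (∑<-*ˡ (suc a) (X 1#) (λ j → N (suc a ∸ j) (F (after-x φ) j))) (sym (X-* _))))
                 (∑<-neg (suc a) (λ j → N (a ∸ j) (second φ j ∘ suc)))) ⟩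
          X (H (after-x φ)) - ∑< (suc a) (λ j → N (a ∸ j) (second φ j ∘ suc))
            -- For j < a the weight is positive, so only arguments m ≥ 1 occur and `second-≥`
            -- applies. For j = a the weight has dropped to 0, and `N-zero` evaluates at the word
            -- that ends in y.
            ≈⟨ +-congˡ (-‿cong (trans (∑<-last a _) (+-cong
                 (∑<-cong-< a (λ j j<a → N-cong-≥ (a ∸ j) (λ m le → second-≥ φ j m (ℕ.≤-trans (ℕ.m<n⇒0<n∸m j<a) le))))
                 (trans (reflexive (≡.cong (λ b → N b (second φ a ∘ suc)) (ℕ.n∸n≡0 a))) (N-zero _))))) ⟩
          X (H (after-x φ)) - (∑< a (λ j → N (a ∸ j) (F (after-x φ) j)) + ι (σ (φ ∘ (y ∷_)) (xʸ a ∷ u) v)) ∎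

        H-step : ∀ φ → H φ ≈ X (H (after-x φ)) + r φ
        H-step φ = begin
          H φ
            ≈⟨ trans (∑<-cong (suc a) (λ j → trans (N-cong (suc a ∸ j) (last-letter φ j)) (N-+ (suc a ∸ j) (first φ j) (second φ j))))
                 (∑<-+ (suc a) (λ j → N (suc a ∸ j) (first φ j)) (λ j → N (suc a ∸ j) (second φ j))) ⟩
          (N (suc a) (first φ 0) + s) + ∑< (suc a) (λ j → N (suc a ∸ j) (second φ j))
            ≈⟨ +-congˡ (second-sum φ) ⟩
          (N (suc a) (first φ 0) + s) + (X (H (after-x φ)) - (s + ι (σ (φ ∘ (y ∷_)) (xʸ a ∷ u) v)))
            ≈⟨ solve 4 (λ n s h e → (n :+ s) :+ (h :- (s :+ e)) := h :+ (n :- e)) refl _ _ _ _ ⟩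
          X (H (after-x φ)) + r φ ∎
          where s = ∑< a (λ j → N (a ∸ j) (F (after-x φ) j))

        K-step : ∀ φ → K φ ≈ X (K (after-x φ)) + r φ
        K-step φ = begin
          N (suc a) (λ m → κ φ u (xʸ (m ∸ 1) ∷ v)) - κ φ (xʸ a ∷ u) v
            ≈⟨ +-cong (trans (N-cong (suc a) (λ m → trans (κ-step φ u (xʸ (m ∸ 1) ∷ v)) (+-congʳ (X-* _))))
                         (trans (N-+ (suc a) _ _) (+-congʳ (trans (N-*ˡ (suc a) (X 1#) _) (sym (X-* _))))))
                      (-‿cong (κ-step φ (xʸ a ∷ u) v)) ⟩
          (X p + N (suc a) (first φ 0)) - (X q + ι (σ (φ ∘ (y ∷_)) (xʸ a ∷ u) v))
            ≈⟨ solve 4 (λ p n q e → (p :+ n) :- (q :+ e) := (p :- q) :+ (n :- e)) refl _ _ _ _ ⟩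
          (X p - X q) + r φ
            ≈⟨ +-congʳ (sym (trans (X-+ p (- q)) (+-congˡ (X-neg q)))) ⟩
          X (p - q) + r φ ∎
          where
          p = N (suc a) (λ m → κ (after-x φ) u (xʸ (m ∸ 1) ∷ v))
          q = κ (after-x φ) (xʸ a ∷ u) v

      -- The weights of `N 1` are all -1, up to the power of t, because 1 / (1 - t) has all
      -- coefficients 1.
      κ-left : ∀ φ v → κ φ [] v ≈ - N 1 (λ m → ι (φ (xʸ (m ∸ 1) ∷ v)))
      κ-left φ v = X-unique (λ φ → κ φ [] v) (λ φ → - N 1 (λ m → ι (φ (xʸ (m ∸ 1) ∷ v)))) after-x (λ φ → ι (φ (y ∷ v)))
        (λ φ → κ-step φ [] v)
        (λ φ → begin
          - N 1 (λ m → ι (φ (xʸ (m ∸ 1) ∷ v)))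
            ≈⟨ -‿cong (trans (N-suc 0 _) (+-cong (X-cong (N-cong-≥ 1 (λ { (suc m) _ → refl }))) (-‿cong (N-zero _)))) ⟩
          - (X (N 1 (λ m → ι (φ (x ∷ xʸ (m ∸ 1) ∷ v)))) - ι (φ (y ∷ v)))
            ≈⟨ solve 2 (λ p q → :- (p :- q) := :- p :+ q) refl _ _ ⟩
          - X (N 1 (λ m → ι (φ (x ∷ xʸ (m ∸ 1) ∷ v)))) + ι (φ (y ∷ v))
            ≈⟨ +-congʳ (sym (X-neg _)) ⟩
          X (- N 1 (λ m → ι (φ (x ∷ xʸ (m ∸ 1) ∷ v)))) + ι (φ (y ∷ v)) ∎) φ

      κ-right : ∀ φ u → κ φ u [] ≈ τ (λ j → ι (φ (xʸ j ∷ u)))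
      κ-right φ u = X-unique (λ φ → κ φ u []) (λ φ → τ (λ j → ι (φ (xʸ j ∷ u)))) after-x (λ φ → ι (φ (y ∷ u)))
        (λ φ → trans (κ-step φ u []) (+-congˡ (ι-cong (σ-[] _ u))))
        (λ φ → trans (τ-unfold _) (+-comm _ _)) φ

      module _
        (Z : Word → R.Carrier)
        (Z-shuffle : ∀ U V → Z (word U) R.* Z (word V) R.≈ σ Z (word U) (word V))
        (ι-* : ∀ a b → ι (a R.* b) ≈ ι a * ι b)
        where

        g⁺ : List ℕ → Carrier
        g⁺ L = ι (Z (word L))

        open NegativePart A W g⁺ using (g⁻)

        -- Only the second row is twisted. The letters xⁿ y in `κ` stand for an entry that has not
        -- yet been given to either row; giving it to one or to the other yields the two terms of
        -- `f₂-product`.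
        f₂ : List ℕ → List ℕ → Carrier
        f₂ U V = wsum V (λ M → κ Z (word U) (word M))

        f₂-[] : ∀ V → f₂ [] V ≈ - g⁻ (1 ∷ V)
        f₂-[] V = begin
          wsum V (λ M → κ Z [] (word M))
            ≈⟨ wsum-cong V (λ M → κ-left Z (word M)) ⟩
          wsum V (λ M → - N 1 (λ m → g⁺ (m ∷ M)))
            ≈⟨ trans (wsum-neg V _) (-‿cong (wsum-N V 1 (λ m M → g⁺ (m ∷ M)))) ⟩
          - g⁻ (1 ∷ V) ∎

        f₂-product : ∀ a U V → ∑< (suc a) (λ j → g⁺ (suc j ∷ U) * g⁻ (suc a ∸ j ∷ V))
                             ≈ f₂ U (suc a ∷ V) - f₂ (suc a ∷ U) V
        f₂-product a U V = begin
          ∑< (suc a) (λ j → g⁺ (suc j ∷ U) * N (suc a ∸ j) (λ m → wsum V (λ M → g⁺ (m ∷ M))))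
            ≈⟨ ∑<-cong (suc a) (λ j → begin
                 g⁺ (suc j ∷ U) * N (suc a ∸ j) (λ m → wsum V (λ M → g⁺ (m ∷ M)))
                   ≈⟨ trans (sym (N-*ˡ (suc a ∸ j) (g⁺ (suc j ∷ U)) _)) (N-cong (suc a ∸ j) (λ m → trans (sym (wsum-*ˡ V (g⁺ (suc j ∷ U)) _))
                        (wsum-cong V (λ M → trans (sym (ι-* _ _)) (ι-cong (Z-shuffle (suc j ∷ U) (m ∷ M))))))) ⟩
                 N (suc a ∸ j) (λ m → wsum V (λ M → ι (σ Z (word (suc j ∷ U)) (word (m ∷ M)))))
                   ≈⟨ sym (wsum-N V (suc a ∸ j) _) ⟩
                 wsum V (λ M → N (suc a ∸ j) (λ m → ι (σ Z (word (suc j ∷ U)) (word (m ∷ M))))) ∎) ⟩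
          ∑< (suc a) (λ j → wsum V (λ M → N (suc a ∸ j) (λ m → ι (σ Z (word (suc j ∷ U)) (word (m ∷ M))))))
            ≈⟨ trans (sym (wsum-∑< V (suc a) (λ j M → N (suc a ∸ j) (λ m → ι (σ Z (word (suc j ∷ U)) (word (m ∷ M)))))))
                 (wsum-cong V (λ M → κ-product a Z (word U) (word M))) ⟩
          wsum V (λ M → N (suc a) (λ m → κ Z (word U) (word (m ∷ M))) - κ Z (word (suc a ∷ U)) (word M))
            ≈⟨ trans (wsum-+ V _ _) (+-cong (wsum-N V (suc a) (λ m M → κ Z (word U) (word (m ∷ M)))) (wsum-neg V _)) ⟩
          f₂ U (suc a ∷ V) - f₂ (suc a ∷ U) V ∎

        private
          module ⁺ = Star A g⁺

          E-τ : ∀ us (h : ℕ → List ℕ → Carrier) → ⁺.E (λ U → τ (λ j → h j U)) us ≈ τ (λ j → ⁺.E (h j) us)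
          E-τ []       h = refl
          E-τ (u ∷ us) h = sym (trans (τ-+ _ _) (+-cong
            (trans (τ-cong (λ j → *-comm (h j []) _)) (trans (τ-*ˡ (⁺.S (u ∷ us)) (λ j → h j [])) (*-comm _ _)))
            (trans (τ-neg (λ j → ⁺.E (λ U → h j (u ++ U)) us)) (-‿cong (sym (E-τ us (λ j U → h j (u ++ U))))))))

        τ-S⁺ : ∀ us → τ (λ j → ⁺.S (map [_] (suc j ∷ us))) ≈ ⁺.E (λ U → f₂ U []) (map [_] us)
        τ-S⁺ us = trans (sym (E-τ (map [_] us) (λ j U → g⁺ (suc j ∷ U))))
          (⁺.E-cong (map [_] us) (λ U → sym (κ-right Z (word U))))

-- The cyclic sum of symmetric star series, for abstract regularised values

module SymmetricSums where

  open import Algebra.Bundles using (CommutativeRing)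
  open import Level using (0ℓ)
  open import Defs using (Word; x; y)
  open import Data.Integer using (+_)
  open import Data.List using (List; []; _∷_; _++_; _∷ʳ_; [_]; map; length; reverse)
  import Data.List.Properties as List
  open import Data.List.Relation.Unary.All as All using (All; []; _∷_)
  open import Data.Nat as ℕ using (ℕ; zero; suc; _∸_; _≤_; NonZero)
  open import Data.Nat.ListAction using (sum)
  open import Data.Product using (_,_)
  open import Data.Sum using (inj₁; inj₂)
  open import Data.Empty using (⊥-elim)
  open import Function using (_∘_)
  open import Relation.Nullary using (¬_)
  open import Relation.Binary.PropositionalEquality as ≡ using (_≡_)
  open RingSums
  open StarSums
  open CyclicSums
  open PowerSeriesSums
  open WeightedSeries
  open NegativeParts
  open Words

  module SymmetricCyclicSum
    (R : CommutativeRing 0ℓ 0ℓ)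
    (A : CommutativeRing 0ℓ 0ℓ) (W : Weighting A)
    (ι : CommutativeRing.Carrier R → CommutativeRing.Carrier A)
    (κ : (Word → CommutativeRing.Carrier R) → Word → Word → CommutativeRing.Carrier A)
    (Z : Word → CommutativeRing.Carrier R)
    where
    private
      module R = CommutativeRing R
      module RT = RingTools R
    open CommutativeRing A hiding (zero)
    open RingTools A
    open CyclicSum A
    open Weighting W
    open WeightedSums A W
    open import Relation.Binary.Reasoning.Setoid setoid

    g : List ℕ → R.Carrier
    g L = Z (word L)

    module Solved
      (ι-cong : ∀ {a b} → a R.≈ b → ι a ≈ ι b)
      (ι-+ : ∀ a b → ι (a R.+ b) ≈ ι a + ι b)
      (ι-* : ∀ a b → ι (a R.* b) ≈ ι a * ι b)
      (ι-neg : ∀ a → ι (R.- a) ≈ - ι a)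
      (ι-0 : ι R.0# ≈ 0#)
      (ι-1 : ι R.1# ≈ 1#)
      (ι-integer : ∀ m → ι (RT.fromInt (+ m)) ≈ integer m)
      (κ-step : ∀ φ u v → κ φ u v ≈ X (κ (φ ∘ (x ∷_)) u v) + ι (ShuffleSum.σ R (φ ∘ (y ∷_)) u v))
      (Z-shuffle : ∀ U V → Z (word U) R.* Z (word V) R.≈ ShuffleSum.σ R Z (word U) (word V))
      (Z-y : Z (y ∷ []) R.≈ R.0#)
      (C-value : ∀ {ks k} → All NonZero ks → 2 ≤ k → Star.C R g (map [_] ks) [ k ] R.≈ g [ sum ks ℕ.+ k ])
      where

      open NegativePart A W (ι ∘ g) using (g⁻; S⁻; S⁻-wsum; positive; negative; negate; negative-sum; negative-ones)
      private
        f₂ : List ℕ → List ℕ → Carrier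
        f₂ = SymmetricShuffle.f₂ R A W ι κ ι-cong ι-+ κ-step Z Z-shuffle ι-*
        module Sym = SymmetricSum A (ι ∘ g) g⁻ f₂
        module Sᴿ = Star R g
        module ⁺ = Star A (ι ∘ g)
        module Cyc = CyclicSumFormula R g

      Ŝ : List ℕ → Carrier
      Ŝ = Sym.Ŝ

      -- All insertions of y into a word form its shuffle with y, whose value is a multiple of Z(y)
      -- = 0.
      y-insertion : ∀ v → (g (1 ∷ v) R.+ g (v ∷ʳ 1)) R.+ Sᴿ.∂ g v R.≈ R.0#
      y-insertion v = R.trans (R.sym (ShuffleSum.σ-y R Z v)) (R.trans (R.sym (Z-shuffle (1 ∷ []) v))
        (R.trans (R.*-congʳ Z-y) (R.zeroˡ _)))

      private
        ι-E : ∀ us h → ⁺.E (ι ∘ h) us ≈ ι (Sᴿ.E h us)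
        ι-E []       h = refl
        ι-E (u ∷ us) h = sym (trans (ι-+ _ _) (+-cong
          (trans (ι-* _ _) (*-congˡ (sym (ι-E us _)))) (trans (ι-neg _) (-‿cong (sym (ι-E us _))))))

        ι-∑< : ∀ n f → ι (RT.∑< n f) ≈ ∑< n (ι ∘ f)
        ι-∑< zero    f = ι-0
        ι-∑< (suc n) f = trans (ι-+ _ _) (+-congˡ (ι-∑< n (f ∘ suc)))

        ι-positive : ∀ k ks → positive k ks ≈ ι (Cyc.S-split k ks)
        ι-positive k ks = trans (∑<-cong (k ∸ 1) (λ j → trans (ι-E (map [_] (ks ∷ʳ (k ∸ j))) (λ U → g (suc j ∷ U)))
          (ι-cong (R.reflexive (≡.cong (λ us → Sᴿ.S ([ suc j ] ∷ us)) (List.map-++ [_] ks [ k ∸ j ]))))))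
          (sym (ι-∑< (k ∸ 1) _))

        ι-cyc : ∀ acc ks → cyc positive acc ks ≈ ι (CyclicSum.cyc R Cyc.S-split acc ks)
        ι-cyc acc []       = sym ι-0
        ι-cyc acc (k ∷ ks) = trans (+-cong (ι-positive k (ks ++ acc)) (ι-cyc (acc ∷ʳ k) ks)) (sym (ι-+ _ _))

      positive-ones : ∀ {M} → All (_≡ 1) M → cyc positive [] M ≈ 0#
      positive-ones {M} ones = trans (ι-cyc [] M) (trans (ι-cong (Cyc.S-split-ones ones)) ι-0)

      positive-sum : ∀ {M} → All NonZero M → ¬ All (_≡ 1) M → cyc positive [] M ≈ integer (sum M) * ι (g [ suc (sum M) ])
      positive-sum {M} pos ¬ones with all-ones? pos
      ... | inj₁ ones = ⊥-elim (¬ones ones)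
      ... | inj₂ (pre , k , post , ≡.refl , 2≤k) = trans (ι-cyc [] M) (trans
        (ι-cong (Cyc.S-split-sum y-insertion (λ n → g [ n ]) C-value pre post pos 2≤k))
        (trans (ι-* _ _) (*-congʳ (ι-integer (sum M)))))

      left right : ℕ → List ℕ → Carrier
      left k ks  = ∑< (k ∸ 1) (λ j → Ŝ (suc j ∷ ks ∷ʳ (k ∸ j)))
      right k ks = τ (λ j → Ŝ (suc j ∷ ks ∷ʳ k))

      private
        S⁺-ι : ∀ ks → Sym.S⁺ ks ≈ ι (Sᴿ.S (map [_] ks))
        S⁺-ι []       = sym ι-1
        S⁺-ι (k ∷ ks) = ι-E (map [_] ks) (λ U → g (k ∷ U))

      Ŝ-expansion : ∀ ks → Ŝ ks ≈ Splits.spl A (λ p q →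
                      ι (Sᴿ.S (map [_] p)) * wsum q (λ M → ι (Sᴿ.S (map [_] (reverse M))))) ks
      Ŝ-expansion ks = Splits.spl-cong A ks (λ p q → *-cong (S⁺-ι p)
        (trans (S⁻-wsum (reverse q)) (trans (wsum-reverse q Sym.S⁺) (wsum-cong q (λ M → S⁺-ι (reverse M))))))

      private
        τ-*ʳ : ∀ f c → τ (λ j → f j * c) ≈ τ f * c
        τ-*ʳ f c = trans (τ-cong (λ j → *-comm (f j) c)) (trans (τ-*ˡ c f) (*-comm _ _))

        decomposition : ∀ {ks} → All NonZero ks →
                        cyc left [] ks ≈ (cyc right [] ks + cyc positive [] ks) + cyc negative [] ks
        decomposition = Sym.Ŝ-cyclic-sum
          (SymmetricShuffle.f₂-product R A W ι κ ι-cong ι-+ κ-step Z Z-shuffle ι-*)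
          (SymmetricShuffle.f₂-[] R A W ι κ ι-cong ι-+ κ-step Z Z-shuffle ι-*)
          τ τ-cong τ-+ τ-*ʳ
          (SymmetricShuffle.τ-S⁺ R A W ι κ ι-cong ι-+ κ-step Z Z-shuffle ι-*)

        Ŝ-row : ∀ k → Ŝ [ k ] ≈ S⁻ [ k ] + ι (g [ k ])
        Ŝ-row k = +-cong (*-identityˡ _) (*-identityʳ _)

      -- The two factors contribute k times the first and k times the second of the two terms that
      -- make up the depth-one series `Ŝ`.
      Ŝ-cyclic-sum : ∀ {ks} → All NonZero ks → ¬ All (_≡ 1) ks →
                     cyc left [] ks ≈ cyc right [] ks + integer (sum ks) * Ŝ [ suc (sum ks) ]
      Ŝ-cyclic-sum {ks} pos ¬ones = begin
        cyc left [] ks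
          ≈⟨ decomposition pos ⟩
        (cyc right [] ks + cyc positive [] ks) + cyc negative [] ks
          ≈⟨ +-cong (+-congˡ (positive-sum pos ¬ones)) (negative-sum positive-ones positive-sum pos ¬ones) ⟩
        (cyc right [] ks + n * ι (g [ suc (sum ks) ])) + n * S⁻ [ suc (sum ks) ]
          ≈⟨ solve 4 (λ r n p q → (r :+ n :* p) :+ n :* q := r :+ n :* (q :+ p)) refl _ _ _ _ ⟩
        cyc right [] ks + n * (S⁻ [ suc (sum ks) ] + ι (g [ suc (sum ks) ]))
          ≈⟨ +-congˡ (*-congˡ (sym (Ŝ-row (suc (sum ks))))) ⟩
        cyc right [] ks + n * Ŝ [ suc (sum ks) ] ∎
        where n = integer (sum ks)

      -- For ones the positive part vanishes, so its expected value must be subtracted to complete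
      -- the depth-one series; the correction of the negative part enters with the sign of the
      -- length.
      Ŝ-cyclic-sum-ones : ∀ {ks} → All (_≡ 1) ks →
                          cyc left [] ks ≈ (cyc right [] ks + integer (sum ks) * Ŝ [ suc (sum ks) ])
                            - (integer (sum ks) * ι (g [ suc (sum ks) ])
                               - negate (length ks) (integer (sum ks) * ι (g [ suc (sum ks) ])))
      Ŝ-cyclic-sum-ones {ks} ones = begin
        cyc left [] ks
          ≈⟨ decomposition (All.map (λ { ≡.refl → _ }) ones) ⟩
        (cyc right [] ks + cyc positive [] ks) + cyc negative [] ks
          ≈⟨ +-cong (+-congˡ (positive-ones ones)) (negative-ones positive-ones positive-sum ones) ⟩
        (cyc right [] ks + 0#) + (n * S⁻ [ suc (sum ks) ] + negate (length ks) (n * ι (g [ suc (sum ks) ])))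
          ≈⟨ trans (+-congʳ (+-identityʳ _)) (solve 5 (λ r n p q e → r :+ (n :* q :+ e) := (r :+ n :* (q :+ p)) :- (n :* p :- e)) refl _ n (ι (g [ suc (sum ks) ])) _ _) ⟩
        (cyc right [] ks + n * (S⁻ [ suc (sum ks) ] + ι (g [ suc (sum ks) ])))
          - (n * ι (g [ suc (sum ks) ]) - negate (length ks) (n * ι (g [ suc (sum ks) ])))
          ≈⟨ +-congʳ (+-congˡ (*-congˡ (sym (Ŝ-row (suc (sum ks)))))) ⟩
        (cyc right [] ks + n * Ŝ [ suc (sum ks) ])
          - (n * ι (g [ suc (sum ks) ]) - negate (length ks) (n * ι (g [ suc (sum ks) ]))) ∎
        where n = integer (sum ks)

-- The ring of real numbers and limits of rational sequences

module Reals where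

  open import Algebra.Bundles using (CommutativeRing)
  open import Level using (0ℓ)
  open import Defs using
    ( IsCauchy; ℝ; mkℝ; seq; cauchy; _≈ᴿ_; _+ᴿ_; _*ᴿ_; -ᴿ_; 0ᴿ; 1ᴿ; fromℚ; fromℤ
    ; half-pos; half+half; eventually-bounded; divide)
  open import Data.Integer as ℤ using (+_; -[1+_])
  open import Data.Nat as ℕ using (ℕ; zero; suc)
  import Data.Nat.Properties as ℕ
  open import Data.Product using (∃; _×_; _,_)
  open import Data.Rational as ℚ using (ℚ; 0ℚ; 1ℚ; ½; ∣_∣; _+_; _*_; _-_; -_; _≤_; _<_; positive; _/_)
  import Data.Rational.Properties as ℚ
  open import Data.Rational.Solver using (module +-*-Solver)
  import Data.Rational.Unnormalised as ℚᵘ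
  import Data.Rational.Unnormalised.Properties as ℚᵘ
  open import Relation.Binary.PropositionalEquality as ≡ using (_≡_; refl; cong; sym; trans; subst)
  open RingSums

  module Limits where
    open +-*-Solver

    record Null (f : ℕ → ℚ) : Set where
      constructor null
      field small : ∀ ε → 0ℚ < ε → ∃ λ N → ∀ n → N ℕ.≤ n → ∣ f n ∣ < ε

    open Null public

    null-≗ : ∀ {f g} → (∀ n → f n ≡ g n) → Null f → Null g
    null-≗ eq nf = null λ ε 0<ε → let N , h = small nf ε 0<ε in N , λ n N≤n → subst (λ z → ∣ z ∣ < ε) (eq n) (h n N≤n)

    null-0 : Null (λ _ → 0ℚ)
    null-0 = null λ ε 0<ε → 0 , λ _ _ → 0<ε

    null-+ : ∀ {f g} → Null f → Null g → Null (λ n → f n + g n)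
    null-+ {f} {g} nf ng = null λ ε 0<ε →
      let N₁ , h₁ = small nf (½ * ε) (half-pos 0<ε)
          N₂ , h₂ = small ng (½ * ε) (half-pos 0<ε)
      in N₁ ℕ.⊔ N₂ , λ n N≤n → begin-strict
        ∣ f n + g n ∣     ≤⟨ ℚ.∣p+q∣≤∣p∣+∣q∣ (f n) (g n) ⟩
        ∣ f n ∣ + ∣ g n ∣ <⟨ ℚ.+-mono-< (h₁ n (ℕ.m⊔n≤o⇒m≤o N₁ N₂ N≤n)) (h₂ n (ℕ.m⊔n≤o⇒n≤o N₁ N₂ N≤n)) ⟩
        ½ * ε + ½ * ε     ≡⟨ half+half ε ⟩
        ε ∎
      where open ℚ.≤-Reasoning

    null-neg : ∀ {f} → Null f → Null (λ n → - f n)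
    null-neg {f} nf = null λ ε 0<ε → let N , h = small nf ε 0<ε in N , λ n N≤n → subst (_< ε) (sym (ℚ.∣-p∣≡∣p∣ (f n))) (h n N≤n)

    null-bounded : ∀ {f} (g : ℕ → ℚ) {B} → 0ℚ < B → (∃ λ N → ∀ n → N ℕ.≤ n → ∣ g n ∣ ≤ B) → Null f → Null (λ n → g n * f n)
    null-bounded {f} g {B} 0<B (N₁ , b) nf = null λ ε 0<ε →
      let δ , 0<δ , Bδ≡ε = divide 0<ε 0<B
          N₂ , h = small nf δ 0<δ
      in N₁ ℕ.⊔ N₂ , λ n N≤n → begin-strict
        ∣ g n * f n ∣     ≡⟨ ℚ.∣p*q∣≡∣p∣*∣q∣ (g n) (f n) ⟩
        ∣ g n ∣ * ∣ f n ∣ ≤⟨ ℚ.*-monoʳ-≤-nonNeg ∣ f n ∣ {{ℚ.∣-∣-nonNeg (f n)}} (b n (ℕ.m⊔n≤o⇒m≤o N₁ N₂ N≤n)) ⟩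
        B * ∣ f n ∣       <⟨ ℚ.*-monoʳ-<-pos B {{positive 0<B}} (h n (ℕ.m⊔n≤o⇒n≤o N₁ N₂ N≤n)) ⟩
        B * δ             ≡⟨ Bδ≡ε ⟩
        ε ∎
      where open ℚ.≤-Reasoning

    null-*ˡ : ∀ {f g} → IsCauchy g → Null f → Null (λ n → g n * f n)
    null-*ˡ {f} {g} cg nf = let B , 0<B , N , b = eventually-bounded {g} cg in null-bounded g 0<B (N , b) nf

    null-scale : ∀ {f} c → Null f → Null (λ n → c * f n)
    null-scale {f} c = null-bounded {f} (λ _ → c) {∣ c ∣ + 1ℚ} (ℚ.+-mono-≤-< (ℚ.0≤∣p∣ c) (ℚ.positive⁻¹ 1ℚ))
      (0 , λ _ _ → subst (_≤ ∣ c ∣ + 1ℚ) (ℚ.+-identityʳ ∣ c ∣) (ℚ.+-monoʳ-≤ ∣ c ∣ (ℚ.nonNegative⁻¹ 1ℚ)))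

    null-squeeze : ∀ {f g} → (∀ n → 0ℚ ≤ f n) → (∀ n → f n ≤ g n) → Null g → Null f
    null-squeeze {f} {g} 0≤f f≤g ng = null λ ε 0<ε → let N , h = small ng ε 0<ε in N , λ n N≤n → begin-strict
        ∣ f n ∣ ≡⟨ ℚ.0≤p⇒∣p∣≡p (0≤f n) ⟩
        f n     ≤⟨ f≤g n ⟩
        g n     ≡⟨ ℚ.0≤p⇒∣p∣≡p (ℚ.≤-trans (0≤f n) (f≤g n)) ⟨
        ∣ g n ∣ <⟨ h n N≤n ⟩
        ε ∎
      where open ℚ.≤-Reasoning

    null-suc : ∀ {f} → Null (λ n → f (suc n)) → Null f
    null-suc nf = null λ ε 0<ε → let N , h = small nf ε 0<ε in suc N , λ { (suc n) (ℕ.s≤s N≤n) → h n N≤n }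

    -- Convergence of a bare rational sequence. That it is Cauchy is a consequence (`lim-cauchy`),
    -- which spares separate Cauchy proofs for the truncated sums.
    record Lim (f : ℕ → ℚ) (a : ℝ) : Set where
      constructor lim
      field difference : Null (λ n → f n - seq a n)

    open Lim public

  -- _≈ᴿ_ unfolds to a Π-type, from which the two reals cannot be recovered.
  infix 4 _≈_
  record _≈_ (a b : ℝ) : Set where
    constructor wrap
    field unwrap : a ≈ᴿ b

  open _≈_ public

  module Real where
    open +-*-Solver
    open Limits

    pointwise : ∀ {a b} → (∀ n → seq a n ≡ seq b n) → a ≈ b
    pointwise {a} {b} eq = wrap (small (null-≗ (λ n → sym (trans (cong (_- seq b n) (eq n)) (ℚ.+-inverseʳ (seq b n)))) null-0))

    private
      ≈-sym : ∀ {a b} → a ≈ b → b ≈ a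
      ≈-sym {a} {b} (wrap p) = wrap (small (null-≗ (λ n → solve 2 (λ a b → :- (a :- b) := b :- a) refl (seq a n) (seq b n)) (null-neg (null p))))

      ≈-trans : ∀ {a b c} → a ≈ b → b ≈ c → a ≈ c
      ≈-trans {a} {b} {c} (wrap p) (wrap q) = wrap (small (null-≗
        (λ n → solve 3 (λ a b c → (a :- b) :+ (b :- c) := a :- c) refl (seq a n) (seq b n) (seq c n)) (null-+ (null p) (null q))))

      +-cong : ∀ {a a′ b b′} → a ≈ a′ → b ≈ b′ → (a +ᴿ b) ≈ (a′ +ᴿ b′)
      +-cong {a} {a′} {b} {b′} (wrap p) (wrap q) = wrap (small (null-≗
        (λ n → solve 4 (λ a a′ b b′ → (a :- a′) :+ (b :- b′) := (a :+ b) :- (a′ :+ b′)) refl (seq a n) (seq a′ n) (seq b n) (seq b′ n))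
        (null-+ (null p) (null q))))

      neg-cong : ∀ {a b} → a ≈ b → (-ᴿ a) ≈ (-ᴿ b)
      neg-cong {a} {b} (wrap p) = wrap (small (null-≗ (λ n → solve 2 (λ a b → :- (a :- b) := (:- a) :- (:- b)) refl (seq a n) (seq b n)) (null-neg (null p))))

      *-cong : ∀ {a a′ b b′} → a ≈ a′ → b ≈ b′ → (a *ᴿ b) ≈ (a′ *ᴿ b′)
      *-cong {a} {a′} {b} {b′} (wrap p) (wrap q) = wrap (small (null-≗
        (λ n → solve 4 (λ a a′ b b′ → b :* (a :- a′) :+ a′ :* (b :- b′) := a :* b :- a′ :* b′) refl (seq a n) (seq a′ n) (seq b n) (seq b′ n))
        (null-+ (null-*ˡ {g = seq b} (cauchy b) (null p)) (null-*ˡ {g = seq a′} (cauchy a′) (null q)))))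

    ℝ-ring : CommutativeRing 0ℓ 0ℓ
    ℝ-ring = record
      { Carrier = ℝ ; _≈_ = _≈_ ; _+_ = _+ᴿ_ ; _*_ = _*ᴿ_ ; -_ = -ᴿ_ ; 0# = 0ᴿ ; 1# = 1ᴿ
      ; isCommutativeRing = record
        { isRing = record
          { +-isAbelianGroup = record
            { isGroup = record
              { isMonoid = record
                { isSemigroup = record
                  { isMagma = record
                    { isEquivalence = record { refl = pointwise (λ _ → refl) ; sym = ≈-sym ; trans = ≈-trans }
                    ; ∙-cong = +-cong }
                  ; assoc = λ a b c → pointwise (λ n → ℚ.+-assoc (seq a n) (seq b n) (seq c n)) }
                ; identity = (λ a → pointwise (λ n → ℚ.+-identityˡ (seq a n))) , (λ a → pointwise (λ n → ℚ.+-identityʳ (seq a n))) }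
              ; inverse = (λ a → pointwise (λ n → ℚ.+-inverseˡ (seq a n))) , (λ a → pointwise (λ n → ℚ.+-inverseʳ (seq a n)))
              ; ⁻¹-cong = neg-cong }
            ; comm = λ a b → pointwise (λ n → ℚ.+-comm (seq a n) (seq b n)) }
          ; *-cong = *-cong
          ; *-assoc = λ a b c → pointwise (λ n → ℚ.*-assoc (seq a n) (seq b n) (seq c n))
          ; *-identity = (λ a → pointwise (λ n → ℚ.*-identityˡ (seq a n))) , (λ a → pointwise (λ n → ℚ.*-identityʳ (seq a n)))
          ; distrib = (λ a b c → pointwise (λ n → ℚ.*-distribˡ-+ (seq a n) (seq b n) (seq c n)))
                    , (λ a b c → pointwise (λ n → ℚ.*-distribʳ-+ (seq a n) (seq b n) (seq c n))) }
        ; *-comm = λ a b → pointwise (λ n → ℚ.*-comm (seq a n) (seq b n)) } }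

    ℚ-ring : CommutativeRing 0ℓ 0ℓ
    ℚ-ring = ℚ.+-*-commutativeRing

    suc/1 : ∀ n → + suc n / 1 ≡ 1ℚ + + n / 1
    suc/1 zero    = refl
    suc/1 (suc n) = ℚ.toℚᵘ-injective (ℚᵘ.≃-trans (ℚ.toℚᵘ-fromℚᵘ (ℚᵘ.mkℚᵘ (+ suc (suc n)) 0))
      (ℚᵘ.≃-trans (ℚᵘ.*≡* (cong (λ m → + (suc (suc m) ℕ.* 1)) (sym (ℕ.*-identityʳ n))))
        (ℚᵘ.≃-sym (ℚᵘ.≃-trans (ℚ.toℚᵘ-homo-+ 1ℚ (+ suc n / 1))
          (ℚᵘ.+-cong (ℚᵘ.≃-refl {ℚᵘ.1ℚᵘ}) (ℚ.toℚᵘ-fromℚᵘ (ℚᵘ.mkℚᵘ (+ suc n) 0)))))))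

    private
      module ℝT = RingTools ℝ-ring
      open import Algebra.Properties.Semiring.Mult (CommutativeRing.semiring ℝ-ring) using () renaming (_×_ to _×ʳ_)

    fromInt-fromℤ : ∀ i → ℝT.fromInt i ≈ fromℤ i
    fromInt-fromℤ i = pointwise (λ m → lemma m i)
      where
      nat : ∀ m n → seq (n ×ʳ 1ᴿ) m ≡ + n / 1
      nat m zero    = refl
      nat m (suc n) = trans (cong (λ z → 1ℚ + z) (nat m n)) (sym (suc/1 n))
      lemma : ∀ m i → seq (ℝT.fromInt i) m ≡ i / 1
      lemma m (+ n)    = nat m n
      lemma m -[1+ n ] = cong -_ (nat m (suc n))

    lim-seq : ∀ a → Lim (seq a) a
    lim-seq a = lim (null-≗ (λ n → sym (ℚ.+-inverseʳ (seq a n))) null-0)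

    lim-≗ : ∀ {f g a} → (∀ n → f n ≡ g n) → Lim f a → Lim g a
    lim-≗ {a = a} eq (lim l) = lim (null-≗ (λ n → cong (_- seq a n) (eq n)) l)

    lim-≈ : ∀ {f a b} → a ≈ b → Lim f a → Lim f b
    lim-≈ {f} {a} {b} (wrap p) (lim l) = lim (null-≗ (λ n → solve 3 (λ f a b → (f :- a) :+ (a :- b) := f :- b) refl (f n) (seq a n) (seq b n)) (null-+ l (null p)))

    lim-+ : ∀ {f g a b} → Lim f a → Lim g b → Lim (λ n → f n + g n) (a +ᴿ b)
    lim-+ {f} {g} {a} {b} (lim p) (lim q) = lim (null-≗ (λ n → solve 4 (λ f g a b → (f :- a) :+ (g :- b) := (f :+ g) :- (a :+ b)) refl (f n) (g n) (seq a n) (seq b n)) (null-+ p q))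

    lim-neg : ∀ {f a} → Lim f a → Lim (λ n → - f n) (-ᴿ a)
    lim-neg {f} {a} (lim p) = lim (null-≗ (λ n → solve 2 (λ f a → :- (f :- a) := (:- f) :- (:- a)) refl (f n) (seq a n)) (null-neg p))

    lim-null : ∀ {f g a} → Lim f a → Null (λ n → g n - f n) → Lim g a
    lim-null {f} {g} {a} (lim l) d = lim (null-≗ (λ n → solve 3 (λ f g a → (g :- f) :+ (f :- a) := g :- a) refl (f n) (g n) (seq a n)) (null-+ d l))

    lim-cauchy : ∀ {f a} → Lim f a → IsCauchy f
    lim-cauchy {f} {a} (lim l) ε 0<ε =
      let N₁ , h₁ = small l (½ * (½ * ε)) (half-pos (half-pos 0<ε))
          N₂ , h₂ = cauchy a (½ * ε) (half-pos 0<ε)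
      in N₁ ℕ.⊔ N₂ , λ m n N≤m N≤n → begin-strict
        ∣ f m - f n ∣
          ≡⟨ cong ∣_∣ (solve 4 (λ f a g b → f :- g := ((f :- a) :- (g :- b)) :+ (a :- b)) refl (f m) (seq a m) (f n) (seq a n)) ⟩
        ∣ ((f m - seq a m) - (f n - seq a n)) + (seq a m - seq a n) ∣
          ≤⟨ ℚ.≤-trans (ℚ.∣p+q∣≤∣p∣+∣q∣ ((f m - seq a m) - (f n - seq a n)) _) (ℚ.+-monoˡ-≤ ∣ seq a m - seq a n ∣
               (ℚ.≤-trans (ℚ.∣p+q∣≤∣p∣+∣q∣ (f m - seq a m) (- (f n - seq a n)))
                 (ℚ.≤-reflexive (cong (λ z → ∣ f m - seq a m ∣ + z) (ℚ.∣-p∣≡∣p∣ (f n - seq a n)))))) ⟩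
        (∣ f m - seq a m ∣ + ∣ f n - seq a n ∣) + ∣ seq a m - seq a n ∣
          <⟨ ℚ.+-mono-< (ℚ.+-mono-< (h₁ m (ℕ.m⊔n≤o⇒m≤o N₁ N₂ N≤m)) (h₁ n (ℕ.m⊔n≤o⇒m≤o N₁ N₂ N≤n)))
               (h₂ m n (ℕ.m⊔n≤o⇒n≤o N₁ N₂ N≤m) (ℕ.m⊔n≤o⇒n≤o N₁ N₂ N≤n)) ⟩
        (½ * (½ * ε) + ½ * (½ * ε)) + ½ * ε
          ≡⟨ trans (cong (_+ ½ * ε) (half+half (½ * ε))) (half+half ε) ⟩
        ε ∎
      where open ℚ.≤-Reasoning

    lim-unique : ∀ {f a b} → Lim f a → Lim f b → a ≈ b
    lim-unique {f} {a} {b} (lim p) (lim q) = wrap (small (null-≗ (λ n → solve 3 (λ f a b → (f :- b) :- (f :- a) := a :- b) refl (f n) (seq a n) (seq b n)) (null-+ q (null-neg p))))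

    -- Convergent sequences are Cauchy and hence themselves real numbers, equal to their limits, so
    -- compatibility of the product with equality is enough.
    lim-* : ∀ {f g a b} → Lim f a → Lim g b → Lim (λ n → f n * g n) (a *ᴿ b)
    lim-* {f} {g} {a} {b} p q = lim-≈ {f = λ n → f n * g n} (*-cong (lim-≈-limit p) (lim-≈-limit q)) (lim-seq (real p *ᴿ real q))
      where
      real : ∀ {f a} → Lim f a → ℝ
      real {f} l = mkℝ f (lim-cauchy l)
      lim-≈-limit : ∀ {f a} (l : Lim f a) → real l ≈ a
      lim-≈-limit l = lim-unique (lim-seq (real l)) l

-- Truncated harmonic sums, the cyclic sum as a closed chain, and removal of leading ones

module TruncatedSums where

  open import Algebra.Bundles using (CommutativeRing)
  open import Level using (0ℓ)
  open import Data.Bool using (if_then_else_; true)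
  open import Data.Integer using (+_)
  open import Data.List using (List; []; _∷_; _++_; _∷ʳ_; [_]; map; replicate)
  open import Data.List.Relation.Unary.All as All using (All; []; _∷_)
  import Data.List.Properties as List
  open import Data.Nat as ℕ using (ℕ; zero; suc; _≤_; _<_; z≤n; s≤s; NonZero)
  open import Data.Nat.ListAction using (sum)
  import Data.Nat.Properties as ℕ
  open import Function using (_∘_)
  open import Relation.Binary.PropositionalEquality as ≡ using (_≡_)
  open RingSums
  open StarSums
  open PowerSeriesSums using (module PowerSeries)
  open WeightedSeries using (module Weights)

  module Truncation (R : CommutativeRing 0ℓ 0ℓ)
    (p : ℕ → ℕ → CommutativeRing.Carrier R)
    where
    open CommutativeRing R hiding (zero)
    open RingTools R
    import Algebra.Properties.Ring ring as RP
    open import Relation.Binary.Reasoning.Setoid setoid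

    -- tr (k₁ ∷ ⋯ ∷ k_r ∷ []) N = ∑ p k₁ n₁ ⋯ p k_r n_r over N > n₁ > ⋯ > n_r ≥ 0.
    tr : List ℕ → ℕ → Carrier
    tr []       N       = 1#
    tr (k ∷ ks) zero    = 0#
    tr (k ∷ ks) (suc N) = tr (k ∷ ks) N + p k N * tr ks N

    -- The operator f ↦ (i ↦ ∑ p k₁ n₁ ⋯ p k_r n_r f n_r), over i > n₁ > ⋯ > n_r ≥ 0.
    below : List ℕ → (ℕ → Carrier) → ℕ → Carrier
    below []       f i = f i
    below (k ∷ ks) f i = ∑< i (λ j → p k j * below ks f j)

    tr-below : ∀ ks i → tr ks i ≈ below ks (λ _ → 1#) i
    tr-below []       i       = refl
    tr-below (k ∷ ks) zero    = refl
    tr-below (k ∷ ks) (suc i) = trans (+-cong (tr-below (k ∷ ks) i) (*-congˡ (tr-below ks i))) (sym (∑<-last i _))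

    below-cong : ∀ ks i {f g} → (∀ j → j ≤ i → f j ≈ g j) → below ks f i ≈ below ks g i
    below-cong []       i eq = eq i ℕ.≤-refl
    below-cong (k ∷ ks) i eq = ∑<-cong-< i (λ j j<i → *-congˡ (below-cong ks j (λ l l≤j → eq l (ℕ.≤-trans l≤j (ℕ.<⇒≤ j<i)))))

    below-lin : ∀ ks c f g i → below ks (λ j → c * f j - g j) i ≈ c * below ks f i - below ks g i
    below-lin []       c f g i = refl
    below-lin (k ∷ ks) c f g i = begin
      ∑< i (λ j → p k j * below ks (λ j → c * f j - g j) j)
        ≈⟨ ∑<-cong i (λ j → trans (*-congˡ (below-lin ks c f g j))
             (solve 4 (λ p c a b → p :* (c :* a :- b) := c :* (p :* a) :- p :* b) refl _ _ _ _)) ⟩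
      ∑< i (λ j → c * (p k j * below ks f j) - p k j * below ks g j)
        ≈⟨ trans (∑<-+ i _ _) (+-cong (∑<-*ˡ i c _) (∑<-neg i _)) ⟩
      c * below (k ∷ ks) f i - below (k ∷ ks) g i ∎

    below-++ : ∀ ks ls f i → below (ks ++ ls) f i ≈ below ks (below ls f) i
    below-++ []       ls f i = refl
    below-++ (k ∷ ks) ls f i = ∑<-cong i (λ j → *-congˡ (below-++ ks ls f j))

    module Cyclic (N : ℕ) where
      open Star R (λ L → tr L N)

      rows : List ℕ → List Row
      rows = map [_]

      before : ℕ → ℕ → Carrier
      before n i = if n ℕ.<ᵇ i then 1# else 0#

      -- H ks n i = ∑ p k₁ m₁ ⋯ p k_r m_r over i ≤ m₁ ≤ ⋯ ≤ m_r ≤ n (for n < N).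
      H : List ℕ → ℕ → ℕ → Carrier
      H []       n i = 1# - before n i
      H (k ∷ ks) n i = ∑< N (λ m → p k m * H ks n m) - below [ k ] (H ks n) i

      -- A functional `ℒ` of this kind represents the summations already performed over the
      -- unfinished row, leaving its upper bound i ≤ N open. Linearity is all that is needed to
      -- carry it through the recursion of `E`.
      record Linear (ℒ : (ℕ → Carrier) → Carrier) : Set where
        field
          cong-< : ∀ {f g} → (∀ i → i ≤ N → f i ≈ g i) → ℒ f ≈ ℒ g
          +-homo : ∀ f g → ℒ (λ i → f i + g i) ≈ ℒ f + ℒ g
          *-homo : ∀ c f → ℒ (λ i → c * f i) ≈ c * ℒ f

        minus-homo : ∀ f g → ℒ (λ i → f i - g i) ≈ ℒ f - ℒ g
        minus-homo f g = trans (+-homo f (λ i → - g i)) (+-congˡ (trans (cong-< (λ i _ → sym (RP.-1*x≈-x (g i))))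
          (trans (*-homo (- 1#) g) (RP.-1*x≈-x _))))

        0-homo : ℒ (λ _ → 0#) ≈ 0#
        0-homo = trans (cong-< (λ i _ → sym (zeroˡ 0#))) (trans (*-homo 0# (λ _ → 0#)) (zeroˡ _))

        ∑<-homo : ∀ n (f : ℕ → ℕ → Carrier) → ℒ (λ i → ∑< n (λ j → f j i)) ≈ ∑< n (λ j → ℒ (f j))
        ∑<-homo zero    f = 0-homo
        ∑<-homo (suc n) f = trans (+-homo (f 0) _) (+-congˡ (∑<-homo n (f ∘ suc)))

      open Linear

      below-linear : ∀ {ℒ} k → Linear ℒ → Linear (ℒ ∘ below [ k ])
      below-linear k lin = record
        { cong-< = λ eq → cong-< lin (λ i i≤N → below-cong [ k ] i (λ j j≤i → eq j (ℕ.≤-trans j≤i i≤N)))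
        ; +-homo = λ f g → trans (cong-< lin (λ i _ → trans (∑<-cong i (λ j → distribˡ _ _ _)) (∑<-+ i _ _))) (+-homo lin _ _)
        ; *-homo = λ c f → trans (cong-< lin (λ i _ → trans (∑<-cong i (λ j → solve 3 (λ p c a → p :* (c :* a) := c :* (p :* a)) refl _ _ _)) (∑<-*ˡ i c _)))
                             (*-homo lin c _) }

      sum-linear : ∀ k → Linear (λ f → ∑< N (λ i → p k i * f i))
      sum-linear k = record
        { cong-< = λ eq → ∑<-cong-< N (λ i i<N → *-congˡ (eq i (ℕ.<⇒≤ i<N)))
        ; +-homo = λ f g → trans (∑<-cong N (λ i → distribˡ _ _ _)) (∑<-+ N _ _)
        ; *-homo = λ c f → trans (∑<-cong N (λ i → solve 3 (λ p c a → p :* (c :* a) := c :* (p :* a)) refl _ _ _)) (∑<-*ˡ N c _) }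

      private
        ∑<-before : ∀ M f i → i ≤ M → ∑< i f ≈ ∑< M (λ n → f n * before n i)
        ∑<-before M       f zero    _         = sym (trans (∑<-cong M (λ n → zeroʳ _)) (∑<-0 M))
        ∑<-before (suc M) f (suc i) (s≤s i≤M) = +-cong (sym (*-identityʳ _)) (∑<-before M (f ∘ suc) i i≤M)

        weight : ℕ → List ℕ → ℕ → Carrier
        weight k V n = p k n * below V (λ _ → 1#) n

        tr-weight : ∀ k V i → tr (k ∷ V) i ≈ ∑< i (weight k V)
        tr-weight k V i = tr-below (k ∷ V) i

        h-front : ∀ {ℒ} → Linear ℒ → ∀ l U → ℒ (tr (l ∷ U)) ≈ ℒ (below [ l ] (tr U))
        h-front lin l U = cong-< lin (λ i _ → trans (tr-below (l ∷ U) i) (∑<-cong i (λ j → *-congˡ (sym (tr-below U j)))))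

      -- E and S as sums over chains ending in the row k ∷ V.
      E-chain : ∀ {ℒ} (lin : Linear ℒ) us k V →
                E (λ U → ℒ (tr U)) (rows us ∷ʳ (k ∷ V)) ≈ ∑< N (λ n → weight k V n * ℒ (H us n))
      S-chain : ∀ u us k V →
                S ([ u ] ∷ rows us ∷ʳ (k ∷ V)) ≈ ∑< N (λ n → weight k V n * ∑< N (λ m → p u m * H us n m))

      S-chain u us k V = trans
        (E-cong (rows us ∷ʳ (k ∷ V)) (λ U → trans (tr-below (u ∷ U) N) (∑<-cong N (λ j → *-congˡ (sym (tr-below U j))))))
        (E-chain (sum-linear u) us k V)

      E-chain {ℒ} lin [] k V rewrite List.++-identityʳ V = begin
        ℒ (λ _ → 1#) * tr (k ∷ V) N - ℒ (tr (k ∷ V))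
          ≈⟨ +-cong (*-congˡ (tr-weight k V N)) (-‿cong (begin
               ℒ (tr (k ∷ V))
                 ≈⟨ cong-< lin (λ i i≤N → trans (tr-weight k V i) (∑<-before N (weight k V) i i≤N)) ⟩
               ℒ (λ i → ∑< N (λ n → weight k V n * before n i))
                 ≈⟨ ∑<-homo lin N (λ n i → weight k V n * before n i) ⟩
               ∑< N (λ n → ℒ (λ i → weight k V n * before n i))
                 ≈⟨ ∑<-cong N (λ n → *-homo lin (weight k V n) (before n)) ⟩
               ∑< N (λ n → weight k V n * ℒ (before n)) ∎)) ⟩
        ℒ (λ _ → 1#) * ∑< N (weight k V) - ∑< N (λ n → weight k V n * ℒ (before n))
          ≈⟨ sym (trans (∑<-+ N _ _) (+-cong (∑<-*ˡ N (ℒ (λ _ → 1#)) (weight k V)) (∑<-neg N _))) ⟩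
        ∑< N (λ n → ℒ (λ _ → 1#) * weight k V n - weight k V n * ℒ (before n))
          ≈⟨ ∑<-cong N (λ n → trans (solve 3 (λ l w b → l :* w :- w :* b := w :* (l :- b)) refl _ _ _)
               (*-congˡ (sym (minus-homo lin (λ _ → 1#) (before n))))) ⟩
        ∑< N (λ n → weight k V n * ℒ (H [] n)) ∎
      E-chain {ℒ} lin (u ∷ us) k V = begin
        ℒ (λ _ → 1#) * S ([ u ] ∷ rows us ∷ʳ (k ∷ V)) - E (λ U → ℒ (tr (u ∷ U))) (rows us ∷ʳ (k ∷ V))
          ≈⟨ +-cong (*-congˡ (S-chain u us k V)) (-‿cong (trans (E-cong (rows us ∷ʳ (k ∷ V)) (h-front lin u))
               (E-chain (below-linear u lin) us k V))) ⟩
        ℒ (λ _ → 1#) * ∑< N (λ n → weight k V n * c n) - ∑< N (λ n → weight k V n * ℒ (below [ u ] (H us n)))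
          ≈⟨ sym (trans (∑<-+ N _ _) (+-cong (∑<-*ˡ N (ℒ (λ _ → 1#)) _) (∑<-neg N _))) ⟩
        ∑< N (λ n → ℒ (λ _ → 1#) * (weight k V n * c n) - weight k V n * ℒ (below [ u ] (H us n)))
          ≈⟨ ∑<-cong N (λ n → begin
               ℒ (λ _ → 1#) * (weight k V n * c n) - weight k V n * ℒ (below [ u ] (H us n))
                 ≈⟨ solve 4 (λ l w c b → l :* (w :* c) :- w :* b := w :* (c :* l :- b)) refl _ _ _ _ ⟩
               weight k V n * (c n * ℒ (λ _ → 1#) - ℒ (below [ u ] (H us n)))
                 ≈⟨ *-congˡ (+-congʳ (sym (trans (cong-< lin (λ i _ → sym (*-identityʳ _))) (*-homo lin (c n) (λ _ → 1#))))) ⟩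
               weight k V n * (ℒ (λ _ → c n) - ℒ (below [ u ] (H us n)))
                 ≈⟨ *-congˡ (sym (minus-homo lin (λ _ → c n) (below [ u ] (H us n)))) ⟩
               weight k V n * ℒ (H (u ∷ us) n) ∎) ⟩
        ∑< N (λ n → weight k V n * ℒ (H (u ∷ us) n)) ∎
        where
        c : ℕ → Carrier
        c n = ∑< N (λ m → p u m * H us n m)

      -- Subtracting the sum with `u` appended below `V` from the free sum over the index of `u`
      -- leaves the indices that are at least the last one of `V`. This is the condition that
      -- `H (u ∷ us)` adds to the chain.
      C-chain : ∀ us k V → C (rows us) (k ∷ V) ≈ ∑< N (λ n → p k n * below V (H us n) n)
      C-chain [] k V = trans (tr-weight k V N) (∑<-cong N (λ n → *-congˡ (below-cong V n (λ j j≤n → sym (at-most n j j≤n)))))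
        where
        at-most : ∀ n j → j ≤ n → 1# - before n j ≈ 1#
        at-most n       zero    _         = trans (+-congˡ RP.-0#≈0#) (+-identityʳ _)
        at-most (suc n) (suc j) (s≤s j≤n) = at-most n j j≤n
      C-chain (u ∷ us) k V = begin
        S ([ u ] ∷ rows us ∷ʳ (k ∷ V)) - C (rows us) (k ∷ V ∷ʳ u)
          ≈⟨ +-cong (S-chain u us k V) (-‿cong (C-chain us k (V ∷ʳ u))) ⟩
        ∑< N (λ n → weight k V n * c n) - ∑< N (λ n → p k n * below (V ∷ʳ u) (H us n) n)
          ≈⟨ sym (trans (∑<-+ N _ _) (+-congˡ (∑<-neg N _))) ⟩
        ∑< N (λ n → weight k V n * c n - p k n * below (V ∷ʳ u) (H us n) n)
          ≈⟨ ∑<-cong N (λ n → begin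
               weight k V n * c n - p k n * below (V ∷ʳ u) (H us n) n
                 ≈⟨ solve 4 (λ p b c d → (p :* b) :* c :- p :* d := p :* (c :* b :- d)) refl _ _ _ _ ⟩
               p k n * (c n * below V (λ _ → 1#) n - below (V ∷ʳ u) (H us n) n)
                 ≈⟨ *-congˡ (trans (+-congˡ (-‿cong (below-++ V [ u ] (H us n) n))) (sym (below-lin V (c n) (λ _ → 1#) (below [ u ] (H us n)) n))) ⟩
               p k n * below V (λ i → c n * 1# - below [ u ] (H us n) i) n
                 ≈⟨ *-congˡ (below-cong V n (λ j _ → +-congʳ (*-identityʳ _))) ⟩
               p k n * below V (H (u ∷ us) n) n ∎) ⟩
        ∑< N (λ n → p k n * below V (H (u ∷ us) n) n) ∎
        where
        c : ℕ → Carrier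
        c n = ∑< N (λ m → p u m * H us n m)

      module _ (p-0 : ∀ n → p 0 n ≈ 1#) (p-+ : ∀ a b n → p a n * p b n ≈ p (a ℕ.+ b) n) where
        private
          ∑<-vanish : ∀ {M} m f → m ≤ M → (∀ i → m ≤ i → i < M → f i ≈ 0#) → ∑< M f ≈ ∑< m f
          ∑<-vanish {M} zero f _ eq = trans (∑<-cong-< M (λ i → eq i z≤n)) (∑<-0 M)
          ∑<-vanish (suc m) f (s≤s m≤M) eq = +-congˡ (∑<-vanish m (f ∘ suc) m≤M (λ i m≤i i<M → eq (suc i) (s≤s m≤i) (s≤s i<M)))

          H-above : ∀ us {n i} → n < i → i ≤ N → H us n i ≈ 0#
          H-above [] {n} {i} n<i _ with n ℕ.<ᵇ i | ℕ.<⇒<ᵇ n<i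
          ... | true | _ = -‿inverseʳ _
          H-above (u ∷ us) {n} {i} n<i i≤N = trans (+-congʳ (∑<-vanish i _ i≤N (λ m i≤m m<N →
            trans (*-congˡ (H-above us (ℕ.<-≤-trans n<i i≤m) (ℕ.<⇒≤ m<N))) (zeroʳ _)))) (-‿inverseʳ _)

          H-diagonal : ∀ us n → n < N → H us n n ≈ p (sum us) n
          H-diagonal [] n n<N = trans (irreflexive n) (sym (p-0 n))
            where
            irreflexive : ∀ n → 1# - before n n ≈ 1#
            irreflexive zero    = trans (+-congˡ RP.-0#≈0#) (+-identityʳ _)
            irreflexive (suc n) = irreflexive n
          H-diagonal (u ∷ us) n n<N = begin
            ∑< N f - ∑< n f          ≈⟨ +-congʳ (trans (∑<-vanish (suc n) f n<N (λ m n<m m<N →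
                                          trans (*-congˡ (H-above us n<m (ℕ.<⇒≤ m<N))) (zeroʳ _))) (∑<-last n f)) ⟩
            (∑< n f + f n) - ∑< n f  ≈⟨ solve 2 (λ a b → (a :+ b) :- a := b) refl _ _ ⟩
            p u n * H us n n         ≈⟨ trans (*-congˡ (H-diagonal us n n<N)) (p-+ u (sum us) n) ⟩
            p (u ℕ.+ sum us) n ∎
            where
            f : ℕ → Carrier
            f m = p u m * H us n m

        -- Since the chain n ≤ m₁ ≤ ⋯ ≤ m_r ≤ n is constant.
        C-single : ∀ us k → C (rows us) [ k ] ≈ tr [ sum us ℕ.+ k ] N
        C-single us k = begin
          C (rows us) [ k ]
            ≈⟨ C-chain us k [] ⟩
          ∑< N (λ n → p k n * H us n n)
            ≈⟨ ∑<-cong-< N (λ n n<N → trans (*-congˡ (H-diagonal us n n<N)) (trans (p-+ k (sum us) n)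
                 (trans (reflexive (≡.cong (λ z → p z n) (ℕ.+-comm k (sum us)))) (sym (*-identityʳ _))))) ⟩
          ∑< N (weight (sum us ℕ.+ k) [])
            ≈⟨ sym (tr-weight (sum us ℕ.+ k) [] N) ⟩
          tr [ sum us ℕ.+ k ] N ∎

  -- Multiplying the generating series ∑ⱼ tr (1ʲ L) uʲ by ∏ (1 + p 1 n u)⁻¹ regularises the leading
  -- ones of L; this does not change S on lists of rows whose last row has no leading one.
  module Regularised (R : CommutativeRing 0ℓ 0ℓ)
    (p : ℕ → ℕ → CommutativeRing.Carrier R)
    where
    open CommutativeRing R hiding (zero)
    open RingTools R
    open Truncation R p
    open PowerSeries R
    open Weights R using (X; X-*)
    private
      module A = CommutativeRing series
      module AT = RingTools series
    open import Relation.Binary.Reasoning.Setoid setoid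

    inverse : ℕ → Series
    inverse zero            = ι 1#
    inverse (suc N) zero    = 1#
    inverse (suc N) (suc i) = inverse N (suc i) - p 1 N * inverse (suc N) i

    inverse-0 : ∀ N → inverse N 0 ≡ 1#
    inverse-0 zero    = ≡.refl
    inverse-0 (suc N) = ≡.refl

    ones : List ℕ → ℕ → Series
    ones L N j = tr (replicate j 1 ++ L) N

    P : ℕ → List ℕ → ℕ → Carrier
    P m L N = (inverse N ⊛ ones L N) m

    private
      inverse-suc : ∀ N → inverse N ≋ λ i → inverse (suc N) i + p 1 N * X (inverse (suc N)) i
      inverse-suc N zero    = trans (reflexive (inverse-0 N)) (sym (trans (+-congˡ (zeroʳ _)) (+-identityʳ _)))
      inverse-suc N (suc i) = solve 2 (λ a b → a := (a :- b) :+ b) refl _ _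

      step : ∀ N (e e′ : Series) δ → e′ ≋ (λ j → (e j + p 1 N * X e j) + ι δ j) →
             inverse (suc N) ⊛ e′ ≋ λ m → (inverse N ⊛ e) m + δ * inverse (suc N) m
      step N e e′ δ eq = A.trans (A.*-congˡ {x = h} (A.trans eq (λ j → +-congʳ (+-congˡ (sym (ι-*ˡ (p 1 N) (X e) j))))))
        (A.trans (A.*-congˡ {x = h} (A.+-congʳ (A.+-congˡ {x = e} (A.*-congˡ {x = q} (X-* e)))))
        (A.trans (AT.solve 5 (λ h e q ξ d → h AT.:* ((e AT.:+ q AT.:* (ξ AT.:* e)) AT.:+ d)
                                AT.:= ((h AT.:+ q AT.:* (ξ AT.:* h)) AT.:* e) AT.:+ (d AT.:* h)) A.refl h e q (X A.1#) (ι δ))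
        (A.+-cong (A.*-congʳ {x = e} (A.sym (A.trans (inverse-suc N) (A.+-congˡ {x = h}
            (A.trans (λ j → sym (ι-*ˡ (p 1 N) (X h) j)) (A.*-congˡ {x = q} (X-* h)))))))
          (ι-*ˡ δ h))))
        where
        h = inverse (suc N)
        q = ι (p 1 N)

    -- Raising `N` adds to the sums for 1ʲ L the terms whose largest index is N. If this index
    -- belongs to a leading 1, the increment is the factor `p 1 N` u, which the new factor of
    -- `inverse` cancels; only the terms in which it belongs to `k` survive.
    P-suc : ∀ m k L N → P m (k ∷ L) (suc N) ≈ P m (k ∷ L) N + (p k N * tr L N) * inverse (suc N) m
    P-suc m k L N = step N (ones (k ∷ L) N) (ones (k ∷ L) (suc N)) (p k N * tr L N)
      (λ { zero → +-congʳ (sym (trans (+-congˡ (zeroʳ _)) (+-identityʳ _))) ; (suc j) → sym (+-identityʳ _) }) m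

    P-[]-suc : ∀ m N → P m [] (suc N) ≈ P m [] N
    P-[]-suc m N = trans (step N (ones [] N) (ones [] (suc N)) 0#
      (λ { zero → sym (trans (+-identityʳ _) (trans (+-congˡ (zeroʳ _)) (+-identityʳ _))) ; (suc j) → sym (+-identityʳ _) }) m)
      (trans (+-congˡ (zeroˡ _)) (+-identityʳ _))

    P-[] : ∀ m N → P m [] N ≈ ι 1# m
    P-[] m zero    = trans (A.*-identityˡ (ones [] 0) m) (empty m)
      where
      empty : ∀ m → ones [] 0 m ≈ ι 1# m
      empty zero    = refl
      empty (suc m) = refl
    P-[] m (suc N) = trans (P-[]-suc m N) (P-[] m N)

    P-0 : ∀ m k L → P m (k ∷ L) 0 ≈ 0#
    P-0 m k L = trans (A.*-identityˡ (ones (k ∷ L) 0) m) (empty m)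
      where
      empty : ∀ m → ones (k ∷ L) 0 m ≈ 0#
      empty zero    = refl
      empty (suc m) = refl

    -- The value `reg 0` of m ones followed by L is the coefficient of uᵐ in the regularised series
    -- of L; the argument `m` counts the ones already removed.
    reg : ℕ → List ℕ → ℕ → Carrier
    reg m []                = P m []
    reg m (0 ∷ L)           = P m (0 ∷ L)
    reg m (1 ∷ L)           = reg (suc m) L
    reg m (suc (suc k) ∷ L) = P m (suc (suc k) ∷ L)

    module _ (N : ℕ) where
      module G = Star R (λ L → reg 0 L N)
      module T = Star R (λ L → tr L N)

      rows : List ℕ → List Row
      rows = map [_]

      private
        E-⊛ : ∀ us (f : Series) (h : Row → Series) m →
              T.E (λ U → (f ⊛ h U) m) us ≈ (f ⊛ (λ j → T.E (λ U → h U j) us)) m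
        E-⊛ us f h zero    = T.E-*ˡ us (f 0) (λ U → h U 0)
        E-⊛ us f h (suc m) = trans (T.E-+ us _ _) (+-cong (T.E-*ˡ us (f 0) (λ U → h U (suc m))) (E-⊛ us (f ∘ suc) h m))

        ⊛-tailʳ : ∀ f g n → (f ⊛ g) (suc n) ≈ f (suc n) * g 0 + (f ⊛ (g ∘ suc)) n
        ⊛-tailʳ f g zero    = +-comm _ _
        ⊛-tailʳ f g (suc n) = trans (+-congˡ (⊛-tailʳ (f ∘ suc) g n))
          (solve 3 (λ a b c → a :+ (b :+ c) := b :+ (a :+ c)) refl _ _ _)

        ones-1 : ∀ L j → ones (1 ∷ L) N j ≡ ones L N (suc j)
        ones-1 L j = ≡.cong (λ L → tr L N) (shift j)
          where
          shift : ∀ j → replicate j 1 ++ 1 ∷ L ≡ 1 ∷ replicate j 1 ++ L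
          shift zero    = ≡.refl
          shift (suc j) = ≡.cong (1 ∷_) (shift j)

        reg-≥2 : ∀ m k L → 2 ≤ k → reg m (k ∷ L) N ≡ P m (k ∷ L) N
        reg-≥2 m (suc (suc k)) L _ = ≡.refl
        reg-≥2 m 1 L (s≤s ())

        P-zero : ∀ L → P 0 L N ≈ tr L N
        P-zero L = trans (*-congʳ (reflexive (inverse-0 N))) (*-identityˡ _)

        e : List Row → Series
        e us j = T.E (λ U → ones U N j) us

        -- Without leading ones the unfinished row is empty, so `E-g` applies.
        e-0 : ∀ us v → e (us ∷ʳ v) 0 ≈ 0#
        e-0 []       v = T.E-g refl v []
        e-0 (u ∷ us) v = T.E-g refl u (us ∷ʳ v)

        E-step : ∀ m u us → (∀ U → reg m (u ++ U) N ≈ P m (u ++ U) N) →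
                 T.E (λ U → reg m U N) (u ∷ us) ≈ (inverse N ⊛ e (u ∷ us)) m
        E-step m u us eq = begin
          P m [] N * T.S (u ∷ us) - T.E (λ U → reg m (u ++ U) N) us
            ≈⟨ +-congˡ (-‿cong (T.E-cong us eq)) ⟩
          T.E (λ U → P m U N) (u ∷ us)
            ≈⟨ E-⊛ (u ∷ us) (inverse N) (λ U → ones U N) m ⟩
          (inverse N ⊛ e (u ∷ us)) m ∎

        -- A row 1 raises the counter from `m` to `suc m`, that is, it shifts the series by one
        -- degree. The coefficient lost in the shift is `e ws 0`, which vanishes, so the convolution
        -- with `inverse` passes through.
        E-reg : ∀ m us k V → All NonZero us → 2 ≤ k →
                T.E (λ U → reg m U N) (rows us ∷ʳ (k ∷ V)) ≈ (inverse N ⊛ e (rows us ∷ʳ (k ∷ V))) m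
        E-reg m [] k V _ 2≤k = E-step m (k ∷ V) [] (λ U → reflexive (reg-≥2 m k (V ++ U) 2≤k))
        E-reg m (suc (suc l) ∷ us) k V _ 2≤k = E-step m [ suc (suc l) ] (rows us ∷ʳ (k ∷ V)) (λ U → refl)
        E-reg m (zero ∷ us) k V (() ∷ _) 2≤k
        E-reg m (1 ∷ us) k V (_ ∷ pos) 2≤k = begin
          P m [] N * T.S ([ 1 ] ∷ ws) - T.E (λ U → reg (suc m) U N) ws
            ≈⟨ +-congˡ (-‿cong (trans (E-reg (suc m) us k V pos 2≤k) (trans (⊛-tailʳ (inverse N) (e ws) m)
                 (trans (+-congʳ (trans (*-congˡ (e-0 (rows us) (k ∷ V))) (zeroʳ _))) (+-identityˡ _))))) ⟩
          (inverse N ⊛ ones [] N) m * T.S ([ 1 ] ∷ ws) - (inverse N ⊛ (e ws ∘ suc)) m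
            ≈⟨ collect (inverse N) m ⟩
          (inverse N ⊛ (λ j → ones [] N j * T.S ([ 1 ] ∷ ws) - e ws (suc j))) m
            ≈⟨ A.*-congˡ {x = inverse N} (λ j → +-congˡ (-‿cong (T.E-cong ws (λ U → reflexive (≡.sym (ones-1 U j)))))) m ⟩
          (inverse N ⊛ e ([ 1 ] ∷ ws)) m ∎
          where
          ws = rows us ∷ʳ (k ∷ V)
          s = T.S ([ 1 ] ∷ ws)
          collect : ∀ (f : Series) m → (f ⊛ ones [] N) m * s - (f ⊛ (e ws ∘ suc)) m
                                     ≈ (f ⊛ (λ j → ones [] N j * s - e ws (suc j))) m
          collect f m = conv f (ones [] N) (e ws ∘ suc) m
            where
            conv : ∀ (f a b : Series) m → (f ⊛ a) m * s - (f ⊛ b) m ≈ (f ⊛ (λ j → a j * s - b j)) m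
            conv f a b zero    = solve 4 (λ f a b s → (f :* a) :* s :- f :* b := f :* (a :* s :- b)) refl _ _ _ _
            conv f a b (suc m) = trans
              (solve 6 (λ f a b s p q → (f :* a :+ p) :* s :- (f :* b :+ q) := f :* (a :* s :- b) :+ (p :* s :- q)) refl _ _ _ _ _ _)
              (+-congˡ (conv (f ∘ suc) a b m))

      -- For a first row 1, the inner sums are replaced by induction and the coefficient of u is
      -- read off: `inverse` begins with 1 and `e ws` begins with 0, so regularising has no effect.
      -- The last row, starting with k ≥ 2, ends every run of leading ones.
      S-reg : ∀ us k V → All NonZero us → 2 ≤ k → G.S (rows us ∷ʳ (k ∷ V)) ≈ T.S (rows us ∷ʳ (k ∷ V))
      E-same : ∀ us k V → All NonZero us → 2 ≤ k → ∀ h → G.E h (rows us ∷ʳ (k ∷ V)) ≈ T.E h (rows us ∷ʳ (k ∷ V))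

      E-same []       k V pos 2≤k h = +-congʳ (*-congˡ (S-reg [] k V pos 2≤k))
      E-same (u ∷ us) k V (pu ∷ pos) 2≤k h = +-cong (*-congˡ (S-reg (u ∷ us) k V (pu ∷ pos) 2≤k))
        (-‿cong (E-same us k V pos 2≤k (λ U → h (u ∷ U))))

      S-reg [] k V _ 2≤k = trans (reflexive (reg-≥2 0 k (V ++ []) 2≤k)) (P-zero (k ∷ V ++ []))
      S-reg (suc (suc l) ∷ us) k V (_ ∷ pos) 2≤k = trans (G.E-cong (rows us ∷ʳ (k ∷ V)) (λ U → P-zero (suc (suc l) ∷ U)))
        (E-same us k V pos 2≤k _)
      S-reg (1 ∷ us) k V (_ ∷ pos) 2≤k = begin
        G.E (λ U → reg 1 U N) ws
          ≈⟨ E-same us k V pos 2≤k _ ⟩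
        T.E (λ U → reg 1 U N) ws
          ≈⟨ E-reg 1 us k V pos 2≤k ⟩
        inverse N 0 * e ws 1 + inverse N 1 * e ws 0
          ≈⟨ +-cong (trans (*-congʳ (reflexive (inverse-0 N))) (*-identityˡ _)) (trans (*-congˡ (e-0 (rows us) (k ∷ V))) (zeroʳ _)) ⟩
        e ws 1 + 0#
          ≈⟨ +-identityʳ _ ⟩
        T.S ([ 1 ] ∷ ws) ∎
        where ws = rows us ∷ʳ (k ∷ V)

      C-reg : ∀ us k V → All NonZero us → 2 ≤ k → G.C (rows us) (k ∷ V) ≈ T.C (rows us) (k ∷ V)
      C-reg []       k V _ 2≤k = trans (reflexive (reg-≥2 0 k V 2≤k)) (P-zero (k ∷ V))
      C-reg (u ∷ us) k V (pu ∷ pos) 2≤k = +-cong (S-reg (u ∷ us) k V (pu ∷ pos) 2≤k) (-‿cong (C-reg us k (V ∷ʳ u) pos 2≤k))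

      C-reg-value : (∀ n → p 0 n ≈ 1#) → (∀ a b n → p a n * p b n ≈ p (a ℕ.+ b) n) →
                    ∀ us k → All NonZero us → 2 ≤ k → G.C (rows us) [ k ] ≈ tr [ sum us ℕ.+ k ] N
      C-reg-value p-0 p-+ us k pos 2≤k = trans (C-reg us k [] pos 2≤k) (Cyclic.C-single N p-0 p-+ us k)

-- Coefficients of iterated integrals

module IteratedIntegrals where

  open import Algebra.Bundles using (CommutativeRing)
  open import Defs using (Letter; x; y; Word; 1/_^_; truncated)
  open import Data.Integer as ℤ using (+_)
  open import Data.List using (List; []; _∷_)
  open import Data.List.Relation.Unary.All as All using (All; []; _∷_)
  open import Data.Nat as ℕ using (ℕ; zero; suc; _∸_; NonZero)
  import Data.Nat.Properties as ℕ
  open import Data.Product using (∃; _×_; _,_)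
  open import Data.Rational as ℚ using (ℚ; 0ℚ; 1ℚ; _+_; _*_; _≤_; nonNegative; _/_)
  import Data.Rational.Properties as ℚ
  open import Data.Rational.Solver using (module +-*-Solver)
  import Data.Rational.Unnormalised as ℚᵘ
  import Data.Rational.Unnormalised.Properties as ℚᵘ
  open import Function using (_∘_)
  open import Relation.Binary.PropositionalEquality
  open RingSums
  open PowerSeriesSums using (module PowerSeries)
  open Words
  open Reals
  open TruncatedSums

  module Rational where
    open Real using (ℚ-ring; suc/1) public
    open RingTools ℚ-ring hiding (solve; _:=_; _:+_; _:*_; _:-_; :-_; con) public
    open PowerSeries ℚ-ring public
    open +-*-Solver

    nat inv : ℕ → ℚ
    nat n = + n / 1
    inv zero    = 0ℚ
    inv (suc n) = + 1 / suc n

    p : ℕ → ℕ → ℚ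
    p k n = 1/ suc n ^ k

    nat-+ : ∀ m n → nat (m ℕ.+ n) ≡ nat m + nat n
    nat-+ zero    n = sym (ℚ.+-identityˡ (nat n))
    nat-+ (suc m) n = trans (suc/1 (m ℕ.+ n)) (trans (cong (λ z → 1ℚ + z) (nat-+ m n))
      (trans (sym (ℚ.+-assoc 1ℚ (nat m) (nat n))) (cong (_+ nat n) (sym (suc/1 m)))))

    nat-inv : ∀ n → nat (suc n) * inv (suc n) ≡ 1ℚ
    nat-inv n = ℚ.toℚᵘ-injective (ℚᵘ.≃-trans (ℚ.toℚᵘ-homo-* (nat (suc n)) (inv (suc n)))
      (ℚᵘ.≃-trans (ℚᵘ.*-cong (ℚ.toℚᵘ-fromℚᵘ (ℚᵘ.mkℚᵘ (+ suc n) 0)) (ℚ.toℚᵘ-fromℚᵘ (ℚᵘ.mkℚᵘ (+ 1) n)))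
        (ℚᵘ.*≡* (cong (λ m → + suc m) (trans (ℕ.*-identityʳ _) (trans (ℕ.*-identityʳ n) (sym (trans (ℕ.+-identityʳ _) (ℕ.+-identityʳ n)))))))))

    inv-cancel : ∀ n a b → nat (suc n) * a ≡ b → a ≡ inv (suc n) * b
    inv-cancel n a b eq = begin
      a                                 ≡⟨ ℚ.*-identityˡ a ⟨
      1ℚ * a                            ≡⟨ cong (_* a) (nat-inv n) ⟨
      nat (suc n) * inv (suc n) * a     ≡⟨ solve 3 (λ n i a → n :* i :* a := i :* (n :* a)) refl (nat (suc n)) (inv (suc n)) a ⟩
      inv (suc n) * (nat (suc n) * a)   ≡⟨ cong (inv (suc n) *_) eq ⟩
      inv (suc n) * b ∎
      where open ≡-Reasoning

    private
      /-* : ∀ a b .{{_ : NonZero a}} .{{_ : NonZero b}} →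
            (+ 1 / (a ℕ.* b)) {{ℕ.m*n≢0 a b}} ≡ + 1 / a * (+ 1 / b)
      /-* (suc a) (suc b) = ℚ.toℚᵘ-injective (ℚᵘ.≃-trans (ℚ.toℚᵘ-fromℚᵘ (ℚᵘ.mkℚᵘ (+ 1) (b ℕ.+ a ℕ.* suc b)))
        (ℚᵘ.≃-trans (ℚᵘ.*≡* refl) (ℚᵘ.≃-trans
          (ℚᵘ.≃-sym (ℚᵘ.*-cong (ℚ.toℚᵘ-fromℚᵘ (ℚᵘ.mkℚᵘ (+ 1) a)) (ℚ.toℚᵘ-fromℚᵘ (ℚᵘ.mkℚᵘ (+ 1) b))))
          (ℚᵘ.≃-sym (ℚ.toℚᵘ-homo-* (+ 1 / suc a) (+ 1 / suc b))))))

    p-0 : ∀ n → p 0 n ≡ 1ℚ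
    p-0 n = refl

    p-suc : ∀ k n → p (suc k) n ≡ inv (suc n) * p k n
    p-suc k n = /-* (suc n) (suc n ℕ.^ k) {{_}} {{ℕ.m^n≢0 (suc n) k}}

    p-1 : ∀ n → p 1 n ≡ inv (suc n)
    p-1 n = trans (p-suc 0 n) (ℚ.*-identityʳ _)

    p-+ : ∀ a b n → p a n * p b n ≡ p (a ℕ.+ b) n
    p-+ zero    b n = ℚ.*-identityˡ _
    p-+ (suc a) b n = trans (cong (_* p b n) (p-suc a n)) (trans (ℚ.*-assoc (inv (suc n)) (p a n) (p b n))
      (trans (cong (inv (suc n) *_) (p-+ a b n)) (sym (p-suc (a ℕ.+ b) n))))

    0≤inv : ∀ n → 0ℚ ≤ inv n
    0≤inv zero    = ℚ.≤-refl
    0≤inv (suc n) = ℚ.nonNegative⁻¹ (inv (suc n)) {{ℚ.normalize-nonNeg 1 (suc n)}}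

    0≤* : ∀ {a b} → 0ℚ ≤ a → 0ℚ ≤ b → 0ℚ ≤ a * b
    0≤* {a} {b} 0≤a 0≤b = subst (_≤ a * b) (ℚ.*-zeroˡ b) (ℚ.*-monoʳ-≤-nonNeg b {{nonNegative 0≤b}} 0≤a)

    *-mono : ∀ {a b c d} → 0ℚ ≤ a → 0ℚ ≤ d → a ≤ b → c ≤ d → a * c ≤ b * d
    *-mono {a} {b} {c} {d} 0≤a 0≤d a≤b c≤d = ℚ.≤-trans (ℚ.*-monoˡ-≤-nonNeg a {{nonNegative 0≤a}} c≤d)
      (ℚ.*-monoʳ-≤-nonNeg d {{nonNegative 0≤d}} a≤b)

    inv-antitone : ∀ m n → m ℕ.≤ n → inv (suc n) ≤ inv (suc m)
    inv-antitone m n m≤n = ℚ.toℚᵘ-cancel-≤ (ℚᵘ.≤-respˡ-≃ (ℚᵘ.≃-sym (ℚ.toℚᵘ-fromℚᵘ (ℚᵘ.mkℚᵘ (+ 1) n)))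
      (ℚᵘ.≤-respʳ-≃ (ℚᵘ.≃-sym (ℚ.toℚᵘ-fromℚᵘ (ℚᵘ.mkℚᵘ (+ 1) m)))
        (ℚᵘ.*≤* (ℤ.+≤+ (ℕ.*-monoʳ-≤ 1 (ℕ.s≤s m≤n))))))

    0≤+ : ∀ {a b} → 0ℚ ≤ a → 0ℚ ≤ b → 0ℚ ≤ a + b
    0≤+ 0≤a 0≤b = ℚ.+-mono-≤ 0≤a 0≤b

    ≤+ : ∀ a {b} → 0ℚ ≤ b → a ≤ a + b
    ≤+ a {b} 0≤b = subst (_≤ a + b) (ℚ.+-identityʳ a) (ℚ.+-monoʳ-≤ a 0≤b)

    ∑<-nonNeg : ∀ n f → (∀ j → 0ℚ ≤ f j) → 0ℚ ≤ ∑< n f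
    ∑<-nonNeg zero    f h = ℚ.≤-refl
    ∑<-nonNeg (suc n) f h = 0≤+ (h 0) (∑<-nonNeg n (f ∘ suc) (h ∘ suc))

    ∑<-extend : ∀ {m n} f → m ℕ.≤ n → (∀ j → 0ℚ ≤ f j) → ∑< m f ≤ ∑< n f
    ∑<-extend {n = n} f ℕ.z≤n h = ∑<-nonNeg n f h
    ∑<-extend f (ℕ.s≤s m≤n) h = ℚ.+-monoʳ-≤ (f 0) (∑<-extend (f ∘ suc) m≤n (h ∘ suc))

    open Truncation ℚ-ring p public

    tr-truncated : ∀ ks N → tr ks N ≡ truncated ks N
    tr-truncated []       N       = refl
    tr-truncated (k ∷ ks) zero    = refl
    tr-truncated (k ∷ ks) (suc N) = cong₂ (λ a b → a + p k N * b) (tr-truncated (k ∷ ks) N) (tr-truncated ks N)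

    0≤p : ∀ k n → 0ℚ ≤ p k n
    0≤p zero    n = ℚ.nonNegative⁻¹ 1ℚ
    0≤p (suc k) n = subst (0ℚ ≤_) (sym (p-suc k n)) (0≤* (0≤inv (suc n)) (0≤p k n))

    0≤tr : ∀ ks N → 0ℚ ≤ tr ks N
    0≤tr []       N       = ℚ.nonNegative⁻¹ 1ℚ
    0≤tr (k ∷ ks) zero    = ℚ.≤-refl
    0≤tr (k ∷ ks) (suc N) = 0≤+ (0≤tr (k ∷ ks) N) (0≤* (0≤p k N) (0≤tr ks N))

    tr-mono : ∀ ks m d → tr ks m ≤ tr ks (m ℕ.+ d)
    tr-mono ks       m zero    = ℚ.≤-reflexive (cong (tr ks) (sym (ℕ.+-identityʳ m)))
    tr-mono []       m (suc d) = ℚ.≤-refl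
    tr-mono (k ∷ ks) m (suc d) = subst (λ z → tr (k ∷ ks) m ≤ tr (k ∷ ks) z) (sym (ℕ.+-suc m d))
      (ℚ.≤-trans (tr-mono (k ∷ ks) m d) (≤+ (tr (k ∷ ks) (m ℕ.+ d)) (0≤* (0≤p k (m ℕ.+ d)) (0≤tr ks (m ℕ.+ d)))))

    -- c w n is the coefficient of zⁿ in the iterated integral of the word w from 0 to z.
    c : Word → ℕ → ℚ
    c []      n = ι 1ℚ n
    c (x ∷ w) n = inv n * c w n
    c (y ∷ w) n = inv n * ∑< n (c w)

    0≤c : ∀ w n → 0ℚ ≤ c w n
    0≤c []      zero    = ℚ.nonNegative⁻¹ 1ℚ
    0≤c []      (suc n) = ℚ.≤-refl
    0≤c (x ∷ w) n = 0≤* (0≤inv n) (0≤c w n)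
    0≤c (y ∷ w) n = 0≤* (0≤inv n) (∑<-nonNeg n (c w) (0≤c w))

    c-0 : ∀ a w → c (a ∷ w) 0 ≡ 0ℚ
    c-0 x w = ℚ.*-zeroˡ (c w 0)
    c-0 y w = refl

    c-run : ∀ k w n → c (xʸ k ∷ w) (suc n) ≡ p (suc k) n * ∑< (suc n) (c w)
    c-run zero    w n = cong (_* ∑< (suc n) (c w)) (sym (p-1 n))
    c-run (suc k) w n = trans (cong (inv (suc n) *_) (c-run k w n))
      (trans (sym (ℚ.*-assoc (inv (suc n)) (p (suc k) n) _)) (cong (_* ∑< (suc n) (c w)) (sym (p-suc (suc k) n))))

    -- The coefficients of the multiple polylogarithm up to degree N add up to the truncated value
    -- at z = 1. The induction alternates with `c-word`, since the integration belonging to y sums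
    -- the lower coefficients.
    c-sum : ∀ {ks} → All NonZero ks → ∀ N → ∑< (suc N) (c (word ks)) ≡ tr ks N
    c-word : ∀ k {ks} → All NonZero ks → ∀ n → c (word (suc k ∷ ks)) (suc n) ≡ p (suc k) n * tr ks n

    c-word k pos n = trans (c-run k _ n) (cong (p (suc k) n *_) (c-sum pos n))

    c-sum [] N = trans (cong (λ z → 1ℚ + z) (∑<-0 N)) (ℚ.+-identityʳ 1ℚ)
    c-sum {suc k ∷ ks} (_ ∷ pos) zero    = trans (ℚ.+-identityʳ _) (first k)
      where
      first : ∀ k → c (xʸ k ∷ word ks) 0 ≡ 0ℚ
      first zero    = c-0 y (word ks)
      first (suc k) = c-0 x (xʸ k ∷ word ks)
    c-sum {suc k ∷ ks} (_ ∷ pos) (suc N) = trans (∑<-last (suc N) (c (word (suc k ∷ ks))))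
      (cong₂ _+_ (c-sum (_ ∷ pos) N) (c-word k pos N))

  -- Words being read backwards, these are the words of 𝔥¹.
  data Anchored : Word → Set where
    []  : Anchored []
    yᴬ∷_ : ∀ {w} → Anchored w → Anchored (y ∷ w)
    xᴬ∷_ : ∀ {a w} → Anchored (a ∷ w) → Anchored (x ∷ a ∷ w)

  anchored-run : ∀ k {w} → Anchored w → Anchored (xʸ k ∷ w)
  anchored-run zero    a = yᴬ∷ a
  anchored-run (suc zero) a = xᴬ∷ yᴬ∷ a
  anchored-run (suc (suc k)) a = xᴬ∷ anchored-run (suc k) a

  anchored-word : ∀ ks → Anchored (word ks)
  anchored-word []       = []
  anchored-word (k ∷ ks) = anchored-run (k ∸ 1) (anchored-word ks)

  anchored-index : ∀ {a w} → Anchored (a ∷ w) → ∃ λ k → ∃ λ ks → All NonZero ks × a ∷ w ≡ word (suc k ∷ ks)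
  anchored-index (yᴬ∷ [])                 = 0 , [] , [] , refl
  anchored-index (yᴬ∷ a@(yᴬ∷ _)) = let k , ks , pos , eq = anchored-index a in 0 , suc k ∷ ks , _ ∷ pos , cong (y ∷_) eq
  anchored-index (yᴬ∷ a@(xᴬ∷ _)) = let k , ks , pos , eq = anchored-index a in 0 , suc k ∷ ks , _ ∷ pos , cong (y ∷_) eq
  anchored-index (xᴬ∷ a) = let k , ks , pos , eq = anchored-index a in suc k , ks , pos , cong (x ∷_) eq

  module ShuffleCoefficients where
    open Rational
    open ShuffleSum ℚ-ring
    open +-*-Solver
    open ≡-Reasoning

    private
      module A = CommutativeRing series

      -- The operator z d/dz and multiplication by z / (1 - z). Integration against dz / z inverts
      -- the first; the form belonging to y is dz / (1 - z), that is, `K` followed by dz / z.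
      θ K : Series → Series
      θ f n = nat n * f n
      K f n = ∑< n f

      θ-⊛ : ∀ f g n → θ (f ⊛ g) n ≡ (θ f ⊛ g) n + (f ⊛ θ g) n
      θ-⊛ f g zero    = solve 2 (λ f g → con 0ℚ :* (f :* g) := con 0ℚ :* f :* g :+ f :* (con 0ℚ :* g)) refl (f 0) (g 0)
      θ-⊛ f g (suc n) = begin
        nat (suc n) * (f 0 * g (suc n) + F)
          ≡⟨ ℚ.*-distribˡ-+ (nat (suc n)) (f 0 * g (suc n)) F ⟩
        nat (suc n) * (f 0 * g (suc n)) + nat (suc n) * F
          ≡⟨ cong (λ z → nat (suc n) * (f 0 * g (suc n)) + z) (trans (cong (_* F) (suc/1 n))
               (trans (ℚ.*-distribʳ-+ F 1ℚ (nat n)) (cong₂ _+_ (ℚ.*-identityˡ F) (θ-⊛ (f ∘ suc) g n)))) ⟩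
        nat (suc n) * (f 0 * g (suc n)) + (F + (G + H))
          ≡⟨ solve 6 (λ s f0 g1 a b c → s :* (f0 :* g1) :+ (a :+ (b :+ c)) := (con 0ℚ :* f0 :* g1 :+ (a :+ b)) :+ (f0 :* (s :* g1) :+ c))
               refl (nat (suc n)) (f 0) (g (suc n)) F G H ⟩
        (θ f 0 * g (suc n) + (F + G)) + (f ⊛ θ g) (suc n)
          ≡⟨ cong (λ z → (θ f 0 * g (suc n) + z) + (f ⊛ θ g) (suc n))
               (trans (sym (A.distribʳ g (f ∘ suc) (θ (f ∘ suc)) n)) (A.*-congʳ {x = g} (λ m →
                 trans (cong (_+ θ (f ∘ suc) m) (sym (ℚ.*-identityˡ (f (suc m)))))
                   (trans (sym (ℚ.*-distribʳ-+ (f (suc m)) 1ℚ (nat m))) (cong (_* f (suc m)) (sym (suc/1 m))))) n)) ⟩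
        (θ f ⊛ g) (suc n) + (f ⊛ θ g) (suc n) ∎
        where
        F = ((f ∘ suc) ⊛ g) n
        G = (θ (f ∘ suc) ⊛ g) n
        H = ((f ∘ suc) ⊛ θ g) n

      K-⊛ˡ : ∀ f g n → K (f ⊛ g) n ≡ (K f ⊛ g) n
      K-⊛ˡ f g zero    = sym (ℚ.*-zeroˡ (g 0))
      K-⊛ˡ f g (suc n) = begin
        ∑< (suc n) (f ⊛ g)
          ≡⟨ ∑<-last n (f ⊛ g) ⟩
        K (f ⊛ g) n + (f ⊛ g) n
          ≡⟨ cong (_+ (f ⊛ g) n) (K-⊛ˡ f g n) ⟩
        (K f ⊛ g) n + (f ⊛ g) n
          ≡⟨ sym (A.distribʳ g (K f) f n) ⟩
        ((λ m → K f m + f m) ⊛ g) n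
          ≡⟨ A.*-congʳ {x = g} (λ m → sym (∑<-last m f)) n ⟩
        ((K f ∘ suc) ⊛ g) n
          ≡⟨ trans (cong (_+ ((K f ∘ suc) ⊛ g) n) (ℚ.*-zeroˡ (g (suc n)))) (ℚ.+-identityˡ _) ⟨
        (K f ⊛ g) (suc n) ∎

      K-cong : ∀ {f g} → f ≋ g → K f ≋ K g
      K-cong eq n = ∑<-cong n eq

      K-⊛ʳ : ∀ f g n → K (f ⊛ g) n ≡ (f ⊛ K g) n
      K-⊛ʳ f g n = trans (K-cong (A.*-comm f g) n) (trans (K-⊛ˡ g f n) (A.*-comm (K g) f n))

      step : Letter → Series → Series
      step x f = f
      step y f = K f

      step-cong : ∀ a {f g} → f ≋ g → step a f ≋ step a g
      step-cong x eq = eq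
      step-cong y eq = K-cong eq

      step-⊛ˡ : ∀ a f g → step a (f ⊛ g) ≋ step a f ⊛ g
      step-⊛ˡ x f g n = refl
      step-⊛ˡ y f g n = K-⊛ˡ f g n

      step-⊛ʳ : ∀ a f g → step a (f ⊛ g) ≋ f ⊛ step a g
      step-⊛ʳ x f g n = refl
      step-⊛ʳ y f g n = K-⊛ʳ f g n

      c-step : ∀ a w n → c (a ∷ w) n ≡ inv n * step a (c w) n
      c-step x w n = refl
      c-step y w n = refl

      -- In degree 0 the left side is 0, so the integrand must have no constant term. This is where
      -- words with an x at the far end have to be excluded.
      θ-c : ∀ {a w} → Anchored (a ∷ w) → θ (c (a ∷ w)) ≋ step a (c w)
      θ-c {a} {w} anc (suc n) = trans (cong (nat (suc n) *_) (c-step a w (suc n)))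
        (trans (sym (ℚ.*-assoc (nat (suc n)) (inv (suc n)) _)) (trans (cong (_* step a (c w) (suc n)) (nat-inv n)) (ℚ.*-identityˡ _)))
      θ-c {y} {w} anc zero = ℚ.*-zeroˡ (c (y ∷ w) 0)
      θ-c {x} {b ∷ w} (xᴬ∷ anc) zero = trans (ℚ.*-zeroˡ (c (x ∷ b ∷ w) 0)) (sym (c-0 b w))

      tail : ∀ {a w} → Anchored (a ∷ w) → Anchored w
      tail (yᴬ∷ a) = a
      tail (xᴬ∷ a) = a

    σ-*ˡ : ∀ d φ u v → σ (λ w → d * φ w) u v ≡ d * σ φ u v
    σ-*ˡ d φ []      v       = refl
    σ-*ˡ d φ (a ∷ u) []      = refl
    σ-*ˡ d φ (a ∷ u) (b ∷ v) = trans (cong₂ _+_ (σ-*ˡ d (φ ∘ (a ∷_)) u (b ∷ v)) (σ-*ˡ d (φ ∘ (b ∷_)) (a ∷ u) v)) (sym (ℚ.*-distribˡ-+ d _ _))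

    σ-∑< : ∀ n (φ : ℕ → Word → ℚ) u v → σ (λ w → ∑< n (λ j → φ j w)) u v ≡ ∑< n (λ j → σ (φ j) u v)
    σ-∑< n φ []      v       = refl
    σ-∑< n φ (a ∷ u) []      = refl
    σ-∑< n φ (a ∷ u) (b ∷ v) = trans (cong₂ _+_ (σ-∑< n (λ j → φ j ∘ (a ∷_)) u (b ∷ v)) (σ-∑< n (λ j → φ j ∘ (b ∷_)) (a ∷ u) v))
      (sym (∑<-+ n (λ j → σ (φ j ∘ (a ∷_)) u (b ∷ v)) (λ j → σ (φ j ∘ (b ∷_)) (a ∷ u) v)))

    private
      σ-step : ∀ a u v n → σ (λ w → c (a ∷ w) n) u v ≡ inv n * step a (λ m → σ (λ w → c w m) u v) n
      σ-step x u v n = σ-*ˡ (inv n) (λ w → c w n) u v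
      σ-step y u v n = trans (σ-*ˡ (inv n) (λ w → ∑< n (c w)) u v) (cong (inv n *_) (σ-∑< n (λ j w → c w j) u v))

    -- Both sides are killed by evaluation at 0 and have the same derivative.
    c-shuffle : ∀ {u v} → Anchored u → Anchored v → ∀ n → σ (λ w → c w n) u v ≡ (c u ⊛ c v) n
    c-shuffle {[]}    {v}     au av n = sym (A.*-identityˡ (c v) n)
    c-shuffle {a ∷ u} {[]}    au av n = sym (A.*-identityʳ (c (a ∷ u)) n)
    c-shuffle {a ∷ u} {b ∷ v} au av zero = begin
      σ (λ w → c (a ∷ w) 0) u (b ∷ v) + σ (λ w → c (b ∷ w) 0) (a ∷ u) v
        ≡⟨ cong₂ _+_ (trans (σ-step a u (b ∷ v) 0) (ℚ.*-zeroˡ (step a (λ m → σ (λ w → c w m) u (b ∷ v)) 0)))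
             (trans (σ-step b (a ∷ u) v 0) (ℚ.*-zeroˡ (step b (λ m → σ (λ w → c w m) (a ∷ u) v) 0))) ⟩
      0ℚ
        ≡⟨ trans (cong (_* c (b ∷ v) 0) (c-0 a u)) (ℚ.*-zeroˡ (c (b ∷ v) 0)) ⟨
      c (a ∷ u) 0 * c (b ∷ v) 0 ∎
    c-shuffle {a ∷ u} {b ∷ v} au av (suc n) = begin
      σ (λ w → c (a ∷ w) (suc n)) u (b ∷ v) + σ (λ w → c (b ∷ w) (suc n)) (a ∷ u) v
        ≡⟨ cong₂ _+_ (trans (σ-step a u (b ∷ v) (suc n)) (cong (inv (suc n) *_) (trans (step-cong a (c-shuffle (tail au) av) (suc n)) (step-⊛ˡ a (c u) (c (b ∷ v)) (suc n)))))
             (trans (σ-step b (a ∷ u) v (suc n)) (cong (inv (suc n) *_) (trans (step-cong b (c-shuffle au (tail av)) (suc n)) (step-⊛ʳ b (c (a ∷ u)) (c v) (suc n))))) ⟩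
      inv (suc n) * (step a (c u) ⊛ c (b ∷ v)) (suc n) + inv (suc n) * (c (a ∷ u) ⊛ step b (c v)) (suc n)
        ≡⟨ sym (ℚ.*-distribˡ-+ (inv (suc n)) _ _) ⟩
      inv (suc n) * ((step a (c u) ⊛ c (b ∷ v)) (suc n) + (c (a ∷ u) ⊛ step b (c v)) (suc n))
        ≡⟨ cong (inv (suc n) *_) (cong₂ _+_ (A.*-congʳ {x = c (b ∷ v)} (λ m → sym (θ-c au m)) (suc n)) (A.*-congˡ {x = c (a ∷ u)} (λ m → sym (θ-c av m)) (suc n))) ⟩
      inv (suc n) * ((θ (c (a ∷ u)) ⊛ c (b ∷ v)) (suc n) + (c (a ∷ u) ⊛ θ (c (b ∷ v))) (suc n))
        ≡⟨ sym (inv-cancel n _ _ (θ-⊛ (c (a ∷ u)) (c (b ∷ v)) (suc n))) ⟩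
      (c (a ∷ u) ⊛ c (b ∷ v)) (suc n) ∎

-- The product of truncations against the truncation of the shuffle

module KernelEstimates where

  open import Defs using (y; truncated-cauchy; IsCauchy; half-pos; half+half)
  open import Data.List using (List; []; _∷_; replicate)
  open import Data.List.Relation.Unary.All as All using (All; []; _∷_)
  import Data.List.Relation.Unary.All.Properties as All
  open import Data.Nat as ℕ using (ℕ; zero; suc; _∸_; NonZero)
  import Data.Nat.Properties as ℕ
  open import Data.Product using (_,_)
  open import Data.Rational as ℚ using (ℚ; 0ℚ; 1ℚ; ½; ∣_∣; _+_; _*_; _-_; -_; _≤_; _<_; nonNegative)
  import Data.Rational.Properties as ℚ
  open import Data.Rational.Solver using (module +-*-Solver)
  open import Data.Sum using (inj₁; inj₂)
  open import Function using (_∘_)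
  open import Relation.Binary.PropositionalEquality
  open RingSums
  open Words
  open Reals
  open TruncatedSums
  open IteratedIntegrals

  module Kernel where
    open Rational
    open Limits
    open +-*-Solver

    double : ℕ → ℕ
    double n = n ℕ.+ n

    -- The mean of a multiple harmonic sum tends to 0: the increment of tr (2 ∷ ks) from N to 2N
    -- is at least N (2N)⁻² tr ks N.
    mean-null : ∀ ks → All NonZero ks → Null (λ n → tr ks n * inv (suc n))
    mean-null ks pos = null-suc (null-squeeze
      (λ n → 0≤* (0≤tr ks (suc n)) (0≤inv (suc (suc n))))
      (λ n → bound n)
      -- The factor 4 comes from 1 / N = 4 N (2N)⁻².
      (null-scale (1ℚ + 1ℚ + 1ℚ + 1ℚ) growth))
      where
      t : ℕ → ℚ
      t = tr (2 ∷ ks)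
      t-cauchy : IsCauchy t
      t-cauchy ε 0<ε = let N , h = truncated-cauchy 2 ks (ℕ.s≤s (ℕ.s≤s ℕ.z≤n)) pos ε 0<ε in
        N , λ m n N≤m N≤n → subst (_< ε) (sym (cong₂ (λ a b → ∣ a - b ∣) (tr-truncated (2 ∷ ks) m) (tr-truncated (2 ∷ ks) n))) (h m n N≤m N≤n)
      growth : Null (λ n → t (double (suc n)) - t (suc n))
      growth = null λ ε 0<ε → let N , h = t-cauchy ε 0<ε in
        N , λ n N≤n → h (double (suc n)) (suc n) (ℕ.≤-trans N≤n (ℕ.≤-trans (ℕ.n≤1+n n) (ℕ.m≤m+n (suc n) (suc n)))) (ℕ.≤-trans N≤n (ℕ.n≤1+n n))
      module _ (n : ℕ) where
        N = suc n
        i v : ℚ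
        i = inv (double N)
        v = tr ks N
        0≤i = 0≤inv (double N)
        0≤v = 0≤tr ks N
        increment : ∀ d → d ℕ.≤ N → t N + nat d * (i * i * v) ≤ t (N ℕ.+ d)
        increment zero    _     = ℚ.≤-reflexive (trans (cong (λ z → t N + z) (ℚ.*-zeroˡ (i * i * v)))
          (trans (ℚ.+-identityʳ (t N)) (cong t (sym (ℕ.+-identityʳ N)))))
        increment (suc d) d<N = begin
          t N + nat (suc d) * (i * i * v)
            ≡⟨ cong (λ z → t N + z * (i * i * v)) (suc/1 d) ⟩
          t N + (1ℚ + nat d) * (i * i * v)
            ≡⟨ solve 3 (λ t n w → t :+ (con 1ℚ :+ n) :* w := (t :+ n :* w) :+ w) refl (t N) (nat d) (i * i * v) ⟩
          (t N + nat d * (i * i * v)) + i * i * v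
            ≤⟨ ℚ.+-mono-≤ (increment d (ℕ.<⇒≤ d<N)) (*-mono (0≤* 0≤i 0≤i) (0≤tr ks (N ℕ.+ d)) square (tr-mono ks N d)) ⟩
          t (N ℕ.+ d) + p 2 (N ℕ.+ d) * tr ks (N ℕ.+ d)
            ≡⟨ cong t (sym (ℕ.+-suc N d)) ⟩
          t (N ℕ.+ suc d) ∎
          where
          open ℚ.≤-Reasoning
          i≤ : i ≤ inv (suc (N ℕ.+ d))
          i≤ = inv-antitone (N ℕ.+ d) (n ℕ.+ N) (subst (ℕ._≤ n ℕ.+ N) (ℕ.+-suc n d) (ℕ.+-monoʳ-≤ n d<N))
          square : i * i ≤ p 2 (N ℕ.+ d)
          square = ℚ.≤-trans (*-mono 0≤i (0≤inv (suc (N ℕ.+ d))) i≤ i≤)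
            (ℚ.≤-reflexive (sym (trans (p-suc 1 (N ℕ.+ d)) (cong (inv (suc (N ℕ.+ d)) *_) (p-1 (N ℕ.+ d))))))
        half-N : nat N * i + nat N * i ≡ 1ℚ
        half-N = trans (sym (ℚ.*-distribʳ-+ i (nat N) (nat N))) (trans (cong (_* i) (sym (nat-+ N N))) (nat-inv (n ℕ.+ N)))
        inv-N : inv N ≡ i + i
        inv-N = begin
          inv N                                 ≡⟨ trans (cong (inv N *_) half-N) (ℚ.*-identityʳ (inv N)) ⟨
          inv N * (nat N * i + nat N * i)       ≡⟨ solve 3 (λ k n i → k :* (n :* i :+ n :* i) := (n :* k) :* (i :+ i)) refl (inv N) (nat N) i ⟩
          (nat N * inv N) * (i + i)             ≡⟨ trans (cong (_* (i + i)) (nat-inv n)) (ℚ.*-identityˡ (i + i)) ⟩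
          i + i ∎
          where open ≡-Reasoning
        bound : v * inv (suc N) ≤ (1ℚ + 1ℚ + 1ℚ + 1ℚ) * (t (double N) - t N)
        bound = begin
          v * inv (suc N)
            ≤⟨ ℚ.*-monoˡ-≤-nonNeg v {{nonNegative 0≤v}} (inv-antitone n N (ℕ.n≤1+n n)) ⟩
          v * inv N
            ≡⟨ cong (v *_) (trans inv-N (sym (trans (cong ((i + i) *_) half-N) (ℚ.*-identityʳ (i + i))))) ⟩
          v * ((i + i) * (nat N * i + nat N * i))
            ≡⟨ solve 3 (λ v i n → v :* ((i :+ i) :* (n :* i :+ n :* i)) := (con 1ℚ :+ con 1ℚ :+ con 1ℚ :+ con 1ℚ) :* (n :* (i :* i :* v))) refl v i (nat N) ⟩
          (1ℚ + 1ℚ + 1ℚ + 1ℚ) * (nat N * (i * i * v))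
            ≤⟨ ℚ.*-monoˡ-≤-nonNeg (1ℚ + 1ℚ + 1ℚ + 1ℚ) (subst (_≤ t (double N) - t N)
                 (solve 2 (λ t w → (t :+ w) :- t := w) refl (t N) (nat N * (i * i * v)))
                 (ℚ.+-monoˡ-≤ (- t N) (increment N ℕ.≤-refl))) ⟩
          (1ℚ + 1ℚ + 1ℚ + 1ℚ) * (t (double N) - t N) ∎
          where open ℚ.≤-Reasoning

    -- h m a is the complete symmetric polynomial of degree m in 1, 1/2, …, 1/a.
    h : ℕ → ℕ → ℚ
    h zero    a       = 1ℚ
    h (suc m) zero    = 0ℚ
    h (suc m) (suc a) = h (suc m) a + inv (suc a) * h m (suc a)

    0≤h : ∀ m a → 0ℚ ≤ h m a
    0≤h zero    a       = ℚ.nonNegative⁻¹ 1ℚ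
    0≤h (suc m) zero    = ℚ.≤-refl
    0≤h (suc m) (suc a) = 0≤+ (0≤h (suc m) a) (0≤* (0≤inv (suc a)) (0≤h m (suc a)))

    -- These are the coefficients of (-log(1 - z))ᵐ / m!.
    e : ℕ → ℕ → ℚ
    e m = c (replicate m y)

    private
      S : ℕ → ℕ → ℚ
      S m B = ∑< B (e m)

      e-suc : ∀ m b → nat (suc b) * e (suc m) (suc b) ≡ S m (suc b)
      e-suc m b = trans (sym (ℚ.*-assoc (nat (suc b)) (inv (suc b)) _)) (trans (cong (_* S m (suc b)) (nat-inv b)) (ℚ.*-identityˡ _))

      part : ℕ → ℕ → ℕ → ℚ
      part m B a = ∑< B (λ b → e m b * inv (a ℕ.+ b))

      A : ℕ → ℕ → ℕ → ℚ
      A m B a = nat a * part m B a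

    -- ∑_{b ≥ 0} e m b / (a + b) = h m a / a, and D is a times the tail of this series.
    D : ℕ → ℕ → ℕ → ℚ
    D m B a = h m a - A m B a

    private
      -- Both differences compare 1 / (a + b + 1) with 1 / (a + b + 2); a step in `a` is traded for
      -- a step in `b`.
      exchange : ∀ a b → nat (suc a) * inv (suc a ℕ.+ suc b) - nat a * inv (a ℕ.+ suc b)
                       ≡ nat (suc b) * (inv (suc a ℕ.+ b) - inv (suc a ℕ.+ suc b))
      exchange a b = begin
        nat (suc a) * j - nat a * inv (a ℕ.+ suc b)
          ≡⟨ cong (λ z → nat (suc a) * j - nat a * inv z) (ℕ.+-suc a b) ⟩
        nat (suc a) * j - nat a * i
          ≡⟨ solve 5 (λ sa a sb i j → sa :* j :- a :* i := ((sa :+ sb) :* j :- (a :+ sb) :* i) :+ sb :* (i :- j)) refl (nat (suc a)) (nat a) (nat (suc b)) i j ⟩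
        ((nat (suc a) + nat (suc b)) * j - (nat a + nat (suc b)) * i) + nat (suc b) * (i - j)
          ≡⟨ cong (_+ nat (suc b) * (i - j)) (cong₂ _-_ (trans (cong (_* j) (sym (nat-+ (suc a) (suc b)))) (nat-inv (a ℕ.+ suc b)))
               (trans (cong (_* i) (trans (sym (nat-+ a (suc b))) (cong nat (ℕ.+-suc a b)))) (nat-inv (a ℕ.+ b)))) ⟩
        (1ℚ - 1ℚ) + nat (suc b) * (i - j)
          ≡⟨ solve 1 (λ z → (con 1ℚ :- con 1ℚ) :+ z := z) refl _ ⟩
        nat (suc b) * (i - j) ∎
        where
        open ≡-Reasoning
        i = inv (suc a ℕ.+ b)
        j = inv (suc a ℕ.+ suc b)

      -- Summation by parts: `exchange` moves the difference in `a` to a difference in `b`, and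
      -- `e-suc` expresses (b + 1) times the coefficient of `e (suc m)` by the partial sum of `e m`.
      -- The last term is the boundary term.
      A-step : ∀ m B a → A (suc m) (suc B) (suc a) ≡ (A (suc m) (suc B) a + part m B (suc a)) - S m B * inv (suc a ℕ.+ B)
      A-step m zero a = begin
        nat (suc a) * (e (suc m) 0 * inv (suc a ℕ.+ 0) + 0ℚ)
          ≡⟨ cong (λ z → nat (suc a) * (z * inv (suc a ℕ.+ 0) + 0ℚ)) (c-0 y (replicate m y)) ⟩
        nat (suc a) * (0ℚ * inv (suc a ℕ.+ 0) + 0ℚ)
          ≡⟨ solve 4 (λ sa a i j → sa :* (con 0ℚ :* i :+ con 0ℚ) := (a :* (con 0ℚ :* j :+ con 0ℚ) :+ con 0ℚ) :- con 0ℚ :* i) refl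
               (nat (suc a)) (nat a) (inv (suc a ℕ.+ 0)) (inv (a ℕ.+ 0)) ⟩
        (nat a * (0ℚ * inv (a ℕ.+ 0) + 0ℚ) + 0ℚ) - 0ℚ * inv (suc a ℕ.+ 0)
          ≡⟨ cong (λ z → (nat a * (z * inv (a ℕ.+ 0) + 0ℚ) + 0ℚ) - 0ℚ * inv (suc a ℕ.+ 0)) (c-0 y (replicate m y)) ⟨
        (A (suc m) 1 a + 0ℚ) - 0ℚ * inv (suc a ℕ.+ 0) ∎
        where open ≡-Reasoning
      A-step m (suc B) a = begin
        nat (suc a) * part (suc m) (suc (suc B)) (suc a)
          ≡⟨ cong (nat (suc a) *_) (∑<-last (suc B) (λ b → e (suc m) b * inv (suc a ℕ.+ b))) ⟩
        nat (suc a) * (part (suc m) (suc B) (suc a) + E * inv (suc a ℕ.+ suc B))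
          ≡⟨ trans (ℚ.*-distribˡ-+ (nat (suc a)) _ _) (cong (_+ nat (suc a) * (E * inv (suc a ℕ.+ suc B))) (A-step m B a)) ⟩
        ((A (suc m) (suc B) a + part m B (suc a)) - S m B * i) + nat (suc a) * (E * j)
          ≡⟨ solve 7 (λ α q s i sa E j → ((α :+ q) :- s :* i) :+ sa :* (E :* j) := ((α :+ q) :- s :* i) :+ E :* (sa :* j)) refl
               (A (suc m) (suc B) a) (part m B (suc a)) (S m B) i (nat (suc a)) E j ⟩
        ((A (suc m) (suc B) a + part m B (suc a)) - S m B * i) + E * (nat (suc a) * j)
          ≡⟨ cong (λ z → ((A (suc m) (suc B) a + part m B (suc a)) - S m B * i) + E * z)
               (trans (solve 2 (λ u w → u := (u :- w) :+ w) refl (nat (suc a) * j) (nat a * k)) (cong (_+ nat a * k) (exchange a B))) ⟩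
        ((A (suc m) (suc B) a + part m B (suc a)) - S m B * i) + E * (nat (suc B) * (i - j) + nat a * k)
          ≡⟨ solve 9 (λ α q s i E n j a k → ((α :+ q) :- s :* i) :+ E :* (n :* (i :- j) :+ a :* k)
                          := (α :+ a :* (E :* k)) :+ (q :- s :* i) :+ (n :* E) :* (i :- j)) refl
               (A (suc m) (suc B) a) (part m B (suc a)) (S m B) i E (nat (suc B)) j (nat a) k ⟩
        (A (suc m) (suc B) a + nat a * (E * k)) + (part m B (suc a) - S m B * i) + (nat (suc B) * E) * (i - j)
          ≡⟨ cong₂ (λ u w → u + (part m B (suc a) - S m B * i) + w * (i - j))
               (trans (sym (ℚ.*-distribˡ-+ (nat a) (part (suc m) (suc B) a) (E * k))) (cong (nat a *_) (sym (∑<-last (suc B) (λ b → e (suc m) b * inv (a ℕ.+ b))))))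
               (trans (e-suc m B) (∑<-last B (e m))) ⟩
        A (suc m) (suc (suc B)) a + (part m B (suc a) - S m B * i) + (S m B + e m B) * (i - j)
          ≡⟨ solve 6 (λ α q s i f j → α :+ (q :- s :* i) :+ (s :+ f) :* (i :- j) := (α :+ (q :+ f :* i)) :- (s :+ f) :* j) refl
               (A (suc m) (suc (suc B)) a) (part m B (suc a)) (S m B) i (e m B) j ⟩
        (A (suc m) (suc (suc B)) a + (part m B (suc a) + e m B * i)) - (S m B + e m B) * j
          ≡⟨ cong₂ (λ u w → (A (suc m) (suc (suc B)) a + u) - w * j) (sym (∑<-last B (λ b → e m b * inv (suc a ℕ.+ b)))) (sym (∑<-last B (e m))) ⟩
        (A (suc m) (suc (suc B)) a + part m (suc B) (suc a)) - S m (suc B) * j ∎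
        where
        open ≡-Reasoning
        E = e (suc m) (suc B)
        i = inv (suc a ℕ.+ B)
        j = inv (suc a ℕ.+ suc B)
        k = inv (a ℕ.+ suc B)

      -- The partial sums obey the recursion defining `h` up to the boundary term, so the tail obeys
      -- it with that term as a nonnegative source. Positivity of the tail and its convergence to 0
      -- both follow by induction from this recursion.
      D-step : ∀ m B a → D (suc m) (suc B) (suc a) ≡ (D (suc m) (suc B) a + inv (suc a) * D m B (suc a)) + S m B * inv (suc a ℕ.+ B)
      D-step m B a = begin
        (h (suc m) a + inv (suc a) * h m (suc a)) - A (suc m) (suc B) (suc a)
          ≡⟨ cong (λ z → (h (suc m) a + inv (suc a) * h m (suc a)) - z) (A-step m B a) ⟩
        (h (suc m) a + inv (suc a) * h m (suc a)) - ((A (suc m) (suc B) a + part m B (suc a)) - s)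
          ≡⟨ cong (λ z → (h (suc m) a + inv (suc a) * h m (suc a)) - ((A (suc m) (suc B) a + z) - s)) (inv-cancel a (part m B (suc a)) (A m B (suc a)) refl) ⟩
        (h (suc m) a + inv (suc a) * h m (suc a)) - ((A (suc m) (suc B) a + inv (suc a) * A m B (suc a)) - s)
          ≡⟨ solve 6 (λ h i h′ α β s → (h :+ i :* h′) :- ((α :+ i :* β) :- s) := ((h :- α) :+ i :* (h′ :- β)) :+ s) refl
               (h (suc m) a) (inv (suc a)) (h m (suc a)) (A (suc m) (suc B) a) (A m B (suc a)) s ⟩
        (D (suc m) (suc B) a + inv (suc a) * D m B (suc a)) + s ∎
        where
        open ≡-Reasoning
        s = S m B * inv (suc a ℕ.+ B)

      0≤S : ∀ m B → 0ℚ ≤ S m B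
      0≤S m B = ∑<-nonNeg B (e m) (0≤c (replicate m y))

      D-empty : ∀ m a → D m 0 a ≡ h m a
      D-empty m a = trans (cong (λ z → h m a - z) (ℚ.*-zeroʳ (nat a))) (solve 1 (λ h → h :- con 0ℚ := h) refl (h m a))

      part-0 : ∀ B a → part 0 (suc B) a ≡ inv a
      part-0 B a = trans (cong₂ _+_ (trans (ℚ.*-identityˡ _) (cong inv (ℕ.+-identityʳ a)))
        (trans (∑<-cong B (λ b → ℚ.*-zeroˡ (inv (a ℕ.+ suc b)))) (∑<-0 B))) (ℚ.+-identityʳ (inv a))

      D-0 : ∀ B a → D 0 (suc B) (suc a) ≡ 0ℚ
      D-0 B a = trans (cong (λ z → 1ℚ - nat (suc a) * z) (part-0 B (suc a))) (trans (cong (λ z → 1ℚ - z) (nat-inv a)) (ℚ.+-inverseʳ 1ℚ))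

      D-suc-0 : ∀ m B → D (suc m) B 0 ≡ 0ℚ
      D-suc-0 m B = trans (cong (λ z → 0ℚ - z) (ℚ.*-zeroˡ (part (suc m) B 0))) (ℚ.+-inverseʳ 0ℚ)

    0≤D : ∀ m B a → 0ℚ ≤ D m B a
    0≤D m       zero    a       = subst (0ℚ ≤_) (sym (D-empty m a)) (0≤h m a)
    0≤D zero    (suc B) zero    = subst (0ℚ ≤_) (sym (trans (cong (λ z → 1ℚ - z) (ℚ.*-zeroˡ (part 0 (suc B) 0))) (ℚ.+-identityʳ 1ℚ))) (ℚ.nonNegative⁻¹ 1ℚ)
    0≤D zero    (suc B) (suc a) = ℚ.≤-reflexive (sym (D-0 B a))
    0≤D (suc m) (suc B) zero    = ℚ.≤-reflexive (sym (D-suc-0 m (suc B)))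
    0≤D (suc m) (suc B) (suc a) = subst (0ℚ ≤_) (sym (D-step m B a))
      (0≤+ (0≤+ (0≤D (suc m) (suc B) a) (0≤* (0≤inv (suc a)) (0≤D m B (suc a)))) (0≤* (0≤S m B) (0≤inv (suc a ℕ.+ B))))

    -- Induction along `D-step`: the source is a mean of the harmonic sum of m ones, which tends to
    -- 0 by `mean-null`, and the tail is 0 at a = 0.
    D-null : ∀ m a → Null (λ B → D m B (suc a))
    D-null zero    a = null-suc (null-≗ (λ B → sym (D-0 B a)) null-0)
    D-null (suc m) a = go (suc a)
      where
      ones : All NonZero (replicate m 1)
      ones = All.replicate⁺ m _
      word-ones : ∀ m → word (replicate m 1) ≡ replicate m y
      word-ones zero    = refl
      word-ones (suc m) = cong (y ∷_) (word-ones m)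
      boundary : ∀ a → Null (λ B → S m B * inv (suc a ℕ.+ B))
      boundary a = null-suc (null-squeeze (λ B → 0≤* (0≤S m (suc B)) (0≤inv (suc a ℕ.+ suc B)))
        (λ B → ℚ.≤-trans (ℚ.*-monoˡ-≤-nonNeg (S m (suc B)) {{nonNegative (0≤S m (suc B))}}
                 (inv-antitone B (a ℕ.+ suc B) (ℕ.≤-trans (ℕ.n≤1+n B) (ℕ.m≤n+m (suc B) a))))
               (ℚ.≤-reflexive (cong (_* inv (suc B)) (trans (cong (λ w → ∑< (suc B) (c w)) (sym (word-ones m))) (c-sum ones B)))))
        (mean-null (replicate m 1) ones))
      go : ∀ a → Null (λ B → D (suc m) B a)
      go zero    = null-≗ (λ B → sym (D-suc-0 m B)) null-0
      go (suc a) = null-suc (null-≗ (λ B → sym (D-step m B a))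
        (null-+ (null-+ (null-shift (go a)) (null-scale (inv (suc a)) (D-null m a))) (boundary a)))
        where
        null-shift : ∀ {f} → Null f → Null (λ n → f (suc n))
        null-shift nf = null λ ε 0<ε → let N , k = small nf ε 0<ε in N , λ n N≤n → k (suc n) (ℕ.≤-trans N≤n (ℕ.n≤1+n n))

    kernel : ∀ m B a → part m B (suc a) ≡ inv (suc a) * (h m (suc a) - D m B (suc a))
    kernel m B a = inv-cancel a (part m B (suc a)) _ (solve 2 (λ h α → α := h :- (h :- α)) refl (h m (suc a)) (A m B (suc a)))

    module _ (f : ℕ → ℚ) (0≤f : ∀ n → 0ℚ ≤ f n) (f-0 : f 0 ≡ 0ℚ) (m : ℕ) where
      -- Both sum the array f(a) e(b) / (a + b): `triangle` over a + b ≤ N, and `squares` over a ≤ N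
      -- and all b, the column sums being known through `h`. With a = 0 excluded by `f-0`, no
      -- division by 0 is hidden here.
      triangle squares : ℕ → ℚ
      triangle N = ∑< (suc N) (λ n → inv n * (f ⊛ e m) n)
      squares N  = ∑< (suc N) (λ a → (inv a * f a) * h m a)

      private
        ⊛-sum : ∀ (f g : Series) n → (f ⊛ g) n ≡ ∑< (suc n) (λ a → f a * g (n ∸ a))
        ⊛-sum f g zero    = sym (ℚ.+-identityʳ _)
        ⊛-sum f g (suc n) = cong (λ z → f 0 * g (suc n) + z) (⊛-sum (f ∘ suc) g n)

        term : ℕ → ℕ → ℚ
        term a b = f a * (e m b * inv (a ℕ.+ b))

        column : ℕ → ℕ → ℚ
        column M a = ∑< (suc (M ∸ a)) (term a)

        diagonal : ∀ n → inv n * (f ⊛ e m) n ≡ ∑< (suc n) (λ a → term a (n ∸ a))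
        diagonal n = trans (cong (inv n *_) (⊛-sum f (e m) n)) (trans (sym (∑<-*ˡ (suc n) (inv n) (λ a → f a * e m (n ∸ a))))
          (∑<-cong-< (suc n) (λ a a≤n → trans
            (solve 3 (λ i f e → i :* (f :* e) := f :* (e :* i)) refl (inv n) (f a) (e m (n ∸ a)))
            (cong (λ z → f a * (e m (n ∸ a) * inv z)) (sym (ℕ.m+[n∸m]≡n (ℕ.≤-pred a≤n)))))))

        triangle-columns : ∀ N → triangle N ≡ ∑< (suc N) (column N)
        triangle-columns zero    = cong (_+ 0ℚ) (diagonal 0)
        triangle-columns (suc N) = begin
          triangle (suc N)
            ≡⟨ ∑<-last (suc N) (λ n → inv n * (f ⊛ e m) n) ⟩
          triangle N + inv (suc N) * (f ⊛ e m) (suc N)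
            ≡⟨ cong₂ _+_ (triangle-columns N) (diagonal (suc N)) ⟩
          ∑< (suc N) (column N) + ∑< (suc (suc N)) (λ a → term a (suc N ∸ a))
            ≡⟨ cong (_+ ∑< (suc (suc N)) (λ a → term a (suc N ∸ a))) (sym (trans (∑<-last (suc N) shorter)
                 (trans (cong₂ _+_ (∑<-cong-< (suc N) (λ a a≤N → cong (λ z → ∑< z (term a)) (ℕ.+-∸-assoc 1 (ℕ.≤-pred a≤N))))
                                   (cong (λ z → ∑< z (term (suc N))) (ℕ.n∸n≡0 N))) (ℚ.+-identityʳ (∑< (suc N) (column N)))))) ⟩
          ∑< (suc (suc N)) shorter + ∑< (suc (suc N)) (λ a → term a (suc N ∸ a))
            ≡⟨ sym (∑<-+ (suc (suc N)) shorter (λ a → term a (suc N ∸ a))) ⟩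
          ∑< (suc (suc N)) (λ a → shorter a + term a (suc N ∸ a))
            ≡⟨ ∑<-cong (suc (suc N)) (λ a → sym (∑<-last (suc N ∸ a) (term a))) ⟩
          ∑< (suc (suc N)) (column (suc N)) ∎
          where
          open ≡-Reasoning
          shorter : ℕ → ℚ
          shorter a = ∑< (suc N ∸ a) (term a)

        tail : ℕ → ℕ → ℚ
        tail M a = (inv a * f a) * D m (suc (M ∸ a)) a

        column-tail : ∀ M a → (inv a * f a) * h m a ≡ tail M a + column M a
        column-tail M zero = begin
          (0ℚ * f 0) * h m 0
            ≡⟨ solve 3 (λ f h d → (con 0ℚ :* f) :* h := (con 0ℚ :* f) :* d :+ con 0ℚ) refl (f 0) (h m 0) (D m (suc (M ∸ 0)) 0) ⟩
          tail M 0 + 0ℚ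
            ≡⟨ cong (tail M 0 +_) (trans (∑<-cong (suc (M ∸ 0)) (λ b → trans (cong (_* (e m b * inv b)) f-0) (ℚ.*-zeroˡ (e m b * inv b)))) (∑<-0 (suc (M ∸ 0)))) ⟨
          tail M 0 + column M 0 ∎
          where open ≡-Reasoning
        column-tail M (suc a) = begin
          (inv (suc a) * f (suc a)) * h m (suc a)
            ≡⟨ solve 4 (λ i f h d → (i :* f) :* h := (i :* f) :* d :+ f :* (i :* (h :- d))) refl (inv (suc a)) (f (suc a)) (h m (suc a)) (D m B (suc a)) ⟩
          tail M (suc a) + f (suc a) * (inv (suc a) * (h m (suc a) - D m B (suc a)))
            ≡⟨ cong (λ z → tail M (suc a) + f (suc a) * z) (kernel m B a) ⟨
          tail M (suc a) + f (suc a) * part m B (suc a)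
            ≡⟨ cong (λ z → tail M (suc a) + z) (sym (∑<-*ˡ B (f (suc a)) (λ b → e m b * inv (suc a ℕ.+ b)))) ⟩
          tail M (suc a) + column M (suc a) ∎
          where
          open ≡-Reasoning
          B = suc (M ∸ suc a)

        squares-columns : ∀ N M → squares N ≡ ∑< (suc N) (tail M) + ∑< (suc N) (column M)
        squares-columns N M = trans (∑<-cong (suc N) (column-tail M)) (∑<-+ (suc N) (tail M) (column M))

        0≤tail : ∀ M a → 0ℚ ≤ tail M a
        0≤tail M a = 0≤* (0≤* (0≤inv a) (0≤f a)) (0≤D m (suc (M ∸ a)) a)

        0≤column : ∀ M a → 0ℚ ≤ column M a
        0≤column M a = ∑<-nonNeg (suc (M ∸ a)) (term a) (λ b → 0≤* (0≤f a) (0≤* (0≤c (replicate m y) b) (0≤inv (a ℕ.+ b))))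

        tail-null : ∀ a → Null (λ M → tail M a)
        tail-null zero    = null-≗ (λ M → sym (trans (cong (_* D m (suc M) 0) (ℚ.*-zeroˡ (f 0))) (ℚ.*-zeroˡ (D m (suc M) 0)))) null-0
        tail-null (suc a) = null-scale (inv (suc a) * f (suc a)) (null λ ε 0<ε → let N , k = small (D-null m a) ε 0<ε in
          N ℕ.+ suc a , λ M le → k (suc (M ∸ suc a)) (ℕ.≤-trans (ℕ.m+n≤o⇒m≤o∸n N le) (ℕ.n≤1+n _)))

        tails-null : ∀ n → Null (λ M → ∑< n (tail M))
        tails-null zero    = null-0
        tails-null (suc n) = null-≗ (λ M → sym (∑<-last n (tail M))) (null-+ (tails-null n) (tail-null n))

      -- As M → ∞, the first N columns of the triangle M exhaust the first N terms of the limit.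
      squares-triangle : IsCauchy triangle → Null (λ N → squares N - triangle N)
      squares-triangle cau = null λ ε 0<ε →
        let N₁ , k = cau (½ * ε) (half-pos 0<ε) in
        N₁ , λ N N₁≤N →
        -- The auxiliary bound M may depend on N: it is chosen so large that the first N + 1 columns
        -- are almost exhausted, while the difference of the triangles M and N is small for every M
        -- ≥ N ≥ N₁.
        let N₂ , l = small (tails-null (suc N)) (½ * ε) (half-pos 0<ε)
            M = N ℕ.⊔ N₂
        in begin-strict
          ∣ squares N - triangle N ∣
            ≡⟨ ℚ.0≤p⇒∣p∣≡p (nonneg N) ⟩
          squares N - triangle N
            ≡⟨ cong (_- triangle N) (squares-columns N M) ⟩
          (∑< (suc N) (tail M) + ∑< (suc N) (column M)) - triangle N
            ≤⟨ ℚ.+-monoˡ-≤ (- triangle N) (ℚ.+-monoʳ-≤ (∑< (suc N) (tail M))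
                 (ℚ.≤-trans (∑<-extend (column M) (ℕ.s≤s (ℕ.m≤m⊔n N N₂)) (0≤column M)) (ℚ.≤-reflexive (sym (triangle-columns M))))) ⟩
          (∑< (suc N) (tail M) + triangle M) - triangle N
            ≡⟨ ℚ.+-assoc (∑< (suc N) (tail M)) (triangle M) (- triangle N) ⟩
          ∑< (suc N) (tail M) + (triangle M - triangle N)
            ≤⟨ ℚ.+-mono-≤ (≤∣∣ (∑< (suc N) (tail M))) (≤∣∣ (triangle M - triangle N)) ⟩
          ∣ ∑< (suc N) (tail M) ∣ + ∣ triangle M - triangle N ∣
            <⟨ ℚ.+-mono-< (l M (ℕ.m≤n⊔m N N₂)) (k M N (ℕ.≤-trans N₁≤N (ℕ.m≤m⊔n N N₂)) N₁≤N) ⟩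
          ½ * ε + ½ * ε
            ≡⟨ half+half ε ⟩
          ε ∎
        where
        open ℚ.≤-Reasoning
        ≤∣∣ : ∀ q → q ≤ ∣ q ∣
        ≤∣∣ q with ℚ.≤-total 0ℚ q
        ... | inj₁ 0≤q = ℚ.≤-reflexive (sym (ℚ.0≤p⇒∣p∣≡p 0≤q))
        ... | inj₂ q≤0 = ℚ.≤-trans q≤0 (ℚ.0≤∣p∣ q)
        nonneg : ∀ N → 0ℚ ≤ squares N - triangle N
        nonneg N = subst (0ℚ ≤_) (sym (trans (cong₂ _-_ (squares-columns N N) (triangle-columns N))
            (solve 2 (λ t c → (t :+ c) :- c := t) refl (∑< (suc N) (tail N)) (∑< (suc N) (column N)))))
          (∑<-nonNeg (suc N) (tail N) (0≤tail N))

-- Passage to the limit from truncated sums to regularised values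

module ShuffleLimits where

  open import Algebra.Bundles using (CommutativeRing)
  open import Defs using (x; y; Word; ℝ; _*ᴿ_; -ᴿ_; 0ᴿ; 1ᴿ; fromℚ)
  open import Data.Integer using (+_)
  open import Data.List using (List; []; _∷_; _++_; _∷ʳ_; [_]; map; replicate)
  import Data.List.Properties as List
  open import Data.List.Relation.Unary.All as All using (All; []; _∷_)
  open import Data.Nat as ℕ using (ℕ; zero; suc; NonZero)
  open import Data.Nat.ListAction using (sum)
  import Data.Nat.Properties as ℕ
  open import Data.Product using (_,_)
  open import Data.Rational as ℚ using (ℚ; 0ℚ; _+_; _*_; _-_; -_)
  import Data.Rational.Properties as ℚ
  open import Data.Rational.Solver using (module +-*-Solver)
  open import Function using (_∘_)
  open import Relation.Binary.PropositionalEquality as ≡ using (_≡_; cong; cong₂)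
  open RingSums
  open StarSums
  open Words
  open Reals
  open TruncatedSums
  open IteratedIntegrals
  open KernelEstimates

  module ShuffleLimit (Z : Word → ℝ) where
    open Real
    open Limits using (Lim)
    private
      module ℝR = CommutativeRing ℝ-ring
      module ℝT = RingTools ℝ-ring
      module σᴿ = ShuffleSum ℝ-ring
      module σℚ = ShuffleSum ℚ-ring
      module Q = Rational
    open Kernel using (h; triangle; squares-triangle)
    open Regularised ℚ-ring Q.p using (P; P-suc; P-0; P-[]; inverse; reg; C-reg-value)
    import Algebra.Properties.Ring ℝR.ring as RP

    module _
      (Z-shuffle : ∀ {u v} → Anchored u → Anchored v → Z u *ᴿ Z v ≈ σᴿ.σ Z u v)
      (Z-[] : Z [] ≈ 1ᴿ)
      (Z-y : Z (y ∷ []) ≈ 0ᴿ)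
      (Z-lim : ∀ k {ks} → All NonZero ks → Lim (Q.tr (suc (suc k) ∷ ks)) (Z (word (suc (suc k) ∷ ks))))
      where

      private
        ys : ℕ → Word
        ys m = replicate m y

        anchored-ys : ∀ m → Anchored (ys m)
        anchored-ys zero    = []
        anchored-ys (suc m) = yᴬ∷ anchored-ys m

        anchored-ys-++ : ∀ m {w} → Anchored w → Anchored (ys m ++ w)
        anchored-ys-++ zero    a = a
        anchored-ys-++ (suc m) a = yᴬ∷ anchored-ys-++ m a

        σ-ys : ∀ φ m → σᴿ.σ φ (y ∷ []) (ys m) ≈ ℝT.fromInt (+ suc m) *ᴿ φ (ys (suc m))
        σ-ys φ zero    = ℝR.sym (ℝR.trans (ℝR.*-congʳ ℝT.fromInt-1) (ℝR.*-identityˡ _))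
        σ-ys φ (suc m) = ℝR.trans (ℝR.+-congˡ (σ-ys (φ ∘ (y ∷_)) m))
          (ℝR.sym (ℝR.trans (ℝR.distribʳ (φ (ys (suc (suc m)))) 1ᴿ (ℝT.fromInt (+ suc m))) (ℝR.+-congʳ (ℝR.*-identityˡ _))))

        cancel : ∀ m a → ℝT.fromInt (+ suc m) *ᴿ a ≈ 0ᴿ → a ≈ 0ᴿ
        cancel m a eq = ℝR.trans (ℝR.sym (ℝR.trans (ℝR.sym (ℝR.*-assoc r (ℝT.fromInt (+ suc m)) a))
            (ℝR.trans (ℝR.*-congʳ unit) (ℝR.*-identityˡ a)))) (ℝR.trans (ℝR.*-congˡ {r} eq) (ℝR.zeroʳ r))
          where
          r = fromℚ (Q.inv (suc m))
          unit : r *ᴿ ℝT.fromInt (+ suc m) ≈ 1ᴿ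
          unit = ℝR.trans (ℝR.*-congˡ {r} (fromInt-fromℤ (+ suc m)))
            (pointwise (λ _ → ≡.trans (ℚ.*-comm (Q.inv (suc m)) (Q.nat (suc m))) (Q.nat-inv m)))

      -- The shuffle of y with yᵐ is m + 1 times yᵐ⁺¹, and m + 1 is invertible.
      Z-ys : ∀ m → Z (ys (suc m)) ≈ 0ᴿ
      Z-ys m = cancel m _ (ℝR.trans (ℝR.sym (σ-ys Z m)) (ℝR.trans (ℝR.sym (Z-shuffle (anchored-ys 1) (anchored-ys m)))
        (ℝR.trans (ℝR.*-congʳ Z-y) (ℝR.zeroˡ _))))

      neg^ : ℕ → ℝ → ℝ
      neg^ zero    a = a
      neg^ (suc m) a = -ᴿ neg^ m a

      private
        neg^-cong : ∀ m {a b} → a ≈ b → neg^ m a ≈ neg^ m b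
        neg^-cong zero    eq = eq
        neg^-cong (suc m) eq = ℝR.-‿cong (neg^-cong m eq)

        neg^-neg : ∀ m a → neg^ m (-ᴿ a) ≈ -ᴿ neg^ m a
        neg^-neg zero    a = ℝR.refl
        neg^-neg (suc m) a = ℝR.-‿cong (neg^-neg m a)

        neg^-involutive : ∀ m a → neg^ m (neg^ m a) ≈ a
        neg^-involutive zero    a = ℝR.refl
        neg^-involutive (suc m) a = ℝR.trans (ℝR.-‿cong (neg^-neg m (neg^ m a)))
          (ℝR.trans (RP.-‿involutive _) (neg^-involutive m a))

      -- The antipode relation x (w ⧢ yᵐ) = ∑ⱼ (-1)ʲ (yʲ x w) ⧢ yᵐ⁻ʲ, together with Z y = 0.
      Z-regularise : ∀ m {w} → Anchored (x ∷ w) → σᴿ.σ (Z ∘ (x ∷_)) w (ys m) ≈ neg^ m (Z (ys m ++ x ∷ w))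
      Z-regularise zero    {w} anc = σᴿ.σ-[] _ w
      Z-regularise (suc a) {w} anc = ℝR.trans
        (ℝR.trans (ℝT.solve 2 (λ s b → s ℝT.:= (s ℝT.:+ b) ℝT.:- b) ℝR.refl _ _)
          (ℝR.trans (ℝR.+-congʳ (vanish a 0)) (ℝR.+-identityˡ _)))
        (ℝR.-‿cong (ℝR.trans (descend a 0) (neg^-cong a (ℝR.reflexive (cong (λ n → Z (ys (suc n) ++ x ∷ w)) (ℕ.+-identityʳ a))))))
        where
        b : ℕ → ℕ → ℝ
        b a j = σᴿ.σ (Z ∘ (y ∷_)) (ys j ++ x ∷ w) (ys a)
        vanish : ∀ a j → σᴿ.σ Z (ys j ++ x ∷ w) (ys (suc a)) ≈ 0ᴿ
        vanish a j = ℝR.trans (ℝR.sym (Z-shuffle (anchored-ys-++ j anc) (anchored-ys (suc a))))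
          (ℝR.trans (ℝR.*-congˡ {Z (ys j ++ x ∷ w)} (Z-ys a)) (ℝR.zeroʳ _))
        descend : ∀ a j → b a j ≈ neg^ a (Z (ys (suc (a ℕ.+ j)) ++ x ∷ w))
        descend zero    j = σᴿ.σ-[] _ (ys j ++ x ∷ w)
        descend (suc a) j = ℝR.trans
          (ℝR.trans (ℝT.solve 2 (λ s b → s ℝT.:= (s ℝT.:+ b) ℝT.:- b) ℝR.refl _ (b a (suc j)))
            (ℝR.trans (ℝR.+-congʳ (vanish a (suc j))) (ℝR.+-identityˡ _)))
          (ℝR.-‿cong (ℝR.trans (descend a (suc j)) (neg^-cong a (ℝR.reflexive (cong (λ n → Z (ys (suc n) ++ x ∷ w)) (ℕ.+-suc a j))))))

      private
        nonempty : ∀ {a w} → Anchored (a ∷ w) → Lim (λ N → Q.∑< (suc N) (Q.c (x ∷ a ∷ w))) (Z (x ∷ a ∷ w))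
        nonempty anc = let k , ks , pos , eq = anchored-index anc in
          ≡.subst (λ w → Lim (λ N → Q.∑< (suc N) (Q.c (x ∷ w))) (Z (x ∷ w))) (≡.sym eq)
            (lim-≗ (λ N → ≡.sym (Q.c-sum {suc (suc k) ∷ ks} (_ ∷ pos) N)) (Z-lim k pos))

        -- Convergence is available only on nonempty words. With a nonempty first factor every
        -- shuffle is nonempty, and the induction keeps this by exchanging the roles of the factors
        -- when the first is used up.
        σ-lim : ∀ (φ : ℕ → Word → ℚ) (Φ : Word → ℝ) →
                (∀ {a w} → Anchored (a ∷ w) → Lim (λ N → φ N (a ∷ w)) (Φ (a ∷ w))) →
                ∀ {a u v} → Anchored (a ∷ u) → Anchored v → Lim (λ N → σℚ.σ (φ N) (a ∷ u) v) (σᴿ.σ Φ (a ∷ u) v)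
        σ-lim φ Φ φ→Φ {v = []}    au av = φ→Φ au
        σ-lim φ Φ φ→Φ {a} {u} {b ∷ v} au av = lim-+ (left au) (right av)
          where
          cons : ∀ a′ {a w} → Anchored (a ∷ w) → Lim (λ N → φ N (a′ ∷ a ∷ w)) (Φ (a′ ∷ a ∷ w))
          cons x anc = φ→Φ (xᴬ∷ anc)
          cons y anc = φ→Φ (yᴬ∷ anc)
          left : ∀ {a u} → Anchored (a ∷ u) → Lim (λ N → σℚ.σ (φ N ∘ (a ∷_)) u (b ∷ v)) (σᴿ.σ (Φ ∘ (a ∷_)) u (b ∷ v))
          left {u = []}    _       = cons _ av
          left {u = _ ∷ _} (yᴬ∷ au) = σ-lim (λ N → φ N ∘ (y ∷_)) (Φ ∘ (y ∷_)) (cons y) au av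
          left {u = _ ∷ _} (xᴬ∷ au) = σ-lim (λ N → φ N ∘ (x ∷_)) (Φ ∘ (x ∷_)) (cons x) au av
          right : Anchored (b ∷ v) → Lim (λ N → σℚ.σ (φ N ∘ (b ∷_)) (a ∷ u) v) (σᴿ.σ (Φ ∘ (b ∷_)) (a ∷ u) v)
          right (yᴬ∷ av) = σ-lim (λ N → φ N ∘ (y ∷_)) (Φ ∘ (y ∷_)) (cons y) au av
          right (xᴬ∷ av) = σ-lim (λ N → φ N ∘ (x ∷_)) (Φ ∘ (x ∷_)) (cons x) au av

        triangle-shuffle : ∀ m {w} (anc : Anchored w) f-0 N →
                           triangle (Q.c w) (Q.0≤c w) f-0 m N ≡ σℚ.σ (λ v → Q.∑< (suc N) (Q.c (x ∷ v))) w (ys m)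
        triangle-shuffle m {w} anc f-0 N = ≡.trans
          (Q.∑<-cong (suc N) (λ n → ≡.trans (cong (Q.inv n *_) (≡.sym (ShuffleCoefficients.c-shuffle anc (anchored-ys m) n)))
            (≡.sym (ShuffleCoefficients.σ-*ˡ (Q.inv n) (λ v → Q.c v n) w (ys m)))))
          (≡.sym (ShuffleCoefficients.σ-∑< (suc N) (λ n v → Q.c (x ∷ v) n) w (ys m)))

        -- The triangle is the truncation of x (w ⧢ yᵐ), read backwards. All its words have last
        -- letter x and converge, and `squares-triangle` carries the limit over.
        squares-lim : ∀ m {a w} (anc : Anchored (a ∷ w)) →
                      Lim (λ N → Q.∑< (suc N) (λ n → Q.c (x ∷ a ∷ w) n * h m n)) (σᴿ.σ (Z ∘ (x ∷_)) (a ∷ w) (ys m))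
        squares-lim m {a} {w} anc = lim-null triangle-lim (squares-triangle f (Q.0≤c (a ∷ w)) f-0 m (lim-cauchy triangle-lim))
          where
          f = Q.c (a ∷ w)
          f-0 = Q.c-0 a w
          triangle-lim : Lim (triangle f (Q.0≤c (a ∷ w)) f-0 m) (σᴿ.σ (Z ∘ (x ∷_)) (a ∷ w) (ys m))
          triangle-lim = lim-≗ (λ N → ≡.sym (triangle-shuffle m anc f-0 N))
            (σ-lim (λ N v → Q.∑< (suc N) (Q.c (x ∷ v))) (Z ∘ (x ∷_)) nonempty anc (anchored-ys m))

        negℚ : ℕ → ℚ → ℚ
        negℚ zero    a = a
        negℚ (suc m) a = - negℚ m a

        negℚ-lin : ∀ m a b d → negℚ m (a + b * d) ≡ negℚ m a + b * negℚ m d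
        negℚ-lin zero    a b d = ≡.refl
        negℚ-lin (suc m) a b d = ≡.trans (cong -_ (negℚ-lin m a b d))
          (solve 3 (λ a b d → :- (a :+ b :* d) := :- a :+ b :* (:- d)) ≡.refl (negℚ m a) b (negℚ m d))
          where open +-*-Solver

        negℚ-0 : ∀ m → negℚ m 0ℚ ≡ 0ℚ
        negℚ-0 zero    = ≡.refl
        negℚ-0 (suc m) = cong -_ (negℚ-0 m)

        -- The reciprocal of ∏ (1 + u / n) over n ≤ N has the coefficients (-1)ᵐ h.
        inverse-h : ∀ N m → inverse N m ≡ negℚ m (h m N)
        inverse-h zero    zero    = ≡.refl
        inverse-h zero    (suc m) = ≡.sym (negℚ-0 (suc m))
        inverse-h (suc N) zero    = ≡.refl
        inverse-h (suc N) (suc m) = ≡.trans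
          (cong₂ (λ a b → a - b) (inverse-h N (suc m)) (cong₂ _*_ (Q.p-1 N) (inverse-h (suc N) m)))
          (≡.trans (solve 3 (λ a b d → a :- b :* d := a :+ b :* (:- d)) ≡.refl (negℚ (suc m) (h (suc m) N)) (Q.inv (suc N)) (negℚ m (h m (suc N))))
            (≡.sym (negℚ-lin (suc m) (h (suc m) N) (Q.inv (suc N)) (h m (suc N)))))
          where open +-*-Solver

        -- Both sides vanish at N = 0 and have the same increments, by `P-suc` and `inverse-h`.
        P-squares : ∀ m k {ks} → All NonZero ks → ∀ N →
                    negℚ m (Q.∑< (suc N) (λ n → Q.c (word (suc (suc k) ∷ ks)) n * h m n)) ≡ P m (suc (suc k) ∷ ks) N
        P-squares m k {ks} pos zero = ≡.trans (cong (negℚ m) (≡.trans (ℚ.+-identityʳ _)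
            (≡.trans (cong (_* h m 0) (Q.c-0 x (xʸ k ∷ word ks))) (ℚ.*-zeroˡ (h m 0)))))
          (≡.trans (negℚ-0 m) (≡.sym (P-0 m (suc (suc k)) ks)))
        P-squares m k {ks} pos (suc N) = begin
          negℚ m (Q.∑< (suc (suc N)) f)
            ≡⟨ cong (negℚ m) (Q.∑<-last (suc N) f) ⟩
          negℚ m (Q.∑< (suc N) f + Q.c (word (suc (suc k) ∷ ks)) (suc N) * h m (suc N))
            ≡⟨ negℚ-lin m (Q.∑< (suc N) f) (Q.c (word (suc (suc k) ∷ ks)) (suc N)) (h m (suc N)) ⟩
          negℚ m (Q.∑< (suc N) f) + Q.c (word (suc (suc k) ∷ ks)) (suc N) * negℚ m (h m (suc N))
            ≡⟨ cong₂ _+_ (P-squares m k pos N) (cong₂ _*_ (Q.c-word (suc k) pos N) (≡.sym (inverse-h (suc N) m))) ⟩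
          P m (suc (suc k) ∷ ks) N + (Q.p (suc (suc k)) N * Q.tr ks N) * inverse (suc N) m
            ≡⟨ P-suc m (suc (suc k)) ks N ⟨
          P m (suc (suc k) ∷ ks) (suc N) ∎
          where
          open ≡.≡-Reasoning
          f : ℕ → ℚ
          f n = Q.c (word (suc (suc k) ∷ ks)) n * h m n

        lim-neg^ : ∀ m {f a} → Lim f a → Lim (λ n → negℚ m (f n)) (neg^ m a)
        lim-neg^ zero    l = l
        lim-neg^ (suc m) l = lim-neg (lim-neg^ m l)

      -- Removing the ones from the truncated sums and removing them by shuffles in `Z-regularise`
      -- lead to the same limit with the same sign (-1)ᵐ. The truncation uses the product with `h`,
      -- the shuffle side the triangle, and `squares-lim` identifies the two.
      reg-lim : ∀ m {ks} → All NonZero ks → Lim (reg m ks) (Z (ys m ++ word ks))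
      reg-lim zero [] = lim-≗ (λ N → ≡.sym (P-[] 0 N)) (lim-≈ (ℝR.sym Z-[]) (lim-seq 1ᴿ))
      reg-lim (suc m) [] = lim-≗ (λ N → ≡.sym (P-[] (suc m) N)) (lim-≈
        (ℝR.sym (ℝR.trans (ℝR.reflexive (cong Z (List.++-identityʳ (ys (suc m))))) (Z-ys m))) (lim-seq 0ᴿ))
      reg-lim m {1 ∷ ks} (_ ∷ pos) = lim-≈ (ℝR.reflexive (cong Z (shift m))) (reg-lim (suc m) pos)
        where
        shift : ∀ m → ys (suc m) ++ word ks ≡ ys m ++ y ∷ word ks
        shift zero    = ≡.refl
        shift (suc m) = cong (y ∷_) (shift m)
      reg-lim m {suc (suc k) ∷ ks} (_ ∷ pos) = lim-≗ (P-squares m k pos)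
        (lim-≈ (ℝR.trans (neg^-cong m (Z-regularise m (anchored-word (suc (suc k) ∷ ks)))) (neg^-involutive m _)) (lim-neg^ m (limit k)))
        where
        limit : ∀ k → Lim (λ N → Q.∑< (suc N) (λ n → Q.c (x ∷ xʸ k ∷ word ks) n * h m n)) (σᴿ.σ (Z ∘ (x ∷_)) (xʸ k ∷ word ks) (ys m))
        limit zero    = squares-lim m (anchored-word (1 ∷ ks))
        limit (suc k) = squares-lim m (anchored-word (suc (suc k) ∷ ks))

      private
        module S = Star ℝ-ring (Z ∘ word)
        module G (N : ℕ) = Star ℚ-ring (λ L → reg 0 L N)

        rows : List ℕ → List (List ℕ)
        rows = map [_]

        E-lim : ∀ us (h : ℕ → List ℕ → ℚ) (H : List ℕ → ℝ) → All (All NonZero) us →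
                (∀ {U} → All NonZero U → Lim (λ N → h N U) (H U)) → Lim (λ N → G.E N (h N) us) (S.E H us)
        E-lim []       h H _ h→H = h→H []
        E-lim (u ∷ us) h H (pu ∷ pus) h→H = lim-+
          (lim-* (h→H []) (E-lim us (λ N U → reg 0 (u ++ U) N) (λ U → Z (word (u ++ U))) pus (λ pU → reg-lim 0 (All.++⁺ pu pU))))
          (lim-neg (E-lim us (λ N U → h N (u ++ U)) (λ U → H (u ++ U)) pus (λ pU → h→H (All.++⁺ pu pU))))
          where import Data.List.Relation.Unary.All.Properties as All

        C-lim : ∀ {ks} v → All NonZero ks → All NonZero v → Lim (λ N → G.C N (rows ks) v) (S.C (rows ks) v)
        C-lim v [] pv = reg-lim 0 pv
        C-lim {k ∷ ks} v (pk ∷ pks) pv = lim-+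
          (E-lim (rows ks ∷ʳ v) (λ N U → reg 0 (k ∷ U) N) (λ U → Z (word (k ∷ U))) (All.++⁺ (All.map⁺ (All.map (_∷ []) pks)) (pv ∷ []))
            (λ pU → reg-lim 0 (pk ∷ pU)))
          (lim-neg (C-lim (v ++ [ k ]) pks (All.++⁺ pv (pk ∷ []))))
          where import Data.List.Relation.Unary.All.Properties as All

      -- For each N this is the evaluation of the closed chain. Regularised truncations converge
      -- also at rows with leading ones, so all terms of `C` have limits.
      C-value : ∀ {ks k} → All NonZero ks → 2 ℕ.≤ k → S.C (rows ks) [ k ] ≈ Z (word [ sum ks ℕ.+ k ])
      C-value {ks} {suc (suc k)} pos 2≤k = lim-unique
        (lim-≗ (λ N → C-reg-value N Q.p-0 Q.p-+ ks (suc (suc k)) pos 2≤k) (C-lim [ suc (suc k) ] pos (_ ∷ [])))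
        (≡.subst (λ n → Lim (Q.tr [ n ]) (Z (word [ n ]))) (≡.sym weight) (Z-lim (k ℕ.+ sum ks) []))
        where
        weight : sum ks ℕ.+ suc (suc k) ≡ suc (suc (k ℕ.+ sum ks))
        weight = ℕ.+-comm (sum ks) (suc (suc k))
      C-value {k = 1} pos (ℕ.s≤s ())

-- Lists ordered along chains

module ChainOrders where

  open import Algebra.Bundles using (CommutativeRing)
  open import Level using (0ℓ)
  open import Defs using (insertions; permutations)
  open import Data.Bool using (Bool; true; false; if_then_else_; _∧_)
  import Data.Bool.Properties as Bool
  open import Data.Empty using (⊥-elim)
  open import Data.List using (List; []; _∷_; _++_; map; concat; concatMap)
  import Data.List.Properties as List
  open import Data.List.Membership.Propositional using (_∈_; _∉_)
  open import Data.List.Membership.Propositional.Properties using (∈-++⁺ˡ; ∈-++⁺ʳ; ∈-++⁻)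
  open import Data.List.Relation.Unary.All as All using (All; []; _∷_)
  import Data.List.Relation.Unary.All.Properties as All
  open import Data.List.Relation.Unary.AllPairs as AllPairs using ([]; _∷_)
  open import Data.List.Relation.Unary.Any using (here; there)
  open import Data.List.Relation.Unary.Unique.Propositional using (Unique)
  import Data.List.Relation.Unary.Unique.Propositional.Properties as Unique
  open import Data.List.Relation.Binary.Permutation.Propositional as Perm using (_↭_; ↭-sym; ↭-trans; ↭-refl)
  import Data.List.Relation.Binary.Permutation.Propositional.Properties as Perm
  open import Data.Product using (_×_; _,_; proj₁; proj₂)
  open import Data.Sum using (_⊎_; inj₁; inj₂)
  open import Function using (_∘_)
  open import Relation.Binary using (DecidableEquality)
  open import Relation.Binary.PropositionalEquality as ≡ using (_≡_; _≢_; cong; cong₂)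
  open import Relation.Nullary using (does; yes; no)
  open RingSums

  module Sublists {A : Set} (_≟_ : DecidableEquality A) where

    -- Greedy, so that ord tests for a sublist only when the second list has no repetitions.
    ord : List A → List A → Bool
    ord []      ps       = true
    ord (a ∷ s) []       = false
    ord (a ∷ s) (p ∷ ps) = if does (a ≟ p) then ord s ps else ord (a ∷ s) ps

    ord-here : ∀ a s ps → ord (a ∷ s) (a ∷ ps) ≡ ord s ps
    ord-here a s ps with a ≟ a
    ... | yes _ = ≡.refl
    ... | no ¬p = ⊥-elim (¬p ≡.refl)

    ord-there : ∀ {a p} s ps → a ≢ p → ord (a ∷ s) (p ∷ ps) ≡ ord (a ∷ s) ps
    ord-there {a} {p} s ps a≢p with a ≟ p
    ... | yes eq = ⊥-elim (a≢p eq)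
    ... | no _   = ≡.refl

    ord-tail : ∀ a s ps → ord (a ∷ s) ps ≡ true → ord s ps ≡ true
    ord-mono : ∀ s p ps → ord s ps ≡ true → ord s (p ∷ ps) ≡ true

    ord-tail a s (p ∷ ps) h with a ≟ p
    ... | yes _ = ord-mono s p ps h
    ... | no _  = ord-mono s p ps (ord-tail a s ps h)

    ord-mono []      p ps h = ≡.refl
    ord-mono (a ∷ s) p ps h with a ≟ p
    ... | yes _ = ord-tail a s ps h
    ... | no _  = h

    ord-refl : ∀ s → ord s s ≡ true
    ord-refl []      = ≡.refl
    ord-refl (a ∷ s) = ≡.trans (ord-here a s s) (ord-refl s)

    ord-∉ : ∀ {a} s ps → a ∉ ps → ord (a ∷ s) ps ≡ false
    ord-∉ s []       a∉ = ≡.refl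
    ord-∉ s (p ∷ ps) a∉ = ≡.trans (ord-there s ps (λ eq → a∉ (here eq))) (ord-∉ s ps (a∉ ∘ there))

    ord-skip : ∀ s {p} ps → p ∉ s → ord s (p ∷ ps) ≡ ord s ps
    ord-skip []      ps p∉ = ≡.refl
    ord-skip (a ∷ s) ps p∉ = ord-there s ps (λ eq → p∉ (here (≡.sym eq)))

    private
      ∷-∉ : ∀ {p : A} {ps} → Unique (p ∷ ps) → p ∉ ps
      ∷-∉ (p≢ ∷ _) p∈ = All.lookup p≢ p∈ ≡.refl

    ord-∉₂ : ∀ a {b} t ps → b ∉ ps → ord (a ∷ b ∷ t) ps ≡ false
    ord-∉₂ a {b} t ps b∉ = Bool.¬-not (λ h → Bool.not-¬ (ord-tail a (b ∷ t) ps h) (ord-∉ t ps b∉))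

    -- In a list without repetitions `b` has a single position, so the part up to `b` and the part
    -- from `b` on can be tested independently.
    ord-link : ∀ a b s ps → a ≢ b → Unique ps → ord (a ∷ b ∷ s) ps ≡ ord (a ∷ b ∷ []) ps ∧ ord (b ∷ s) ps
    ord-link a b s [] a≢b _ = ≡.refl
    ord-link a b s (p ∷ ps) a≢b u@(_ ∷ ups) with a ≟ p
    ... | yes ≡.refl = ≡.trans (single (ord (b ∷ s) ps) ≡.refl) (cong (ord (b ∷ []) ps ∧_) (≡.sym (ord-there s ps (a≢b ∘ ≡.sym))))
      where
      single : ∀ r → ord (b ∷ s) ps ≡ r → ord (b ∷ s) ps ≡ ord (b ∷ []) ps ∧ ord (b ∷ s) ps
      single true  eq rewrite eq = ≡.sym (≡.trans (Bool.∧-identityʳ _) (prefix ps eq))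
        where
        prefix : ∀ ps → ord (b ∷ s) ps ≡ true → ord (b ∷ []) ps ≡ true
        prefix (p ∷ ps) h with b ≟ p
        ... | yes _ = ≡.refl
        ... | no _  = prefix ps h
      single false eq rewrite eq = ≡.sym (Bool.∧-zeroʳ _)
    ... | no a≢p with b ≟ p
    ...   | yes ≡.refl = ≡.trans (ord-∉₂ a s ps (∷-∉ u)) (≡.sym (cong (_∧ ord s ps) (ord-∉₂ a [] ps (∷-∉ u))))
    ...   | no b≢p = ord-link a b s ps a≢b ups

    last : A → List A → A
    last a []      = a
    last a (b ∷ s) = last b s

    ord-++ : ∀ a s b t ps → Unique ((a ∷ s) ++ b ∷ t) → Unique ps →
             ord ((a ∷ s) ++ b ∷ t) ps ≡ ord (a ∷ s) ps ∧ (ord (last a s ∷ b ∷ []) ps ∧ ord (b ∷ t) ps)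
    ord-++ a [] b t ps u ups = ≡.trans (ord-link a b t ps a≢b ups) (absorb (ord (a ∷ []) ps) (ord (a ∷ b ∷ []) ps) _ implied)
      where
      a≢b : a ≢ b
      a≢b eq = ∷-∉ u (here eq)
      implied : ord (a ∷ b ∷ []) ps ≡ true → ord (a ∷ []) ps ≡ true
      implied h = prefix ps h
        where
        prefix : ∀ ps → ord (a ∷ b ∷ []) ps ≡ true → ord (a ∷ []) ps ≡ true
        prefix (p ∷ ps) h with a ≟ p
        ... | yes _ = ≡.refl
        ... | no _  = prefix ps h
      absorb : ∀ p q r → (q ≡ true → p ≡ true) → q ∧ r ≡ p ∧ (q ∧ r)
      absorb true  q     r h = ≡.refl
      absorb false false r h = ≡.refl
      absorb false true  r h with () ← h ≡.refl
    ord-++ a (c ∷ s) b t ps u@(_ ∷ u′) ups = begin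
      ord (a ∷ c ∷ s ++ b ∷ t) ps
        ≡⟨ ord-link a c (s ++ b ∷ t) ps a≢c ups ⟩
      ord (a ∷ c ∷ []) ps ∧ ord (c ∷ s ++ b ∷ t) ps
        ≡⟨ cong (ord (a ∷ c ∷ []) ps ∧_) (ord-++ c s b t ps u′ ups) ⟩
      ord (a ∷ c ∷ []) ps ∧ (ord (c ∷ s) ps ∧ rest)
        ≡⟨ Bool.∧-assoc (ord (a ∷ c ∷ []) ps) (ord (c ∷ s) ps) rest ⟨
      (ord (a ∷ c ∷ []) ps ∧ ord (c ∷ s) ps) ∧ rest
        ≡⟨ cong (_∧ rest) (ord-link a c s ps a≢c ups) ⟨
      ord (a ∷ c ∷ s) ps ∧ rest ∎
      where
      open ≡.≡-Reasoning
      rest = ord (last c s ∷ b ∷ []) ps ∧ ord (b ∷ t) ps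
      a≢c : a ≢ c
      a≢c eq = ∷-∉ u (here eq)

    private
      ord-∈ : ∀ {q ps} → q ∈ ps → ord (q ∷ []) ps ≡ true
      ord-∈ {q} {_ ∷ ps} (here ≡.refl) = ord-here q [] ps
      ord-∈ {q} {p ∷ ps} (there q∈)    = ord-mono (q ∷ []) p ps (ord-∈ q∈)

      ∈-tail : ∀ {q p : A} {ps} → q ≢ p → q ∈ (p ∷ ps) → q ∈ ps
      ∈-tail q≢p (here eq)  = ⊥-elim (q≢p eq)
      ∈-tail q≢p (there q∈) = q∈

    -- The dichotomy that permits replacing a link by 1 minus the reversed link.
    ord-total : ∀ {a b ps} → a ≢ b → a ∈ ps → b ∈ ps → Unique ps →
                (ord (a ∷ b ∷ []) ps ≡ true × ord (b ∷ a ∷ []) ps ≡ false) ⊎ (ord (a ∷ b ∷ []) ps ≡ false × ord (b ∷ a ∷ []) ps ≡ true)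
    ord-total {a} {b} {p ∷ ps} a≢b a∈ b∈ u@(_ ∷ ups) with a ≟ p | b ≟ p
    ... | yes ≡.refl | yes ≡.refl = ⊥-elim (a≢b ≡.refl)
    ... | yes ≡.refl | no b≢p     = inj₁ (ord-∈ (∈-tail b≢p b∈) , ord-∉₂ b [] ps (∷-∉ u))
    ... | no a≢p     | yes ≡.refl = inj₂ (ord-∉₂ a [] ps (∷-∉ u) , ord-∈ (∈-tail a≢p a∈))
    ... | no a≢p     | no b≢p     = ord-total a≢b (∈-tail a≢p a∈) (∈-tail b≢p b∈) ups

    insertions-↭ : ∀ (a : A) ps → All (_↭ (a ∷ ps)) (insertions a ps)
    insertions-↭ a []       = ↭-refl ∷ []
    insertions-↭ a (p ∷ ps) = ↭-refl ∷ All.map⁺ (All.map (λ q → ↭-trans (Perm.prep p q) (Perm.swap p a ↭-refl)) (insertions-↭ a ps))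

    permutations-↭ : ∀ (es : List A) → All (_↭ es) (permutations es)
    permutations-↭ []       = ↭-refl ∷ []
    permutations-↭ (a ∷ es) = All.concat⁺ (All.map⁺ (All.map
      (λ {ps} q → All.map (λ r → ↭-trans r (Perm.prep a q)) (insertions-↭ a ps)) (permutations-↭ es)))

    unique-↭ : ∀ {es ps : List A} → es ↭ ps → Unique es → Unique ps
    unique-↭ Perm.refl         u = u
    unique-↭ (Perm.prep a q)   (a≢ ∷ u) = Perm.All-resp-↭ q a≢ ∷ unique-↭ q u
    unique-↭ (Perm.swap a b q) ((a≢b ∷ a≢) ∷ b≢ ∷ u) =
      ((a≢b ∘ ≡.sym) ∷ Perm.All-resp-↭ q b≢) ∷ Perm.All-resp-↭ q a≢ ∷ unique-↭ q u
    unique-↭ (Perm.trans q r)  u = unique-↭ r (unique-↭ q u)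

    -- The constructors follow the cases of the recursion for shuffles, so that each choice of
    -- positions occurs exactly once, also when one list is empty.
    data Interleaving : List A → List A → List A → Set where
      nilˡ  : ∀ {q} → Interleaving [] q q
      nilʳ  : ∀ {a c} → Interleaving (a ∷ c) [] (a ∷ c)
      left  : ∀ {a c b q e} → Interleaving c (b ∷ q) e → Interleaving (a ∷ c) (b ∷ q) (a ∷ e)
      right : ∀ {a c b q e} → Interleaving (a ∷ c) q e → Interleaving (a ∷ c) (b ∷ q) (b ∷ e)

    interleaving-ord : ∀ {c q e} → Interleaving c q e → ord c e ≡ true
    interleaving-ord nilˡ                  = ≡.refl
    interleaving-ord (nilʳ {a} {c})        = ord-refl (a ∷ c)
    interleaving-ord (left {a} {c} {e = e} i) = ≡.trans (ord-here a c e) (interleaving-ord i)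
    interleaving-ord (right {a} {c} {b} {e = e} i) = ord-mono (a ∷ c) b e (interleaving-ord i)

    interleaving-∉ : ∀ {c q e p} → Interleaving c q e → p ∉ c → p ∉ q → p ∉ e
    interleaving-∉ nilˡ      p∉c p∉q = p∉q
    interleaving-∉ nilʳ      p∉c p∉q = p∉c
    interleaving-∉ (left i)  p∉c p∉q (here eq)  = p∉c (here eq)
    interleaving-∉ (left i)  p∉c p∉q (there p∈) = interleaving-∉ i (p∉c ∘ there) p∉q p∈
    interleaving-∉ (right i) p∉c p∉q (here eq)  = p∉q (here eq)
    interleaving-∉ (right i) p∉c p∉q (there p∈) = interleaving-∉ i p∉c (p∉q ∘ there) p∈

    interleaving-ordʳ : ∀ {c q e} s → Interleaving c q e → (∀ {p} → p ∈ s → p ∉ c) → ord s e ≡ ord s q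
    interleaving-ordʳ s       nilˡ disj = ≡.refl
    interleaving-ordʳ []      nilʳ disj = ≡.refl
    interleaving-ordʳ (p ∷ s) (nilʳ {a} {c}) disj = ord-∉ s (a ∷ c) (disj (here ≡.refl))
    interleaving-ordʳ s (left {a} {e = e} i) disj = ≡.trans (ord-skip s e (λ a∈ → disj a∈ (here ≡.refl)))
      (interleaving-ordʳ s i (λ p∈ p∈c → disj p∈ (there p∈c)))
    interleaving-ordʳ []      (right i) disj = ≡.refl
    interleaving-ordʳ (p ∷ s) (right {b = b} i) disj with p ≟ b
    ... | yes _ = interleaving-ordʳ s i (disj ∘ there)
    ... | no _  = interleaving-ordʳ (p ∷ s) i disj

    Chain : Set
    Chain = A × List A

    list : Chain → List A
    list (a , s) = a ∷ s

    elements : List Chain → List A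
    elements cs = concat (map list cs)

    -- ps contains each chain in its order, and the first element of each chain before the last
    -- element of the next one.
    good : Chain → List Chain → List A → Bool
    good (a , s) []             ps = ord (a ∷ s) ps
    good (a , s) ((b , t) ∷ cs) ps = ord (a ∷ s) ps ∧ (ord (a ∷ last b t ∷ []) ps ∧ good (b , t) cs ps)

    infixr 5 _⧺_
    -- The first argument lies below the second. The merged chain keeps its first element, to which
    -- the link to the following chain is attached; so the remaining links are unaffected by
    -- merging.
    _⧺_ : Chain → Chain → Chain
    (b , t) ⧺ c = b , t ++ list c

    last-∈ : ∀ a s → last a s ∈ a ∷ s
    last-∈ a []      = here ≡.refl
    last-∈ a (b ∷ s) = there (last-∈ b s)

    private
      rearrange : ∀ p q r → p ∧ (q ∧ r) ≡ r ∧ (q ∧ p)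
      rearrange true  true  true  = ≡.refl
      rearrange true  true  false = ≡.refl
      rearrange true  false true  = ≡.refl
      rearrange true  false false = ≡.refl
      rearrange false true  true  = ≡.refl
      rearrange false true  false = ≡.refl
      rearrange false false true  = ≡.refl
      rearrange false false false = ≡.refl

      rearrange₄ : ∀ p q r z → (p ∧ (q ∧ r)) ∧ z ≡ r ∧ (q ∧ (p ∧ z))
      rearrange₄ true  q     r z = ≡.trans (cong (_∧ z) (Bool.∧-comm q r)) (Bool.∧-assoc r q z)
      rearrange₄ false true  true  z = ≡.refl
      rearrange₄ false true  false z = ≡.refl
      rearrange₄ false false true  z = ≡.refl
      rearrange₄ false false false z = ≡.refl

    good-⧺ : ∀ {a s b t} cs {ps} → Unique ((b ∷ t) ++ a ∷ s) → Unique ps →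
             good ((b , t) ⧺ (a , s)) cs ps ≡ ord (a ∷ s) ps ∧ (ord (last b t ∷ a ∷ []) ps ∧ good (b , t) cs ps)
    good-⧺ {a} {s} {b} {t} [] {ps} u ups = ≡.trans (ord-++ b t a s ps u ups) (rearrange (ord (b ∷ t) ps) (ord (last b t ∷ a ∷ []) ps) (ord (a ∷ s) ps))
    good-⧺ {a} {s} {b} {t} ((d , v) ∷ cs) {ps} u ups = ≡.trans
      (cong (_∧ (ord (b ∷ last d v ∷ []) ps ∧ good (d , v) cs ps)) (ord-++ b t a s ps u ups))
      (rearrange₄ (ord (b ∷ t) ps) (ord (last b t ∷ a ∷ []) ps) (ord (a ∷ s) ps) _)

    good-interleaving : ∀ {c q e} a s cs → Interleaving c q e → (∀ {p} → p ∈ elements ((a , s) ∷ cs) → p ∉ c) →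
                        good (a , s) cs e ≡ good (a , s) cs q
    good-interleaving a s [] i disj = interleaving-ordʳ (a ∷ s) i (disj ∘ ∈-++⁺ˡ)
    good-interleaving a s ((b , t) ∷ cs) i disj = cong₂ _∧_ (interleaving-ordʳ (a ∷ s) i (disj ∘ ∈-++⁺ˡ))
      (cong₂ _∧_ (interleaving-ordʳ (a ∷ last b t ∷ []) i (λ
          { (here ≡.refl)         → disj (here ≡.refl)
          ; (there (here ≡.refl)) → disj (∈-++⁺ʳ (a ∷ s) (∈-++⁺ˡ (last-∈ b t))) }))
        (good-interleaving b t cs i (disj ∘ ∈-++⁺ʳ (a ∷ s))))

    module _ (P : A → Set) where
      data Starts : List A → Set where
        []   : Starts []
        _∷ˢ_ : ∀ {p} → P p → ∀ ps → Starts (p ∷ ps)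

      private
        ord-missing : ∀ {p} s ps → p ∈ s → p ∉ ps → ord s ps ≡ false
        ord-missing (a ∷ s) ps (here ≡.refl) p∉ = ord-∉ s ps p∉
        ord-missing (a ∷ s) ps (there p∈)    p∉ = Bool.¬-not (λ h → Bool.not-¬ (ord-tail a s ps h) (ord-missing s ps p∈ p∉))

        true≢false : ∀ {b} → b ≡ true → b ≡ false → ∀ {X : Set} → X
        true≢false ≡.refl ()

        ∧-true : ∀ p {q} → p ∧ q ≡ true → p ≡ true × q ≡ true
        ∧-true true h = ≡.refl , h

        head-first : ∀ {p ps} a s → P a → p ∈ a ∷ s → p ∉ ps → ord (a ∷ s) (p ∷ ps) ≡ true → P p
        head-first a s pa (here ≡.refl) p∉ h = pa
        head-first {p} {ps} a s pa (there p∈) p∉ h with a ≟ p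
        ... | yes ≡.refl = pa
        ... | no _       = true≢false h (ord-missing (a ∷ s) ps (there p∈) p∉)

        first : ∀ {p ps} a s cs → All (P ∘ proj₁) ((a , s) ∷ cs) → p ∈ elements ((a , s) ∷ cs) → p ∉ ps →
                good (a , s) cs (p ∷ ps) ≡ true → P p
        first a s [] (pa ∷ _) p∈ p∉ h with ∈-++⁻ (a ∷ s) p∈
        ... | inj₁ p∈s = head-first a s pa p∈s p∉ h
        first {p} {ps} a s ((b , t) ∷ cs) (pa ∷ pcs) p∈ p∉ h with ∈-++⁻ (a ∷ s) p∈
        ... | inj₁ p∈s = head-first a s pa p∈s p∉ (proj₁ (∧-true (ord (a ∷ s) (p ∷ ps)) h))
        ... | inj₂ p∈′ = first b t cs pcs p∈′ p∉ (proj₂ (∧-true (ord (a ∷ last b t ∷ []) (p ∷ ps)) (proj₂ (∧-true (ord (a ∷ s) (p ∷ ps)) h))))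

      -- Within its own chain, the first element of a permitted list has nothing below it, so it is
      -- the head of that chain. For the labels this says that the word starts with y, where values
      -- multiply by shuffles.
      good-starts : ∀ {ps} a s cs → All (P ∘ proj₁) ((a , s) ∷ cs) → (∀ {p} → p ∈ ps → p ∈ elements ((a , s) ∷ cs)) →
                    Unique ps → good (a , s) cs ps ≡ true → Starts ps
      good-starts {[]}     a s cs pcs sub u h = []
      good-starts {p ∷ ps} a s cs pcs sub u h = first a s cs pcs (sub (here ≡.refl)) (∷-∉ u) h ∷ˢ ps

  -- Sums over linear extensions by inclusion-exclusion

  module PermutationSums (R : CommutativeRing 0ℓ 0ℓ) {A : Set} (_≟_ : DecidableEquality A) where
    open CommutativeRing R hiding (zero)
    open RingTools R
    open Sublists _≟_
    open import Relation.Binary.Reasoning.Setoid setoid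

    ind : Bool → Carrier
    ind b = if b then 1# else 0#

    ind-∧ : ∀ a b → ind (a ∧ b) ≈ ind a * ind b
    ind-∧ true  b = sym (*-identityˡ _)
    ind-∧ false b = sym (zeroˡ _)

    ∑-cong-All : ∀ {B : Set} {P : B → Set} {bs f g} → All P bs → (∀ {b} → P b → f b ≈ g b) → ∑ bs f ≈ ∑ bs g
    ∑-cong-All []         eq = refl
    ∑-cong-All (pb ∷ pbs) eq = +-cong (eq pb) (∑-cong-All pbs eq)

    I : (List A → Carrier) → List A → List A → Carrier
    I φ []      q       = φ q
    I φ (a ∷ c) []      = φ (a ∷ c)
    I φ (a ∷ c) (b ∷ q) = I (φ ∘ (a ∷_)) c (b ∷ q) + I (φ ∘ (b ∷_)) (a ∷ c) q

    I-cong : ∀ c q {f g} → (∀ {e} → Interleaving c q e → f e ≈ g e) → I f c q ≈ I g c q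
    I-cong []      q       eq = eq nilˡ
    I-cong (a ∷ c) []      eq = eq nilʳ
    I-cong (a ∷ c) (b ∷ q) eq = +-cong (I-cong c (b ∷ q) (eq ∘ left)) (I-cong (a ∷ c) q (eq ∘ right))

    I-*ˡ : ∀ c q d f → I (λ e → d * f e) c q ≈ d * I f c q
    I-*ˡ []      q       d f = refl
    I-*ˡ (a ∷ c) []      d f = refl
    I-*ˡ (a ∷ c) (b ∷ q) d f = trans (+-cong (I-*ˡ c (b ∷ q) d (f ∘ (a ∷_))) (I-*ˡ (a ∷ c) q d (f ∘ (b ∷_)))) (sym (distribˡ d _ _))

    private
      -- The sum of Ψ (l ++ a ∷ r) over the decompositions l ++ r such that c is a sublist of r.
      J : A → List A → (List A → Carrier) → List A → Carrier
      J a c Ψ []      = ind (ord c []) * Ψ (a ∷ [])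
      J a c Ψ (b ∷ e) = ind (ord c (b ∷ e)) * Ψ (a ∷ b ∷ e) + J a c (Ψ ∘ (b ∷_)) e

      J-insertions : ∀ a c Ψ ps → a ∉ ps → ∑ (insertions a ps) (λ ps′ → ind (ord (a ∷ c) ps′) * Ψ ps′) ≈ J a c Ψ ps
      J-insertions a c Ψ []       a∉ = trans (+-identityʳ _) (*-congʳ (reflexive (cong ind (ord-here a c []))))
      J-insertions a c Ψ (b ∷ ps) a∉ = +-cong (*-congʳ (reflexive (cong ind (ord-here a c (b ∷ ps)))))
        (trans (∑-map (b ∷_) (insertions a ps) _) (trans
          (∑-cong (insertions a ps) (λ ps′ → *-congʳ (reflexive (cong ind (ord-there c ps′ (λ eq → a∉ (here eq)))))))
          (J-insertions a c (Ψ ∘ (b ∷_)) ps (a∉ ∘ there))))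

      J-false : ∀ a c Ψ ps → ord c ps ≡ false → J a c Ψ ps ≈ 0#
      J-false a c Ψ []       eq rewrite eq = zeroˡ _
      J-false a c Ψ (b ∷ ps) eq rewrite eq = trans (+-cong (zeroˡ _) (J-false a c (Ψ ∘ (b ∷_)) ps
        (Bool.¬-not (λ h → Bool.not-¬ (ord-mono c b ps h) eq)))) (+-identityˡ _)

      J-ord : ∀ a c Ψ ps → J a c Ψ ps ≈ ind (ord c ps) * J a c Ψ ps
      J-ord a c Ψ ps with ord c ps in eq
      ... | true  = sym (*-identityˡ _)
      ... | false = trans (J-false a c Ψ ps eq) (sym (zeroˡ _))

      -- Every interleaving of `a ∷ c` with `q` arises exactly once by interleaving `c` with `q` and
      -- then placing `a` in front of all of `c`.
      I-J : ∀ a c q Ψ → (∀ {p} → p ∈ c → p ∉ q) → Unique c → I (J a c Ψ) c q ≈ I Ψ (a ∷ c) q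
      I-J a []      []      Ψ disj u = *-identityˡ _
      I-J a []      (b ∷ q) Ψ disj u = +-cong (*-identityˡ _) (I-J a [] q (Ψ ∘ (b ∷_)) (λ ()) u)
      I-J a (d ∷ c) []      Ψ disj u = trans (+-cong
        (trans (*-congʳ (reflexive (cong ind (ord-refl (d ∷ c))))) (*-identityˡ _))
        (J-false a (d ∷ c) _ c (ord-∉ c c (λ d∈ → All.lookup (AllPairs.head u) d∈ ≡.refl)))) (+-identityʳ _)
      I-J a (d ∷ c) (b ∷ q) Ψ disj u = begin
        I (J a (d ∷ c) Ψ ∘ (d ∷_)) c (b ∷ q) + I (J a (d ∷ c) Ψ ∘ (b ∷_)) (d ∷ c) q
          ≈⟨ +-cong (I-cong c (b ∷ q) (λ {e} i → trans (+-cong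
                      (trans (*-congʳ (reflexive (cong ind (≡.trans (ord-here d c e) (interleaving-ord i))))) (*-identityˡ _))
                      (J-false a (d ∷ c) (Ψ ∘ (d ∷_)) e (ord-∉ c e (interleaving-∉ i (λ d∈ → All.lookup (AllPairs.head u) d∈ ≡.refl) (disj (here ≡.refl))))))
                      (+-identityʳ _)))
                    (trans (I-cong (d ∷ c) q (λ {e} i → +-congʳ (trans (*-congʳ (reflexive (cong ind (ord-mono (d ∷ c) b e (interleaving-ord i))))) (*-identityˡ _))))
                      (trans (I-+ (d ∷ c) q (λ e → Ψ (a ∷ b ∷ e)) _) (+-congˡ (I-J a (d ∷ c) q (Ψ ∘ (b ∷_)) (λ p∈ → disj p∈ ∘ there) u)))) ⟩
        I (λ e → Ψ (a ∷ d ∷ e)) c (b ∷ q) + (I (λ e → Ψ (a ∷ b ∷ e)) (d ∷ c) q + I (Ψ ∘ (b ∷_)) (a ∷ d ∷ c) q)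
          ≈⟨ sym (+-assoc _ _ _) ⟩
        I Ψ (a ∷ d ∷ c) (b ∷ q) ∎
        where
        I-+ : ∀ c q f g → I (λ e → f e + g e) c q ≈ I f c q + I g c q
        I-+ []      q       f g = refl
        I-+ (a ∷ c) []      f g = refl
        I-+ (a ∷ c) (b ∷ q) f g = trans (+-cong (I-+ c (b ∷ q) _ _) (I-+ (a ∷ c) q _ _))
          (solve 4 (λ p q r s → (p :+ q) :+ (r :+ s) := (p :+ r) :+ (q :+ s)) refl _ _ _ _)

    -- The elements of `c` stand first in the list and are therefore inserted last, its head at the
    -- very end. The order condition allows each of them only places in front of those of `c`
    -- inserted before, and `I-J` collects these places.
    permutations-chain : ∀ c es Ψ → Unique (c ++ es) →
                         ∑ (permutations (c ++ es)) (λ ps → ind (ord c ps) * Ψ ps) ≈ ∑ (permutations es) (I Ψ c)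
    permutations-chain []      es Ψ u = ∑-cong (permutations es) (λ ps → *-identityˡ _)
    permutations-chain (a ∷ c) es Ψ u@(a≢ ∷ u′) = begin
      ∑ (concatMap (insertions a) (permutations (c ++ es))) (λ ps → ind (ord (a ∷ c) ps) * Ψ ps)
        ≈⟨ ∑-concatMap (insertions a) (permutations (c ++ es)) _ ⟩
      ∑ (permutations (c ++ es)) (λ ps → ∑ (insertions a ps) (λ ps → ind (ord (a ∷ c) ps) * Ψ ps))
        ≈⟨ ∑-cong-All (permutations-↭ (c ++ es)) (λ {ps} q → trans
             (J-insertions a c Ψ ps (λ a∈ → All.lookup a≢ (Perm.∈-resp-↭ q a∈) ≡.refl)) (J-ord a c Ψ ps)) ⟩
      ∑ (permutations (c ++ es)) (λ ps → ind (ord c ps) * J a c Ψ ps)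
        ≈⟨ permutations-chain c es (J a c Ψ) u′ ⟩
      ∑ (permutations es) (I (J a c Ψ) c)
        ≈⟨ ∑-cong-All (permutations-↭ es) (λ {ps} q → I-J a c ps Ψ (λ p∈c p∈ps → disjoint p∈c (Perm.∈-resp-↭ q p∈ps)) (Unique-++ˡ c u′)) ⟩
      ∑ (permutations es) (I Ψ (a ∷ c)) ∎
      where
      Unique-++ˡ : ∀ c {es} → Unique (c ++ es) → Unique c
      Unique-++ˡ []      _        = []
      Unique-++ˡ (b ∷ c) (b≢ ∷ u) = All.++⁻ˡ c b≢ ∷ Unique-++ˡ c u
      disjoint : ∀ {p} → p ∈ c → p ∉ es
      disjoint = go c u′
        where
        go : ∀ c → Unique (c ++ es) → ∀ {p} → p ∈ c → p ∉ es
        go (b ∷ c) (b≢ ∷ _) (here ≡.refl) p∈es = All.lookup b≢ (∈-++⁺ʳ c p∈es) ≡.refl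
        go (b ∷ c) (_ ∷ u)  (there p∈)    p∈es = go c u p∈ p∈es

    private
      insertions-swap : ∀ (a b : A) ps Ψ → ∑ (insertions b ps) (λ ps′ → ∑ (insertions a ps′) Ψ)
                                   ≈ ∑ (insertions a ps) (λ ps′ → ∑ (insertions b ps′) Ψ)
      insertions-swap a b []       Ψ = solve 3 (λ p q z → (p :+ (q :+ z)) :+ z := (q :+ (p :+ z)) :+ z) refl _ _ 0#
      insertions-swap a b (p ∷ ps) Ψ = begin
        (Ψ (a ∷ b ∷ p ∷ ps) + ∑ (map (b ∷_) (insertions a (p ∷ ps))) Ψ) + ∑ (map (p ∷_) (insertions b ps)) (λ ps′ → ∑ (insertions a ps′) Ψ)
          ≈⟨ expand a b ⟩
        (Ψ (a ∷ b ∷ p ∷ ps) + (Ψ (b ∷ a ∷ p ∷ ps) + s₁)) + (s₂ + ∑ (insertions b ps) (λ ps′ → ∑ (insertions a ps′) (Ψ ∘ (p ∷_))))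
          ≈⟨ +-congˡ (+-congˡ (insertions-swap a b ps (Ψ ∘ (p ∷_)))) ⟩
        (Ψ (a ∷ b ∷ p ∷ ps) + (Ψ (b ∷ a ∷ p ∷ ps) + s₁)) + (s₂ + ∑ (insertions a ps) (λ ps′ → ∑ (insertions b ps′) (Ψ ∘ (p ∷_))))
          ≈⟨ solve 5 (λ u v s t w → (u :+ (v :+ s)) :+ (t :+ w) := (v :+ (u :+ t)) :+ (s :+ w)) refl _ _ _ _ _ ⟩
        (Ψ (b ∷ a ∷ p ∷ ps) + (Ψ (a ∷ b ∷ p ∷ ps) + s₂)) + (s₁ + ∑ (insertions a ps) (λ ps′ → ∑ (insertions b ps′) (Ψ ∘ (p ∷_))))
          ≈⟨ sym (expand b a) ⟩
        (Ψ (b ∷ a ∷ p ∷ ps) + ∑ (map (a ∷_) (insertions b (p ∷ ps))) Ψ) + ∑ (map (p ∷_) (insertions a ps)) (λ ps′ → ∑ (insertions b ps′) Ψ) ∎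
        where
        s₁ = ∑ (insertions a ps) (λ ps′ → Ψ (b ∷ p ∷ ps′))
        s₂ = ∑ (insertions b ps) (λ ps′ → Ψ (a ∷ p ∷ ps′))
        expand : ∀ a b → (Ψ (a ∷ b ∷ p ∷ ps) + ∑ (map (b ∷_) (insertions a (p ∷ ps))) Ψ) + ∑ (map (p ∷_) (insertions b ps)) (λ ps′ → ∑ (insertions a ps′) Ψ)
               ≈ (Ψ (a ∷ b ∷ p ∷ ps) + (Ψ (b ∷ a ∷ p ∷ ps) + ∑ (insertions a ps) (λ ps′ → Ψ (b ∷ p ∷ ps′))))
                 + (∑ (insertions b ps) (λ ps′ → Ψ (a ∷ p ∷ ps′)) + ∑ (insertions b ps) (λ ps′ → ∑ (insertions a ps′) (Ψ ∘ (p ∷_))))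
        expand a b = +-cong (+-congˡ (+-congˡ (trans (∑-map (b ∷_) (map (p ∷_) (insertions a ps)) Ψ) (∑-map (p ∷_) (insertions a ps) (Ψ ∘ (b ∷_))))))
          (trans (∑-map (p ∷_) (insertions b ps) _) (trans
            (∑-cong (insertions b ps) (λ ps′ → +-congˡ (∑-map (p ∷_) (insertions a ps′) Ψ)))
            (∑-+ (insertions b ps) _ _)))

    -- Merging two chains puts their elements in another order, so the sum must not depend on the
    -- order in which `permutations` receives them.
    permutations-resp : ∀ {es es′} → es ↭ es′ → ∀ Ψ → ∑ (permutations es) Ψ ≈ ∑ (permutations es′) Ψ
    permutations-resp Perm.refl Ψ = refl
    permutations-resp (Perm.prep {as} {bs} a q) Ψ = trans (∑-concatMap (insertions a) (permutations as) Ψ)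
      (trans (permutations-resp q _) (sym (∑-concatMap (insertions a) (permutations bs) Ψ)))
    permutations-resp (Perm.swap {as} {bs} a b q) Ψ = begin
      ∑ (permutations (a ∷ b ∷ as)) Ψ
        ≈⟨ two a b as ⟩
      ∑ (permutations as) (λ ps → ∑ (insertions b ps) (λ ps′ → ∑ (insertions a ps′) Ψ))
        ≈⟨ ∑-cong (permutations as) (λ ps → insertions-swap a b ps Ψ) ⟩
      ∑ (permutations as) (λ ps → ∑ (insertions a ps) (λ ps′ → ∑ (insertions b ps′) Ψ))
        ≈⟨ permutations-resp q _ ⟩
      ∑ (permutations bs) (λ ps → ∑ (insertions a ps) (λ ps′ → ∑ (insertions b ps′) Ψ))
        ≈⟨ sym (two b a bs) ⟩
      ∑ (permutations (b ∷ a ∷ bs)) Ψ ∎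
      where
      two : ∀ a b as → ∑ (permutations (a ∷ b ∷ as)) Ψ ≈ ∑ (permutations as) (λ ps → ∑ (insertions b ps) (λ ps′ → ∑ (insertions a ps′) Ψ))
      two a b as = trans (∑-concatMap (insertions a) (permutations (b ∷ as)) Ψ) (∑-concatMap (insertions b) (permutations as) _)
    permutations-resp (Perm.trans q r) Ψ = trans (permutations-resp q Ψ) (permutations-resp r Ψ)

    module _ (P : A → Set) (φ : List A → Carrier)
             (φ-* : ∀ {c q} → Starts P c → Starts P q → φ c * φ q ≈ I φ c q) where

      chainSum : Chain → List Chain → Carrier
      chainSum c []        = φ (list c)
      chainSum c (c′ ∷ cs) = φ (list c) * chainSum c′ cs - chainSum (c′ ⧺ c) cs

      -- The first link is replaced by 1 minus its reversal. Without the link the first chain is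
      -- free, and interleaving it with the rest gives a product by `φ-*`. The reversed link puts
      -- the top of the second chain below the bottom of the first, which makes them a single chain,
      -- and the induction continues with one chain fewer.
      ∑-good : ∀ c cs → Unique (elements (c ∷ cs)) → All (P ∘ proj₁) (c ∷ cs) →
               ∑ (permutations (elements (c ∷ cs))) (λ ps → ind (good c cs ps) * φ ps) ≈ chainSum c cs
      ∑-good (a , s) [] u heads = trans (permutations-chain (a ∷ s) [] φ u) (+-identityʳ _)
      ∑-good (a , s) ((b , t) ∷ cs) u heads@(pa ∷ pcs) = begin
        ∑ (permutations ((a ∷ s) ++ es)) (λ ps → ind (good (a , s) ((b , t) ∷ cs) ps) * φ ps)
          ≈⟨ ∑-cong-All (permutations-↭ ((a ∷ s) ++ es)) (λ q → split (unique-↭ (↭-sym q) u) (λ p∈ → Perm.∈-resp-↭ (↭-sym q) p∈)) ⟩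
        ∑ (permutations ((a ∷ s) ++ es)) (λ ps → ind (ord (a ∷ s) ps) * (ind (good (b , t) cs ps) * φ ps) - ind (good merged cs ps) * φ ps)
          ≈⟨ trans (∑-+ (permutations ((a ∷ s) ++ es)) _ _) (+-congˡ (∑-neg (permutations ((a ∷ s) ++ es)) _)) ⟩
        ∑ (permutations ((a ∷ s) ++ es)) (λ ps → ind (ord (a ∷ s) ps) * (ind (good (b , t) cs ps) * φ ps))
          - ∑ (permutations ((a ∷ s) ++ es)) (λ ps → ind (good merged cs ps) * φ ps)
          ≈⟨ +-cong free (-‿cong (trans (permutations-resp exchange _) (∑-good merged cs (unique-↭ exchange u) (All.head pcs ∷ All.tail pcs)))) ⟩
        φ (a ∷ s) * chainSum (b , t) cs - chainSum merged cs ∎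
        where
        es = elements ((b , t) ∷ cs)
        merged = (b , t) ⧺ (a , s)
        exchange : (a ∷ s) ++ es ↭ elements (merged ∷ cs)
        exchange = ≡.subst₂ _↭_ (List.++-assoc (a ∷ s) (b ∷ t) (elements cs)) ≡.refl
          (Perm.++⁺ʳ (elements cs) (Perm.++-comm (a ∷ s) (b ∷ t)))
        disjoint : ∀ {p} → p ∈ es → p ∉ a ∷ s
        disjoint = go (a ∷ s) u
          where
          go : ∀ c → Unique (c ++ es) → ∀ {p} → p ∈ es → p ∉ c
          go (b ∷ c) (b≢ ∷ _) p∈es (here ≡.refl) = All.lookup b≢ (∈-++⁺ʳ c p∈es) ≡.refl
          go (b ∷ c) (_ ∷ u)  p∈es (there p∈)    = go c u p∈es p∈
        unique-left : ∀ c {d} → Unique (c ++ d) → Unique c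
        unique-left []      _        = []
        unique-left (b ∷ c) (b≢ ∷ u) = All.++⁻ˡ c b≢ ∷ unique-left c u
        last∈es : last b t ∈ es
        last∈es = ∈-++⁺ˡ (last-∈ b t)
        split : ∀ {ps} → Unique ps → (∀ {p} → p ∈ (a ∷ s) ++ es → p ∈ ps) →
                ind (good (a , s) ((b , t) ∷ cs) ps) * φ ps
                ≈ ind (ord (a ∷ s) ps) * (ind (good (b , t) cs ps) * φ ps) - ind (good merged cs ps) * φ ps
        split {ps} ups all = begin
          ind (ord (a ∷ s) ps ∧ (ord (a ∷ last b t ∷ []) ps ∧ good (b , t) cs ps)) * φ ps
            ≈⟨ *-congʳ (trans (ind-∧ (ord (a ∷ s) ps) _) (*-congˡ (ind-∧ (ord (a ∷ last b t ∷ []) ps) _))) ⟩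
          (o * (ind (ord (a ∷ last b t ∷ []) ps) * γ)) * φ ps
            ≈⟨ *-congʳ (*-congˡ (*-congʳ (complement (ord-total (λ eq → disjoint last∈es (here (≡.sym eq))) (all (here ≡.refl)) (all (∈-++⁺ʳ (a ∷ s) last∈es)) ups)))) ⟩
          (o * ((1# - r) * γ)) * φ ps
            ≈⟨ trans (solve 5 (λ o r γ f i → (o :* ((i :- r) :* γ)) :* f := o :* (i :* (γ :* f)) :- (o :* (r :* γ)) :* f) refl o r γ (φ ps) 1#)
                 (+-congʳ (*-congˡ (*-identityˡ _))) ⟩
          o * (γ * φ ps) - (o * (r * γ)) * φ ps
            ≈⟨ +-congˡ (-‿cong (*-congʳ (sym (trans (reflexive (cong ind (good-⧺ cs (unique-left _ (unique-↭ exchange u)) ups)))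
                 (trans (ind-∧ (ord (a ∷ s) ps) _) (*-congˡ (ind-∧ (ord (last b t ∷ a ∷ []) ps) _))))))) ⟩
          o * (γ * φ ps) - ind (good merged cs ps) * φ ps ∎
          where
          o = ind (ord (a ∷ s) ps)
          r = ind (ord (last b t ∷ a ∷ []) ps)
          γ = ind (good (b , t) cs ps)
          complement : ∀ {p q} → (p ≡ true × q ≡ false) ⊎ (p ≡ false × q ≡ true) → ind p ≈ 1# - ind q
          complement (inj₁ (≡.refl , ≡.refl)) = sym (trans (+-congˡ RP.-0#≈0#) (+-identityʳ 1#))
            where import Algebra.Properties.Ring ring as RP
          complement (inj₂ (≡.refl , ≡.refl)) = sym (-‿inverseʳ 1#)
        free : ∑ (permutations ((a ∷ s) ++ es)) (λ ps → ind (ord (a ∷ s) ps) * (ind (good (b , t) cs ps) * φ ps))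
               ≈ φ (a ∷ s) * chainSum (b , t) cs
        free = begin
          ∑ (permutations ((a ∷ s) ++ es)) (λ ps → ind (ord (a ∷ s) ps) * (ind (good (b , t) cs ps) * φ ps))
            ≈⟨ permutations-chain (a ∷ s) es _ u ⟩
          ∑ (permutations es) (I (λ e → ind (good (b , t) cs e) * φ e) (a ∷ s))
            ≈⟨ ∑-cong-All (permutations-↭ es) (λ {q} q↭ → begin
                 I (λ e → ind (good (b , t) cs e) * φ e) (a ∷ s) q
                   ≈⟨ I-cong (a ∷ s) q (λ i → *-congʳ (reflexive (cong ind (good-interleaving b t cs i disjoint)))) ⟩
                 I (λ e → ind (good (b , t) cs q) * φ e) (a ∷ s) q
                   ≈⟨ I-*ˡ (a ∷ s) q (ind (good (b , t) cs q)) φ ⟩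
                 ind (good (b , t) cs q) * I φ (a ∷ s) q
                   ≈⟨ product q (good (b , t) cs q) (λ h → good-starts P b t cs pcs (Perm.∈-resp-↭ q↭)
                        (unique-↭ (↭-sym q↭) (unique-right (a ∷ s) u)) h) ⟩
                 φ (a ∷ s) * (ind (good (b , t) cs q) * φ q) ∎) ⟩
          ∑ (permutations es) (λ q → φ (a ∷ s) * (ind (good (b , t) cs q) * φ q))
            ≈⟨ ∑-*ˡ (permutations es) (φ (a ∷ s)) _ ⟩
          φ (a ∷ s) * ∑ (permutations es) (λ q → ind (good (b , t) cs q) * φ q)
            ≈⟨ *-congˡ (∑-good (b , t) cs (unique-right (a ∷ s) u) pcs) ⟩
          φ (a ∷ s) * chainSum (b , t) cs ∎
          where
          unique-right : ∀ c {d} → Unique (c ++ d) → Unique d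
          unique-right []      u       = u
          unique-right (b ∷ c) (_ ∷ u) = unique-right c u
          product : ∀ q γ → (γ ≡ true → Starts P q) → ind γ * I φ (a ∷ s) q ≈ φ (a ∷ s) * (ind γ * φ q)
          product q true  h = trans (*-identityˡ _) (trans (sym (φ-* (pa ∷ˢ s) (h ≡.refl))) (*-congˡ (sym (*-identityˡ _))))
          product q false h = trans (zeroˡ _) (sym (trans (*-congˡ (zeroˡ _)) (zeroʳ _)))

-- Shuffle regularised values at T = 0

module RegularisedValues where

  open import Algebra.Bundles using (CommutativeRing)
  open import Algebra.Bundles.Raw using (RawRing)
  open import Defs hiding (T; _≈_; _sh_)
  open import Defs using (_sh_; T)
  open import Data.Integer using (+_)
  open import Data.List using (List; []; _∷_; _++_; _∷ʳ_; [_]; map; replicate; reverse)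
  import Data.List.Properties as List
  open import Data.List.Relation.Unary.All as All using (All; []; _∷_)
  import Data.List.Relation.Unary.All.Properties as All
  import Data.List.Relation.Unary.Any.Properties as Any
  open import Data.Nat as ℕ using (ℕ; zero; suc; _∸_; NonZero)
  open import Data.Product using (_×_; _,_; proj₂)
  open import Data.Rational as ℚ using (ℚ; 1ℚ)
  import Data.Rational.Properties as ℚ
  open import Function using (_∘_)
  open import Relation.Binary.PropositionalEquality as ≡ using (_≡_; cong; cong₂; subst)
  open RingSums
  open Words
  open Reals
  open IteratedIntegrals

  module Regularisation (Zˢʰ : 𝔥¹ → Polynomial) (isReg : IsShuffleRegularization Zˢʰ) where
    open Real
    open Limits using (Lim)
    open IsShuffleRegularization isReg
    open IsℚAlgebraHomomorphism isℚAlgebraHomomorphism using (isRingHomomorphism; scale-homo)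
    private
      module R = CommutativeRing ℝ-ring
      module RT = RingTools ℝ-ring
      module H = RawRing ⟨𝔥¹,sh⟩
      open import Algebra.Morphism.Structures using (module RingMorphisms)
      module hom = RingMorphisms.IsRingHomomorphism isRingHomomorphism
    open import Relation.Binary.Reasoning.Setoid R.setoid

    ev : 𝔥¹ → ℝ
    ev p = evaluate (Zˢʰ p) 0ᴿ

    private
      evaluate-0 : ∀ p → evaluate p 0ᴿ ≈ coefficient p 0
      evaluate-0 []      = R.refl
      evaluate-0 (a ∷ p) = R.trans (R.+-congˡ {a} (R.zeroˡ _)) (R.+-identityʳ a)

      add-0 : ∀ p q → coefficient (addᴾ p q) 0 ≈ coefficient p 0 +ᴿ coefficient q 0
      add-0 []      q       = R.sym (R.+-identityˡ _)
      add-0 (a ∷ p) []      = R.sym (R.+-identityʳ _)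
      add-0 (a ∷ p) (b ∷ q) = R.refl

      map-0 : ∀ a q → coefficient (map (a *ᴿ_) q) 0 ≈ a *ᴿ coefficient q 0
      map-0 a []      = R.sym (R.zeroʳ a)
      map-0 a (b ∷ q) = R.refl

      mul-0 : ∀ p q → coefficient (mulᴾ p q) 0 ≈ coefficient p 0 *ᴿ coefficient q 0
      mul-0 []      q = R.sym (R.zeroˡ _)
      mul-0 (a ∷ p) q = R.trans (add-0 (map (a *ᴿ_) q) _) (R.trans (R.+-identityʳ _) (map-0 a q))

    -- Equality of polynomials is equality of coefficients, so the laws for values at T = 0 can be
    -- read off from the constant coefficients.
    ev-coefficient : ∀ p → ev p ≈ coefficient (Zˢʰ p) 0
    ev-coefficient p = evaluate-0 (Zˢʰ p)

    ev-cong : ∀ {p q} → p H.≈ q → ev p ≈ ev q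
    ev-cong {p} {q} eq = R.trans (ev-coefficient p) (R.trans (wrap (hom.⟦⟧-cong eq 0)) (R.sym (ev-coefficient q)))

    ev-+ : ∀ p q → ev (p H.+ q) ≈ ev p +ᴿ ev q
    ev-+ p q = begin
      ev (p H.+ q)                                       ≈⟨ ev-coefficient (p H.+ q) ⟩
      coefficient (Zˢʰ (p H.+ q)) 0                      ≈⟨ wrap (hom.+-homo p q 0) ⟩
      coefficient (addᴾ (Zˢʰ p) (Zˢʰ q)) 0               ≈⟨ add-0 (Zˢʰ p) (Zˢʰ q) ⟩
      coefficient (Zˢʰ p) 0 +ᴿ coefficient (Zˢʰ q) 0     ≈⟨ R.+-cong (ev-coefficient p) (ev-coefficient q) ⟨
      ev p +ᴿ ev q ∎

    ev-* : ∀ p q → ev (p H.* q) ≈ ev p *ᴿ ev q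
    ev-* p q = begin
      ev (p H.* q)                                       ≈⟨ ev-coefficient (p H.* q) ⟩
      coefficient (Zˢʰ (p H.* q)) 0                      ≈⟨ wrap (hom.*-homo p q 0) ⟩
      coefficient (mulᴾ (Zˢʰ p) (Zˢʰ q)) 0               ≈⟨ mul-0 (Zˢʰ p) (Zˢʰ q) ⟩
      coefficient (Zˢʰ p) 0 *ᴿ coefficient (Zˢʰ q) 0     ≈⟨ R.*-cong (ev-coefficient p) (ev-coefficient q) ⟨
      ev p *ᴿ ev q ∎

    ev-scale : ∀ c p → ev (scale¹ c p) ≈ fromℚ c *ᴿ ev p
    ev-scale c p = begin
      ev (scale¹ c p)                                    ≈⟨ ev-coefficient (scale¹ c p) ⟩
      coefficient (Zˢʰ (scale¹ c p)) 0                   ≈⟨ wrap (scale-homo c p 0) ⟩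
      coefficient (map (fromℚ c *ᴿ_) (Zˢʰ p)) 0          ≈⟨ map-0 (fromℚ c) (Zˢʰ p) ⟩
      fromℚ c *ᴿ coefficient (Zˢʰ p) 0                   ≈⟨ R.*-congˡ {fromℚ c} (ev-coefficient p) ⟨
      fromℚ c *ᴿ ev p ∎

    -- The value 0 is junk: only words of 𝔥¹ are ever evaluated.
    value : Word → ℝ
    value []      = ev (word¹ [] ε)
    value (y ∷ w) = ev (word¹ (y ∷ w) (y∷ w))
    value (x ∷ w) = 0ᴿ

    value-word¹ : ∀ {w} (w¹ : IsWord¹ w) → value w ≡ ev (word¹ w w¹)
    value-word¹ ε      = ≡.refl
    value-word¹ (y∷ w) = ≡.refl

    private
      term : ℚ × Word → ℝ
      term (c , w) = fromℚ c *ᴿ value w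

    ev-∑ : ∀ p (p¹ : In𝔥¹ p) → ev (p , p¹) ≈ RT.∑ p term
    ev-∑ [] [] = R.trans (ev-coefficient ([] , [])) (wrap (hom.0#-homo 0))
    ev-∑ ((c , w) ∷ p) (w¹ ∷ p¹) = begin
      ev ((c , w) ∷ p , w¹ ∷ p¹)
        ≈⟨ ev-+ ((c , w) ∷ [] , w¹ ∷ []) (p , p¹) ⟩
      ev ((c , w) ∷ [] , w¹ ∷ []) +ᴿ ev (p , p¹)
        ≈⟨ R.+-cong (ev-cong {(c , w) ∷ [] , w¹ ∷ []} {scale¹ c (word¹ w w¹)}
             (λ v → cong (λ d → coeff ((d , w) ∷ []) v) (≡.sym (ℚ.*-identityʳ c)))) (ev-∑ p p¹) ⟩
      ev (scale¹ c (word¹ w w¹)) +ᴿ RT.∑ p term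
        ≈⟨ R.+-congʳ (R.trans (ev-scale c (word¹ w w¹)) (R.*-congˡ {fromℚ c} (R.reflexive (≡.sym (value-word¹ w¹))))) ⟩
      RT.∑ ((c , w) ∷ p) term ∎

    -- Z reads words from the last letter to the first.
    Z : Word → ℝ
    Z w = value (reverse w)

    private
      anchored-snoc : ∀ w → Anchored (w ∷ʳ y)
      anchored-snoc []          = yᴬ∷ []
      anchored-snoc (y ∷ w)     = yᴬ∷ anchored-snoc w
      anchored-snoc (x ∷ [])    = xᴬ∷ yᴬ∷ []
      anchored-snoc (x ∷ a ∷ w) = xᴬ∷ anchored-snoc (a ∷ w)

      reverse-anchored : ∀ {w} → Anchored w → IsWord¹ (reverse w)
      reverse-anchored {[]}    []  = ε
      reverse-anchored {a ∷ w} anc = subst IsWord¹ (≡.sym (List.unfold-reverse a w)) (go a w anc)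
        where
        go : ∀ a w → Anchored (a ∷ w) → IsWord¹ (reverse w ∷ʳ a)
        go y [] _ = y∷ []
        go a (b ∷ w) anc = subst (λ z → IsWord¹ (z ∷ʳ a)) (≡.sym (List.unfold-reverse b w)) (extend (go b w (tail anc)))
          where
          tail : ∀ {a b w} → Anchored (a ∷ b ∷ w) → Anchored (b ∷ w)
          tail (yᴬ∷ anc) = anc
          tail (xᴬ∷ anc) = anc
          extend : ∀ {u} → IsWord¹ (u ∷ʳ b) → IsWord¹ ((u ∷ʳ b) ∷ʳ a)
          extend {[]}    (y∷ _) = y∷ _
          extend {_ ∷ u} (y∷ _) = y∷ _

    anchored-reverse : ∀ w → Anchored (reverse (y ∷ w))
    anchored-reverse w = subst Anchored (≡.sym (List.unfold-reverse y w)) (anchored-snoc (reverse w))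

    Z-shuffle : ∀ {u v} → Anchored u → Anchored v → Z u *ᴿ Z v ≈ ShuffleSum.σ ℝ-ring Z u v
    Z-shuffle {u} {v} au av = begin
      value (reverse u) *ᴿ value (reverse v)
        ≈⟨ R.*-cong (R.reflexive (value-word¹ u¹)) (R.reflexive (value-word¹ v¹)) ⟩
      ev (word¹ (reverse u) u¹) *ᴿ ev (word¹ (reverse v) v¹)
        ≈⟨ R.sym (ev-* (word¹ (reverse u) u¹) (word¹ (reverse v) v¹)) ⟩
      ev (word¹ (reverse u) u¹ H.* word¹ (reverse v) v¹)
        ≈⟨ ev-∑ (((1ℚ , reverse u) ∷ []) sh ((1ℚ , reverse v) ∷ [])) (proj₂ (word¹ (reverse u) u¹ H.* word¹ (reverse v) v¹)) ⟩
      RT.∑ (((1ℚ , reverse u) ∷ []) sh ((1ℚ , reverse v) ∷ [])) term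
        ≡⟨ cong (λ p → RT.∑ p term) (≡.trans (List.++-identityʳ (products ++ [])) (List.++-identityʳ products)) ⟩
      RT.∑ products term
        ≈⟨ RT.∑-map (λ (w : Word) → (1ℚ ℚ.* 1ℚ , w)) (shuffle (reverse u) (reverse v)) term ⟩
      RT.∑ (shuffle (reverse u) (reverse v)) (λ w → fromℚ (1ℚ ℚ.* 1ℚ) *ᴿ value w)
        ≈⟨ RT.∑-cong (shuffle (reverse u) (reverse v)) (λ w → R.*-identityˡ (value w)) ⟩
      RT.∑ (map reverse (shuffleʳ (reverse (reverse u)) (reverse (reverse v)))) value
        ≈⟨ RT.∑-map reverse (shuffleʳ (reverse (reverse u)) (reverse (reverse v))) value ⟩
      RT.∑ (shuffleʳ (reverse (reverse u)) (reverse (reverse v))) Z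
        ≡⟨ cong₂ (λ u v → RT.∑ (shuffleʳ u v) Z) (List.reverse-involutive u) (List.reverse-involutive v) ⟩
      RT.∑ (shuffleʳ u v) Z
        ≈⟨ ShuffleSum.σ-shuffle ℝ-ring Z u v ⟩
      ShuffleSum.σ ℝ-ring Z u v ∎
      where
      u¹ = reverse-anchored au
      v¹ = reverse-anchored av
      products : 𝔥
      products = map (1ℚ ℚ.* 1ℚ ,_) (shuffle (reverse u) (reverse v))

    Z-[] : Z [] ≈ 1ᴿ
    Z-[] = R.trans (ev-coefficient (word¹ [] ε)) (wrap (hom.1#-homo 0))

    Z-y : Z (y ∷ []) ≈ 0ᴿ
    Z-y = R.trans (ev-coefficient (word¹ (y ∷ []) (y∷ []))) (wrap (y↦T 0))

    reverse-word : ∀ ks → reverse (word ks) ≡ z (reverse ks)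
    reverse-word []       = ≡.refl
    reverse-word (k ∷ ks) = ≡.trans
      (≡.trans (List.reverse-++ (replicate (k ∸ 1) x) (y ∷ word ks)) (cong (_++ reverse (replicate (k ∸ 1) x)) (List.unfold-reverse y (word ks))))
      (≡.trans (≡.trans (List.++-assoc (reverse (word ks)) [ y ] _) (cong₂ (λ u v → u ++ y ∷ v) (reverse-word ks) (reverse-replicate (k ∸ 1))))
      (≡.trans (cong (z (reverse ks) ++_) (≡.sym (List.++-identityʳ (y ∷ replicate (k ∸ 1) x))))
      (≡.trans (≡.sym (List.concatMap-++ _ (reverse ks) [ k ])) (cong z (≡.sym (List.unfold-reverse k ks))))))
      where
      reverse-replicate : ∀ n → reverse (replicate n x) ≡ replicate n x
      reverse-replicate zero    = ≡.refl
      reverse-replicate (suc n) = ≡.trans (List.unfold-reverse x (replicate n x)) (≡.trans (cong (_∷ʳ x) (reverse-replicate n)) (rotate n))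
        where
        rotate : ∀ n → replicate n x ∷ʳ x ≡ x ∷ replicate n x
        rotate zero    = ≡.refl
        rotate (suc n) = cong (x ∷_) (rotate n)

    Z-ζ : ∀ k {ks} (pos : All NonZero (reverse ks)) (2≤k : 2 ℕ.≤ k) →
          Z (word (k ∷ ks)) ≈ ζ (reverse ks ∷ʳ k) (snoc (reverse ks) pos 2≤k)
    Z-ζ k {ks} pos 2≤k = begin
      value (reverse (word (k ∷ ks)))
        ≡⟨ cong value (≡.trans (reverse-word (k ∷ ks)) (cong z (List.unfold-reverse k ks))) ⟩
      value (z ks′)
        ≡⟨ value-word¹ (z-word¹ ks′) ⟩
      ev (word¹ (z ks′) (z-word¹ ks′))
        ≈⟨ ev-coefficient (word¹ (z ks′) (z-word¹ ks′)) ⟩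
      coefficient (Zˢʰ (word¹ (z ks′) (z-word¹ ks′))) 0
        ≈⟨ wrap (extends-Z ks′ adm 0) ⟩
      ζ ks′ adm ∎
      where
      ks′ = reverse ks ∷ʳ k
      adm = snoc (reverse ks) pos 2≤k

    Z-lim : ∀ k {ks} → All NonZero ks → Lim (Rational.tr (suc (suc k) ∷ ks)) (Z (word (suc (suc k) ∷ ks)))
    Z-lim k {ks} pos = lim-≈ (R.sym (Z-ζ (suc (suc k)) {ks} pos′ (ℕ.s≤s (ℕ.s≤s ℕ.z≤n))))
      (lim-≗ (λ N → ≡.trans (cong (λ l → truncated l N) index) (≡.sym (Rational.tr-truncated (suc (suc k) ∷ ks) N))) (lim-seq _))
      where
      pos′ : All NonZero (reverse ks)
      pos′ = All.tabulate (All.lookup pos ∘ Any.reverse⁻)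
      index : reverse (reverse ks ∷ʳ suc (suc k)) ≡ suc (suc k) ∷ ks
      index = ≡.trans (List.reverse-++ (reverse ks) [ suc (suc k) ]) (cong (suc (suc k) ∷_) (List.reverse-involutive ks))

-- The star value of an index as a sum over joined rows

module StarPosets where

  open import Algebra.Bundles using (CommutativeRing)
  open import Defs hiding (T; _≈_; _sh_; ∑; W)
  open import Data.Bool using (Bool; true; false; if_then_else_; _∧_)
  import Data.Bool.Properties as Bool
  open import Data.Empty using (⊥-elim)
  open import Data.Fin as Fin using (Fin; zero; suc; toℕ; inject₁)
  import Data.Fin.Properties as Fin
  open import Data.List using (List; []; _∷_; _++_; [_]; map; replicate; reverse; concat; tabulate; lookup; length; filter)
  import Data.List.Properties as List
  open import Data.List.Membership.Propositional using (_∈_)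
  open import Data.List.Membership.Propositional.Properties using (∈-lookup)
  open import Data.List.Relation.Unary.All as All using (All; []; _∷_)
  import Data.List.Relation.Unary.All.Properties as All
  open import Data.List.Relation.Unary.AllPairs as AllPairs using ([]; _∷_)
  open import Data.List.Relation.Unary.Any using (here; there)
  open import Data.List.Relation.Unary.Unique.Propositional using (Unique)
  open import Data.List.Relation.Binary.Permutation.Propositional using (_↭_; ↭-sym)
  import Data.List.Relation.Binary.Permutation.Propositional.Properties as Perm
  open import Data.List.Relation.Binary.Pointwise as Pointwise using (Pointwise; []; _∷_)
  open import Data.Nat as ℕ using (ℕ; zero; suc; _∸_; NonZero)
  import Data.Nat.Properties as ℕ
  open import Data.Product using (∃; ∃₂; _×_; _,_; proj₁; proj₂)
  import Data.Product.Properties as Product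
  open import Data.Rational using (1ℚ)
  open import Data.Sum using (inj₁; inj₂)
  open import Function using (_∘_; _∋_; id)
  open import Relation.Binary using (DecidableEquality)
  open import Relation.Binary.Construct.Closure.Transitive as TransClosure using (TransClosure; _∷_)
  open import Relation.Binary.PropositionalEquality as ≡ using (_≡_; cong; cong₂; subst)
  open import Relation.Nullary using (Dec; does; yes; no; ¬_)
  open RingSums
  open StarSums
  open Words
  open Reals
  open IteratedIntegrals
  open ChainOrders
  open RegularisedValues

  module Positions {A : Set} (_≟_ : DecidableEquality A) where
    open Sublists _≟_

    lookup-unique : ∀ {ps : List A} → Unique ps → ∀ i j → lookup ps i ≡ lookup ps j → i ≡ j
    lookup-unique (p≢ ∷ u) zero    zero    eq = ≡.refl
    lookup-unique (p≢ ∷ u) zero    (suc j) eq = ⊥-elim (All.lookup p≢ (∈-lookup j) eq)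
    lookup-unique (p≢ ∷ u) (suc i) zero    eq = ⊥-elim (All.lookup p≢ (∈-lookup i) (≡.sym eq))
    lookup-unique (p≢ ∷ u) (suc i) (suc j) eq = cong suc (lookup-unique u i j eq)

    private
      ord-position : ∀ {b} ps → ord (b ∷ []) ps ≡ true → ∃ λ j → lookup ps j ≡ b
      ord-position {b} (p ∷ ps) h with b ≟ p
      ... | yes ≡.refl = zero , ≡.refl
      ... | no _       = let j , eq = ord-position ps h in suc j , eq

    ord-positions : ∀ {a b} ps → ord (a ∷ b ∷ []) ps ≡ true → ∃₂ λ i j → i Fin.< j × lookup ps i ≡ a × lookup ps j ≡ b
    ord-positions {a} (p ∷ ps) h with a ≟ p
    ... | yes ≡.refl = let j , eq = ord-position ps h in zero , suc j , ℕ.s≤s ℕ.z≤n , ≡.refl , eq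
    ... | no _       = let i , j , i<j , eqᵢ , eqⱼ = ord-positions ps h in suc i , suc j , ℕ.s≤s i<j , eqᵢ , eqⱼ

    module _ (_≺_ : A → A → Set) (irreflexive : ∀ {p} → ¬ (p ≺ p)) {ps : List A} (u : Unique ps)
             (linear : ∀ i j → lookup ps i ≺ lookup ps j → i Fin.< j) where
      linear⇒ord : ∀ {p q} → p ≺ q → p ∈ ps → q ∈ ps → ord (p ∷ q ∷ []) ps ≡ true
      linear⇒ord {p} {q} p≺q p∈ q∈ with ord-total (λ { ≡.refl → irreflexive p≺q }) p∈ q∈ u
      ... | inj₁ (h , _) = h
      ... | inj₂ (_ , h) = let i , j , i<j , eqᵢ , eqⱼ = ord-positions ps h in
        ⊥-elim (ℕ.<-asym i<j (linear j i (≡.subst₂ _≺_ (≡.sym eqⱼ) (≡.sym eqᵢ) p≺q)))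

    module _ (_⋖_ : A → A → Set) {ps : List A} (u : Unique ps)
             (covers : ∀ {p q} → p ⋖ q → ord (p ∷ q ∷ []) ps ≡ true) where
      -- A generating relation gives two increasing positions in `ps`; they are the given ones
      -- because `ps` has no repetitions. Positions then increase along every sequence of generating
      -- relations.
      covers⇒linear : ∀ i j → TransClosure _⋖_ (lookup ps i) (lookup ps j) → i Fin.< j
      covers⇒linear i j = go i j ≡.refl ≡.refl
        where
        go : ∀ i j {p q} → lookup ps i ≡ p → lookup ps j ≡ q → TransClosure _⋖_ p q → i Fin.< j
        go i j eqᵢ eqⱼ TransClosure.[ p⋖q ] = let i′ , j′ , i′<j′ , eqᵢ′ , eqⱼ′ = ord-positions ps (covers p⋖q) in
          ≡.subst₂ Fin._<_ (lookup-unique u i′ i (≡.trans eqᵢ′ (≡.sym eqᵢ))) (lookup-unique u j′ j (≡.trans eqⱼ′ (≡.sym eqⱼ))) i′<j′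
        go i j eqᵢ eqⱼ (p⋖r ∷ r≺q) = let i′ , k , i′<k , eqᵢ′ , eqₖ = ord-positions ps (covers p⋖r) in
          ℕ.<-trans (subst (Fin._< k) (lookup-unique u i′ i (≡.trans eqᵢ′ (≡.sym eqᵢ))) i′<k) (go k j eqₖ eqⱼ r≺q)

    private
      ord-prefix₁ : ∀ {a s} ps → ord (a ∷ s) ps ≡ true → ord (a ∷ []) ps ≡ true
      ord-prefix₁ {a} (p ∷ ps) h with a ≟ p
      ... | yes _ = ≡.refl
      ... | no _  = ord-prefix₁ ps h

      ord-prefix₂ : ∀ {a b s} ps → ord (a ∷ b ∷ s) ps ≡ true → ord (a ∷ b ∷ []) ps ≡ true
      ord-prefix₂ {a} (p ∷ ps) h with a ≟ p
      ... | yes _ = ord-prefix₁ ps h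
      ... | no _  = ord-prefix₂ ps h

      ∧-intro : ∀ {p q} → p ≡ true → q ≡ true → p ∧ q ≡ true
      ∧-intro ≡.refl ≡.refl = ≡.refl

      ∧-elim : ∀ p {q} → p ∧ q ≡ true → p ≡ true × q ≡ true
      ∧-elim true h = ≡.refl , h

      member : ∀ {p ps} → p ∈ ps → ord (p ∷ []) ps ≡ true
      member {p} {_ ∷ ps} (here ≡.refl) = ord-here p [] ps
      member {p} {q ∷ ps} (there p∈)    = ord-mono (p ∷ []) q ps (member p∈)

    ord-tabulate⁻ : ∀ {m} (f : Fin m → A) {ps} → ord (tabulate f) ps ≡ true →
                    ∀ i j → toℕ j ≡ suc (toℕ i) → ord (f i ∷ f j ∷ []) ps ≡ true
    ord-tabulate⁻ {suc (suc m)} f {ps} h zero    (suc zero) eq = ord-prefix₂ ps h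
    ord-tabulate⁻ {suc m} f {ps} h (suc i) (suc j) eq = ord-tabulate⁻ (f ∘ suc) (ord-tail (f zero) (tabulate (f ∘ suc)) ps h) i j (ℕ.suc-injective eq)

    ord-tabulate⁺ : ∀ {m} (f : Fin m → A) {ps} → (∀ {i j} → f i ≡ f j → i ≡ j) → Unique ps → (∀ i → f i ∈ ps) →
                    (∀ i j → toℕ j ≡ suc (toℕ i) → ord (f i ∷ f j ∷ []) ps ≡ true) → ord (tabulate f) ps ≡ true
    ord-tabulate⁺ {zero}        f inj u f∈ h = ≡.refl
    ord-tabulate⁺ {suc zero}    f inj u f∈ h = member (f∈ zero)
    ord-tabulate⁺ {suc (suc m)} f {ps} inj u f∈ h = ≡.trans
      (ord-link (f zero) (f (suc zero)) (tabulate (λ i → f (suc (suc i)))) ps (λ eq → Fin.0≢1+n (inj eq)) u)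
      (∧-intro (h zero (suc zero) ≡.refl)
        (ord-tabulate⁺ (f ∘ suc) (λ eq → Fin.suc-injective (inj eq)) u (f∈ ∘ suc) (λ i j eq → h (suc i) (suc j) (cong suc eq))))

    first final : Chain → A
    first         = proj₁
    final (a , s) = last a s

    rowChain : ∀ {m} → (Fin m → A) → NonZero m → Chain
    rowChain {suc m} f _ = f zero , tabulate (f ∘ suc)

    rowChain-list : ∀ {m} (f : Fin m → A) nz → list (rowChain f nz) ≡ tabulate f
    rowChain-list {suc m} f _ = ≡.refl

    rowChain-first : ∀ {m} (f : Fin m → A) nz → ∃ λ i → first (rowChain f nz) ≡ f i × toℕ i ≡ 0
    rowChain-first {suc m} f _ = zero , ≡.refl , ≡.refl

    rowChain-final : ∀ {m} (f : Fin m → A) nz → ∃ λ i → final (rowChain f nz) ≡ f i × suc (toℕ i) ≡ m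
    rowChain-final {suc zero}    f _ = zero , ≡.refl , ≡.refl
    rowChain-final {suc (suc m)} f _ = let i , eq , eq′ = rowChain-final (f ∘ suc) _ in suc i , eq , cong suc eq′

    good-tabulate⁻ : ∀ n (ch : Fin (suc n) → Chain) {ps} → good (ch zero) (tabulate (ch ∘ suc)) ps ≡ true →
                     (∀ i → ord (list (ch i)) ps ≡ true) × (∀ i → ord (first (ch (inject₁ i)) ∷ final (ch (suc i)) ∷ []) ps ≡ true)
    good-tabulate⁻ zero    ch h = (λ { zero → h }) , λ ()
    good-tabulate⁻ (suc n) ch {ps} h =
      let h₁ , h₂₃ = ∧-elim (ord (list (ch zero)) ps) h
          h₂ , h₃  = ∧-elim (ord (first (ch zero) ∷ final (ch (suc zero)) ∷ []) ps) h₂₃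
          rows , links = good-tabulate⁻ n (ch ∘ suc) h₃
      in (λ { zero → h₁ ; (suc i) → rows i }) , (λ { zero → h₂ ; (suc i) → links i })

    good-tabulate⁺ : ∀ n (ch : Fin (suc n) → Chain) {ps} → (∀ i → ord (list (ch i)) ps ≡ true) →
                     (∀ i → ord (first (ch (inject₁ i)) ∷ final (ch (suc i)) ∷ []) ps ≡ true) →
                     good (ch zero) (tabulate (ch ∘ suc)) ps ≡ true
    good-tabulate⁺ zero    ch rows links = rows zero
    good-tabulate⁺ (suc n) ch rows links = ∧-intro (rows zero) (∧-intro (links zero)
      (good-tabulate⁺ n (ch ∘ suc) (rows ∘ suc) (links ∘ suc)))

  module StarValue (Zˢʰ : 𝔥¹ → Polynomial) (isReg : IsShuffleRegularization Zˢʰ) where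
    open Real using (ℝ-ring)
    open Regularisation Zˢʰ isReg
    private
      module R = CommutativeRing ℝ-ring
      module RT = RingTools ℝ-ring
    module S = Star ℝ-ring (Z ∘ word)
    open import Relation.Binary.Reasoning.Setoid R.setoid

    does-≡ : ∀ {P : Set} (d : Dec P) {b} → (P → b ≡ true) → (b ≡ true → P) → does d ≡ b
    does-≡ (yes p) to from = ≡.sym (to p)
    does-≡ (no ¬p) to from = ≡.sym (Bool.¬-not (¬p ∘ from))

    ∑-filter : ∀ {B : Set} {P : B → Set} (P? : ∀ b → Dec (P b)) bs f →
               RT.∑ (filter P? bs) f ≈ RT.∑ bs (λ b → (if does (P? b) then 1ᴿ else 0ᴿ) *ᴿ f b)
    ∑-filter P? []       f = R.refl
    ∑-filter P? (b ∷ bs) f with does (P? b)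
    ... | true  = R.+-cong (R.sym (R.*-identityˡ (f b))) (∑-filter P? bs f)
    ... | false = R.trans (∑-filter P? bs f) (R.sym (R.trans (R.+-congʳ (R.zeroˡ (f b))) (R.+-identityˡ _)))

    module _ (k₀ : ℕ) (ks₀ : List ℕ) (pos : All NonZero (k₀ ∷ ks₀)) where
      private
        ks = k₀ ∷ ks₀
        X = X⋆ ks
        P = 2-Poset.Carrier X

        _≟_ : DecidableEquality P
        _≟_ = Product.≡-dec Fin._≟_ Fin._≟_

      open Sublists _≟_
      open Positions _≟_
      open PermutationSums ℝ-ring _≟_

      private
        nonZero : ∀ i → NonZero (lookup ks i)
        nonZero i = All.lookup pos (∈-lookup i)

        ch : Fin (length ks) → Chain
        ch i = rowChain (i ,_) (nonZero i)

        chains : List Chain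
        chains = tabulate (ch ∘ suc)

        elements-X : 2-Poset.elements X ≡ elements (ch zero ∷ chains)
        elements-X = cong concat (≡.trans (List.map-tabulate id _) (≡.trans
          (List.tabulate-cong (λ i → ≡.trans (List.map-tabulate id (i ,_)) (≡.sym (rowChain-list (i ,_) (nonZero i)))))
          (≡.sym (List.map-tabulate ch list))))

        ,-injective : ∀ {i : Fin (length ks)} {m n : Fin (lookup ks i)} → (P ∋ (i , m)) ≡ (i , n) → m ≡ n
        ,-injective ≡.refl = ≡.refl

        irreflexive : ∀ {p} → ¬ 2-Poset._≺_ X p p
        irreflexive = IsDecStrictPartialOrder.irrefl (2-Poset.isDecStrictPartialOrder X) ≡.refl
          where open import Relation.Binary using (module IsDecStrictPartialOrder)

        module _ {ps : List P} (q : ps ↭ 2-Poset.elements X) where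
          u : Unique ps
          u = unique-↭ (↭-sym q) (2-Poset.elements-unique X)
          all∈ : ∀ p → p ∈ ps
          all∈ p = Perm.∈-resp-↭ (↭-sym q) (2-Poset.elements-complete X p)

          -- The order is generated by neighbours in a row and by the links between rows, and `good`
          -- tests precisely these. In a list that contains every element once, not being after is
          -- the same as being before.
          linear⇒good : IsLinearExtension X ps → good (ch zero) chains ps ≡ true
          linear⇒good lin = good-tabulate⁺ _ ch
            (λ i → ≡.trans (cong (λ l → ord l ps) (rowChain-list (i ,_) (nonZero i)))
              (ord-tabulate⁺ (i ,_) ,-injective u (λ m → all∈ (i , m))
                (λ m n eq → before (inj₁ (≡.refl , eq)))))
            (λ i → let m , eqₘ , m≡0 = rowChain-first (inject₁ i ,_) (nonZero (inject₁ i))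
                       n , eqₙ , n≡k = rowChain-final (suc i ,_) (nonZero (suc i))
                   in ≡.trans (cong₂ (λ a b → ord (a ∷ b ∷ []) ps) eqₘ eqₙ)
                        (before (inj₂ (cong suc (≡.sym (Fin.toℕ-inject₁ i)) , m≡0 , n≡k))))
            where
            before : ∀ {p r} → _⋖_ ks p r → ord (p ∷ r ∷ []) ps ≡ true
            before c = linear⇒ord (2-Poset._≺_ X) irreflexive u lin TransClosure.[ c ] (all∈ _) (all∈ _)

          good⇒linear : good (ch zero) chains ps ≡ true → IsLinearExtension X ps
          good⇒linear h = covers⇒linear (_⋖_ ks) u covers
            where
            rows = proj₁ (good-tabulate⁻ _ ch h)
            links = proj₂ (good-tabulate⁻ _ ch h)
            covers : ∀ {p r} → _⋖_ ks p r → ord (p ∷ r ∷ []) ps ≡ true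
            covers {i , m} {.i , n} (inj₁ (≡.refl , eq)) = ord-tabulate⁻ (i ,_)
              (≡.trans (cong (λ l → ord l ps) (≡.sym (rowChain-list (i ,_) (nonZero i)))) (rows i)) m n eq
            covers {i , m} {suc j , n} (inj₂ (eq , m≡0 , n≡k)) with Fin.toℕ-injective {i = inject₁ j} {j = i} (≡.trans (Fin.toℕ-inject₁ j) (ℕ.suc-injective eq))
            ... | ≡.refl = let m′ , eqₘ , m′≡0 = rowChain-first (inject₁ j ,_) (nonZero (inject₁ j))
                               n′ , eqₙ , n′≡k = rowChain-final (suc j ,_) (nonZero (suc j))
                           in ≡.trans (cong₂ (λ a b → ord (a ∷ b ∷ []) ps)
                                (≡.trans (cong (inject₁ j ,_) (Fin.toℕ-injective (≡.trans m≡0 (≡.sym m′≡0)))) (≡.sym eqₘ))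
                                (≡.trans (cong (suc j ,_) (Fin.toℕ-injective (ℕ.suc-injective (≡.trans n≡k (≡.sym n′≡k))))) (≡.sym eqₙ)))
                              (links j)

          linear≡good : does (isLinearExtension? X ps) ≡ good (ch zero) chains ps
          linear≡good = does-≡ (isLinearExtension? X ps) linear⇒good good⇒linear

        φ : List P → ℝ
        φ ps = value (map (label ks) ps)

        Y : P → Set
        Y p = label ks p ≡ y

        I-σ : ∀ (ψ : Word → ℝ) c q → I (ψ ∘ map (label ks)) c q ≈ ShuffleSum.σ ℝ-ring ψ (map (label ks) c) (map (label ks) q)
        I-σ ψ []      q       = R.refl
        I-σ ψ (a ∷ c) []      = R.refl
        I-σ ψ (a ∷ c) (b ∷ q) = R.+-cong (I-σ (ψ ∘ (label ks a ∷_)) c (b ∷ q)) (I-σ (ψ ∘ (label ks b ∷_)) (a ∷ c) q)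

        -- Linear extensions are listed from the first letter on whereas `Z` reads from the last;
        -- `σ-reverse` reconciles the two.
        φ-* : ∀ {c q} → Starts Y c → Starts Y q → φ c *ᴿ φ q ≈ I φ c q
        φ-* {c} {q} sc sq = begin
          value lc *ᴿ value lq
            ≈⟨ R.*-cong (R.reflexive (cong value (≡.sym (List.reverse-involutive lc)))) (R.reflexive (cong value (≡.sym (List.reverse-involutive lq)))) ⟩
          Z (reverse lc) *ᴿ Z (reverse lq)
            ≈⟨ Z-shuffle (anchored sc) (anchored sq) ⟩
          σ Z (reverse lc) (reverse lq)
            ≈⟨ σ-reverse Z lc lq ⟩
          σ (Z ∘ reverse) lc lq
            ≈⟨ σ-cong (λ w → R.reflexive (cong value (List.reverse-involutive w))) lc lq ⟩
          σ value lc lq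
            ≈⟨ R.sym (I-σ value c q) ⟩
          I φ c q ∎
          where
          open ShuffleSum ℝ-ring
          lc = map (label ks) c
          lq = map (label ks) q
          anchored : ∀ {c} → Starts Y c → Anchored (reverse (map (label ks) c))
          anchored [] = []
          anchored (_∷ˢ_ {p} eq ps) = subst (λ a → Anchored (reverse (a ∷ map (label ks) ps))) (≡.sym eq) (anchored-reverse (map (label ks) ps))

        letters : ∀ {m} → NonZero m → tabulate {n = m} letter ≡ y ∷ replicate (m ∸ 1) x
        letters {suc m} _ = cong (y ∷_) (constant-x m)
          where
          constant-x : ∀ m → tabulate {n = m} (λ _ → x) ≡ replicate m x
          constant-x zero    = ≡.refl
          constant-x (suc m) = cong (x ∷_) (constant-x m)

        letters-row : ∀ i → map (label ks) (list (ch i)) ≡ reverse (word (lookup ks i ∷ []))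
        letters-row i = ≡.trans (cong (map (label ks)) (rowChain-list (i ,_) (nonZero i)))
          (≡.trans (List.map-tabulate (i ,_) (label ks)) (≡.trans (letters (nonZero i))
            (≡.sym (≡.trans (reverse-word (lookup ks i ∷ [])) (List.++-identityʳ _)))))

        -- A chain is listed upwards and a row from the last letter back, hence the reversal. It
        -- turns the chain `c′ ⧺ c` into the row `u ++ u′`, so that `chainSum` matches `E`.
        Spells : Chain → List ℕ → Set
        Spells c u = map (label ks) (list c) ≡ reverse (word u)

        φ-word : ∀ {c} u → Spells c u → φ (list c) ≈ Z (word (u ++ []))
        φ-word u eq = R.reflexive (cong value (≡.trans eq (cong (reverse ∘ word) (≡.sym (List.++-identityʳ u)))))

        word-++ : ∀ u v → word (u ++ v) ≡ word u ++ word v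
        word-++ []      v = ≡.refl
        word-++ (k ∷ u) v = ≡.trans (cong (xʸ k ∸ 1 ∷_) (word-++ u v)) (≡.sym (List.++-assoc (replicate (k ∸ 1) x) (y ∷ word u) (word v)))

        Spells-⧺ : ∀ {c c′} u u′ → Spells c u → Spells c′ u′ → Spells (c′ ⧺ c) (u ++ u′)
        Spells-⧺ {c} {c′} u u′ eq eq′ = ≡.trans (List.map-++ (label ks) (list c′) (list c))
          (≡.trans (cong₂ _++_ eq′ eq) (≡.trans (≡.sym (List.reverse-++ (word u) (word u′))) (cong reverse (≡.sym (word-++ u u′)))))

        chainSum-E : ∀ {c cs us} u → Spells c u → Pointwise Spells cs us →
                     chainSum Y φ φ-* c cs ≈ S.E (λ U → Z (word (u ++ U))) us
        chainSum-E {c} u eq [] = φ-word {c} u eq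
        chainSum-E {c} u eq (_∷_ {c′} {u′} {cs} {us} eq′ eqs) = R.+-cong
          (R.*-cong (φ-word {c} u eq) (chainSum-E u′ eq′ eqs))
          (R.-‿cong (R.trans (chainSum-E (u ++ u′) (Spells-⧺ {c} {c′} u u′ eq eq′) eqs)
            (S.E-cong us (λ U → R.reflexive (cong (Z ∘ word) (List.++-assoc u u′ U))))))

        heads : All (Y ∘ proj₁) (ch zero ∷ chains)
        heads = All.tabulate⁺ {f = ch} (λ i → let m , eq , m≡0 = rowChain-first (i ,_) (nonZero i)
          in ≡.trans (cong (label ks) eq) (letter-0 m m≡0))
          where
          letter-0 : ∀ {n} (m : Fin n) → toℕ m ≡ 0 → letter m ≡ y
          letter-0 zero _ = ≡.refl

        spelled : Pointwise Spells chains (map [_] ks₀)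
        spelled = subst (Pointwise Spells chains)
          (≡.trans (≡.sym (List.map-tabulate (lookup ks₀) [_])) (cong (map [_]) (List.tabulate-lookup ks₀)))
          (Pointwise.tabulate⁺ (letters-row ∘ suc))

      ζ⋆ᴷʸ-S-∷ : ζ⋆ᴷʸ Zˢʰ ks ≈ S.S (map [_] ks)
      ζ⋆ᴷʸ-S-∷ = begin
        ev (w⋆ ks , w⋆-∈𝔥¹ ks)
          ≈⟨ ev-∑ (w⋆ ks) (w⋆-∈𝔥¹ ks) ⟩
        RT.∑ (w⋆ ks) (λ (c , w) → fromℚ c *ᴿ value w)
          ≈⟨ RT.∑-map (λ ps → 1ℚ , map (label ks) ps) (linearExtensions X) _ ⟩
        RT.∑ (linearExtensions X) (λ ps → 1ᴿ *ᴿ φ ps)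
          ≈⟨ RT.∑-cong (linearExtensions X) (λ ps → R.*-identityˡ (φ ps)) ⟩
        RT.∑ (linearExtensions X) φ
          ≈⟨ ∑-filter (isLinearExtension? X) (permutations (2-Poset.elements X)) φ ⟩
        RT.∑ (permutations (2-Poset.elements X)) (λ ps → ind (does (isLinearExtension? X ps)) *ᴿ φ ps)
          ≈⟨ ∑-cong-All (permutations-↭ (2-Poset.elements X)) (λ {ps} q → R.*-congʳ {φ ps} (R.reflexive (cong ind (linear≡good q)))) ⟩
        RT.∑ (permutations (2-Poset.elements X)) (λ ps → ind (good (ch zero) chains ps) *ᴿ φ ps)
          ≡⟨ cong (λ es → RT.∑ (permutations es) (λ ps → ind (good (ch zero) chains ps) *ᴿ φ ps)) elements-X ⟩
        RT.∑ (permutations (elements (ch zero ∷ chains))) (λ ps → ind (good (ch zero) chains ps) *ᴿ φ ps)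
          ≈⟨ ∑-good Y φ φ-* (ch zero) chains (subst Unique elements-X (2-Poset.elements-unique X)) heads ⟩
        chainSum Y φ φ-* (ch zero) chains
          ≈⟨ chainSum-E (k₀ ∷ []) (letters-row zero) spelled ⟩
        S.S (map [_] ks) ∎

    ζ⋆ᴷʸ-S : ∀ {ks} → All NonZero ks → ζ⋆ᴷʸ Zˢʰ ks ≈ S.S (map [_] ks)
    ζ⋆ᴷʸ-S {[]}     _   = R.trans (ev-∑ (w⋆ []) (w⋆-∈𝔥¹ []))
      (R.trans (R.+-identityʳ _) (R.trans (R.*-identityˡ (value [])) Z-[]))
    ζ⋆ᴷʸ-S {k ∷ ks} pos = ζ⋆ᴷʸ-S-∷ k ks pos

-- Coefficients of weighted sums

module SeriesCoefficients where

  open import Algebra.Bundles using (CommutativeRing)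
  open import Level using (0ℓ)
  open import Defs using (weakCompositions; binomials)
  open import Data.Fin as Fin using (Fin; toℕ)
  open import Data.Integer as ℤ using (ℤ; +_; -1ℤ)
  import Data.Integer.Properties as ℤ
  open import Data.List using (List; []; _∷_; _++_; _∷ʳ_; map; length; lookup; take; drop; zipWith; upTo; applyUpTo; allFin)
  import Data.List.Properties as List
  open import Data.Nat as ℕ using (ℕ; zero; suc; _∸_)
  open import Data.Nat.Combinatorics using (_C_)
  open import Data.Nat.ListAction using (sum)
  open import Function using (_∘_; id)
  open import Relation.Binary.PropositionalEquality as ≡ using (_≡_; cong)
  open RingSums
  open CyclicSums
  open PowerSeriesSums
  open WeightedSeries

  module IndexedSums (R : CommutativeRing 0ℓ 0ℓ) where
    open CommutativeRing R hiding (zero)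
    open RingTools R
    open CyclicSum R

    ∑-applyUpTo : ∀ {A : Set} (h : ℕ → A) n f → ∑ (applyUpTo h n) f ≈ ∑< n (f ∘ h)
    ∑-applyUpTo h zero    f = refl
    ∑-applyUpTo h (suc n) f = +-congˡ (∑-applyUpTo (h ∘ suc) n f)

    ∑-upTo : ∀ n f → ∑ (upTo n) f ≈ ∑< n f
    ∑-upTo = ∑-applyUpTo id

    cyc-allFin : ∀ F acc ks → cyc F acc ks ≈ ∑ (allFin (length ks)) (λ i →
                 F (lookup ks i) (drop (suc (toℕ i)) ks ++ acc ++ take (toℕ i) ks))
    cyc-allFin F acc []       = refl
    cyc-allFin F acc (k ∷ ks) = +-cong
      (reflexive (cong (λ l → F k (ks ++ l)) (≡.sym (List.++-identityʳ acc))))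
      (trans (cyc-allFin F (acc ∷ʳ k) ks) (trans
        (∑-cong (allFin (length ks)) (λ i → reflexive (cong (λ l → F (lookup ks i) (drop (suc (toℕ i)) ks ++ l)) (List.++-assoc acc (k ∷ []) (take (toℕ i) ks)))))
        (trans (sym (∑-map Fin.suc (allFin (length ks)) rotation))
          (reflexive (cong (λ is → ∑ is rotation) (List.map-tabulate id Fin.suc))))))
      where
      rotation : Fin (length (k ∷ ks)) → Carrier
      rotation i = F (lookup (k ∷ ks) i) (drop (suc (toℕ i)) (k ∷ ks) ++ acc ++ take (toℕ i) (k ∷ ks))

  module Coefficients (R : CommutativeRing 0ℓ 0ℓ) where
    open CommutativeRing R hiding (zero)
    open RingTools R
    open IndexedSums R
    open PowerSeries R
    open Weights R using (weighting; ν′)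
    open WeightedSums series weighting using (wsum)
    open Splits series using (spl)
    open import Relation.Binary.Reasoning.Setoid setoid
    private module Sr = RingTools series

    ∑-coefficient : ∀ {A : Set} (as : List A) f n → Sr.∑ as f n ≡ ∑ as (λ a → f a n)
    ∑-coefficient []       f n = ≡.refl
    ∑-coefficient (a ∷ as) f n = cong (λ s → f a n + s) (∑-coefficient as f n)

    ∑<-coefficient : ∀ m f n → Sr.∑< m f n ≡ ∑< m (λ j → f j n)
    ∑<-coefficient zero    f n = ≡.refl
    ∑<-coefficient (suc m) f n = cong (λ s → f 0 n + s) (∑<-coefficient m (f ∘ suc) n)

    spl-coefficient : ∀ ks Φ n → spl Φ ks n ≈ ∑< (suc (length ks)) (λ i → Φ (take i ks) (drop i ks) n)
    spl-coefficient []       Φ n = sym (+-identityʳ _)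
    spl-coefficient (k ∷ ks) Φ n = +-congˡ (spl-coefficient ks (λ p q → Φ (k ∷ p) q) n)

    -- Here the twist meets the definition of the symmetric series: each weight `ν` is a sign times
    -- a binomial coefficient, and over the entries the signs collect into the sign of the weight,
    -- the binomials into `binomials`.
    wsum-coefficient : ∀ q (G : List ℕ → Carrier) n →
      wsum q (ι ∘ G) n ≈ fromInt (-1ℤ ℤ.^ sum q)
                         * ∑ (weakCompositions (length q) n) (λ ls → fromInt (+ binomials q ls) * G (zipWith ℕ._+_ q ls))
    wsum-coefficient [] G zero = solve 1 (λ g → g := con (+ 1) :* (con (+ 1) :* g :+ con (+ 0))) refl (G [])
    wsum-coefficient [] G (suc n) = sym (zeroʳ _)
    wsum-coefficient (b ∷ q) G n = begin
      wsum (b ∷ q) (ι ∘ G) n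
        ≈⟨ τ-coefficient (λ l → ι (ν′ b l) ⊛ wsum q (λ M → ι (G (b ℕ.+ l ∷ M)))) n ⟩
      ∑< (suc n) (λ l → (ι (ν′ b l) ⊛ wsum q (λ M → ι (G (b ℕ.+ l ∷ M)))) (n ∸ l))
        ≈⟨ ∑<-cong (suc n) factor ⟩
      ∑< (suc n) (λ l → (s * t) * (fromInt (+ c l) * rest l))
        ≈⟨ ∑<-*ˡ (suc n) (s * t) (λ l → fromInt (+ c l) * rest l) ⟩
      (s * t) * ∑< (suc n) (λ l → fromInt (+ c l) * rest l)
        ≈⟨ *-cong sign (∑<-cong (suc n) absorb) ⟩
      fromInt (-1ℤ ℤ.^ (b ℕ.+ sum q)) * ∑< (suc n) (λ l → ∑ (map (l ∷_) (ls l)) term)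
        ≈⟨ *-congˡ (trans (sym (∑-upTo (suc n) (λ l → ∑ (map (l ∷_) (ls l)) term))) (sym (∑-concatMap (λ l → map (l ∷_) (ls l)) (upTo (suc n)) term))) ⟩
      fromInt (-1ℤ ℤ.^ sum (b ∷ q)) * ∑ (weakCompositions (suc (length q)) n) term ∎
      where
      s t : Carrier
      s = fromInt (-1ℤ ℤ.^ b)
      t = fromInt (-1ℤ ℤ.^ sum q)
      c : ℕ → ℕ
      c l = (b ℕ.+ l ∸ 1) C l
      ls : ℕ → List (List ℕ)
      ls l = weakCompositions (length q) (n ∸ l)
      term : List ℕ → Carrier
      term m = fromInt (+ binomials (b ∷ q) m) * G (zipWith ℕ._+_ (b ∷ q) m)
      below : ℕ → List ℕ → Carrier
      below l m = G (b ℕ.+ l ∷ zipWith ℕ._+_ q m)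
      rest : ℕ → Carrier
      rest l = ∑ (ls l) (λ m → fromInt (+ binomials q m) * below l m)
      sign : s * t ≈ fromInt (-1ℤ ℤ.^ (b ℕ.+ sum q))
      sign = trans (sym (fromInt-* (-1ℤ ℤ.^ b) (-1ℤ ℤ.^ sum q))) (reflexive (cong fromInt (≡.sym (ℤ.^-distribˡ-+-* -1ℤ b (sum q)))))
      factor : ∀ l → (ι (ν′ b l) ⊛ wsum q (λ M → ι (G (b ℕ.+ l ∷ M)))) (n ∸ l) ≈ (s * t) * (fromInt (+ c l) * rest l)
      factor l = trans (ι-*ˡ (ν′ b l) (wsum q (λ M → ι (G (b ℕ.+ l ∷ M)))) (n ∸ l)) (trans
        (*-cong (fromInt-* (-1ℤ ℤ.^ b) (+ c l)) (wsum-coefficient q (λ M → G (b ℕ.+ l ∷ M)) (n ∸ l)))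
        (solve 4 (λ s c t e → (s :* c) :* (t :* e) := (s :* t) :* (c :* e)) refl s (fromInt (+ c l)) t (rest l)))
      absorb : ∀ l → fromInt (+ c l) * rest l ≈ ∑ (map (l ∷_) (ls l)) term
      absorb l = trans (sym (∑-*ˡ (ls l) (fromInt (+ c l)) (λ m → fromInt (+ binomials q m) * below l m)))
        (trans (∑-cong (ls l) (λ m → trans (sym (*-assoc (fromInt (+ c l)) (fromInt (+ binomials q m)) (below l m)))
          (*-congʳ (trans (sym (fromInt-* (+ c l) (+ binomials q m))) (reflexive (cong fromInt (≡.sym (ℤ.pos-* (c l) (binomials q m)))))))))
        (sym (∑-map (l ∷_) (ls l) term)))

-- From the abstract series to the symmetric star values

module SymmetricStarValues where

  open import Defs hiding (_≈_; T)
  open import Defs using () renaming (_≈_ to _≈ˢ_)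
  open import Algebra.Bundles using (CommutativeRing)
  open import Data.Bool as Bool using (true)
  open import Data.Fin using (Fin; toℕ)
  open import Data.Integer using (+_; -1ℤ) renaming (_+_ to _+ℤ_; _*_ to _*ℤ_; _^_ to _^ℤ_)
  import Data.Integer as ℤ
  import Data.Integer.Properties as ℤ
  open import Data.Integer.Solver using (module +-*-Solver)
  open import Data.List using (List; []; _∷_; _++_; _∷ʳ_; [_]; length; lookup; take; drop; upTo; allFin; reverse; zipWith; map; replicate)
  import Data.List.Properties as List
  open import Data.List.Relation.Unary.All as All using (All; []; _∷_)
  import Data.List.Relation.Unary.All.Properties as All
  import Data.List.Relation.Unary.Any.Properties as Any
  open import Data.Nat as ℕ using (ℕ; zero; suc; NonZero; _∸_)
  import Data.Nat.Properties as ℕ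
  open import Data.Nat.ListAction using (sum)
  open import Data.Empty using (⊥-elim)
  open import Data.Product using (∃; ∃₂; _×_; _,_)
  open import Data.Sum using (_⊎_; inj₁; inj₂)
  open import Function using (_∘_)
  open import Relation.Binary.PropositionalEquality as ≡ using (_≡_; cong; subst)
  open import Relation.Nullary using (yes; no; ¬_)
  open RingSums
  open StarSums
  open CyclicSums
  open PowerSeriesSums
  open WeightedSeries
  open NegativeParts
  open Words
  open SymmetricSums
  open Reals using (module Real)
  open IteratedIntegrals
  open ShuffleLimits
  open RegularisedValues
  open StarPosets
  open SeriesCoefficients

  unwrapˢ : ∀ {f g} → (∀ n → f n Reals.≈ g n) → f ≈ˢ g
  unwrapˢ eq n = Reals.unwrap (eq n)

  module Translation (Zˢʰ : 𝔥¹ → Polynomial) (isReg : IsShuffleRegularization Zˢʰ) where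
    open Real using (ℝ-ring; pointwise; fromInt-fromℤ)
    open Regularisation Zˢʰ isReg
    open StarValue Zˢʰ isReg using (ζ⋆ᴷʸ-S)
    open PowerSeries ℝ-ring using (series; ι; ι-cong; ι-*; ι-*ˡ; τ; τ-coefficient; τ-cong; _≋_)
    private
      module R = CommutativeRing ℝ-ring
      module RT = RingTools ℝ-ring
      module A = CommutativeRing series
      module AT = RingTools series
      module W = Weights ℝ-ring
      module IR = IndexedSums ℝ-ring
      module IA = IndexedSums series
      module Co = Coefficients ℝ-ring
      module Sᴿ = Star ℝ-ring (Z ∘ word)
    open ShuffleSum ℝ-ring using (σ)
    open CyclicSum series
    open NegativePart series W.weighting (ι ∘ Z ∘ word) using (negate)
    open import Relation.Binary.Reasoning.Setoid R.setoid

    private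
      κ : (Word → ℝ) → Word → Word → ℝ[[t]]
      κ φ u v n = σ (λ w → φ (xʸ n ∷ w)) u v

      κ-step : ∀ φ u v → κ φ u v ≋ (W.X (κ (φ ∘ (x ∷_)) u v) A.+ ι (σ (φ ∘ (y ∷_)) u v))
      κ-step φ u v zero    = R.sym (R.+-identityˡ _)
      κ-step φ u v (suc n) = R.sym (R.+-identityʳ _)

      ι-+ : ∀ a b → ι (a +ᴿ b) ≋ (ι a A.+ ι b)
      ι-+ a b zero    = R.refl
      ι-+ a b (suc n) = R.sym (R.+-identityˡ 0ᴿ)

      ι-neg : ∀ a → ι (-ᴿ a) ≋ (A.- ι a)
      ι-neg a zero    = R.refl
      ι-neg a (suc n) = pointwise (λ _ → ≡.refl)

      ι-0 : ι 0ᴿ ≋ A.0#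
      ι-0 zero    = R.refl
      ι-0 (suc n) = R.refl

      open SymmetricCyclicSum ℝ-ring series W.weighting ι κ Z using (module Solved)
      open Solved ι-cong ι-+ ι-* ι-neg ι-0 (λ n → R.refl) (λ m n → R.refl) κ-step
        (λ U V → Z-shuffle (anchored-word U) (anchored-word V)) Z-y
        (ShuffleLimit.C-value Z Z-shuffle Z-[] Z-y Z-lim)

      ∑ᴿ-∑ : ∀ {B : Set} (bs : List B) f → ∑ᴿ bs f ≡ RT.∑ bs f
      ∑ᴿ-∑ []       f = ≡.refl
      ∑ᴿ-∑ (b ∷ bs) f = cong (f b +ᴿ_) (∑ᴿ-∑ bs f)

      ∑ᴿ-cong : ∀ {B : Set} (bs : List B) {f g} → (∀ b → f b R.≈ g b) → ∑ᴿ bs f R.≈ RT.∑ bs g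
      ∑ᴿ-cong bs {f} eq = R.trans (R.reflexive (∑ᴿ-∑ bs f)) (RT.∑-cong bs eq)

      ∑ᴿ-upTo : ∀ n f → ∑ᴿ (upTo n) f R.≈ RT.∑< n f
      ∑ᴿ-upTo n f = R.trans (R.reflexive (∑ᴿ-∑ (upTo n) f)) (IR.∑-upTo n f)

      reverse-All : ∀ {P : ℕ → Set} {ks} → All P ks → All P (reverse ks)
      reverse-All pks = All.tabulate (All.lookup pks ∘ Any.reverse⁻)

      zipWith-NonZero : ∀ {ks} → All NonZero ks → ∀ ls → All NonZero (zipWith ℕ._+_ ks ls)
      zipWith-NonZero []                      ls       = []
      zipWith-NonZero (_ ∷ pos)               []       = []
      zipWith-NonZero (_∷_ {suc k} _ pos) (l ∷ ls) = _ ∷ zipWith-NonZero pos ls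

      S : List ℕ → ℝ
      S ks = Sᴿ.S (map [_] ks)

    -- The i-th summand of the definition is the splitting after i entries. Its inner sum is the
    -- twisted star value of the reversed rest, since the twist commutes with reversal.
    ζ⋆ᴷʸ-Ŝ-Ŝ : ∀ ks → All NonZero ks → ζ⋆ᴷʸ-Ŝ Zˢʰ ks ≋ Ŝ ks
    ζ⋆ᴷʸ-Ŝ-Ŝ ks pos n = begin
      ζ⋆ᴷʸ-Ŝ Zˢʰ ks n
        ≈⟨ ∑ᴿ-upTo (suc (length ks)) _ ⟩
      RT.∑< (suc (length ks)) (λ i → fromℤ (-1ℤ ^ℤ sum (drop i ks)) *ᴿ ζ⋆ᴷʸ Zˢʰ (take i ks) *ᴿ
        ∑ᴿ (weakCompositions (length (drop i ks)) n) (λ ls →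
          fromℤ (+ binomials (drop i ks) ls) *ᴿ ζ⋆ᴷʸ Zˢʰ (reverse (zipWith ℕ._+_ (drop i ks) ls))))
        ≈⟨ RT.∑<-cong (suc (length ks)) summand ⟩
      RT.∑< (suc (length ks)) (λ i → Φ (take i ks) (drop i ks) n)
        ≈⟨ R.sym (Co.spl-coefficient ks Φ n) ⟩
      Splits.spl series Φ ks n
        ≈⟨ R.sym (Ŝ-expansion ks n) ⟩
      Ŝ ks n ∎
      where
      open WeightedSums series W.weighting using (wsum)
      Φ : List ℕ → List ℕ → ℝ[[t]]
      Φ p q = ι (S p) A.* wsum q (λ M → ι (S (reverse M)))
      summand : ∀ i → fromℤ (-1ℤ ^ℤ sum (drop i ks)) *ᴿ ζ⋆ᴷʸ Zˢʰ (take i ks) *ᴿ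
        ∑ᴿ (weakCompositions (length (drop i ks)) n) (λ ls →
          fromℤ (+ binomials (drop i ks) ls) *ᴿ ζ⋆ᴷʸ Zˢʰ (reverse (zipWith ℕ._+_ (drop i ks) ls)))
        R.≈ Φ (take i ks) (drop i ks) n
      summand i = begin
        fromℤ s *ᴿ ζ⋆ᴷʸ Zˢʰ p *ᴿ ∑ᴿ (weakCompositions (length q) n) (λ ls → fromℤ (+ binomials q ls) *ᴿ ζ⋆ᴷʸ Zˢʰ (reverse (zipWith ℕ._+_ q ls)))
          ≈⟨ R.*-cong (R.*-cong (R.sym (fromInt-fromℤ s)) (ζ⋆ᴷʸ-S (All.take⁺ i pos)))
               (∑ᴿ-cong (weakCompositions (length q) n) (λ ls → R.*-cong (R.sym (fromInt-fromℤ (+ binomials q ls)))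
                 (ζ⋆ᴷʸ-S (reverse-All (zipWith-NonZero (All.drop⁺ i pos) ls))))) ⟩
        RT.fromInt s *ᴿ S p *ᴿ total
          ≈⟨ RT.solve 3 (λ a b c → a RT.:* b RT.:* c RT.:= b RT.:* (a RT.:* c)) R.refl (RT.fromInt s) (S p) total ⟩
        S p *ᴿ (RT.fromInt s *ᴿ total)
          ≈⟨ R.*-congˡ {S p} (R.sym (Co.wsum-coefficient q (S ∘ reverse) n)) ⟩
        S p *ᴿ wsum q (λ M → ι (S (reverse M))) n
          ≈⟨ R.sym (ι-*ˡ (S p) (wsum q (λ M → ι (S (reverse M)))) n) ⟩
        Φ p q n ∎
        where
        p = take i ks
        q = drop i ks
        s = -1ℤ ^ℤ sum q
        total = RT.∑ (weakCompositions (length q) n) (λ ls → RT.fromInt (+ binomials q ls) *ᴿ S (reverse (zipWith ℕ._+_ q ls)))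

    module _ (ζŜ : List ℕ → ℝ[[t]]) (ζŜ-Ŝ : ∀ ks → All NonZero ks → ζŜ ks ≋ Ŝ ks) (ks : List ℕ) where
      private
        left′ right′ : ℕ → List ℕ → ℝ[[t]]
        left′ k l  = AT.∑< (k ∸ 1) (λ j → ζŜ (suc j ∷ l ∷ʳ (k ∸ j)))
        right′ k l = τ (λ j → ζŜ (suc j ∷ l ∷ʳ k))

        left′-left : ∀ {k l} → NonZero k → All NonZero l → left′ k l ≋ left k l
        left′-left {k} {l} nz pos = AT.∑<-cong-< (k ∸ 1) {λ j → ζŜ (suc j ∷ l ∷ʳ (k ∸ j))} {λ j → Ŝ (suc j ∷ l ∷ʳ (k ∸ j))}
          (λ j j<k-1 → ζŜ-Ŝ (suc j ∷ l ∷ʳ (k ∸ j)) (_ ∷ All.∷ʳ⁺ pos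
            (ℕ.>-nonZero (ℕ.m<n⇒0<n∸m (ℕ.<-≤-trans j<k-1 (ℕ.m∸n≤m k 1))))))

        right′-right : ∀ {k l} → NonZero k → All NonZero l → right′ k l ≋ right k l
        right′-right {k} {l} nz pos = τ-cong {λ j → ζŜ (suc j ∷ l ∷ʳ k)} {λ j → Ŝ (suc j ∷ l ∷ʳ k)}
          (λ j → ζŜ-Ŝ (suc j ∷ l ∷ʳ k) (_ ∷ All.∷ʳ⁺ pos nz))

        cyc-∑ᴿ : ∀ F n → ∑ᴿ (allFin (length ks)) (λ i → F (lookup ks i) (drop (suc (toℕ i)) ks ++ take (toℕ i) ks) n) R.≈ cyc F [] ks n
        cyc-∑ᴿ F n = R.sym (R.trans (IA.cyc-allFin F [] ks n) (R.reflexive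
          (≡.trans (Co.∑-coefficient (allFin (length ks)) (λ i → F (lookup ks i) (drop (suc (toℕ i)) ks ++ take (toℕ i) ks)) n)
            (≡.sym (∑ᴿ-∑ (allFin (length ks)) (λ i → F (lookup ks i) (drop (suc (toℕ i)) ks ++ take (toℕ i) ks) n))))))

        assoc : ∀ (i : Fin (length ks)) (m : ℕ) → drop (suc (toℕ i)) ks ++ take (toℕ i) ks ++ m ∷ [] ≡ (drop (suc (toℕ i)) ks ++ take (toℕ i) ks) ∷ʳ m
        assoc i m = ≡.sym (List.++-assoc (drop (suc (toℕ i)) ks) (take (toℕ i) ks) (m ∷ []))

      left-sum : All NonZero ks → ∀ n →
        (∑ (allFin (length ks)) λ i → ∑ (upTo (lookup ks i ∸ 1)) λ j →
           ζŜ (suc j ∷ drop (suc (toℕ i)) ks ++ take (toℕ i) ks ++ (lookup ks i ∸ j) ∷ [])) n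
        R.≈ cyc left [] ks n
      left-sum pos n = begin
        ∑ᴿ (allFin (length ks)) (λ i → ∑ᴿ (upTo (lookup ks i ∸ 1)) λ j → ζŜ (suc j ∷ drop (suc (toℕ i)) ks ++ take (toℕ i) ks ++ (lookup ks i ∸ j) ∷ []) n)
          ≈⟨ ∑ᴿ-cong (allFin (length ks)) (λ i → R.trans (∑ᴿ-upTo (lookup ks i ∸ 1) (λ j → ζŜ (suc j ∷ drop (suc (toℕ i)) ks ++ take (toℕ i) ks ++ (lookup ks i ∸ j) ∷ []) n)) (R.trans
               (RT.∑<-cong (lookup ks i ∸ 1) (λ j → R.reflexive (cong (λ l → ζŜ (suc j ∷ l) n) (assoc i (lookup ks i ∸ j)))))
               (R.reflexive (≡.sym (Co.∑<-coefficient (lookup ks i ∸ 1) (λ j → ζŜ (suc j ∷ (drop (suc (toℕ i)) ks ++ take (toℕ i) ks) ∷ʳ (lookup ks i ∸ j))) n))))) ⟩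
        RT.∑ (allFin (length ks)) (λ i → left′ (lookup ks i) (drop (suc (toℕ i)) ks ++ take (toℕ i) ks) n)
          ≡⟨ ≡.sym (∑ᴿ-∑ (allFin (length ks)) (λ i → left′ (lookup ks i) (drop (suc (toℕ i)) ks ++ take (toℕ i) ks) n)) ⟩
        ∑ᴿ (allFin (length ks)) (λ i → left′ (lookup ks i) (drop (suc (toℕ i)) ks ++ take (toℕ i) ks) n)
          ≈⟨ cyc-∑ᴿ left′ n ⟩
        cyc left′ [] ks n
          ≈⟨ cyc-cong-All {NonZero} {left′} {left} left′-left [] pos n ⟩
        cyc left [] ks n ∎

      ∑∞-τ : ∀ (f : ℕ → ℝ[[t]]) n → ∑∞ (λ j → t^ j · f j) n R.≈ τ f n
      ∑∞-τ f n = R.trans (∑ᴿ-upTo (suc n) (λ j → (t^ j · f j) n)) (R.trans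
        (RT.∑<-cong-< (suc n) {λ j → (t^ j · f j) n} {λ j → f j (n ∸ j)} (λ j j<1+n → shifted j (ℕ.≤⇒≤ᵇ (ℕ.≤-pred j<1+n))))
        (R.sym (τ-coefficient f n)))
        where
        shifted : ∀ j → Bool.T (j ℕ.≤ᵇ n) → (t^ j · f j) n R.≈ f j (n ∸ j)
        shifted j _ with true ← j ℕ.≤ᵇ n = R.refl

      right-sum : All NonZero ks → ∀ n →
        (∑ (allFin (length ks)) λ i → ∑∞ λ j →
           t^ j · ζŜ (suc j ∷ drop (suc (toℕ i)) ks ++ take (toℕ i) ks ++ lookup ks i ∷ [])) n
        R.≈ cyc right [] ks n
      right-sum pos n = begin
        ∑ᴿ (allFin (length ks)) (λ i → ∑∞ (λ j → t^ j · ζŜ (suc j ∷ drop (suc (toℕ i)) ks ++ take (toℕ i) ks ++ lookup ks i ∷ [])) n)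
          ≈⟨ ∑ᴿ-cong (allFin (length ks)) (λ i → R.trans (∑∞-τ (λ j → ζŜ (suc j ∷ drop (suc (toℕ i)) ks ++ take (toℕ i) ks ++ lookup ks i ∷ [])) n)
               (τ-cong {λ j → ζŜ (suc j ∷ drop (suc (toℕ i)) ks ++ take (toℕ i) ks ++ lookup ks i ∷ [])} {λ j → ζŜ (suc j ∷ (drop (suc (toℕ i)) ks ++ take (toℕ i) ks) ∷ʳ lookup ks i)} (λ j m → R.reflexive (cong (λ l → ζŜ (suc j ∷ l) m) (assoc i (lookup ks i)))) n)) ⟩
        RT.∑ (allFin (length ks)) (λ i → right′ (lookup ks i) (drop (suc (toℕ i)) ks ++ take (toℕ i) ks) n)
          ≡⟨ ≡.sym (∑ᴿ-∑ (allFin (length ks)) (λ i → right′ (lookup ks i) (drop (suc (toℕ i)) ks ++ take (toℕ i) ks) n)) ⟩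
        ∑ᴿ (allFin (length ks)) (λ i → right′ (lookup ks i) (drop (suc (toℕ i)) ks ++ take (toℕ i) ks) n)
          ≈⟨ cyc-∑ᴿ right′ n ⟩
        cyc right′ [] ks n
          ≈⟨ cyc-cong-All {NonZero} {right′} {right} right′-right [] pos n ⟩
        cyc right [] ks n ∎

    module _ {ks : List ℕ} (ones : All (_≡ 1) ks) where
      δ₁-ones : δ₁ ks ≡ + 1
      δ₁-ones with List.≡-dec ℕ._≟_ ks (replicate (length ks) 1)
      ... | yes _ = ≡.refl
      ... | no ¬p = ⊥-elim (¬p (constant-1 ones))
        where
        constant-1 : ∀ {l} → All (_≡ 1) l → l ≡ replicate (length l) 1
        constant-1 []            = ≡.refl
        constant-1 (≡.refl ∷ ones) = cong (1 ∷_) (constant-1 ones)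

      length-ones : length ks ≡ sum ks
      length-ones = go ones
        where
        go : ∀ {l} → All (_≡ 1) l → length l ≡ sum l
        go []              = ≡.refl
        go (≡.refl ∷ ones) = cong suc (go ones)

    δ₁-¬ones : ∀ {ks} → ¬ All (_≡ 1) ks → δ₁ ks ≡ + 0
    δ₁-¬ones {ks} ¬ones with List.≡-dec ℕ._≟_ ks (replicate (length ks) 1)
    ... | yes eq = ⊥-elim (¬ones (subst (All (_≡ 1)) (≡.sym eq) (All.replicate⁺ (length ks) ≡.refl)))
    ... | no _   = ≡.refl

    negate-ι : ∀ m c → negate m (ι c) ≋ ι (RT.fromInt (-1ℤ ^ℤ m) *ᴿ c)
    negate-ι zero    c = A.sym {ι (RT.fromInt (+ 1) *ᴿ c)} {ι c} (ι-cong (R.trans (R.*-congʳ {c} RT.fromInt-1) (R.*-identityˡ c)))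
    negate-ι (suc m) c = A.trans {negate (suc m) (ι c)} {A.- ι (s *ᴿ c)} {ι (RT.fromInt (-1ℤ ^ℤ suc m) *ᴿ c)}
      (A.-‿cong {negate m (ι c)} {ι (s *ᴿ c)} (negate-ι m c))
      (A.trans {A.- ι (s *ᴿ c)} {ι (-ᴿ (s *ᴿ c))} {ι (RT.fromInt (-1ℤ ^ℤ suc m) *ᴿ c)} (A.sym {ι (-ᴿ (s *ᴿ c))} {A.- ι (s *ᴿ c)} (ι-neg (s *ᴿ c)))
        (ι-cong (R.trans (RT.solve 2 (λ s c → RT.:- (s RT.:* c) RT.:= (RT.con -1ℤ RT.:* s) RT.:* c) R.refl s c)
          (R.*-congʳ {c} (R.sym (RT.fromInt-* -1ℤ (-1ℤ ^ℤ m)))))))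
      where s = RT.fromInt (-1ℤ ^ℤ m)

    negate-cong : ∀ m {f g} → f ≋ g → negate m f ≋ negate m g
    negate-cong zero    eq = eq
    negate-cong (suc m) {f} {g} eq = A.-‿cong {negate m f} {negate m g} (negate-cong m {f} {g} eq)

    fromInt-δ : ∀ e m → RT.fromInt (+ 1 *ℤ (+ 1 +ℤ -1ℤ *ℤ e) *ℤ m) R.≈ (RT.fromInt (+ 1) +ᴿ -ᴿ RT.fromInt e) *ᴿ RT.fromInt m
    fromInt-δ e m = begin
      RT.fromInt (+ 1 *ℤ (+ 1 +ℤ -1ℤ *ℤ e) *ℤ m)
        ≡⟨ cong (λ d → RT.fromInt (d *ℤ m)) (solve 1 (λ e → con (+ 1) :* (con (+ 1) :+ con -1ℤ :* e) := con (+ 1) :- e) ≡.refl e) ⟩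
      RT.fromInt ((+ 1 ℤ.- e) *ℤ m)
        ≈⟨ RT.fromInt-* (+ 1 ℤ.- e) m ⟩
      RT.fromInt (+ 1 ℤ.- e) *ᴿ RT.fromInt m
        ≈⟨ R.*-congʳ {RT.fromInt m} (R.trans (RT.fromInt-+ (+ 1) (ℤ.- e)) (R.+-congˡ {RT.fromInt (+ 1)} (RT.fromInt-neg e))) ⟩
      (RT.fromInt (+ 1) +ᴿ -ᴿ RT.fromInt e) *ᴿ RT.fromInt m ∎
      where open +-*-Solver

    constant-ι : ∀ {a b} → a R.≈ b → constant a ≋ ι b
    constant-ι eq zero    = eq
    constant-ι eq (suc n) = R.refl

    g-ζ : ∀ k .{{_ : NonZero k}} → Z (word [ suc k ]) R.≈ ζ (suc k ∷ []) (depth-one-admissible k)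
    g-ζ (suc k) = Z-ζ (suc (suc k)) {[]} [] (ℕ.s≤s (ℕ.s≤s ℕ.z≤n))

    module _ (ζŜ : List ℕ → ℝ[[t]]) (ζŜ-Ŝ : ∀ ks → All NonZero ks → ζŜ ks ≋ Ŝ ks) where
      Ŝ-sum-formula : ∀ k .{{_ : NonZero k}} ks → All NonZero ks → sum ks ≡ k → ∀ n →
        (∑ (allFin (length ks)) λ i → ∑ (upTo (lookup ks i ∸ 1)) λ j →
           ζŜ (suc j ∷ drop (suc (toℕ i)) ks ++ take (toℕ i) ks ++ (lookup ks i ∸ j) ∷ [])) n
        R.≈
        ((∑ (allFin (length ks)) λ i → ∑∞ λ j →
           t^ j · ζŜ (suc j ∷ drop (suc (toℕ i)) ks ++ take (toℕ i) ks ++ lookup ks i ∷ []))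
        ⊕ fromℤ (+ k) · ζŜ (suc k ∷ [])
        ⊖ constant (fromℤ (δ₁ ks *ℤ (+ 1 +ℤ -1ℤ ^ℤ suc k) *ℤ + k) *ᴿ ζ (suc k ∷ []) (depth-one-admissible k))) n
      Ŝ-sum-formula k ks pos ≡.refl n = R.trans (left-sum ζŜ ζŜ-Ŝ ks pos n) (R.trans (solved (all-ones? pos))
        (R.+-cong (R.+-cong (R.sym (right-sum ζŜ ζŜ-Ŝ ks pos n)) (R.sym middle)) (R.-‿cong {_} {constant c n} R.refl)))
        where
        c = fromℤ (δ₁ ks *ℤ (+ 1 +ℤ -1ℤ ^ℤ suc k) *ℤ + k) *ᴿ ζ (suc k ∷ []) (depth-one-admissible k)
        m = RT.fromInt (+ k)
        v = Z (word [ suc k ])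

        middle : fromℤ (+ k) *ᴿ ζŜ (suc k ∷ []) n R.≈ (W.integer k A.* Ŝ [ suc k ]) n
        middle = R.trans (R.*-cong (R.sym (fromInt-fromℤ (+ k))) (ζŜ-Ŝ (suc k ∷ []) (_ ∷ []) n))
          (R.sym (ι-*ˡ m (Ŝ [ suc k ]) n))

        solved : (All (_≡ 1) ks ⊎ ∃ λ pre → ∃₂ λ k post → ks ≡ pre ++ k ∷ post × 2 ℕ.≤ k) →
          cyc left [] ks n R.≈ (cyc right [] ks n +ᴿ (W.integer k A.* Ŝ [ suc k ]) n) +ᴿ -ᴿ constant c n
        solved (inj₂ (pre , b , post , eq , 2≤b)) = R.trans (Ŝ-cyclic-sum pos ¬ones n)
          (R.sym (R.trans (R.+-congˡ (R.-‿cong vanishing)) (RT.solve 1 (λ a → a RT.:- RT.con (+ 0) RT.:= a) R.refl (cyc right [] ks n +ᴿ (W.integer k A.* Ŝ [ suc k ]) n))))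
          where
          ¬ones : ¬ All (_≡ 1) ks
          ¬ones ones = ℕ.<⇒≢ 2≤b (≡.sym (All.head (All.++⁻ʳ pre (subst (All (_≡ 1)) eq ones))))
          vanishing : constant c n R.≈ 0ᴿ
          vanishing = R.trans (constant-ι (R.trans (R.*-congʳ {ζ (suc k ∷ []) (depth-one-admissible k)}
            (R.reflexive (cong fromℤ (cong (λ d → d *ℤ (+ 1 +ℤ -1ℤ ^ℤ suc k) *ℤ + k) (δ₁-¬ones ¬ones))))) (R.zeroˡ _)) n) (ι-0 n)
        -- For ones the length is the weight k, so the sign of the correction is (-1)ᵏ, and 1 -
        -- (-1)ᵏ is the factor 1 + (-1)ᵏ⁺¹ of the theorem.
        solved (inj₁ ones) = R.trans (Ŝ-cyclic-sum-ones ones n) (R.+-congˡ (R.-‿cong (R.sym correction)))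
          where
          s = RT.fromInt (-1ℤ ^ℤ k)
          product : W.integer k A.* ι v ≋ ι (m *ᴿ v)
          product = A.sym {ι (m *ᴿ v)} {W.integer k A.* ι v} (ι-* m v)
          coefficient-δ : fromℤ (δ₁ ks *ℤ (+ 1 +ℤ -1ℤ ^ℤ suc k) *ℤ + k) R.≈ (RT.fromInt (+ 1) +ᴿ -ᴿ s) *ᴿ m
          coefficient-δ = R.trans (R.reflexive (cong fromℤ (cong (λ d → d *ℤ (+ 1 +ℤ -1ℤ ^ℤ suc k) *ℤ + k) (δ₁-ones ones))))
            (R.trans (R.sym (fromInt-fromℤ (+ 1 *ℤ (+ 1 +ℤ -1ℤ ^ℤ suc k) *ℤ + k))) (fromInt-δ (-1ℤ ^ℤ k) (+ k)))
          correction : constant c n R.≈ (W.integer k A.* ι v) n +ᴿ -ᴿ negate (length ks) (W.integer k A.* ι v) n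
          correction = R.trans (constant-ι {b = m *ᴿ v +ᴿ -ᴿ (s *ᴿ (m *ᴿ v))} (R.trans (R.*-cong coefficient-δ (R.sym (g-ζ k)))
              (RT.solve 3 (λ s m v → ((RT.con (+ 1) RT.:- s) RT.:* m) RT.:* v RT.:= m RT.:* v RT.:- s RT.:* (m RT.:* v)) R.refl s m v)) n)
            (R.trans (ι-+ (m *ᴿ v) (-ᴿ (s *ᴿ (m *ᴿ v))) n) (R.+-cong (R.sym (product n)) (R.trans (ι-neg (s *ᴿ (m *ᴿ v)) n)
              (R.-‿cong (R.sym (R.trans (negate-cong (length ks) product n) (R.trans (R.reflexive (cong (λ l → negate l (ι (m *ᴿ v)) n) (length-ones ones))) (negate-ι k (m *ᴿ v) n))))))))

-- The formula for the symmetric star series of an arbitrary index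

open import Defs
open import Data.Fin using (Fin; toℕ)
open import Data.Integer using (+_; -1ℤ) renaming (_+_ to _+ℤ_; _*_ to _*ℤ_; _^_ to _^ℤ_)
open import Data.List using (List; []; _∷_; _++_; length; lookup; take; drop; upTo; allFin)
open import Data.List.Relation.Unary.All using (All)
open import Data.Nat using (ℕ; suc; NonZero; _∸_)
open import Data.Nat.ListAction using (sum)
open import Relation.Binary.PropositionalEquality using (_≡_; _≢_)

theorem2p4 :
  (Zˢʰ : 𝔥¹ → Polynomial) → IsShuffleRegularization Zˢʰ →
  (k : ℕ) .{{_ : NonZero k}} →
  (ks : List ℕ) → All NonZero ks → ks ≢ [] → sum ks ≡ k →
  let ζŜ = ζ⋆ᴷʸ-Ŝ Zˢʰ
      before = λ (i : Fin (length ks)) → take (toℕ i) ks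
      after = λ (i : Fin (length ks)) → drop (suc (toℕ i)) ks
  in
  (∑ (allFin (length ks)) λ i → ∑ (upTo (lookup ks i ∸ 1)) λ j →
     ζŜ (suc j ∷ after i ++ before i ++ (lookup ks i ∸ j) ∷ []))
  ≈
  (∑ (allFin (length ks)) λ i → ∑∞ λ j →
     t^ j · ζŜ (suc j ∷ after i ++ before i ++ lookup ks i ∷ []))
  ⊕ fromℤ (+ k) · ζŜ (suc k ∷ [])
  ⊖ constant (fromℤ (δ₁ ks *ℤ (+ 1 +ℤ -1ℤ ^ℤ suc k) *ℤ + k) *ᴿ ζ (suc k ∷ []) (depth-one-admissible k))
theorem2p4 Zˢʰ isReg k ks pos _ eq = SymmetricStarValues.unwrapˢ
  (Ŝ-sum-formula (ζ⋆ᴷʸ-Ŝ Zˢʰ) ζ⋆ᴷʸ-Ŝ-Ŝ k ks pos eq)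
  where open SymmetricStarValues.Translation Zˢʰ isReg
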